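{- Suppose $k\ge 4$ is even. Let $L$ be an irredundant linear system with girth $s(L)=k-1$ that has an irredundant $2\times k$ subsystem. Then there exists $p_L$ such that $L$ is uncommon over $\mathbb{F}_p$ for all primes $p\ge p_L$.
   Context: An $m\times K$ linear system $L$ is a collection of $m$ homogeneous linear equations in $K$ variables $x_1,\dots,x_K$ with integer coefficients, identified with its coefficient matrix $L\in\mathbb{Z}^{m\times K}$ (equations $L\mathbf{x}=0$). Row spans are taken over $\mathbb{Q}$. $L$ is irredundant if: (1) its rows are linearly independent; (2) no column of $L$ is zero; (3) the row span of $L$ contains no vector having one entry $1$, one entry $-1$ and all other entries $0$. The girth $s(L)$ is the minimum size of the support of a nonzero vector in the row span of $L$. An $m'\times k'$ linear system $L'$ on a subset $x_{i_1},\dots,x_{i_{k'}}$ of the variables is a subsystem of $L$ if $L\mathbf{x}=0$ implies $L'\mathbf{x}'=0$, where $\mathbf{x}'=(x_{i_1},\dots,x_{i_{k'}})$ (equivalently, each row of $L'$, extended by zeros to all $K$ variables, lies in the row span of $L$). For a prime $p$, $n\in\mathbb{N}$ and $f:\mathbb{F}_p^n\to\mathbb{R}$, let $t_L(f)=\mathbb{E}_{\mathbf{x}\in(\mathbb{F}_p^n)^K:\,L\mathbf{x}=0}\,f(x_1)\cdots f(x_K)$ (average over all solutions). An irredundant $m\times K$ system $L$ is common over $\mathbb{F}_p$ if for all $n\in\mathbb{N}$ and all $f:\mathbb{F}_p^n\to[0,1]$ one has $t_L(f)+t_L(1-f)\ge 2^{1-K}$; otherwise $L$ is uncommon over $\mathbb{F}_p$.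 -}

module Defs where

open import Data.Nat as ℕ using (ℕ; zero; suc; NonZero)
import Data.Nat.Properties as ℕ
import Data.Nat.Divisibility as ℕ
open import Data.Integer as ℤ using (ℤ; +_; 0ℤ)
import Data.Integer.Divisibility as ℤ
open import Data.Rational as ℚ using (ℚ; 0ℚ; 1ℚ; ½; ∣_∣)
import Data.Rational.Properties as ℚ
open import Data.Rational.Solver using (module +-*-Solver)
open import Data.Fin using (Fin; toℕ)
open import Data.Fin.Properties using (all?)
open import Data.List as List using (List; []; _∷_; length; filter; allFin; cartesianProductWith)
open import Data.Vec as Vec using (Vec; []; _∷_; lookup)
open import Data.Product using (∃; ∃-syntax; _×_; _,_)
open import Relation.Nullary using (Dec; ¬_; ¬?)
open import Relation.Binary.PropositionalEquality using (_≡_; _≢_; refl; sym; trans; cong; cong₂; subst)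
open import Algebra.Definitions.RawMonoid ℚ.+-0-rawMonoid using () renaming (sum to sumℚ)
open import Algebra.Definitions.RawMonoid ℤ.+-0-rawMonoid using () renaming (sum to sumℤ)

------------------------------------------------------------------------
-- Real numbers as Cauchy sequences of rationals.  Two sequences denote
-- the same real when each is ≤ℝ the other; all operations are pointwise.

IsCauchy : (ℕ → ℚ) → Set
IsCauchy s = ∀ ε → 0ℚ ℚ.< ε →
  ∃[ N ] (∀ a b → N ℕ.≤ a → N ℕ.≤ b → ∣ s a ℚ.- s b ∣ ℚ.< ε)

record ℝ : Set where
  constructor mkℝ
  field
    seq    : ℕ → ℚ
    cauchy : IsCauchy seq

open ℝ public

private
  open ℚ.≤-Reasoning

  half-pos : ∀ {ε} → 0ℚ ℚ.< ε → 0ℚ ℚ.< ½ ℚ.* ε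
  half-pos {ε} 0<ε = begin-strict
    0ℚ        ≡⟨ sym (ℚ.*-zeroʳ ½) ⟩
    ½ ℚ.* 0ℚ  <⟨ ℚ.*-monoʳ-<-pos ½ 0<ε ⟩
    ½ ℚ.* ε   ∎

  half+half : ∀ ε → ½ ℚ.* ε ℚ.+ ½ ℚ.* ε ≡ ε
  half+half = solve 1 (λ ε → con ½ :* ε :+ con ½ :* ε := ε) refl
    where open +-*-Solver

  cauchy-+ : ∀ {s t} → IsCauchy s → IsCauchy t → IsCauchy (λ a → s a ℚ.+ t a)
  cauchy-+ {s} {t} cs ct ε 0<ε with cs (½ ℚ.* ε) (half-pos 0<ε) | ct (½ ℚ.* ε) (half-pos 0<ε)
  ... | M , hM | N , hN = M ℕ.⊔ N , λ a b ha hb → begin-strict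
    ∣ (s a ℚ.+ t a) ℚ.- (s b ℚ.+ t b) ∣
      ≡⟨ cong ∣_∣ (rearrange (s a) (t a) (s b) (t b)) ⟩
    ∣ (s a ℚ.- s b) ℚ.+ (t a ℚ.- t b) ∣
      ≤⟨ ℚ.∣p+q∣≤∣p∣+∣q∣ (s a ℚ.- s b) (t a ℚ.- t b) ⟩
    ∣ s a ℚ.- s b ∣ ℚ.+ ∣ t a ℚ.- t b ∣
      <⟨ ℚ.+-mono-< (hM a b (ℕ.m⊔n≤o⇒m≤o M N ha) (ℕ.m⊔n≤o⇒m≤o M N hb))
                    (hN a b (ℕ.m⊔n≤o⇒n≤o M N ha) (ℕ.m⊔n≤o⇒n≤o M N hb)) ⟩
    ½ ℚ.* ε ℚ.+ ½ ℚ.* ε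
      ≡⟨ half+half ε ⟩
    ε ∎
    where
    rearrange : ∀ w x y z → (w ℚ.+ x) ℚ.- (y ℚ.+ z) ≡ (w ℚ.- y) ℚ.+ (x ℚ.- z)
    rearrange = solve 4 (λ w x y z → (w :+ x) :- (y :+ z) := (w :- y) :+ (x :- z)) refl
      where open +-*-Solver

  cauchy-neg : ∀ {s} → IsCauchy s → IsCauchy (λ a → ℚ.- s a)
  cauchy-neg {s} cs ε 0<ε with cs ε 0<ε
  ... | N , hN = N , λ a b ha hb → begin-strict
    ∣ (ℚ.- s a) ℚ.- (ℚ.- s b) ∣  ≡⟨ cong ∣_∣ (swap (s a) (s b)) ⟩
    ∣ s b ℚ.- s a ∣              <⟨ hN b a hb ha ⟩
    ε                            ∎
    where
    swap : ∀ x y → (ℚ.- x) ℚ.- (ℚ.- y) ≡ y ℚ.- x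
    swap = solve 2 (λ x y → (:- x) :- (:- y) := y :- x) refl
      where open +-*-Solver

  Bounded : (ℕ → ℚ) → Set
  Bounded s = ∃[ B ] 0ℚ ℚ.< B × ∃[ N ] (∀ a → N ℕ.≤ a → ∣ s a ∣ ℚ.≤ B)

  bounded : ∀ {s} → IsCauchy s → Bounded s
  bounded {s} cs with cs 1ℚ (ℚ.positive⁻¹ 1ℚ)
  ... | N , hN = 1ℚ ℚ.+ ∣ s N ∣ , ℚ.+-mono-<-≤ (ℚ.positive⁻¹ 1ℚ) (ℚ.0≤∣p∣ (s N)) , N , λ a ha → begin
    ∣ s a ∣                        ≡⟨ cong ∣_∣ (split (s a) (s N)) ⟩
    ∣ (s a ℚ.- s N) ℚ.+ s N ∣      ≤⟨ ℚ.∣p+q∣≤∣p∣+∣q∣ (s a ℚ.- s N) (s N) ⟩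
    ∣ s a ℚ.- s N ∣ ℚ.+ ∣ s N ∣    ≤⟨ ℚ.+-monoˡ-≤ ∣ s N ∣ (ℚ.<⇒≤ (hN a N ha ℕ.≤-refl)) ⟩
    1ℚ ℚ.+ ∣ s N ∣                 ∎
    where
    split : ∀ x y → x ≡ (x ℚ.- y) ℚ.+ y
    split = solve 2 (λ x y → x := (x :- y) :+ y) refl
      where open +-*-Solver

  -- δ with B * δ = ε
  quotient : ∀ {B ε} → 0ℚ ℚ.< B → 0ℚ ℚ.< ε → ∃[ δ ] 0ℚ ℚ.< δ × B ℚ.* δ ≡ ε
  quotient {B} {ε} 0<B 0<ε = B⁻¹ ℚ.* ε , pos , eq
    where
    instance
      posB : ℚ.Positive B
      posB = ℚ.positive 0<B
      nzB : ℚ.NonZero B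
      nzB = ℚ.pos⇒nonZero B
    B⁻¹ = ℚ.1/ B
    instance
      posB⁻¹ : ℚ.Positive B⁻¹
      posB⁻¹ = ℚ.1/pos⇒pos B
    pos : 0ℚ ℚ.< B⁻¹ ℚ.* ε
    pos = begin-strict
      0ℚ           ≡⟨ sym (ℚ.*-zeroʳ B⁻¹) ⟩
      B⁻¹ ℚ.* 0ℚ   <⟨ ℚ.*-monoʳ-<-pos B⁻¹ 0<ε ⟩
      B⁻¹ ℚ.* ε    ∎
    eq : B ℚ.* (B⁻¹ ℚ.* ε) ≡ ε
    eq = begin-equality
      B ℚ.* (B⁻¹ ℚ.* ε)  ≡⟨ sym (ℚ.*-assoc B B⁻¹ ε) ⟩
      (B ℚ.* B⁻¹) ℚ.* ε  ≡⟨ cong (ℚ._* ε) (ℚ.*-inverseʳ B) ⟩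
      1ℚ ℚ.* ε           ≡⟨ ℚ.*-identityˡ ε ⟩
      ε                  ∎

  scale-< : ∀ {x B y δ} → 0ℚ ℚ.< B → ∣ x ∣ ℚ.≤ B → ∣ y ∣ ℚ.< δ → ∣ x ℚ.* y ∣ ℚ.< B ℚ.* δ
  scale-< {x} {B} {y} {δ} 0<B x≤B y<δ = begin-strict
    ∣ x ℚ.* y ∣      ≡⟨ ℚ.∣p*q∣≡∣p∣*∣q∣ x y ⟩
    ∣ x ∣ ℚ.* ∣ y ∣  ≤⟨ ℚ.*-monoʳ-≤-nonNeg ∣ y ∣ x≤B ⟩
    B ℚ.* ∣ y ∣      <⟨ ℚ.*-monoʳ-<-pos B y<δ ⟩
    B ℚ.* δ          ∎
    where
    instance
      posB : ℚ.Positive B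
      posB = ℚ.positive 0<B
      nny : ℚ.NonNegative ∣ y ∣
      nny = ℚ.nonNegative (ℚ.0≤∣p∣ y)

  product-close : ∀ w x y z {B C δ γ} → 0ℚ ℚ.< B → 0ℚ ℚ.< C → ∣ w ∣ ℚ.≤ B → ∣ z ∣ ℚ.≤ C →
    ∣ x ℚ.- z ∣ ℚ.< δ → ∣ w ℚ.- y ∣ ℚ.< γ → ∣ w ℚ.* x ℚ.- y ℚ.* z ∣ ℚ.< B ℚ.* δ ℚ.+ C ℚ.* γ
  product-close w x y z {B} {C} {δ} {γ} 0<B 0<C w≤B z≤C x-z<δ w-y<γ = begin-strict
    ∣ w ℚ.* x ℚ.- y ℚ.* z ∣
      ≡⟨ cong ∣_∣ (rearrange w x y z) ⟩
    ∣ w ℚ.* (x ℚ.- z) ℚ.+ z ℚ.* (w ℚ.- y) ∣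
      ≤⟨ ℚ.∣p+q∣≤∣p∣+∣q∣ (w ℚ.* (x ℚ.- z)) (z ℚ.* (w ℚ.- y)) ⟩
    ∣ w ℚ.* (x ℚ.- z) ∣ ℚ.+ ∣ z ℚ.* (w ℚ.- y) ∣
      <⟨ ℚ.+-mono-< (scale-< {w} {B} {x ℚ.- z} {δ} 0<B w≤B x-z<δ)
                    (scale-< {z} {C} {w ℚ.- y} {γ} 0<C z≤C w-y<γ) ⟩
    B ℚ.* δ ℚ.+ C ℚ.* γ ∎
    where
    rearrange : ∀ w x y z → w ℚ.* x ℚ.- y ℚ.* z ≡ w ℚ.* (x ℚ.- z) ℚ.+ z ℚ.* (w ℚ.- y)
    rearrange = solve 4 (λ w x y z → w :* x :- y :* z := w :* (x :- z) :+ z :* (w :- y)) refl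
      where open +-*-Solver

  cauchy-* : ∀ {s t} → IsCauchy s → IsCauchy t → IsCauchy (λ a → s a ℚ.* t a)
  cauchy-* {s} {t} cs ct ε 0<ε = combine (bounded cs) (bounded ct)
    where
    close : ℕ → Set
    close n = ∀ a b → n ℕ.≤ a → n ℕ.≤ b → ∣ s a ℚ.* t a ℚ.- s b ℚ.* t b ∣ ℚ.< ε

    combine : Bounded s → Bounded t → ∃ close
    combine (B , 0<B , Nₛ , hB) (C , 0<C , Nₜ , hC) =
      let δ , 0<δ , Bδ = quotient 0<B (half-pos 0<ε)
          γ , 0<γ , Cγ = quotient 0<C (half-pos 0<ε)
          M , hM = ct δ 0<δ
          N , hN = cs γ 0<γ
      in (Nₛ ℕ.⊔ Nₜ) ℕ.⊔ (M ℕ.⊔ N) , λ a b ha hb →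
        let ha₁ = ℕ.m⊔n≤o⇒m≤o (Nₛ ℕ.⊔ Nₜ) (M ℕ.⊔ N) ha
            ha₂ = ℕ.m⊔n≤o⇒n≤o (Nₛ ℕ.⊔ Nₜ) (M ℕ.⊔ N) ha
            hb₁ = ℕ.m⊔n≤o⇒m≤o (Nₛ ℕ.⊔ Nₜ) (M ℕ.⊔ N) hb
            hb₂ = ℕ.m⊔n≤o⇒n≤o (Nₛ ℕ.⊔ Nₜ) (M ℕ.⊔ N) hb
        in subst (∣ s a ℚ.* t a ℚ.- s b ℚ.* t b ∣ ℚ.<_)
             (trans (cong₂ ℚ._+_ Bδ Cγ) (half+half ε))
             (product-close (s a) (t a) (s b) (t b) 0<B 0<C
               (hB a (ℕ.m⊔n≤o⇒m≤o Nₛ Nₜ ha₁)) (hC b (ℕ.m⊔n≤o⇒n≤o Nₛ Nₜ hb₁))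
               (hM a b (ℕ.m⊔n≤o⇒m≤o M N ha₂) (ℕ.m⊔n≤o⇒m≤o M N hb₂))
               (hN a b (ℕ.m⊔n≤o⇒n≤o M N ha₂) (ℕ.m⊔n≤o⇒n≤o M N hb₂)))

infixl 7 _*ℝ_
infixl 6 _+ℝ_ _-ℝ_
infix  4 _≤ℝ_

fromℚ : ℚ → ℝ
fromℚ q = mkℝ (λ _ → q) λ ε 0<ε → 0 , λ _ _ _ _ →
  subst (ℚ._< ε) (sym (cong ∣_∣ (ℚ.+-inverseʳ q))) 0<ε

0ℝ 1ℝ : ℝ
0ℝ = fromℚ 0ℚ
1ℝ = fromℚ 1ℚ

_+ℝ_ _-ℝ_ _*ℝ_ : ℝ → ℝ → ℝ
x +ℝ y = mkℝ (λ a → seq x a ℚ.+ seq y a) (cauchy-+ {seq x} {seq y} (cauchy x) (cauchy y))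
x -ℝ y = mkℝ (λ a → seq x a ℚ.- seq y a)
  (cauchy-+ {seq x} {λ a → ℚ.- seq y a} (cauchy x) (cauchy-neg {seq y} (cauchy y)))
x *ℝ y = mkℝ (λ a → seq x a ℚ.* seq y a) (cauchy-* {seq x} {seq y} (cauchy x) (cauchy y))

-- The ε is needed: termwise comparison would not respect equality of limits.
_≤ℝ_ : ℝ → ℝ → Set
x ≤ℝ y = ∀ ε → 0ℚ ℚ.< ε → ∃[ N ] (∀ a → N ℕ.≤ a → seq x a ℚ.≤ seq y a ℚ.+ ε)

sumℝ : List ℝ → ℝ
sumℝ = List.foldr _+ℝ_ 0ℝ

productℝ : ∀ {K} → Vec ℝ K → ℝ
productℝ = Vec.foldr _ _*ℝ_ 1ℝ

-- The value on the empty list is a dummy; averages are only taken over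
-- solution sets of homogeneous systems, which contain the zero vector.
averageℝ : List ℝ → ℝ
averageℝ []         = 0ℝ
averageℝ l@(_ ∷ xs) = fromℚ (+ 1 ℚ./ suc (length xs)) *ℝ sumℝ l

------------------------------------------------------------------------
-- Linear systems

LinearSystem : ℕ → ℕ → Set
LinearSystem m K = Fin m → Fin K → ℤ

ℤ→ℚ : ℤ → ℚ
ℤ→ℚ z = z ℚ./ 1

module _ {m K : ℕ} (L : LinearSystem m K) where

  rowCombination : (Fin m → ℚ) → (Fin K → ℚ)
  rowCombination c j = sumℚ λ i → c i ℚ.* ℤ→ℚ (L i j)

  InRowSpan : (Fin K → ℚ) → Set
  InRowSpan v = ∃[ c ] (∀ j → v j ≡ rowCombination c j)

  RowsIndependent : Set
  RowsIndependent = ∀ c → (∀ j → rowCombination c j ≡ 0ℚ) → ∀ i → c i ≡ 0ℚ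

  IsSolution : (Fin K → ℚ) → Set
  IsSolution x = ∀ i → sumℚ (λ j → ℤ→ℚ (L i j) ℚ.* x j) ≡ 0ℚ

-- One entry 1, one entry -1, all other entries 0.
IsDifference : ∀ {K} → (Fin K → ℚ) → Set
IsDifference v = ∃[ i ] ∃[ j ] i ≢ j × v i ≡ 1ℚ × v j ≡ ℚ.- 1ℚ ×
  (∀ l → l ≢ i → l ≢ j → v l ≡ 0ℚ)

record Irredundant {m K} (L : LinearSystem m K) : Set where
  field
    independent  : RowsIndependent L
    noZeroColumn : ∀ j → ¬ (∀ i → L i j ≡ 0ℤ)
    noDifference : ∀ v → InRowSpan L v → ¬ IsDifference v

NonZeroVector : ∀ {K} → (Fin K → ℚ) → Set
NonZeroVector v = ∃[ j ] v j ≢ 0ℚ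

supportSize : ∀ {K} → (Fin K → ℚ) → ℕ
supportSize {K} v = length (filter (λ j → ¬? (v j ℚ.≟ 0ℚ)) (allFin K))

-- HasGirth L s says that s(L) is defined and equal to s: the minimum does
-- not exist when the row span is zero.
record HasGirth {m K} (L : LinearSystem m K) (s : ℕ) : Set where
  field
    attained : ∃[ v ] InRowSpan L v × NonZeroVector v × supportSize v ≡ s
    minimal  : ∀ v → InRowSpan L v → NonZeroVector v → s ℕ.≤ supportSize v

-- L′ is a system in the variables x_{ι 0}, …, x_{ι (k′-1)} of L.
record IsSubsystem {m′ k′ m K} (L′ : LinearSystem m′ k′) (ι : Fin k′ → Fin K)
                   (L : LinearSystem m K) : Set where
  field
    distinct : ∀ {a b} → ι a ≡ ι b → a ≡ b
    implied  : ∀ x → IsSolution L x → IsSolution L′ (λ a → x (ι a))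

------------------------------------------------------------------------
-- Commonness over 𝔽ₚ

-- Elements of 𝔽ₚ are represented by their residues in Fin p.
𝔽^ : ℕ → ℕ → Set
𝔽^ p n = Vec (Fin p) n

vectors : ∀ {A : Set} → List A → (n : ℕ) → List (Vec A n)
vectors xs zero    = [] ∷ []
vectors xs (suc n) = cartesianProductWith _∷_ xs (vectors xs n)

module _ {m K : ℕ} (L : LinearSystem m K) (p n : ℕ) where

  -- An integer combination of residues vanishes in 𝔽ₚ when p divides it.
  IsSolution𝔽 : Vec (𝔽^ p n) K → Set
  IsSolution𝔽 x = ∀ (i : Fin m) (a : Fin n) →
    + p ℤ.∣ sumℤ (λ j → L i j ℤ.* + toℕ (lookup (lookup x j) a))

  isSolution𝔽? : ∀ x → Dec (IsSolution𝔽 x)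
  isSolution𝔽? x = all? λ i → all? λ a → p ℕ.∣? _

  solutions : List (Vec (𝔽^ p n) K)
  solutions = filter isSolution𝔽? (vectors (vectors (allFin p) n) K)

  t : (𝔽^ p n → ℝ) → ℝ
  t f = averageℝ (List.map (λ x → productℝ (Vec.map f x)) solutions)

-- 2^(1-K), including K = 0.
2^1-_ : ℕ → ℝ
2^1- K = fromℚ (ℚ._/_ (+ 2) (2 ℕ.^ K) {{ℕ.m^n≢0 2 K}})

Common : ∀ {m K} → LinearSystem m K → ℕ → Set
Common {K = K} L p = ∀ n (f : 𝔽^ p n → ℝ) → (∀ x → 0ℝ ≤ℝ f x × f x ≤ℝ 1ℝ) →
  2^1- K ≤ℝ t L p n f +ℝ t L p n (λ x → 1ℝ -ℝ f x)

Uncommon : ∀ {m K} → LinearSystem m K → ℕ → Set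
Uncommon L p = ¬ Common L p

{-
  Let h be such that k = 4 + 2h.  For large p the span of L mod p still has no nonzero vector supported on
  k - 2 variables, and the 2 × k subsystem gives a two-dimensional space of span vectors on k variables, with
  coordinates ρ_i = ⟨ℓ_i , z⟩ for pairwise independent points ℓ_i of the plane.  Such points satisfy a relation
  Σ γ_i ℓ_i^{⊗(k-2)} = 0 with all γ_i ≠ 0, unique up to scaling.

  Take f = (E + g)/(2E) on 𝔽_p^D, where E is a large constant and g is a real combination of kernels κ_t, one for
  every label t = (j , ±) with j < k, of weight -(k-1) for j = 0 and weight 1 for the other j.  The kernel κ_t is
  the Fourier transform of a product of multilinear phases of degrees k-2, k-3, k-3 with coefficients ±γ_j, γ_j a_j,
  γ_j b_j, where ℓ_j = (a_j , b_j); the sign makes κ_(j,-) conjugate to κ_(j,+), so g is real.  In the expansion of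
  t_L(f) + t_L(1-f) a labelling of some of the variables contributes the product of its weights times a normalised
  sum of the phases over dual frequency vectors, which is a natural number.  On at most k - 2 variables this number
  is 1, and the weights sum to 0; odd supports cancel between f and 1 - f.  On k variables the number is at most
  Λ = p^{2D}, and equality forces the multilinear phases to vanish on a two-dimensional space.  Newton's identities
  and the relation for γ then show that the labels j are all distinct, so that the product of the weights is
  negative.  Replacing the phases by n independent copies raises the numbers to the n-th power, so the negative
  terms dominate all others on k variables, and the terms on more variables are killed by taking E large.

  The additive character of 𝔽_p is constructed with values in bounded rational sequences modulo null sequences,
  from rational points of the unit circle whose p-th powers tend to 1; evaluating far along the sequence gives a
  rational-valued f.
-}
{-# OPTIONS --safe #-}
module Submission where

open import Algebra.Bundles using (CommutativeRing; RawRing)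
import Algebra.Solver.Ring.AlmostCommutativeRing as ACR
open import Axiom.UniquenessOfIdentityProofs using (module Decidable⇒UIP)
open import Data.Bool using (Bool; _∧_; false; if_then_else_; not; true)
import Data.Bool.Properties as Bool
open import Data.Empty using (⊥; ⊥-elim)
open import Data.Fin as Fin using (Fin; fromℕ<; suc; toℕ; zero)
import Data.Fin.Properties as Fin
open import Data.Integer as ℤ using (+_; -[1+_]; 0ℤ; ℤ)
import Data.Integer.DivMod as ℤ
import Data.Integer.Divisibility as ℤ
open import Data.Integer.Divisibility.Signed using (divides; ∣ᵤ⇒∣; ∣⇒∣ᵤ)
import Data.Integer.Properties as ℤ
open import Data.List as List using (List; []; _++_; _∷_; allFin; cartesianProduct; cartesianProductWith; filter; length; map)
open import Data.List.Membership.Propositional as Membership using (_∈_; _∉_; find)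
open import Data.List.Membership.Propositional.Properties using (∈-allFin; ∈-cartesianProductWith⁺; ∈-cartesianProductWith⁻; ∈-cartesianProduct⁺; ∈-filter⁺; ∈-filter⁻; ∈-map⁺; ∈-map⁻)
open import Data.List.Properties using (filter-all; length-++; length-map)
open import Data.List.Relation.Unary.All as All using (All; []; _∷_)
open import Data.List.Relation.Unary.All.Properties as All using (¬All⇒Any¬)
open import Data.List.Relation.Unary.AllPairs using ([]; _∷_)
open import Data.List.Relation.Unary.Any using (Any; any?; here; there)
import Data.List.Relation.Unary.Unique.Propositional.Properties as Unique
open import Data.Maybe using (Maybe; is-just; just; nothing)
open import Data.Nat as ℕ using (NonZero; suc; s≤s; zero; z≤n; ℕ)
open import Data.Nat.Coprimality using (coprime-Bézout; prime⇒coprime)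
import Data.Nat.DivMod as ℕ
import Data.Nat.Divisibility as ℕ
open import Data.Nat.GCD using (module Bézout)
import Data.Nat.ListAction as ListAction
open import Data.Nat.Primality using (Prime; euclidsLemma; prime⇒irreducible; prime⇒nonTrivial; prime⇒nonZero)
import Data.Nat.Properties as ℕ
open import Data.Product using (_,_; proj₁; proj₂; ∃; ∃-syntax)
import Data.Product.Properties as Product
open import Data.Rational as ℚ using (0ℚ; 1ℚ; ½; ℚ)
import Data.Rational.Properties as ℚ
import Data.Rational.Unnormalised as ℚᵘ
import Data.Rational.Unnormalised.Properties as ℚᵘ
open import Data.Sum as Sum using (_⊎_; inj₁; inj₂)
open import Data.Vec as Vec using (Vec; []; _∷_; lookup; zipWith)
import Data.Vec.Properties as Vec
import Data.Vec.Relation.Unary.All as VAll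
import Data.Vec.Relation.Unary.All.Properties as VAll
open import Function using (_∘_; case_of_; id)
open import Level using (0ℓ)
open import Relation.Binary.Definitions using (DecidableEquality; tri<; tri>; tri≈)
open import Relation.Binary.PropositionalEquality as ≡ using (_≡_; _≢_; module ≡-Reasoning)
open import Relation.Nullary using (Dec; contradiction; does; no; yes; ¬?; ¬_)
open import Relation.Nullary.Decidable using (map′)
open import Relation.Unary using (Decidable)

-- Fullness has to force distinct labels on every set of k variables, since `L` may have further
-- k-sets with a two-dimensional span whose points are unrelated to the ℓ_j. The block of degree k -
-- 2 only constrains the numbers ±γ_(j_i). The two blocks of degree k - 3 bind labels to points:
-- together with the first they say that the vectors ±ℓ_(j_i) are images of the points of the new
-- set under one linear map. If a label repeats, this map has rank at most one, all labels coincide,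
-- and what remains is a relation between bare signs at points that, after signing, lie on an affine
-- line. Evenness of k is used in three ways: sets of k - 1 variables, where the girth permits
-- nontrivial spans, cancel between f and 1 - f while sets of k variables do not; signs disappear
-- from (k-2)-th powers; and conjugating a phase of even degree k - 2 negates its coefficient
-- whereas at odd degree k - 3 it does not, which is why labels come in pairs (j , ±). The final
-- inequality is one between integers, so it has slack 1, which absorbs the error of rational
-- approximation.

-- The canonical map from the integers to a commutative ring.

module IntegerCoefficients where

  module FromℤRing (R : CommutativeRing 0ℓ 0ℓ) where

    open CommutativeRing R hiding (zero)
    open import Relation.Binary.Reasoning.Setoid setoid
    open import Algebra.Properties.Ring ring
      using (-‿+-comm; -0#≈0#; -‿distribˡ-*; -‿distribʳ-*; -‿involutive; +-cancelʳ)
    open import Algebra.Properties.Semiring.Mult.TCOptimised semiring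
      using (×-homo-+; ×1-homo-*; 1+×; _×_)

    -- Natural multiples are the variant in which `1 × x` computes to `x`, so `ι (+ 1)` is `1#` by
    -- computation and the solver constant `con (+ 1)` matches `1#` in goals.
    ι : ℤ → Carrier
    ι (+ n)    = n × 1#
    ι -[1+ n ] = - (suc n × 1#)

    private
      cancel : ∀ u a b → (u + a) + - (u + b) ≈ a + - b
      cancel u a b = begin
        (u + a) + - (u + b)       ≈⟨ +-cong (+-comm u a) (sym (-‿+-comm u b)) ⟩
        (a + u) + (- u + - b)     ≈⟨ +-assoc a u _ ⟩
        a + (u + (- u + - b))     ≈⟨ +-congˡ (sym (+-assoc u (- u) (- b))) ⟩
        a + ((u + - u) + - b)     ≈⟨ +-congˡ (trans (+-congʳ (-‿inverseʳ u)) (+-identityˡ _)) ⟩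
        a + - b                   ∎

      ι-⊖ : ∀ m n → ι (m ℤ.⊖ n) ≈ m × 1# + - (n × 1#)
      ι-⊖ m       zero    = sym (trans (+-congˡ -0#≈0#) (+-identityʳ _))
      ι-⊖ zero    (suc n) = sym (+-identityˡ _)
      ι-⊖ (suc m) (suc n) = begin
        ι (suc m ℤ.⊖ suc n)              ≡⟨ ≡.cong ι (ℤ.[1+m]⊖[1+n]≡m⊖n m n) ⟩
        ι (m ℤ.⊖ n)                      ≈⟨ ι-⊖ m n ⟩
        m × 1# + - (n × 1#)              ≈⟨ cancel 1# _ _ ⟨
        (1# + m × 1#) + - (1# + n × 1#)  ≈⟨ +-cong (1+× m 1#) (-‿cong (1+× n 1#)) ⟨
        suc m × 1# + - (suc n × 1#)      ∎

    ι-neg : ∀ i → ι (ℤ.- i) ≈ - ι i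
    ι-neg (+ zero)  = sym -0#≈0#
    ι-neg (+ suc n) = refl
    ι-neg -[1+ n ]  = sym (-‿involutive _)

    ι-+ : ∀ i j → ι (i ℤ.+ j) ≈ ι i + ι j
    ι-+ (+ m)    (+ n)    = ×-homo-+ 1# m n
    ι-+ (+ m)    -[1+ n ] = ι-⊖ m (suc n)
    ι-+ -[1+ m ] (+ n)    = trans (ι-⊖ n (suc m)) (+-comm _ _)
    ι-+ -[1+ m ] -[1+ n ] = begin
      - (suc (suc (m ℕ.+ n)) × 1#)       ≡⟨ ≡.cong (λ k → - (suc k × 1#)) (ℕ.+-suc m n) ⟨
      - ((suc m ℕ.+ suc n) × 1#)         ≈⟨ -‿cong (×-homo-+ 1# (suc m) (suc n)) ⟩
      - (suc m × 1# + suc n × 1#)        ≈⟨ -‿+-comm _ _ ⟨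
      - (suc m × 1#) + - (suc n × 1#)    ∎

    private
      ι-*⁺ : ∀ m j → ι (+ m ℤ.* j) ≈ ι (+ m) * ι j
      ι-*⁺ m (+ n)    = begin
        ι (+ m ℤ.* + n)         ≡⟨ ≡.cong ι (ℤ.pos-* m n) ⟨
        (m ℕ.* n) × 1#          ≈⟨ ×1-homo-* m n ⟩
        ι (+ m) * ι (+ n)       ∎
      ι-*⁺ m -[1+ n ] = begin
        ι (+ m ℤ.* -[1+ n ])         ≡⟨ ≡.cong ι (ℤ.neg-distribʳ-* (+ m) (+ suc n)) ⟨
        ι (ℤ.- (+ m ℤ.* + suc n))    ≈⟨ ι-neg (+ m ℤ.* + suc n) ⟩
        - ι (+ m ℤ.* + suc n)        ≈⟨ -‿cong (ι-*⁺ m (+ suc n)) ⟩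
        - (ι (+ m) * ι (+ suc n))    ≈⟨ -‿distribʳ-* _ _ ⟩
        ι (+ m) * - ι (+ suc n)      ∎

    ι-* : ∀ i j → ι (i ℤ.* j) ≈ ι i * ι j
    ι-* (+ m)    j = ι-*⁺ m j
    ι-* -[1+ m ] j = begin
      ι (-[1+ m ] ℤ.* j)         ≡⟨ ≡.cong ι (ℤ.neg-distribˡ-* (+ suc m) j) ⟨
      ι (ℤ.- (+ suc m ℤ.* j))    ≈⟨ ι-neg (+ suc m ℤ.* j) ⟩
      - ι (+ suc m ℤ.* j)        ≈⟨ -‿cong (ι-*⁺ (suc m) j) ⟩
      - (ι (+ suc m) * ι j)      ≈⟨ -‿distribˡ-* _ _ ⟩
      - ι (+ suc m) * ι j        ∎

    -- Identifies the concrete embeddings used later (rational integers, constant sequences,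
    -- integers modulo p) with `ι`, so that facts about `ι` transfer to them.
    ι-unique : (φ : ℤ → Carrier) → (∀ i j → φ (i ℤ.+ j) ≈ φ i + φ j) → φ (+ 1) ≈ 1# → ∀ z → φ z ≈ ι z
    ι-unique φ φ-+ φ-1 = go
      where
      φ-0 : φ (+ 0) ≈ 0#
      φ-0 = +-cancelʳ (φ (+ 0)) _ _ (trans (sym (φ-+ (+ 0) (+ 0))) (sym (+-identityˡ _)))
      pos : ∀ n → φ (+ n) ≈ ι (+ n)
      pos zero    = φ-0
      pos (suc n) = trans (φ-+ (+ 1) (+ n)) (trans (+-cong φ-1 (pos n)) (sym (ι-+ (+ 1) (+ n))))
      go : ∀ z → φ z ≈ ι z
      go (+ n)    = pos n
      go -[1+ n ] = +-cancelʳ (φ (+ suc n)) _ _ (begin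
        φ -[1+ n ] + φ (+ suc n)     ≈⟨ φ-+ -[1+ n ] (+ suc n) ⟨
        φ (-[1+ n ] ℤ.+ + suc n)     ≡⟨ ≡.cong φ (ℤ.+-inverseˡ (+ suc n)) ⟩
        φ (+ 0)                      ≈⟨ φ-0 ⟩
        0#                           ≈⟨ -‿inverseˡ _ ⟨
        ι -[1+ n ] + ι (+ suc n)     ≈⟨ +-congˡ (sym (pos (suc n))) ⟩
        ι -[1+ n ] + φ (+ suc n)     ∎)

    private
      ℤ-rawRing : RawRing 0ℓ 0ℓ
      ℤ-rawRing = record { Carrier = ℤ ; _≈_ = _≡_ ; _+_ = ℤ._+_ ; _*_ = ℤ._*_ ; -_ = ℤ.-_ ; 0# = + 0 ; 1# = + 1 }

      acr : ACR.AlmostCommutativeRing 0ℓ 0ℓ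
      acr = ACR.fromCommutativeRing R

      morphism : ℤ-rawRing ACR.-Raw-AlmostCommutative⟶ acr
      morphism = record { ⟦_⟧ = ι ; +-homo = ι-+ ; *-homo = ι-* ; -‿homo = ι-neg ; 0-homo = refl ; 1-homo = refl }

      weakDec : ∀ i j → Maybe (ι i ≈ ι j)
      weakDec i j with i ℤ.≟ j
      ... | yes ≡.refl = just refl
      ... | no  _      = nothing

    module Solver where
      open import Algebra.Solver.Ring ℤ-rawRing acr morphism weakDec public

-- Newton's identities for power sums.

module NewtonIdentities where

  open IntegerCoefficients

  module Newton (R : CommutativeRing 0ℓ 0ℓ) where

    open CommutativeRing R hiding (zero)
    open FromℤRing R
    open Solver using (solve; con; _:+_; _:*_; :-_; _:-_; _:=_)
    open import Algebra.Properties.Semiring.Exp semiring using (_^_) public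
    open import Algebra.Properties.Semiring.Mult.TCOptimised semiring using (1+×) renaming (_×_ to _·_) public
    open import Relation.Binary.Reasoning.Setoid setoid

    -- Coefficient of X^n in the product of two power series, by recursion on the first factor so
    -- that its head splits off.
    conv : (ℕ → Carrier) → (ℕ → Carrier) → ℕ → Carrier
    conv f g zero    = f 0 * g 0
    conv f g (suc n) = f 0 * g (suc n) + conv (λ m → f (suc m)) g n

    -- Coefficients of ∏ (1 - β X) over the list.
    elementary : List Carrier → ℕ → Carrier
    elementary l       zero    = 1#
    elementary []      (suc n) = 0#
    elementary (β ∷ l) (suc n) = elementary l (suc n) - β * elementary l n

    powerSum : List Carrier → ℕ → Carrier
    powerSum []      n = 0#
    powerSum (β ∷ l) n = β ^ n + powerSum l n

    conv-cong : ∀ {f f′ g g′} n → (∀ m → m ℕ.≤ n → f m ≈ f′ m) → (∀ m → m ℕ.≤ n → g m ≈ g′ m) →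
                conv f g n ≈ conv f′ g′ n
    conv-cong zero    hf hg = *-cong (hf 0 z≤n) (hg 0 z≤n)
    conv-cong (suc n) hf hg = +-cong (*-cong (hf 0 z≤n) (hg (suc n) ℕ.≤-refl))
      (conv-cong n (λ m m≤ → hf (suc m) (s≤s m≤)) (λ m m≤ → hg m (ℕ.m≤n⇒m≤1+n m≤)))

    conv-+ : ∀ f f′ g n → conv (λ m → f m + f′ m) g n ≈ conv f g n + conv f′ g n
    conv-+ f f′ g zero    = distribʳ _ _ _
    conv-+ f f′ g (suc n) = trans (+-congˡ (conv-+ _ _ g n))
      (solve 5 (λ a b c d e → (a :+ b) :* c :+ (d :+ e) := (a :* c :+ d) :+ (b :* c :+ e)) refl
        (f 0) (f′ 0) (g (suc n)) _ _)

    conv-* : ∀ c f g n → conv (λ m → c * f m) g n ≈ c * conv f g n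
    conv-* c f g zero    = *-assoc _ _ _
    conv-* c f g (suc n) = trans (+-cong (*-assoc _ _ _) (conv-* c _ g n)) (sym (distribˡ _ _ _))

    -- The top coefficient enters the convolution as `f n * g 0`, and `g 0` is one; all other terms
    -- agree.
    conv-last : ∀ f f′ g n → (∀ m → m ℕ.< n → f m ≈ f′ m) → g 0 ≈ 1# →
                conv f g n ≈ conv f′ g n → f n ≈ f′ n
    conv-last f f′ g zero    hf g0 h = begin
      f 0         ≈⟨ *-identityʳ _ ⟨
      f 0 * 1#    ≈⟨ *-congˡ g0 ⟨
      f 0 * g 0   ≈⟨ h ⟩
      f′ 0 * g 0  ≈⟨ *-congˡ g0 ⟩
      f′ 0 * 1#   ≈⟨ *-identityʳ _ ⟩
      f′ 0        ∎
    conv-last f f′ g (suc n) hf g0 h = conv-last _ _ g n (λ m m< → hf (suc m) (s≤s m<)) g0 (begin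
      y                          ≈⟨ solve 2 (λ x y → y := (x :+ y) :- x) refl x y ⟩
      (x + y) - x                ≈⟨ +-cong h (-‿cong (*-congʳ (hf 0 (s≤s z≤n)))) ⟩
      (x′ + y′) - x′             ≈⟨ solve 2 (λ x y → (x :+ y) :- x := y) refl x′ y′ ⟩
      y′                         ∎)
      where
      x  = f 0 * g (suc n)
      y  = conv (λ m → f (suc m)) g n
      x′ = f′ 0 * g (suc n)
      y′ = conv (λ m → f′ (suc m)) g n

    private
      -- The series β + β²X + ⋯ equals β / (1 - βX), and the factor 1 - βX of `elementary (β ∷ l)`
      -- cancels the denominator.
      conv-geometric : ∀ β l n →
        conv (λ m → β ^ suc m) (elementary (β ∷ l)) n ≈ β * elementary l n
      conv-geometric β l zero    = *-congʳ (*-identityʳ β)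
      conv-geometric β l (suc n) = begin
        β ^ 1 * (e′ - β * e) + conv (λ m → β * β ^ suc m) (elementary (β ∷ l)) n
          ≈⟨ +-cong (*-congʳ (*-identityʳ β)) (trans (conv-* β _ _ n) (*-congˡ (conv-geometric β l n))) ⟩
        β * (e′ - β * e) + β * (β * e)
          ≈⟨ solve 3 (λ β e e′ → β :* (e′ :- β :* e) :+ β :* (β :* e) := β :* e′) refl β e e′ ⟩
        β * e′ ∎
        where
        e  = elementary l n
        e′ = elementary l (suc n)

      conv-elementary-∷ : ∀ f β l n →
        conv f (elementary (β ∷ l)) (suc n) ≈ conv f (elementary l) (suc n) - β * conv f (elementary l) n
      conv-elementary-∷ f β l zero    =
        solve 4 (λ f0 f1 β e → f0 :* (e :- β :* con (+ 1)) :+ f1 :* con (+ 1) :=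
                                (f0 :* e :+ f1 :* con (+ 1)) :- β :* (f0 :* con (+ 1))) refl
          (f 0) (f 1) β (elementary l 1)
      conv-elementary-∷ f β l (suc n) = begin
        f 0 * (e″ - β * e′) + conv (λ m → f (suc m)) (elementary (β ∷ l)) (suc n)
          ≈⟨ +-congˡ (conv-elementary-∷ (λ m → f (suc m)) β l n) ⟩
        f 0 * (e″ - β * e′) + (c′ - β * c)
          ≈⟨ solve 6 (λ f0 β e′ e″ c c′ → f0 :* (e″ :- β :* e′) :+ (c′ :- β :* c) :=
                       (f0 :* e″ :+ c′) :- β :* (f0 :* e′ :+ c)) refl (f 0) β e′ e″ c c′ ⟩
        (f 0 * e″ + c′) - β * (f 0 * e′ + c) ∎
        where
        e′ = elementary l (suc n)
        e″ = elementary l (suc (suc n))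
        c  = conv (λ m → f (suc m)) (elementary l) n
        c′ = conv (λ m → f (suc m)) (elementary l) (suc n)

      conv-zero : ∀ g n → conv (λ _ → 0#) g n ≈ 0#
      conv-zero g zero    = zeroˡ _
      conv-zero g (suc n) = trans (+-cong (zeroˡ _) (conv-zero g n)) (+-identityˡ _)

    -- For e(X) = ∏ (1 - βX) and P(X) = p₁ + p₂X + ⋯ the logarithmic derivative says that the
    -- derivative of e plus P e is zero; this is its coefficient n. The induction adds one factor,
    -- whose geometric series collapses by `conv-geometric`.
    newton : ∀ l n → (suc n · 1#) * elementary l (suc n) +
                     conv (λ m → powerSum l (suc m)) (elementary l) n ≈ 0#
    newton []      n       = trans (+-cong (zeroʳ _) (conv-zero (elementary []) n)) (+-identityˡ _)
    newton (β ∷ l) zero    = begin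
      1# * (elementary l 1 - β * 1#) + (β ^ 1 + powerSum l 1) * 1#
        ≈⟨ solve 3 (λ β e p → con (+ 1) :* (e :- β :* con (+ 1)) :+ (β :* con (+ 1) :+ p) :* con (+ 1) :=
                              con (+ 1) :* e :+ p :* con (+ 1)) refl β (elementary l 1) (powerSum l 1) ⟩
      1# * elementary l 1 + powerSum l 1 * 1#
        ≈⟨ newton l 0 ⟩
      0# ∎
    newton (β ∷ l) (suc n) = begin
      (suc (suc n) · 1#) * (e″ - β * e′) + conv (λ m → β ^ suc m + powerSum l (suc m)) (elementary (β ∷ l)) (suc n)
        ≈⟨ +-cong (*-congʳ (1+× (suc n) 1#)) (conv-+ (λ m → β ^ suc m) (λ m → powerSum l (suc m)) (elementary (β ∷ l)) (suc n)) ⟩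
      (1# + N) * (e″ - β * e′) + (conv (λ m → β ^ suc m) (elementary (β ∷ l)) (suc n) +
                                  conv (λ m → powerSum l (suc m)) (elementary (β ∷ l)) (suc n))
        ≈⟨ +-congˡ (+-cong (conv-geometric β l (suc n)) (conv-elementary-∷ _ β l n)) ⟩
      (1# + N) * (e″ - β * e′) + (β * e′ + (c′ - β * c))
        ≈⟨ solve 6 (λ N β e′ e″ c c′ →
             (con (+ 1) :+ N) :* (e″ :- β :* e′) :+ (β :* e′ :+ (c′ :- β :* c)) :=
             ((con (+ 1) :+ N) :* e″ :+ c′) :- β :* (N :* e′ :+ c)) refl N β e′ e″ c c′ ⟩
      ((1# + N) * e″ + c′) - β * (N * e′ + c)
        ≈⟨ +-cong (trans (+-congʳ (*-congʳ (sym (1+× (suc n) 1#)))) (newton l (suc n)))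
                  (-‿cong (*-congˡ (newton l n))) ⟩
      0# - β * 0#
        ≈⟨ solve 1 (λ β → con (+ 0) :- β :* con (+ 0) := con (+ 0)) refl β ⟩
      0# ∎
      where
      N  = suc n · 1#
      e′ = elementary l (suc n)
      e″ = elementary l (suc (suc n))
      c  = conv (λ m → powerSum l (suc m)) (elementary l) n
      c′ = conv (λ m → powerSum l (suc m)) (elementary l) (suc n)

    elementary-vanishes : ∀ l n → length l ℕ.< n → elementary l n ≈ 0#
    elementary-vanishes []      (suc n) _       = refl
    elementary-vanishes (β ∷ l) (suc n) (s≤s h) = begin
      elementary l (suc n) - β * elementary l n
        ≈⟨ +-cong (elementary-vanishes l (suc n) (ℕ.m≤n⇒m≤1+n h)) (-‿cong (*-congˡ (elementary-vanishes l n h))) ⟩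
      0# - β * 0#
        ≈⟨ solve 1 (λ β → con (+ 0) :- β :* con (+ 0) := con (+ 0)) refl β ⟩
      0# ∎

    module _ (domain : ∀ x y → x * y ≈ 0# → x ≈ 0# ⊎ y ≈ 0#)
             (M : ℕ) (char : ∀ n → suc n ℕ.≤ M → ¬ suc n · 1# ≈ 0#)
             (l l′ : List Carrier) (same : ∀ n → n ℕ.≤ M → powerSum l n ≈ powerSum l′ n) where

      private
        cancelˡ : ∀ x y z → ¬ x ≈ 0# → x * y + z ≈ 0# → ∀ y′ z′ → x * y′ + z′ ≈ 0# → z ≈ z′ → y ≈ y′
        cancelˡ x y z x≉0 h y′ z′ h′ z≈z′ with domain x (y - y′) (begin
            x * (y - y′)
              ≈⟨ solve 5 (λ x y z y′ z′ → x :* (y :- y′) := ((x :* y :+ z) :- (x :* y′ :+ z′)) :- (z :- z′)) refl x y z y′ z′ ⟩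
            ((x * y + z) - (x * y′ + z′)) - (z - z′)
              ≈⟨ +-cong (+-cong h (-‿cong h′)) (-‿cong (trans (+-congʳ z≈z′) (-‿inverseʳ z′))) ⟩
            (0# - 0#) - 0#
              ≈⟨ solve 0 ((con (+ 0) :- con (+ 0)) :- con (+ 0) := con (+ 0)) refl ⟩
            0# ∎)
        ... | inj₁ e = contradiction e x≉0
        ... | inj₂ e = begin
          y              ≈⟨ solve 2 (λ y y′ → y := (y :- y′) :+ y′) refl y y′ ⟩
          (y - y′) + y′  ≈⟨ +-congʳ e ⟩
          0# + y′        ≈⟨ +-identityˡ y′ ⟩
          y′             ∎

        elementary-same : ∀ n → n ℕ.≤ M → ∀ m → m ℕ.≤ n → elementary l m ≈ elementary l′ m
        elementary-same n       n≤M zero    _        = refl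
        elementary-same (suc n) n≤M (suc m) (s≤s m≤n) with m ℕ.≟ n
        ... | no  m≢n    = elementary-same n (ℕ.<⇒≤ n≤M) (suc m) (ℕ.≤∧≢⇒< m≤n m≢n)
        ... | yes ≡.refl = cancelˡ _ _ _ (char n n≤M) (newton l n) _ _ (newton l′ n)
          (conv-cong n (λ i i≤ → same (suc i) (ℕ.≤-trans (s≤s i≤) n≤M))
                       (λ i i≤ → elementary-same n (ℕ.<⇒≤ n≤M) i i≤))

      -- Cancelling 1, ..., M in Newton's identities recovers the elementary functions up to index
      -- M. Beyond M they vanish for both lists, which are no longer than M. So all of them agree,
      -- and the identity at index M then isolates the power sum M + 1.
      powerSums-agree-suc : length l ℕ.≤ M → length l′ ℕ.≤ M → powerSum l (suc M) ≈ powerSum l′ (suc M)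
      powerSums-agree-suc hl hl′ =
        conv-last (λ m → powerSum l (suc m)) (λ m → powerSum l′ (suc m)) (elementary l) M
          (λ m m<M → same (suc m) m<M) refl (begin
            conv (λ m → powerSum l (suc m)) (elementary l) M
              ≈⟨ solve 2 (λ u v → v := (u :+ v) :- u) refl _ _ ⟩
            (u + v) - u
              ≈⟨ +-cong (newton l M) (-‿cong (*-congˡ (all (suc M)))) ⟩
            0# - u′
              ≈⟨ +-congʳ (newton l′ M) ⟨
            (u′ + v′) - u′
              ≈⟨ solve 2 (λ u v → (u :+ v) :- u := v) refl _ _ ⟩
            conv (λ m → powerSum l′ (suc m)) (elementary l′) M
              ≈⟨ conv-cong M (λ _ _ → refl) (λ i _ → sym (all i)) ⟩
            conv (λ m → powerSum l′ (suc m)) (elementary l) M ∎)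
        where
        all : ∀ n → elementary l n ≈ elementary l′ n
        all n with n ℕ.≤? M
        ... | yes n≤M = elementary-same n n≤M n ℕ.≤-refl
        ... | no  n≰M = trans (elementary-vanishes l n (ℕ.≤-<-trans hl (ℕ.≰⇒> n≰M)))
                         (sym (elementary-vanishes l′ n (ℕ.≤-<-trans hl′ (ℕ.≰⇒> n≰M))))
        u  = (suc M · 1#) * elementary l (suc M)
        v  = conv (λ m → powerSum l (suc m)) (elementary l) M
        u′ = (suc M · 1#) * elementary l′ (suc M)
        v′ = conv (λ m → powerSum l′ (suc m)) (elementary l′) M

-- Linear relations between tensor powers of points in the plane.

module BinaryForms where

  open import Data.List.Properties using (length-tabulate)
  open import Data.List.Relation.Unary.Unique.Propositional using (Unique)
  open import Data.Product using (_×_)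
  open IntegerCoefficients

  module Removal {A : Set} (_≟_ : DecidableEquality A) where

    remove : A → List A → List A
    remove x = filter (λ y → ¬? (y ≟ x))

    remove-∉ : ∀ x xs → x ∉ remove x xs
    remove-∉ x xs x∈ = proj₂ (∈-filter⁻ (λ y → ¬? (y ≟ x)) {xs = xs} x∈) ≡.refl

    remove-⊆ : ∀ {x y xs} → y ∈ remove x xs → y ∈ xs
    remove-⊆ {x} {xs = xs} y∈ = proj₁ (∈-filter⁻ (λ y → ¬? (y ≟ x)) {xs = xs} y∈)

    remove-∈ : ∀ {x y xs} → y ∈ xs → y ≢ x → y ∈ remove x xs
    remove-∈ {x} = ∈-filter⁺ (λ y → ¬? (y ≟ x))

    remove-unique : ∀ {x xs} → Unique xs → Unique (remove x xs)
    remove-unique {x} = Unique.filter⁺ (λ y → ¬? (y ≟ x))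

    length-remove : ∀ {x xs} → Unique xs → x ∈ xs → suc (length (remove x xs)) ≡ length xs
    length-remove {x} {y ∷ ys} (y∉ ∷ u) x∈ with y ≟ x
    ... | yes ≡.refl = ≡.cong (suc ∘ length) (filter-all (λ z → ¬? (z ≟ x)) (All.map (λ y≢z z≡y → y≢z (≡.sym z≡y)) y∉))
    ... | no  y≢x with x∈
    ...   | here x≡y  = contradiction (≡.sym x≡y) y≢x
    ...   | there x∈ys = ≡.cong suc (length-remove u x∈ys)

  record IsDomain (R : CommutativeRing 0ℓ 0ℓ) : Set where
    open CommutativeRing R
    field
      noZeroDivisors : ∀ x y → x * y ≈ 0# → x ≈ 0# ⊎ y ≈ 0#
      1≉0            : ¬ 1# ≈ 0#

  module Forms (R : CommutativeRing 0ℓ 0ℓ) (isDomain : IsDomain R) where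

    open IsDomain isDomain renaming (noZeroDivisors to domain)
    open CommutativeRing R hiding (zero)
    open FromℤRing R
    open Solver using (solve; con; _:+_; _:*_; :-_; _:-_; _:=_)
    open NewtonIdentities.Newton R
    open import Algebra.Properties.Semiring.Sum semiring
      using (sum; sum-cong-≋; *-distribˡ-sum; ∑-distrib-+; sum-replicate-zero)
    open import Relation.Binary.Reasoning.Setoid setoid

    nonzero-* : ∀ {x y} → ¬ x ≈ 0# → ¬ y ≈ 0# → ¬ x * y ≈ 0#
    nonzero-* x≉0 y≉0 xy≈0 with domain _ _ xy≈0
    ... | inj₁ x≈0 = x≉0 x≈0
    ... | inj₂ y≈0 = y≉0 y≈0

    cancel : ∀ {x y} → ¬ x ≈ 0# → x * y ≈ 0# → y ≈ 0#
    cancel x≉0 xy≈0 with domain _ _ xy≈0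
    ... | inj₁ x≈0 = contradiction x≈0 x≉0
    ... | inj₂ y≈0 = y≈0

    sum-zero : ∀ {n} (f : Fin n → Carrier) → (∀ i → f i ≈ 0#) → sum f ≈ 0#
    sum-zero {n} f h = trans (sum-cong-≋ h) (sum-replicate-zero n)

    sum-single : ∀ {n} (f : Fin n → Carrier) i → (∀ j → j ≢ i → f j ≈ 0#) → sum f ≈ f i
    sum-single f zero    h = trans (+-congˡ (sum-zero _ (λ j → h (suc j) λ ()))) (+-identityʳ _)
    sum-single f (suc i) h = trans (+-cong (h zero λ ())
      (sum-single (f ∘ suc) i (λ j j≢i → h (suc j) (j≢i ∘ Fin.suc-injective)))) (+-identityˡ _)

    private
      erase : ∀ {n} → Fin n → (Fin n → Carrier) → Fin n → Carrier
      erase i f j with j Fin.≟ i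
      ... | yes _ = 0#
      ... | no  _ = f j

      erase-≡ : ∀ {n} (i : Fin n) f → erase i f i ≈ 0#
      erase-≡ i f with i Fin.≟ i
      ... | yes _   = refl
      ... | no  i≢i = contradiction ≡.refl i≢i

      erase-≢ : ∀ {n} (i : Fin n) f j → j ≢ i → erase i f j ≈ f j
      erase-≢ i f j j≢i with j Fin.≟ i
      ... | yes j≡i = contradiction j≡i j≢i
      ... | no  _   = refl

      erase-zero : ∀ {n} (i : Fin n) f j → (j ≢ i → f j ≈ 0#) → erase i f j ≈ 0#
      erase-zero i f j h with j Fin.≟ i
      ... | yes _   = refl
      ... | no  j≢i = h j≢i

      sum-erase : ∀ {n} (f : Fin n → Carrier) i → sum f ≈ f i + sum (erase i f)
      sum-erase f i = begin
        sum f                                   ≈⟨ sum-cong-≋ split ⟩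
        sum (λ j → only j + erase i f j)        ≈⟨ ∑-distrib-+ only (erase i f) ⟩
        sum only + sum (erase i f)              ≈⟨ +-congʳ (sum-single only i λ j j≢i → only-≢ j j≢i) ⟩
        only i + sum (erase i f)                ≈⟨ +-congʳ only-≡ ⟩
        f i + sum (erase i f)                   ∎
        where
        only : Fin _ → Carrier
        only j = f j - erase i f j
        split : ∀ j → f j ≈ only j + erase i f j
        split j = solve 2 (λ x y → x := (x :- y) :+ y) refl (f j) (erase i f j)
        only-≢ : ∀ j → j ≢ i → only j ≈ 0#
        only-≢ j j≢i = trans (+-congˡ (-‿cong (erase-≢ i f j j≢i))) (-‿inverseʳ _)
        only-≡ : only i ≈ f i
        only-≡ = trans (+-congˡ (-‿cong (erase-≡ i f))) (solve 1 (λ x → x :- con (+ 0) := x) refl (f i))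

    sum-pair : ∀ {n} (f : Fin n → Carrier) {i j} → i ≢ j →
               (∀ l → l ≢ i → l ≢ j → f l ≈ 0#) → sum f ≈ f i + f j
    sum-pair f {i} {j} i≢j h = trans (sum-erase f i) (+-congˡ (trans
      (sum-single (erase i f) j (λ l l≢j → erase-zero i f l (λ l≢i → h l l≢i l≢j)))
      (erase-≢ i f j (i≢j ∘ ≡.sym))))

    sum-triple : ∀ {n} (f : Fin n → Carrier) {i j l} → i ≢ j → i ≢ l → j ≢ l →
                 (∀ m → m ≢ i → m ≢ j → m ≢ l → f m ≈ 0#) → sum f ≈ f i + (f j + f l)
    sum-triple f {i} {j} {l} i≢j i≢l j≢l h = trans (sum-erase f i) (+-congˡ (trans
      (sum-pair (erase i f) j≢l (λ m m≢j m≢l → erase-zero i f m (λ m≢i → h m m≢i m≢j m≢l)))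
      (+-cong (erase-≢ i f j (i≢j ∘ ≡.sym)) (erase-≢ i f l (i≢l ∘ ≡.sym)))))

    Point : Set
    Point = Carrier × Carrier

    pair : Point → Point → Carrier
    pair (a , b) (ρ , σ) = a * ρ + b * σ

    det : Point → Point → Carrier
    det (a , b) (a′ , b′) = a * b′ - b * a′

    -- Pairing with `perp m` is the determinant with `m`, so it vanishes at `m` and, in a generic
    -- family, at no other member.
    perp : Point → Point
    perp (a , b) = - b , a

    pairs : Point → List Point → Carrier
    pairs ℓ []       = 1#
    pairs ℓ (z ∷ zs) = pair ℓ z * pairs ℓ zs

    form : ∀ {k} → (Fin k → Carrier) → (Fin k → Point) → List Point → Carrier
    form c ℓ zs = sum λ i → c i * pairs (ℓ i) zs

    -- Σ c_i ℓ_i ⊗ ⋯ ⊗ ℓ_i = 0 (d factors)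
    Relation : ∀ {k} → ℕ → (Fin k → Carrier) → (Fin k → Point) → Set
    Relation d c ℓ = ∀ zs → length zs ≡ d → form c ℓ zs ≈ 0#

    det-self : ∀ ℓ → det ℓ ℓ ≈ 0#
    det-self (a , b) = solve 2 (λ a b → a :* b :- b :* a := con (+ 0)) refl a b

    det-swap : ∀ ℓ ℓ′ → det ℓ ℓ′ ≈ - det ℓ′ ℓ
    det-swap (a , b) (a′ , b′) = solve 4 (λ a b a′ b′ → a :* b′ :- b :* a′ := :- (a′ :* b :- b′ :* a)) refl a b a′ b′

    pair-perp : ∀ ℓ m → pair ℓ (perp m) ≈ det m ℓ
    pair-perp (a , b) (a′ , b′) = solve 4 (λ a b a′ b′ → a :* (:- b′) :+ b :* a′ := a′ :* b :- b′ :* a) refl a b a′ b′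

    -- A multilinear expression is expanded one argument at a time: every argument contributes one
    -- more factor of the first or of the second coordinate, and `go` counts the choices made so far
    -- in `x` and `y`.
    moments⇒Relation : ∀ {k} d (c : Fin k → Carrier) ℓ →
      (∀ x y → x ℕ.+ y ≡ d → sum (λ i → c i * (proj₁ (ℓ i) ^ x * proj₂ (ℓ i) ^ y)) ≈ 0#) → Relation d c ℓ
    moments⇒Relation {k} d c ℓ moments zs eq =
      trans (sum-cong-≋ λ i → *-congˡ {c i} (sym (trans (*-congʳ (*-identityˡ 1#)) (*-identityˡ (pairs (ℓ i) zs))))) (go 0 0 zs eq)
      where
      go : ∀ x y zs → x ℕ.+ y ℕ.+ length zs ≡ d →
           sum (λ i → c i * ((proj₁ (ℓ i) ^ x * proj₂ (ℓ i) ^ y) * pairs (ℓ i) zs)) ≈ 0#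
      go x y []             eq = trans (sum-cong-≋ λ i → *-congˡ {c i} (*-identityʳ (proj₁ (ℓ i) ^ x * proj₂ (ℓ i) ^ y)))
        (moments x y (≡.trans (≡.sym (ℕ.+-identityʳ _)) eq))
      go x y ((ρ , σ) ∷ zs) eq = begin
        sum (λ i → c i * ((A i ^ x * B i ^ y) * ((A i * ρ + B i * σ) * P i)))
          ≈⟨ sum-cong-≋ (λ i → solve 8 (λ c a b u v ρ σ P →
               c :* ((u :* v) :* ((a :* ρ :+ b :* σ) :* P)) :=
               ρ :* (c :* (((a :* u) :* v) :* P)) :+ σ :* (c :* ((u :* (b :* v)) :* P)))
               refl (c i) (A i) (B i) (A i ^ x) (B i ^ y) ρ σ (P i)) ⟩
        sum (λ i → ρ * F i + σ * G i)
          ≈⟨ ∑-distrib-+ (λ i → ρ * F i) (λ i → σ * G i) ⟩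
        sum (λ i → ρ * F i) + sum (λ i → σ * G i)
          ≈⟨ +-cong (sym (*-distribˡ-sum ρ F)) (sym (*-distribˡ-sum σ G)) ⟩
        ρ * sum F + σ * sum G
          ≈⟨ +-cong (*-congˡ (go (suc x) y zs (≡.trans (≡.sym (ℕ.+-suc (x ℕ.+ y) (length zs))) eq)))
                    (*-congˡ (go x (suc y) zs (≡.trans (≡.trans (≡.cong (ℕ._+ length zs) (ℕ.+-suc x y))
                      (≡.sym (ℕ.+-suc (x ℕ.+ y) (length zs)))) eq))) ⟩
        ρ * 0# + σ * 0#
          ≈⟨ solve 2 (λ ρ σ → ρ :* con (+ 0) :+ σ :* con (+ 0) := con (+ 0)) refl ρ σ ⟩
        0# ∎
        where
        A B P F G : Fin k → Carrier
        A i = proj₁ (ℓ i)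
        B i = proj₂ (ℓ i)
        P i = pairs (ℓ i) zs
        F i = c i * ((A i ^ suc x * B i ^ y) * P i)
        G i = c i * ((A i ^ x * B i ^ suc y) * P i)

    -- Gaussian elimination without division: the pivot row is cross-multiplied into the other rows,
    -- and the unknowns found recursively are multiplied by the pivot. If the first column is zero,
    -- the first unit vector is a solution.
    underdetermined : (∀ x → x ≈ 0# ⊎ ¬ x ≈ 0#) → ∀ m (A : Fin m → Fin (suc m) → Carrier) →
      ∃ λ (c : Fin (suc m) → Carrier) → (∃ λ i → ¬ c i ≈ 0#) × (∀ r → sum (λ i → A r i * c i) ≈ 0#)
    underdetermined zero? zero    A = (λ _ → 1#) , (zero , 1≉0) , λ ()
    underdetermined zero? (suc m) A with Fin.any? (λ r → case zero? (A r zero) of λ { (inj₁ z) → no (λ nz → nz z) ; (inj₂ nz) → yes nz })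
    ... | no  all0 = e , (zero , 1≉0) , λ r → trans (sum-single (λ i → A r i * e i) zero (λ { zero h → contradiction ≡.refl h ; (suc i) _ → zeroʳ _ }))
                       (trans (*-identityʳ _) (case zero? (A r zero) of λ { (inj₁ z) → z ; (inj₂ nz) → contradiction (r , nz) all0 }))
      where
      e : Fin (suc (suc m)) → Carrier
      e zero    = 1#
      e (suc _) = 0#
    ... | yes (r₀ , pivot) with underdetermined zero? m (λ r i → A r₀ zero * A (Fin.punchIn r₀ r) (suc i) - A (Fin.punchIn r₀ r) zero * A r₀ (suc i))
    ...   | c′ , (i₀ , c′≉0) , h = c , (suc i₀ , nonzero-* pivot c′≉0) , solves
      where
      open import Algebra.Properties.Semiring.Sum semiring using (*-distribʳ-sum)
      a : Carrier
      a = A r₀ zero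
      row : Fin (suc m) → Carrier
      row r = sum (λ i → A r (suc i) * c′ i)
      c : Fin (suc (suc m)) → Carrier
      c zero    = - row r₀
      c (suc i) = a * c′ i
      total : ∀ r → sum (λ i → A r i * c i) ≈ A r zero * - row r₀ + a * row r
      total r = +-congˡ (trans (sum-cong-≋ {suc m} (λ i → solve 3 (λ x y z → x :* (y :* z) := y :* (x :* z)) refl (A r (suc i)) a (c′ i)))
        (sym (*-distribˡ-sum a (λ i → A r (suc i) * c′ i))))
      solves : ∀ r → sum (λ i → A r i * c i) ≈ 0#
      solves r with r₀ Fin.≟ r
      ... | yes ≡.refl = trans (total r) (solve 2 (λ a x → a :* (:- x) :+ a :* x := con (+ 0)) refl a (row r))
      ... | no  r₀≢r   = ≡.subst (λ r → sum (λ i → A r i * c i) ≈ 0#) (Fin.punchIn-punchOut r₀≢r) (begin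
          sum (λ i → A r′ i * c i)
            ≈⟨ total r′ ⟩
          A r′ zero * - row r₀ + a * row r′
            ≈⟨ solve 4 (λ b x a y → b :* (:- x) :+ a :* y := a :* y :+ (:- b) :* x) refl (A r′ zero) (row r₀) a (row r′) ⟩
          a * row r′ + (- A r′ zero) * row r₀
            ≈⟨ +-cong (*-distribˡ-sum a (λ i → A r′ (suc i) * c′ i)) (*-distribˡ-sum (- A r′ zero) (λ i → A r₀ (suc i) * c′ i)) ⟩
          sum (λ i → a * (A r′ (suc i) * c′ i)) + sum (λ i → - A r′ zero * (A r₀ (suc i) * c′ i))
            ≈⟨ ∑-distrib-+ (λ i → a * (A r′ (suc i) * c′ i)) (λ i → - A r′ zero * (A r₀ (suc i) * c′ i)) ⟨
          sum (λ i → a * (A r′ (suc i) * c′ i) + - A r′ zero * (A r₀ (suc i) * c′ i))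
            ≈⟨ sum-cong-≋ (λ i → solve 5 (λ a u c b v → a :* (u :* c) :+ (:- b) :* (v :* c) := (a :* u :- b :* v) :* c) refl
                 a (A r′ (suc i)) (c′ i) (A r′ zero) (A r₀ (suc i))) ⟩
          sum (λ i → (a * A r′ (suc i) - A r′ zero * A r₀ (suc i)) * c′ i)
            ≈⟨ h (Fin.punchOut r₀≢r) ⟩
          0# ∎)
        where
        r′ = Fin.punchIn r₀ (Fin.punchOut r₀≢r)

    -- Lagrange interpolation: for generic points, `pairs` against this list vanishes exactly at the
    -- indices in `ms`, so it cuts a relation down to the few remaining terms.
    kill : ∀ {k} → (Fin k → Point) → List (Fin k) → List Point
    kill ℓ = List.map (λ m → perp (ℓ m))

    length-kill : ∀ {k} (ℓ : Fin k → Point) ms → length (kill ℓ ms) ≡ length ms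
    length-kill ℓ ms = length-map (λ m → perp (ℓ m)) ms

    Generic : ∀ {k} → (Fin k → Point) → Set
    Generic ℓ = ∀ {i j} → i ≢ j → ¬ det (ℓ i) (ℓ j) ≈ 0#

    pairs-kill-∈ : ∀ {k} (ℓ : Fin k → Point) {i ms} → i ∈ ms → pairs (ℓ i) (kill ℓ ms) ≈ 0#
    pairs-kill-∈ ℓ {i} (here ≡.refl) = trans (*-congʳ (trans (pair-perp (ℓ i) (ℓ i)) (det-self (ℓ i)))) (zeroˡ _)
    pairs-kill-∈ ℓ     (there i∈)    = trans (*-congˡ (pairs-kill-∈ ℓ i∈)) (zeroʳ _)

    pairs-kill-∉ : ∀ {k} {ℓ : Fin k → Point} → Generic ℓ → ∀ {i} ms → i ∉ ms → ¬ pairs (ℓ i) (kill ℓ ms) ≈ 0#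
    pairs-kill-∉ gen []       i∉ = 1≉0
    pairs-kill-∉ {ℓ = ℓ} gen {i} (m ∷ ms) i∉ = nonzero-*
      (λ e → gen (λ m≡i → i∉ (here (≡.sym m≡i))) (trans (sym (pair-perp (ℓ i) (ℓ m))) e))
      (pairs-kill-∉ gen ms (i∉ ∘ there))

    module _ {k : ℕ} where
      open Removal (Fin._≟_ {k}) public

      all-but : Fin k → Fin k → List (Fin k)
      all-but i j = remove j (remove i (allFin k))

      all-but-unique : ∀ i j → Unique (all-but i j)
      all-but-unique i j = remove-unique {xs = remove i (allFin k)} (remove-unique {xs = allFin k} (Unique.allFin⁺ k))

      length-all-but : ∀ {i j} → i ≢ j → suc (suc (length (all-but i j))) ≡ k
      length-all-but {i} {j} i≢j = ≡.trans (≡.cong suc (length-remove (remove-unique (Unique.allFin⁺ k)) (remove-∈ (∈-allFin j) (i≢j ∘ ≡.sym))))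
        (≡.trans (length-remove (Unique.allFin⁺ k) (∈-allFin i)) (length-tabulate (λ i → i)))

      ∈-all-but : ∀ {i j l} → l ≢ i → l ≢ j → l ∈ all-but i j
      ∈-all-but {l = l} l≢i l≢j = remove-∈ (remove-∈ (∈-allFin l) l≢i) l≢j

      ∉-all-but₁ : ∀ i j → i ∉ all-but i j
      ∉-all-but₁ i j i∈ = remove-∉ i (allFin k) (remove-⊆ {xs = remove i (allFin k)} i∈)

    -- The d vectors that kill all indices but `i₀` and `i` reduce the relation to two terms; were
    -- `c i` zero, the term at `i₀` would have to vanish as well.
    relation-nonzero : (∀ x → x ≈ 0# ⊎ ¬ x ≈ 0#) → ∀ {d} {c : Fin (2 ℕ.+ d) → Carrier} {ℓ} → Generic ℓ →
      Relation d c ℓ → (∃ λ i → ¬ c i ≈ 0#) → ∀ i → ¬ c i ≈ 0#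
    relation-nonzero zero? {d} {c} {ℓ} gen rel (i₀ , c≉0) i ci≈0 with i₀ Fin.≟ i
    ... | yes ≡.refl = c≉0 ci≈0
    ... | no  i₀≢i   = nonzero-* c≉0 (pairs-kill-∉ gen ms (∉-all-but₁ i₀ i)) (begin
        c i₀ * P i₀
          ≈⟨ +-identityʳ _ ⟨
        c i₀ * P i₀ + 0#
          ≈⟨ +-congˡ (trans (*-congʳ ci≈0) (zeroˡ _)) ⟨
        c i₀ * P i₀ + c i * P i
          ≈⟨ sum-pair (λ j → c j * P j) i₀≢i (λ l l≢i₀ l≢i → trans (*-congˡ (pairs-kill-∈ ℓ (∈-all-but l≢i₀ l≢i))) (zeroʳ _)) ⟨
        form c ℓ (kill ℓ ms)
          ≈⟨ rel (kill ℓ ms) (≡.trans (length-kill ℓ ms) (ℕ.suc-injective (ℕ.suc-injective (length-all-but i₀≢i)))) ⟩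
        0# ∎)
      where
      ms = all-but i₀ i
      P : Fin (2 ℕ.+ d) → Carrier
      P j = pairs (ℓ j) (kill ℓ ms)

    -- The points y_i satisfy the three-term relations of the ℓ_i, so y is a linear image of ℓ.
    triple-relation : ∀ {d} {c y : Fin (3 ℕ.+ d) → Carrier} {ℓ} → Generic ℓ → (∀ i → ¬ c i ≈ 0#) →
      Relation (suc d) c ℓ → Relation d (λ i → c i * y i) ℓ → ∀ {i j l} → i ≢ j → i ≢ l → j ≢ l →
      det (ℓ j) (ℓ l) * y i + (det (ℓ l) (ℓ i) * y j + det (ℓ i) (ℓ j) * y l) ≈ 0#
    triple-relation {d} {c} {y} {ℓ} gen c≉0 rel₁ rel₀ {i} {j} {l} i≢j i≢l j≢l =
      cancel (nonzero-* (c≉0 i) (pairs-kill-∉ gen ms i∉)) (begin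
        (c i * X i) * (Djl * y i + (Dli * y j + Dij * y l))
          ≈⟨ solve 6 (λ x u v w dli dij → x :* (u :+ (dli :* v :+ dij :* w)) :=
               x :* u :+ ((x :* dli) :* v :+ (x :* dij) :* w)) refl (c i * X i) (Djl * y i) (y j) (y l) Dli Dij ⟩
        (c i * X i) * (Djl * y i) + (((c i * X i) * Dli) * y j + ((c i * X i) * Dij) * y l)
          ≈⟨ +-congˡ (+-cong (*-congʳ pair-l) (*-congʳ pair-j)) ⟩
        (c i * X i) * (Djl * y i) + (((c j * X j) * Djl) * y j + ((c l * X l) * Djl) * y l)
          ≈⟨ solve 10 (λ ci xi cj xj cl xl D yi yj yl →
               (ci :* xi) :* (D :* yi) :+ (((cj :* xj) :* D) :* yj :+ ((cl :* xl) :* D) :* yl) :=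
               D :* ((ci :* yi) :* xi :+ ((cj :* yj) :* xj :+ (cl :* yl) :* xl)))
               refl (c i) (X i) (c j) (X j) (c l) (X l) Djl (y i) (y j) (y l) ⟩
        Djl * ((c i * y i) * X i + ((c j * y j) * X j + (c l * y l) * X l))
          ≈⟨ *-congˡ (sum-triple (λ m → (c m * y m) * X m) i≢j i≢l j≢l vanish) ⟨
        Djl * form (λ m → c m * y m) ℓ (kill ℓ ms)
          ≈⟨ *-congˡ (rel₀ (kill ℓ ms) (≡.trans (length-kill ℓ ms) len)) ⟩
        Djl * 0#
          ≈⟨ zeroʳ _ ⟩
        0# ∎)
      where
      ms = remove l (all-but i j)
      X : Fin (3 ℕ.+ d) → Carrier
      X m = pairs (ℓ m) (kill ℓ ms)
      Dij = det (ℓ i) (ℓ j)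
      Djl = det (ℓ j) (ℓ l)
      Dli = det (ℓ l) (ℓ i)

      len : length ms ≡ d
      len = ℕ.suc-injective (≡.trans
        (length-remove {xs = all-but i j} (all-but-unique i j) (∈-all-but (i≢l ∘ ≡.sym) (j≢l ∘ ≡.sym)))
        (ℕ.suc-injective (ℕ.suc-injective (length-all-but i≢j))))

      i∉ : i ∉ ms
      i∉ i∈ = ∉-all-but₁ i j (remove-⊆ {xs = all-but i j} i∈)

      vanish : ∀ m → m ≢ i → m ≢ j → m ≢ l → (c m * y m) * X m ≈ 0#
      vanish m m≢i m≢j m≢l = trans (*-congˡ (pairs-kill-∈ ℓ (remove-∈ (∈-all-but m≢i m≢j) m≢l))) (zeroʳ _)

      -- Killing `w` as well uses the additional degree of `rel₁`; the two surviving terms give the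
      -- ratio of their weights `c m * X m` as a ratio of determinants.
      two : ∀ {u v w} → u ≢ v → (∀ m → m ≢ u → m ≢ v → m ∈ (w ∷ ms)) →
            (c u * X u) * det (ℓ w) (ℓ u) + (c v * X v) * det (ℓ w) (ℓ v) ≈ 0#
      two {u} {v} {w} u≢v cover = begin
        (c u * X u) * det (ℓ w) (ℓ u) + (c v * X v) * det (ℓ w) (ℓ v)
          ≈⟨ +-cong (rearrange u) (rearrange v) ⟩
        c u * pairs (ℓ u) (kill ℓ (w ∷ ms)) + c v * pairs (ℓ v) (kill ℓ (w ∷ ms))
          ≈⟨ sum-pair (λ m → c m * pairs (ℓ m) (kill ℓ (w ∷ ms))) u≢v
               (λ m m≢u m≢v → trans (*-congˡ (pairs-kill-∈ ℓ (cover m m≢u m≢v))) (zeroʳ _)) ⟨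
        form c ℓ (kill ℓ (w ∷ ms))
          ≈⟨ rel₁ (kill ℓ (w ∷ ms)) (≡.cong suc (≡.trans (length-kill ℓ ms) len)) ⟩
        0# ∎
        where
        rearrange : ∀ m → (c m * X m) * det (ℓ w) (ℓ m) ≈ c m * pairs (ℓ m) (kill ℓ (w ∷ ms))
        rearrange m = trans (*-assoc _ _ _) (*-congˡ (trans (*-comm _ _) (*-congʳ (sym (pair-perp (ℓ m) (ℓ w))))))

      cover : ∀ {m} → m ≢ i → m ≢ j → m ≢ l → m ∈ ms
      cover m≢i m≢j m≢l = remove-∈ (∈-all-but m≢i m≢j) m≢l

      cover-l : ∀ m → m ≢ i → m ≢ j → m ∈ (l ∷ ms)
      cover-l m m≢i m≢j with m Fin.≟ l
      ... | yes m≡l = here m≡l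
      ... | no  m≢l = there (cover m≢i m≢j m≢l)

      cover-j : ∀ m → m ≢ i → m ≢ l → m ∈ (j ∷ ms)
      cover-j m m≢i m≢l with m Fin.≟ j
      ... | yes m≡j = here m≡j
      ... | no  m≢j = there (cover m≢i m≢j m≢l)

      pair-l : (c i * X i) * Dli ≈ (c j * X j) * Djl
      pair-l = begin
        (c i * X i) * Dli
          ≈⟨ solve 2 (λ u v → u := (u :+ v) :- v) refl _ _ ⟩
        ((c i * X i) * Dli + (c j * X j) * det (ℓ l) (ℓ j)) - (c j * X j) * det (ℓ l) (ℓ j)
          ≈⟨ +-cong (two i≢j cover-l) (-‿cong (*-congˡ (det-swap (ℓ l) (ℓ j)))) ⟩
        0# - (c j * X j) * - Djl
          ≈⟨ solve 2 (λ x D → con (+ 0) :- x :* (:- D) := x :* D) refl (c j * X j) Djl ⟩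
        (c j * X j) * Djl ∎

      pair-j : (c i * X i) * Dij ≈ (c l * X l) * Djl
      pair-j = begin
        (c i * X i) * Dij
          ≈⟨ *-congˡ (det-swap (ℓ i) (ℓ j)) ⟩
        (c i * X i) * - det (ℓ j) (ℓ i)
          ≈⟨ solve 4 (λ x D x′ D′ → x :* (:- D) := x′ :* D′ :- (x :* D :+ x′ :* D′)) refl (c i * X i) (det (ℓ j) (ℓ i)) (c l * X l) Djl ⟩
        (c l * X l) * Djl - ((c i * X i) * det (ℓ j) (ℓ i) + (c l * X l) * Djl)
          ≈⟨ +-congˡ (-‿cong (two i≢l cover-j)) ⟩
        (c l * X l) * Djl - 0#
          ≈⟨ solve 1 (λ x → x :- con (+ 0) := x) refl _ ⟩
        (c l * X l) * Djl ∎

-- Relations with signed coefficients and the distinctness of labels.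

module SignedRelations where

  open import Data.List.Properties using (length-tabulate)
  open IntegerCoefficients
  open BinaryForms

  module SignRelation (R : CommutativeRing 0ℓ 0ℓ) (isDomain : IsDomain R) where

    open IsDomain isDomain renaming (noZeroDivisors to domain)
    open CommutativeRing R hiding (zero)
    open FromℤRing R
    open Solver using (solve; con; _:+_; _:*_; :-_; _:-_; _:=_)
    open NewtonIdentities.Newton R
    open Forms R isDomain
    open import Algebra.Properties.Semiring.Sum semiring
      using (sum; sum-cong-≋; *-distribˡ-sum; ∑-distrib-+)
    open import Algebra.Properties.Semiring.Mult.TCOptimised semiring using (×-homo-+)
    open import Relation.Binary.Reasoning.Setoid setoid

    sign : Bool → Carrier
    sign true  = 1#
    sign false = - 1#

    sign² : ∀ b → sign b * sign b ≈ 1#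
    sign² true  = *-identityˡ 1#
    sign² false = solve 0 ((:- con (+ 1)) :* (:- con (+ 1)) := con (+ 1)) refl

    sign≉0 : ∀ b → ¬ sign b ≈ 0#
    sign≉0 b e = 1≉0 (trans (sym (sign² b)) (trans (*-congʳ e) (zeroˡ _)))

    select : Bool → ∀ {n} → (Fin n → Bool) → (Fin n → Carrier) → List Carrier
    select b {zero}  ε β = []
    select b {suc n} ε β with ε zero | b
    ... | true  | true  = β zero ∷ select b (ε ∘ suc) (β ∘ suc)
    ... | false | false = β zero ∷ select b (ε ∘ suc) (β ∘ suc)
    ... | true  | false = select b (ε ∘ suc) (β ∘ suc)
    ... | false | true  = select b (ε ∘ suc) (β ∘ suc)

    select-length : ∀ {n} (ε : Fin n → Bool) β → length (select true ε β) ℕ.+ length (select false ε β) ≡ n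
    select-length {zero}  ε β = ≡.refl
    select-length {suc n} ε β with ε zero
    ... | true  = ≡.cong suc (select-length (ε ∘ suc) (β ∘ suc))
    ... | false = ≡.trans (ℕ.+-suc _ _) (≡.cong suc (select-length (ε ∘ suc) (β ∘ suc)))

    select-powerSum : ∀ {n} (ε : Fin n → Bool) β x →
      powerSum (select true ε β) x ≈ powerSum (select false ε β) x + sum (λ i → sign (ε i) * β i ^ x)
    select-powerSum {zero}  ε β x = sym (+-identityʳ _)
    select-powerSum {suc n} ε β x with ε zero
    ... | true  = trans (+-congˡ (select-powerSum (ε ∘ suc) (β ∘ suc) x))
      (solve 3 (λ b p s → b :+ (p :+ s) := p :+ (con (+ 1) :* b :+ s)) refl (β zero ^ x) _ _)
    ... | false = trans (select-powerSum (ε ∘ suc) (β ∘ suc) x)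
      (solve 3 (λ b p s → p :+ s := (b :+ p) :+ ((:- con (+ 1)) :* b :+ s)) refl (β zero ^ x) _ _)

    powerSum-0 : ∀ l → powerSum l 0 ≈ length l · 1#
    powerSum-0 []      = refl
    powerSum-0 (β ∷ l) = trans (+-congˡ (powerSum-0 l)) (sym (1+× (length l) 1#))

    module _ {h : ℕ} (ε : Fin (4 ℕ.+ (h ℕ.+ h)) → Bool) (ℓ : Fin (4 ℕ.+ (h ℕ.+ h)) → Point) (gen : Generic ℓ)
      (char : ∀ n → suc n ℕ.≤ 4 ℕ.+ (h ℕ.+ h) → ¬ suc n · 1# ≈ 0#)
      (rel : Relation (2 ℕ.+ (h ℕ.+ h)) (λ i → sign (ε i)) ℓ)
      (collinear : ∀ {i j l} → i ≢ j → i ≢ l → j ≢ l →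
        det (ℓ j) (ℓ l) * sign (ε i) + (det (ℓ l) (ℓ i) * sign (ε j) + det (ℓ i) (ℓ j) * sign (ε l)) ≈ 0#)
      where

      private
        k : ℕ
        k = 4 ℕ.+ (h ℕ.+ h)

        e : Fin k → Carrier
        e i = sign (ε i)

        o o′ : Fin k
        o  = zero
        o′ = suc zero

        -- collinear says that the points e_i ℓ_i lie on a line; β is an affine coordinate on it.
        β : Fin k → Carrier
        β i = det (ℓ o) (ℓ i) * (e o * e i)

        β-o : β o ≈ 0#
        β-o = trans (*-congʳ (det-self (ℓ o))) (zeroˡ _)

        e²-cancel : ∀ i x → x * (e i * e i) ≈ x
        e²-cancel i x = trans (*-congˡ (sign² (ε i))) (*-identityʳ x)

        -- Multiplying `collinear` for the triple `o`, `i`, `m` by the product of the three signs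
        -- turns determinants of signed points into differences of β; coinciding indices are treated
        -- apart.
        β-difference : ∀ i m → det (ℓ i) (ℓ m) * (e i * e m) ≈ β m - β i
        β-difference i m with i Fin.≟ m
        ... | yes ≡.refl = trans (trans (*-congʳ (det-self (ℓ i))) (zeroˡ _)) (sym (-‿inverseʳ _))
        ... | no  i≢m with i Fin.≟ o | m Fin.≟ o
        ...   | yes ≡.refl | _ = trans (solve 1 (λ x → x := x :- con (+ 0)) refl (β m)) (+-congˡ (-‿cong (sym β-o)))
        ...   | no  _ | yes ≡.refl = begin
          det (ℓ i) (ℓ o) * (e i * e o)
            ≈⟨ *-congʳ (det-swap (ℓ i) (ℓ o)) ⟩
          - det (ℓ o) (ℓ i) * (e i * e o)
            ≈⟨ solve 3 (λ D x y → (:- D) :* (x :* y) := con (+ 0) :- D :* (y :* x)) refl (det (ℓ o) (ℓ i)) (e i) (e o) ⟩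
          0# - β i
            ≈⟨ +-congʳ β-o ⟨
          β o - β i ∎
        ...   | no i≢o | no m≢o = begin
          Dim * (e i * e m)
            ≈⟨ e²-cancel o _ ⟨
          (Dim * (e i * e m)) * (e o * e o)
            ≈⟨ solve 6 (λ Dim Dmo Doi x y z → (Dim :* (x :* y)) :* (z :* z) :=
                 (z :* x :* y) :* (Dim :* z :+ (Dmo :* x :+ Doi :* y)) :-
                 ((Dmo :* (z :* y)) :* (x :* x) :+ (Doi :* (z :* x)) :* (y :* y))) refl Dim Dmo Doi (e i) (e m) (e o) ⟩
          (e o * e i * e m) * (Dim * e o + (Dmo * e i + Doi * e m)) -
            ((Dmo * (e o * e m)) * (e i * e i) + (Doi * (e o * e i)) * (e m * e m))
            ≈⟨ +-cong (trans (*-congˡ (collinear (i≢o ∘ ≡.sym) (m≢o ∘ ≡.sym) i≢m)) (zeroʳ _))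
                      (-‿cong (+-cong (e²-cancel i _) (e²-cancel m _))) ⟩
          0# - (Dmo * (e o * e m) + β i)
            ≈⟨ +-congˡ (-‿cong (+-congʳ (*-congʳ (det-swap (ℓ m) (ℓ o))))) ⟩
          0# - (- det (ℓ o) (ℓ m) * (e o * e m) + β i)
            ≈⟨ solve 3 (λ D x y → con (+ 0) :- ((:- D) :* x :+ y) := D :* x :- y) refl (det (ℓ o) (ℓ m)) (e o * e m) (β i) ⟩
          β m - β i ∎
          where
          Dim = det (ℓ i) (ℓ m)
          Dmo = det (ℓ m) (ℓ o)
          Doi = det (ℓ o) (ℓ i)

        β-distinct : ∀ {i m} → i ≢ m → ¬ β m - β i ≈ 0#
        β-distinct {i} {m} i≢m h = nonzero-* (gen i≢m) (nonzero-* (sign≉0 (ε i)) (sign≉0 (ε m))) (trans (β-difference i m) h)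

        Q : Fin k → List (Fin k) → Carrier
        Q i []       = 1#
        Q i (m ∷ ms) = (β i - β m) * Q i ms

        -- The signed moment Σ e_i F(β_i) of the polynomial F = X^x ∏ (X - β_m), whose degree is x
        -- plus the length of `ms`.
        S : ℕ → List (Fin k) → Carrier
        S x ms = sum λ i → e i * (β i ^ x * Q i ms)

        E : List (Fin k) → Carrier
        E []       = 1#
        E (m ∷ ms) = e m * E ms

        pairs-kill : ∀ i ms → pairs (ℓ i) (kill ℓ ms) ≈ E ms * (e i ^ length ms * Q i ms)
        pairs-kill i []       = solve 0 (con (+ 1) := con (+ 1) :* (con (+ 1) :* con (+ 1))) refl
        pairs-kill i (m ∷ ms) = begin
          pair (ℓ i) (perp (ℓ m)) * pairs (ℓ i) (kill ℓ ms)
            ≈⟨ *-cong (trans (pair-perp (ℓ i) (ℓ m)) (trans (sym (e²-cancel i _)) (sym (e²-cancel m _)))) (pairs-kill i ms) ⟩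
          ((D * (e i * e i)) * (e m * e m)) * (E ms * (u * Q i ms))
            ≈⟨ solve 6 (λ D x y E u q → ((D :* (x :* x)) :* (y :* y)) :* (E :* (u :* q)) :=
                 (y :* E) :* ((x :* u) :* ((D :* (y :* x)) :* q))) refl D (e i) (e m) (E ms) u (Q i ms) ⟩
          (e m * E ms) * ((e i * u) * ((D * (e m * e i)) * Q i ms))
            ≈⟨ *-congˡ (*-congˡ (*-congʳ (β-difference m i))) ⟩
          (e m * E ms) * ((e i * u) * ((β i - β m) * Q i ms)) ∎
          where
          D = det (ℓ m) (ℓ i)
          u = e i ^ length ms

        E² : ∀ ms → E ms * E ms ≈ 1#
        E² []       = *-identityˡ 1#
        E² (m ∷ ms) = trans (solve 2 (λ x y → (x :* y) :* (x :* y) := (y :* y) :* (x :* x)) refl (e m) (E ms))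
          (trans (e²-cancel m _) (E² ms))

        e-even : ∀ i n → e i ^ (n ℕ.+ n) ≈ 1#
        e-even i zero    = refl
        e-even i (suc n) = ≡.subst (λ j → e i * e i ^ j ≈ 1#) (≡.sym (ℕ.+-suc n n))
          (trans (sym (*-assoc _ _ _)) (trans (*-cong (sign² (ε i)) (e-even i n)) (*-identityˡ 1#)))

        -- Each killing vector contributes a sign e_i by `pairs-kill`. There are k - 2 of them, an
        -- even number, so these signs cancel and only the coefficient e_i of the relation is left.
        top : ∀ ms → length ms ≡ 2 ℕ.+ (h ℕ.+ h) → S 0 ms ≈ 0#
        top ms len = cancel E≉0 (begin
          E ms * S 0 ms
            ≈⟨ *-distribˡ-sum (E ms) (λ i → e i * (1# * Q i ms)) ⟩
          sum (λ i → E ms * (e i * (1# * Q i ms)))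
            ≈⟨ sum-cong-≋ {k} (λ i → begin
                 E ms * (e i * (1# * Q i ms))
                   ≈⟨ *-congˡ (*-congˡ (*-congʳ (trans (reflexive (≡.cong (e i ^_) (≡.trans len (≡.cong suc (≡.sym (ℕ.+-suc h h)))))) (e-even i (suc h))))) ⟨
                 E ms * (e i * (e i ^ length ms * Q i ms))
                   ≈⟨ solve 4 (λ E x u q → E :* (x :* (u :* q)) := x :* (E :* (u :* q))) refl (E ms) (e i) _ (Q i ms) ⟩
                 e i * (E ms * (e i ^ length ms * Q i ms))
                   ≈⟨ *-congˡ (pairs-kill i ms) ⟨
                 e i * pairs (ℓ i) (kill ℓ ms) ∎) ⟩
          form e ℓ (kill ℓ ms)
            ≈⟨ rel (kill ℓ ms) (≡.trans (length-kill ℓ ms) len) ⟩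
          0# ∎)
          where
          E≉0 : ¬ E ms ≈ 0#
          E≉0 z = 1≉0 (trans (sym (E² ms)) (trans (*-congʳ z) (zeroˡ _)))

        -- β vanishes at `o`, so the factor for `o` is a plain factor X.
        S-suc : ∀ x ms → S x (o ∷ ms) ≈ S (suc x) ms
        S-suc x ms = sum-cong-≋ {k} λ i → trans
          (*-congˡ (*-congˡ (*-congʳ (trans (+-congˡ (-‿cong β-o)) (solve 1 (λ x → x :- con (+ 0) := x) refl (β i))))))
          (solve 4 (λ e b u q → e :* (u :* (b :* q)) := e :* ((b :* u) :* q)) refl (e i) (β i) (β i ^ x) (Q i ms))

        S-∷ : ∀ x m ms → S x (m ∷ ms) ≈ S (suc x) ms - β m * S x ms
        S-∷ x m ms = begin
          sum (λ i → e i * (β i ^ x * ((β i - β m) * Q i ms)))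
            ≈⟨ sum-cong-≋ {k} (λ i → solve 5 (λ e b m u q → e :* (u :* ((b :- m) :* q)) := e :* ((b :* u) :* q) :+ (:- m) :* (e :* (u :* q)))
                 refl (e i) (β i) (β m) (β i ^ x) (Q i ms)) ⟩
          sum (λ i → e i * (β i ^ suc x * Q i ms) + - β m * (e i * (β i ^ x * Q i ms)))
            ≈⟨ ∑-distrib-+ (λ i → e i * (β i ^ suc x * Q i ms)) (λ i → - β m * (e i * (β i ^ x * Q i ms))) ⟩
          S (suc x) ms + sum (λ i → - β m * (e i * (β i ^ x * Q i ms)))
            ≈⟨ +-congˡ (*-distribˡ-sum (- β m) (λ i → e i * (β i ^ x * Q i ms))) ⟨
          S (suc x) ms + - β m * S x ms
            ≈⟨ +-congˡ (solve 2 (λ m s → (:- m) :* s := :- (m :* s)) refl (β m) (S x ms)) ⟩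
          S (suc x) ms - β m * S x ms ∎

        total : ∀ x ms → x ℕ.+ length ms ≡ 2 ℕ.+ (h ℕ.+ h) → S x ms ≈ 0#
        total zero    ms eq = top ms eq
        total (suc x) ms eq = trans (sym (S-suc x ms)) (total x (o ∷ ms) (≡.trans (ℕ.+-suc x _) eq))

        -- Descent in the degree: β(o′) times the moment of F is the moment of X F minus that of (X
        -- - β(o′)) F, both of degree one higher, and β(o′) is nonzero. The argument `g` is the
        -- distance to k - 2.
        down : ∀ g x ms → g ℕ.+ (x ℕ.+ length ms) ≡ 2 ℕ.+ (h ℕ.+ h) → S x ms ≈ 0#
        down zero    x ms eq = total x ms eq
        down (suc g) x ms eq = cancel β≉0 (begin
          β o′ * S x ms
            ≈⟨ solve 2 (λ u v → v := u :- (u :- v)) refl (S (suc x) ms) _ ⟩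
          S (suc x) ms - (S (suc x) ms - β o′ * S x ms)
            ≈⟨ +-cong (down g (suc x) ms (≡.trans (ℕ.+-suc g _) eq)) (-‿cong (trans (sym (S-∷ x o′ ms))
                 (down g x (o′ ∷ ms) (≡.trans (≡.cong (g ℕ.+_) (ℕ.+-suc x _)) (≡.trans (ℕ.+-suc g _) eq))))) ⟩
          0# - 0#
            ≈⟨ -‿inverseʳ 0# ⟩
          0# ∎)
          where
          β≉0 : ¬ β o′ ≈ 0#
          β≉0 z = β-distinct {o} {o′} (λ ()) (trans (+-cong z (-‿cong β-o)) (-‿inverseʳ 0#))

        S-powers : ∀ x → S x [] ≈ sum (λ i → e i * β i ^ x)
        S-powers x = sum-cong-≋ {k} λ i → *-congˡ {e i} (*-identityʳ (β i ^ x))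

        l⁺ l⁻ : List Carrier
        l⁺ = select true ε β
        l⁻ = select false ε β

        same : ∀ x → x ℕ.≤ 2 ℕ.+ (h ℕ.+ h) → powerSum l⁺ x ≈ powerSum l⁻ x
        same x x≤ = trans (select-powerSum ε β x) (trans (+-congˡ (trans (sym (S-powers x))
          (down (2 ℕ.+ (h ℕ.+ h) ℕ.∸ x) x [] (≡.trans (≡.cong (2 ℕ.+ (h ℕ.+ h) ℕ.∸ x ℕ.+_) (ℕ.+-identityʳ x)) (ℕ.m∸n+n≡m x≤)))))
          (+-identityʳ _))

        lengths : length l⁺ ℕ.+ length l⁻ ≡ k
        lengths = select-length ε β

        -- Lengths agree in R, and the characteristic is large.
        not-shorter : ∀ (l l′ : List Carrier) → length l ℕ.+ length l′ ≡ k → powerSum l 0 ≈ powerSum l′ 0 → ¬ length l ℕ.< length l′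
        not-shorter l l′ eq h l<l′ = char (length l′ ℕ.∸ suc (length l)) (ℕ.≤-trans (ℕ.≤-reflexive (≡.sym suc-gap)) (ℕ.≤-trans (ℕ.m∸n≤m (length l′) (length l))
            (ℕ.≤-trans (ℕ.m≤n+m (length l′) (length l)) (ℕ.≤-reflexive eq)))) (begin
          suc (length l′ ℕ.∸ suc (length l)) · 1#
            ≡⟨ ≡.cong (_· 1#) suc-gap ⟨
          gap · 1#
            ≈⟨ solve 2 (λ g x → g := (x :+ g) :- x) refl (gap · 1#) (length l · 1#) ⟩
          (length l · 1# + gap · 1#) - length l · 1#
            ≈⟨ +-congʳ (×-homo-+ 1# (length l) gap) ⟨
          (length l ℕ.+ gap) · 1# - length l · 1#
            ≡⟨ ≡.cong (λ n → n · 1# - length l · 1#) (ℕ.m+[n∸m]≡n (ℕ.<⇒≤ l<l′)) ⟩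
          length l′ · 1# - length l · 1#
            ≈⟨ +-cong (sym (powerSum-0 l′)) (-‿cong (trans (sym (powerSum-0 l)) h)) ⟩
          powerSum l′ 0 - powerSum l′ 0
            ≈⟨ -‿inverseʳ _ ⟩
          0# ∎)
          where
          gap : ℕ
          gap = length l′ ℕ.∸ length l
          suc-gap : gap ≡ suc (length l′ ℕ.∸ suc (length l))
          suc-gap = ≡.sym (ℕ.suc-pred gap {{ℕ.>-nonZero (ℕ.m<n⇒0<n∸m l<l′)}}) ▸ ≡.cong suc (ℕ.pred[m∸n]≡m∸[1+n] (length l′) (length l))
            where
            infixr 4 _▸_
            _▸_ = ≡.trans {A = ℕ}

        equal-lengths : length l⁺ ≡ length l⁻
        equal-lengths with ℕ.<-cmp (length l⁺) (length l⁻)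
        ... | tri< lt _ _ = contradiction lt (not-shorter l⁺ l⁻ lengths (same 0 z≤n))
        ... | tri≈ _ eq _ = eq
        ... | tri> _ _ gt = contradiction gt (not-shorter l⁻ l⁺ (≡.trans (ℕ.+-comm (length l⁻) _) lengths) (sym (same 0 z≤n)))

        half≤ : ∀ n → n ℕ.+ n ≡ k → n ℕ.≤ 2 ℕ.+ (h ℕ.+ h)
        half≤ (suc (suc n)) eq = ℕ.≤-trans (ℕ.+-monoʳ-≤ 2 (ℕ.m≤m+n n n)) (ℕ.≤-reflexive
          (≡.trans (≡.sym (≡.trans (ℕ.+-suc n (suc n)) (≡.cong suc (ℕ.+-suc n n)))) (ℕ.suc-injective (ℕ.suc-injective eq))))
        half≤ (suc zero) ()

        short⁺ : length l⁺ ℕ.≤ 2 ℕ.+ (h ℕ.+ h)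
        short⁺ = half≤ _ (≡.trans (≡.cong (length l⁺ ℕ.+_) equal-lengths) lengths)

        short⁻ : length l⁻ ℕ.≤ 2 ℕ.+ (h ℕ.+ h)
        short⁻ = ≡.subst (ℕ._≤ 2 ℕ.+ (h ℕ.+ h)) equal-lengths short⁺

        -- Degree k - 1 is out of reach of the relation. But the plus and the minus class have k/2 ≤
        -- k - 2 members each and the same power sums up to k - 2, so Newton's identities supply one
        -- more.
        next : S (3 ℕ.+ (h ℕ.+ h)) [] ≈ 0#
        next = begin
          S (suc M) []
            ≈⟨ S-powers (suc M) ⟩
          sum (λ i → e i * β i ^ suc M)
            ≈⟨ solve 2 (λ p s → s := (p :+ s) :- p) refl (powerSum l⁻ (suc M)) (sum (λ i → e i * β i ^ suc M)) ⟩
          (powerSum l⁻ (suc M) + sum (λ i → e i * β i ^ suc M)) - powerSum l⁻ (suc M)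
            ≈⟨ +-congʳ (select-powerSum ε β (suc M)) ⟨
          powerSum l⁺ (suc M) - powerSum l⁻ (suc M)
            ≈⟨ +-congʳ (powerSums-agree-suc domain M (λ n n≤ → char n (ℕ.≤-trans n≤ (ℕ.≤-trans (ℕ.n≤1+n M) (ℕ.n≤1+n (suc M))))) l⁺ l⁻ same short⁺ short⁻) ⟩
          powerSum l⁻ (suc M) - powerSum l⁻ (suc M)
            ≈⟨ -‿inverseʳ _ ⟩
          0# ∎
          where
          M : ℕ
          M = 2 ℕ.+ (h ℕ.+ h)

        up : ∀ x ms → x ℕ.+ length ms ℕ.≤ 3 ℕ.+ (h ℕ.+ h) → S x ms ≈ 0#
        up x [] le with x ℕ.≟ 3 ℕ.+ (h ℕ.+ h)
        ... | yes ≡.refl = next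
        ... | no  x≢     = down (2 ℕ.+ (h ℕ.+ h) ℕ.∸ x) x [] (≡.trans (≡.cong (2 ℕ.+ (h ℕ.+ h) ℕ.∸ x ℕ.+_) (ℕ.+-identityʳ x))
          (ℕ.m∸n+n≡m (ℕ.≤-pred (ℕ.≤∧≢⇒< (ℕ.≤-trans (ℕ.≤-reflexive (≡.sym (ℕ.+-identityʳ x))) le) x≢))))
        up x (m ∷ ms) le = begin
          S x (m ∷ ms)
            ≈⟨ S-∷ x m ms ⟩
          S (suc x) ms - β m * S x ms
            ≈⟨ +-cong (up (suc x) ms le′) (-‿cong (*-congˡ (up x ms (ℕ.≤-trans (ℕ.n≤1+n _) le′)))) ⟩
          0# - β m * 0#
            ≈⟨ solve 1 (λ b → con (+ 0) :- b :* con (+ 0) := con (+ 0)) refl (β m) ⟩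
          0# ∎
          where
          le′ = ℕ.≤-trans (ℕ.≤-reflexive (≡.sym (ℕ.+-suc x (length ms)))) le

        rest : List (Fin k)
        rest = remove o (allFin k)

        Q-∈ : ∀ i ms → i ∈ ms → Q i ms ≈ 0#
        Q-∈ i (m ∷ ms) (here ≡.refl) = trans (*-congʳ (-‿inverseʳ _)) (zeroˡ _)
        Q-∈ i (m ∷ ms) (there i∈)    = trans (*-congˡ (Q-∈ i ms i∈)) (zeroʳ _)

        Q-∉ : ∀ i ms → i ∉ ms → ¬ Q i ms ≈ 0#
        Q-∉ i []       i∉ = 1≉0
        Q-∉ i (m ∷ ms) i∉ = nonzero-* (β-distinct (λ m≡i → i∉ (here (≡.sym m≡i)))) (Q-∉ i ms (i∉ ∘ there))

      -- All signed moments of degree below k vanish. The polynomial with roots at every β except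
      -- that of `o` has degree k - 1, and its moment is a single nonzero term because the β are
      -- distinct.
      no-sign-relation : ⊥
      no-sign-relation = nonzero-* (sign≉0 (ε o)) (nonzero-* 1≉0 (Q-∉ o rest (remove-∉ o (allFin k)))) (begin
        e o * (1# * Q o rest)
          ≈⟨ sum-single (λ i → e i * (1# * Q i rest)) o (λ j j≢o → trans (*-congˡ (trans (*-congˡ
               (Q-∈ j rest (remove-∈ (∈-allFin j) j≢o))) (zeroʳ _))) (zeroʳ _)) ⟨
        S 0 rest
          ≈⟨ up 0 rest (ℕ.≤-reflexive (ℕ.suc-injective (≡.trans (length-remove {xs = allFin k} (Unique.allFin⁺ k) (∈-allFin o)) (length-tabulate {n = k} (λ i → i))))) ⟩
        0# ∎)

    module _ {h : ℕ} (char : ∀ n → suc n ℕ.≤ 4 ℕ.+ (h ℕ.+ h) → ¬ suc n · 1# ≈ 0#)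
      {γ : Fin (4 ℕ.+ (h ℕ.+ h)) → Carrier} {ℓ₀ ℓ : Fin (4 ℕ.+ (h ℕ.+ h)) → Point}
      (γ≉0 : ∀ i → ¬ γ i ≈ 0#) (gen₀ : Generic ℓ₀) (gen : Generic ℓ)
      (j : Fin (4 ℕ.+ (h ℕ.+ h)) → Fin (4 ℕ.+ (h ℕ.+ h))) (ε : Fin (4 ℕ.+ (h ℕ.+ h)) → Bool)
      (rel  : Relation (2 ℕ.+ (h ℕ.+ h)) (λ i → sign (ε i) * γ (j i)) ℓ)
      (rel₁ : Relation (1 ℕ.+ (h ℕ.+ h)) (λ i → γ (j i) * proj₁ (ℓ₀ (j i))) ℓ)
      (rel₂ : Relation (1 ℕ.+ (h ℕ.+ h)) (λ i → γ (j i) * proj₂ (ℓ₀ (j i))) ℓ)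
      where

      private
        k : ℕ
        k = 4 ℕ.+ (h ℕ.+ h)

        e a b : Fin k → Carrier
        e i = sign (ε i)
        a i = proj₁ (ℓ₀ (j i))
        b i = proj₂ (ℓ₀ (j i))

        D : Fin k → Fin k → Carrier
        D i l = det (ℓ i) (ℓ l)

        -- As e_i² = 1, the coefficients can be written with the factor e_i γ of `rel`, the form in
        -- which `triple-relation` takes them.
        twist : ∀ (y : Fin k → Carrier) → Relation (1 ℕ.+ (h ℕ.+ h)) (λ i → γ (j i) * y i) ℓ →
                Relation (1 ℕ.+ (h ℕ.+ h)) (λ i → (e i * γ (j i)) * (e i * y i)) ℓ
        twist y r zs eq = trans (sum-cong-≋ {k} λ i → *-congʳ {pairs (ℓ i) zs} (trans
            (solve 3 (λ e g y → (e :* g) :* (e :* y) := (g :* y) :* (e :* e)) refl (e i) (γ (j i)) (y i))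
            (trans (*-congˡ {γ (j i) * y i} (sign² (ε i))) (*-identityʳ _)))) (r zs eq)

        line : ∀ y → Relation (1 ℕ.+ (h ℕ.+ h)) (λ i → γ (j i) * y i) ℓ → ∀ {i l m} → i ≢ l → i ≢ m → l ≢ m →
               D l m * (e i * y i) + (D m i * (e l * y l) + D i l * (e m * y m)) ≈ 0#
        line y r = triple-relation {c = λ i → e i * γ (j i)} {y = λ i → e i * y i} gen
          (λ i → nonzero-* (sign≉0 (ε i)) (γ≉0 (j i))) rel (twist y r)

        -- The signed vectors e ℓ₀(j) at `i`, `l`, `m` are linearly dependent with nonzero
        -- determinants as coefficients. Two of them are parallel by assumption, hence all three
        -- are, and parallel points of the generic family have the same index.
        parallel : ∀ {i l} → i ≢ l → j i ≡ j l → ∀ m → j m ≡ j i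
        parallel {i} {l} i≢l ji≡jl m with m Fin.≟ i | m Fin.≟ l | j m Fin.≟ j i
        ... | yes ≡.refl | _ | _ = ≡.refl
        ... | _ | yes ≡.refl | _ = ≡.sym ji≡jl
        ... | _ | _ | yes eq = eq
        ... | no m≢i | no m≢l | no jm≢ji = contradiction (begin
            (D i l * (e i * e m)) * (a i * b m - b i * a m)
              ≈⟨ solve 12 (λ Dlm Dmi Dil ei el em ai al am bi bl bm →
                   (Dil :* (ei :* em)) :* (ai :* bm :- bi :* am) :=
                   ((ei :* ai) :* (Dlm :* (ei :* bi) :+ (Dmi :* (el :* bl) :+ Dil :* (em :* bm))) :-
                    (ei :* bi) :* (Dlm :* (ei :* ai) :+ (Dmi :* (el :* al) :+ Dil :* (em :* am)))) :-
                   (Dmi :* (ei :* el)) :* (ai :* bl :- bi :* al)) refl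
                   (D l m) (D m i) (D i l) (e i) (e l) (e m) (a i) (a l) (a m) (b i) (b l) (b m) ⟩
            ((e i * a i) * (D l m * (e i * b i) + (D m i * (e l * b l) + D i l * (e m * b m))) -
             (e i * b i) * (D l m * (e i * a i) + (D m i * (e l * a l) + D i l * (e m * a m)))) -
             (D m i * (e i * e l)) * (a i * b l - b i * a l)
              ≈⟨ +-cong (+-cong (*-congˡ (line b rel₂ i≢l (m≢i ∘ ≡.sym) (m≢l ∘ ≡.sym)))
                   (-‿cong (*-congˡ (line a rel₁ i≢l (m≢i ∘ ≡.sym) (m≢l ∘ ≡.sym)))))
                   (-‿cong (*-congˡ (trans (reflexive (≡.cong (λ n → det (ℓ₀ (j i)) (ℓ₀ n)) (≡.sym ji≡jl))) (det-self (ℓ₀ (j i)))))) ⟩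
            ((e i * a i) * 0# - (e i * b i) * 0#) - (D m i * (e i * e l)) * 0#
              ≈⟨ solve 3 (λ x y z → (x :* con (+ 0) :- y :* con (+ 0)) :- z :* con (+ 0) := con (+ 0)) refl _ _ _ ⟩
            0# ∎) (nonzero-* (nonzero-* (gen i≢l) (nonzero-* (sign≉0 (ε i)) (sign≉0 (ε m)))) (gen₀ (jm≢ji ∘ ≡.sym)))

        module _ {i₀ l₀ : Fin k} (i₀≢l₀ : i₀ ≢ l₀) (same : j i₀ ≡ j l₀) where
          constant : ∀ m → j m ≡ j i₀
          constant = parallel i₀≢l₀ same

          sign-relation : Relation (2 ℕ.+ (h ℕ.+ h)) e ℓ
          sign-relation zs eq = cancel (γ≉0 (j i₀)) (begin
            γ (j i₀) * sum (λ i → e i * pairs (ℓ i) zs)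
              ≈⟨ *-distribˡ-sum (γ (j i₀)) (λ i → e i * pairs (ℓ i) zs) ⟩
            sum (λ i → γ (j i₀) * (e i * pairs (ℓ i) zs))
              ≈⟨ sum-cong-≋ {k} (λ i → trans (solve 3 (λ g e p → g :* (e :* p) := (e :* g) :* p) refl (γ (j i₀)) (e i) (pairs (ℓ i) zs))
                   (reflexive (≡.cong (λ n → (e i * γ n) * pairs (ℓ i) zs) (≡.sym (constant i))))) ⟩
            sum (λ i → (e i * γ (j i)) * pairs (ℓ i) zs)
              ≈⟨ rel zs eq ⟩
            0# ∎)

          scaled : ∀ (y : Point → Carrier) → Relation (1 ℕ.+ (h ℕ.+ h)) (λ i → γ (j i) * y (ℓ₀ (j i))) ℓ →
                   ∀ {i l m} → i ≢ l → i ≢ m → l ≢ m →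
                   y (ℓ₀ (j i₀)) * (D l m * e i + (D m i * e l + D i l * e m)) ≈ 0#
          scaled y r {i} {l} {m} i≢l i≢m l≢m = begin
            y₀ * (D l m * e i + (D m i * e l + D i l * e m))
              ≈⟨ solve 7 (λ y Dlm Dmi Dil ei el em → y :* (Dlm :* ei :+ (Dmi :* el :+ Dil :* em)) :=
                   Dlm :* (ei :* y) :+ (Dmi :* (el :* y) :+ Dil :* (em :* y))) refl y₀ (D l m) (D m i) (D i l) (e i) (e l) (e m) ⟩
            D l m * (e i * y₀) + (D m i * (e l * y₀) + D i l * (e m * y₀))
              ≈⟨ +-cong (*-congˡ (*-congˡ (y≈ i))) (+-cong (*-congˡ (*-congˡ (y≈ l))) (*-congˡ (*-congˡ (y≈ m)))) ⟩
            D l m * (e i * y (ℓ₀ (j i))) + (D m i * (e l * y (ℓ₀ (j l))) + D i l * (e m * y (ℓ₀ (j m))))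
              ≈⟨ line (λ i → y (ℓ₀ (j i))) r i≢l i≢m l≢m ⟩
            0# ∎
            where
            y₀ = y (ℓ₀ (j i₀))
            y≈ : ∀ n → y₀ ≈ y (ℓ₀ (j n))
            y≈ n = reflexive (≡.cong (λ x → y (ℓ₀ x)) (≡.sym (constant n)))

          -- ℓ₀ (j i₀) and some other ℓ₀ l have nonzero determinant, so ℓ₀ (j i₀) has a nonzero coordinate.
          collinear : ∀ {i l m} → i ≢ l → i ≢ m → l ≢ m → D l m * e i + (D m i * e l + D i l * e m) ≈ 0#
          collinear {i} {l} {m} i≢l i≢m l≢m with other (j i₀)
            where
            other : ∀ (i : Fin k) → ∃ λ l → i ≢ l
            other zero    = suc zero , λ ()
            other (suc i) = zero , λ ()
          ... | n , j≢n = cancel (gen₀ j≢n) (begin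
            (a₀ * b₁ - b₀ * a₁) * X
              ≈⟨ solve 5 (λ a₀ b₀ a₁ b₁ X → (a₀ :* b₁ :- b₀ :* a₁) :* X := b₁ :* (a₀ :* X) :- a₁ :* (b₀ :* X)) refl a₀ b₀ a₁ b₁ X ⟩
            b₁ * (a₀ * X) - a₁ * (b₀ * X)
              ≈⟨ +-cong (*-congˡ (scaled proj₁ rel₁ i≢l i≢m l≢m)) (-‿cong (*-congˡ (scaled proj₂ rel₂ i≢l i≢m l≢m))) ⟩
            b₁ * 0# - a₁ * 0#
              ≈⟨ solve 2 (λ x y → x :* con (+ 0) :- y :* con (+ 0) := con (+ 0)) refl b₁ a₁ ⟩
            0# ∎)
            where
            a₀ = proj₁ (ℓ₀ (j i₀))
            b₀ = proj₂ (ℓ₀ (j i₀))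
            a₁ = proj₁ (ℓ₀ n)
            b₁ = proj₂ (ℓ₀ n)
            X = D l m * e i + (D m i * e l + D i l * e m)

      -- A repeated label spreads to all indices by `parallel`. The common γ then cancels from
      -- `rel`, the common point from `rel₁` and `rel₂`, and the bare signs satisfy the hypotheses
      -- of `no-sign-relation`.
      relations⇒injective : ∀ {i l} → j i ≡ j l → i ≡ l
      relations⇒injective {i} {l} same with i Fin.≟ l
      ... | yes i≡l = i≡l
      ... | no  i≢l = ⊥-elim (no-sign-relation {h} ε ℓ gen char (sign-relation i≢l same) (collinear i≢l same))

-- Sums over lists and products over finite index sets.

module FiniteSums where

  open import Data.List.Relation.Unary.Unique.Propositional using (Unique)
  open import Defs using (vectors)
  open IntegerCoefficients

  private
    variable
      A B : Set

  length-cartesianProductWith : ∀ {C : Set} (f : A → B → C) xs ys → length (cartesianProductWith f xs ys) ≡ length xs ℕ.* length ys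
  length-cartesianProductWith f []       ys = ≡.refl
  length-cartesianProductWith f (x ∷ xs) ys = ≡.trans (length-++ (List.map (f x) ys)) (≡.cong₂ ℕ._+_ (length-map (f x) ys) (length-cartesianProductWith f xs ys))

  prodList : ∀ {K} → (Fin K → List A) → List (Vec A K)
  prodList {K = zero}  l = [] ∷ []
  prodList {K = suc K} l = cartesianProductWith _∷_ (l zero) (prodList (λ i → l (suc i)))

  module ListSum (R : CommutativeRing 0ℓ 0ℓ) where

    open CommutativeRing R hiding (zero)
    open FromℤRing R using (module Solver)
    open Solver using (solve; _:+_; _:*_; _:=_)
    open import Relation.Binary.Reasoning.Setoid setoid
    open import Algebra.Properties.Ring ring using (-‿+-comm; -0#≈0#)
    open import Algebra.Properties.Semiring.Sum semiring
      using (sum; sum-cong-≋; *-distribˡ-sum; ∑-distrib-+; ∑-comm; sum-replicate-zero) public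

    private
      +-swap : ∀ a b c d → (a + b) + (c + d) ≈ (a + c) + (b + d)
      +-swap = solve 4 (λ a b c d → (a :+ b) :+ (c :+ d) := (a :+ c) :+ (b :+ d)) refl

      *-swap : ∀ a b c d → (a * b) * (c * d) ≈ (a * c) * (b * d)
      *-swap = solve 4 (λ a b c d → (a :* b) :* (c :* d) := (a :* c) :* (b :* d)) refl

    ∑ : List A → (A → Carrier) → Carrier
    ∑ []       f = 0#
    ∑ (x ∷ xs) f = f x + ∑ xs f

    ∏ : ∀ {K} → (Fin K → Carrier) → Carrier
    ∏ {zero}  f = 1#
    ∏ {suc K} f = f zero * ∏ (λ i → f (suc i))

    ⟦_⟧ : Bool → Carrier
    ⟦ true ⟧  = 1#
    ⟦ false ⟧ = 0#

    ∑-cong : ∀ (xs : List A) {f g} → (∀ x → f x ≈ g x) → ∑ xs f ≈ ∑ xs g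
    ∑-cong []       h = refl
    ∑-cong (x ∷ xs) h = +-cong (h x) (∑-cong xs h)

    ∑-cong-∈ : ∀ (xs : List A) {f g} → (∀ x → x ∈ xs → f x ≈ g x) → ∑ xs f ≈ ∑ xs g
    ∑-cong-∈ []       h = refl
    ∑-cong-∈ (x ∷ xs) h = +-cong (h x (here ≡.refl)) (∑-cong-∈ xs (λ y y∈ → h y (there y∈)))

    ∑-0 : ∀ (xs : List A) → ∑ xs (λ _ → 0#) ≈ 0#
    ∑-0 []       = refl
    ∑-0 (x ∷ xs) = trans (+-identityˡ _) (∑-0 xs)

    ∑-+ : ∀ (xs : List A) f g → ∑ xs (λ x → f x + g x) ≈ ∑ xs f + ∑ xs g
    ∑-+ []       f g = sym (+-identityˡ 0#)
    ∑-+ (x ∷ xs) f g = trans (+-congˡ (∑-+ xs f g)) (+-swap _ _ _ _)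

    ∑-*ˡ : ∀ (xs : List A) c f → c * ∑ xs f ≈ ∑ xs (λ x → c * f x)
    ∑-*ˡ []       c f = zeroʳ c
    ∑-*ˡ (x ∷ xs) c f = trans (distribˡ c _ _) (+-congˡ (∑-*ˡ xs c f))

    ∑-*ʳ : ∀ (xs : List A) c f → ∑ xs f * c ≈ ∑ xs (λ x → f x * c)
    ∑-*ʳ []       c f = zeroˡ c
    ∑-*ʳ (x ∷ xs) c f = trans (distribʳ c _ _) (+-congˡ (∑-*ʳ xs c f))

    ∑-neg : ∀ (xs : List A) f → - ∑ xs f ≈ ∑ xs (λ x → - f x)
    ∑-neg []       f = -0#≈0#
    ∑-neg (x ∷ xs) f = trans (sym (-‿+-comm _ _)) (+-congˡ (∑-neg xs f))

    ∑-swap : ∀ (xs : List A) (ys : List B) (f : A → B → Carrier) →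
             ∑ xs (λ x → ∑ ys (λ y → f x y)) ≈ ∑ ys (λ y → ∑ xs (λ x → f x y))
    ∑-swap []       ys f = sym (∑-0 ys)
    ∑-swap (x ∷ xs) ys f = trans (+-congˡ (∑-swap xs ys f)) (sym (∑-+ ys _ _))

    ∑-++ : ∀ (xs ys : List A) f → ∑ (xs ++ ys) f ≈ ∑ xs f + ∑ ys f
    ∑-++ []       ys f = sym (+-identityˡ _)
    ∑-++ (x ∷ xs) ys f = trans (+-congˡ (∑-++ xs ys f)) (sym (+-assoc _ _ _))

    ∑-map : ∀ (h : B → A) xs f → ∑ (List.map h xs) f ≈ ∑ xs (f ∘ h)
    ∑-map h []       f = refl
    ∑-map h (x ∷ xs) f = +-congˡ (∑-map h xs f)

    ∑-cartesian : ∀ {C : Set} (h : A → B → C) xs ys f →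
                  ∑ (cartesianProductWith h xs ys) f ≈ ∑ xs (λ x → ∑ ys (λ y → f (h x y)))
    ∑-cartesian h []       ys f = refl
    ∑-cartesian h (x ∷ xs) ys f = trans (∑-++ (List.map (h x) ys) _ f)
      (+-cong (∑-map (h x) ys f) (∑-cartesian h xs ys f))

    ∑-filter : ∀ {P : A → Set} (P? : Decidable P) xs f →
               ∑ (filter P? xs) f ≈ ∑ xs (λ x → ⟦ does (P? x) ⟧ * f x)
    ∑-filter P? []       f = refl
    ∑-filter P? (x ∷ xs) f with does (P? x)
    ... | true  = +-cong (sym (*-identityˡ _)) (∑-filter P? xs f)
    ... | false = trans (∑-filter P? xs f) (sym (trans (+-congʳ (zeroˡ _)) (+-identityˡ _)))

    ∏-cong : ∀ {K} {f g : Fin K → Carrier} → (∀ i → f i ≈ g i) → ∏ f ≈ ∏ g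
    ∏-cong {zero}  h = refl
    ∏-cong {suc K} h = *-cong (h zero) (∏-cong (λ i → h (suc i)))

    ∏-* : ∀ {K} (f g : Fin K → Carrier) → ∏ (λ i → f i * g i) ≈ ∏ f * ∏ g
    ∏-* {zero}  f g = sym (*-identityˡ 1#)
    ∏-* {suc K} f g = trans (*-congˡ (∏-* (λ i → f (suc i)) (λ i → g (suc i)))) (*-swap _ _ _ _)

    ∏-zero : ∀ {K} (f : Fin K → Carrier) i → f i ≈ 0# → ∏ f ≈ 0#
    ∏-zero f zero    h = trans (*-congʳ h) (zeroˡ _)
    ∏-zero f (suc i) h = trans (*-congˡ (∏-zero _ i h)) (zeroʳ _)

    ∏-∑ : ∀ {K} (l : Fin K → List A) (f : Fin K → A → Carrier) →
          ∏ (λ i → ∑ (l i) (f i)) ≈ ∑ (prodList l) (λ v → ∏ (λ i → f i (lookup v i)))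
    ∏-∑ {K = zero}  l f = sym (+-identityʳ _)
    ∏-∑ {K = suc K} l f = begin
      ∑ (l zero) (f zero) * ∏ (λ i → ∑ (l (suc i)) (f (suc i)))
        ≈⟨ *-congˡ (∏-∑ (λ i → l (suc i)) (λ i → f (suc i))) ⟩
      ∑ (l zero) (f zero) * ∑ (prodList (λ i → l (suc i))) _
        ≈⟨ ∑-*ʳ (l zero) _ _ ⟩
      ∑ (l zero) (λ a → f zero a * ∑ (prodList (λ i → l (suc i))) _)
        ≈⟨ ∑-cong (l zero) (λ a → ∑-*ˡ (prodList (λ i → l (suc i))) (f zero a) _) ⟩
      ∑ (l zero) (λ a → ∑ (prodList (λ i → l (suc i))) (λ v → f zero a * ∏ (λ i → f (suc i) (lookup v i))))
        ≈⟨ ∑-cartesian _∷_ (l zero) _ _ ⟨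
      ∑ (prodList l) (λ v → ∏ (λ i → f i (lookup v i))) ∎

    ∑-vectors-suc : ∀ (xs : List A) n f →
      ∑ (vectors xs (suc n)) f ≈ ∑ xs (λ x → ∑ (vectors xs n) (λ v → f (x ∷ v)))
    ∑-vectors-suc xs n f = ∑-cartesian _∷_ xs (vectors xs n) f

    ∑-indicator-∉ : ∀ (_≟_ : DecidableEquality A) xs z (f : A → Carrier) → z ∉ xs →
                    ∑ xs (λ x → ⟦ does (x ≟ z) ⟧ * f x) ≈ 0#
    ∑-indicator-∉ _≟_ []       z f z∉ = refl
    ∑-indicator-∉ _≟_ (x ∷ xs) z f z∉ with x ≟ z
    ... | yes ≡.refl = contradiction (here ≡.refl) z∉
    ... | no  _      = trans (+-cong (zeroˡ _) (∑-indicator-∉ _≟_ xs z f (z∉ ∘ there))) (+-identityˡ 0#)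

    ∑-indicator-∈ : ∀ (_≟_ : DecidableEquality A) {xs z} (f : A → Carrier) → Unique xs → z ∈ xs →
                    ∑ xs (λ x → ⟦ does (x ≟ z) ⟧ * f x) ≈ f z
    ∑-indicator-∈ _≟_ {x ∷ xs} {z} f (x∉ ∷ u) z∈ with x ≟ z
    ... | yes ≡.refl = trans (+-cong (*-identityˡ _)
                         (∑-indicator-∉ _≟_ xs z f (λ z∈xs → All.lookup x∉ z∈xs ≡.refl))) (+-identityʳ _)
    ... | no  x≢z with z∈
    ...   | here z≡x  = contradiction (≡.sym z≡x) x≢z
    ...   | there z∈xs = trans (+-cong (zeroˡ _) (∑-indicator-∈ _≟_ f u z∈xs)) (+-identityˡ _)

    does-⇔ : ∀ {P Q : Set} (P? : Dec P) (Q? : Dec Q) → (P → Q) → (Q → P) → ⟦ does P? ⟧ ≈ ⟦ does Q? ⟧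
    does-⇔ (yes _) (yes _) _ _ = refl
    does-⇔ (yes p) (no ¬q) f _ = contradiction (f p) ¬q
    does-⇔ (no ¬p) (yes q) _ g = contradiction (g q) ¬p
    does-⇔ (no _)  (no _)  _ _ = refl

    -- Double counting of the pairs (x , y) with x = π y.
    ∑-reindex : ∀ (_≟_ : DecidableEquality A) {xs} (π π⁻¹ : A → A) → Unique xs →
                (∀ {x} → x ∈ xs → π x ∈ xs) → (∀ {x} → x ∈ xs → π⁻¹ x ∈ xs) →
                (∀ x → π⁻¹ (π x) ≡ x) → (∀ x → π (π⁻¹ x) ≡ x) →
                ∀ (f : A → Carrier) → ∑ xs f ≈ ∑ xs (f ∘ π)
    ∑-reindex _≟_ {xs} π π⁻¹ u c c⁻¹ inv inv′ f = begin
      ∑ xs f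
        ≈⟨ ∑-cong-∈ xs (λ x x∈ → sym (trans (∑-indicator-∈ _≟_ (λ _ → f x) u (c⁻¹ x∈)) refl)) ⟩
      ∑ xs (λ x → ∑ xs (λ y → ⟦ does (y ≟ π⁻¹ x) ⟧ * f x))
        ≈⟨ ∑-swap xs xs _ ⟩
      ∑ xs (λ y → ∑ xs (λ x → ⟦ does (y ≟ π⁻¹ x) ⟧ * f x))
        ≈⟨ ∑-cong xs (λ y → ∑-cong xs (λ x → *-congʳ (does-⇔ (y ≟ π⁻¹ x) (x ≟ π y)
             (λ e → ≡.trans (≡.sym (inv′ x)) (≡.cong π (≡.sym e)))
             (λ e → ≡.trans (≡.sym (inv y)) (≡.cong π⁻¹ (≡.sym e)))))) ⟩
      ∑ xs (λ y → ∑ xs (λ x → ⟦ does (x ≟ π y) ⟧ * f x))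
        ≈⟨ ∑-cong-∈ xs (λ y y∈ → ∑-indicator-∈ _≟_ f u (c y∈)) ⟩
      ∑ xs (f ∘ π) ∎

-- The order on the rationals and the embedding of the integers.

module Rationals where

  open import Data.Rational using (_+_; _*_; _-_; -_; _≤_; _<_; ∣_∣)
  open import Relation.Binary.PropositionalEquality using (refl; sym; trans; cong; cong₂; subst; subst₂)
  open IntegerCoefficients
  open import Defs using (ℤ→ℚ)

  ℚ-ring : CommutativeRing 0ℓ 0ℓ
  ℚ-ring = ℚ.+-*-commutativeRing

  module ℚι = FromℤRing ℚ-ring

  ℤ→ℚ-+ : ∀ i j → ℤ→ℚ (i ℤ.+ j) ≡ ℤ→ℚ i + ℤ→ℚ j
  ℤ→ℚ-+ i j = ℚ.toℚᵘ-injective (begin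
    ℚ.toℚᵘ (ℤ→ℚ (i ℤ.+ j))                   ≈⟨ ℚ.toℚᵘ-fromℚᵘ (ℚᵘ.mkℚᵘ (i ℤ.+ j) 0) ⟩
    ℚᵘ.mkℚᵘ (i ℤ.+ j) 0                      ≈⟨ ℚᵘ.*≡* (cong₂ ℤ._*_ (sym (cong₂ ℤ._+_ (ℤ.*-identityʳ i) (ℤ.*-identityʳ j))) refl) ⟩
    ℚᵘ.mkℚᵘ i 0 ℚᵘ.+ ℚᵘ.mkℚᵘ j 0             ≈⟨ ℚᵘ.+-cong (ℚ.toℚᵘ-fromℚᵘ (ℚᵘ.mkℚᵘ i 0)) (ℚ.toℚᵘ-fromℚᵘ (ℚᵘ.mkℚᵘ j 0)) ⟨
    ℚ.toℚᵘ (ℤ→ℚ i) ℚᵘ.+ ℚ.toℚᵘ (ℤ→ℚ j)       ≈⟨ ℚ.toℚᵘ-homo-+ (ℤ→ℚ i) (ℤ→ℚ j) ⟨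
    ℚ.toℚᵘ (ℤ→ℚ i + ℤ→ℚ j)                   ∎)
    where open ℚᵘ.≃-Reasoning

  ℤ→ℚ≡ι : ∀ z → ℤ→ℚ z ≡ ℚι.ι z
  ℤ→ℚ≡ι = ℚι.ι-unique ℤ→ℚ ℤ→ℚ-+ refl

  ℤ→ℚ-* : ∀ i j → ℤ→ℚ (i ℤ.* j) ≡ ℤ→ℚ i * ℤ→ℚ j
  ℤ→ℚ-* i j = trans (ℤ→ℚ≡ι (i ℤ.* j)) (trans (ℚι.ι-* i j) (sym (cong₂ _*_ (ℤ→ℚ≡ι i) (ℤ→ℚ≡ι j))))

  ℤ→ℚ-neg : ∀ i → ℤ→ℚ (ℤ.- i) ≡ - ℤ→ℚ i
  ℤ→ℚ-neg i = trans (ℤ→ℚ≡ι (ℤ.- i)) (trans (ℚι.ι-neg i) (sym (cong -_ (ℤ→ℚ≡ι i))))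

  open ℚι using (module Solver)
  open Solver using (solve; con; _:+_; _:*_; :-_; _:-_; _:=_)

  0≤+ : ∀ {x y} → 0ℚ ≤ x → 0ℚ ≤ y → 0ℚ ≤ x + y
  0≤+ = ℚ.+-mono-≤

  0≤* : ∀ {x y} → 0ℚ ≤ x → 0ℚ ≤ y → 0ℚ ≤ x * y
  0≤* {x} {y} 0≤x 0≤y = subst (_≤ x * y) (ℚ.*-zeroʳ x) (ℚ.*-monoˡ-≤-nonNeg x {{ℚ.nonNegative 0≤x}} 0≤y)

  0<* : ∀ {x y} → 0ℚ < x → 0ℚ < y → 0ℚ < x * y
  0<* {x} {y} 0<x 0<y = subst (_< x * y) (ℚ.*-zeroʳ x) (ℚ.*-monoʳ-<-pos x {{ℚ.positive 0<x}} 0<y)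

  sub-≤ : ∀ {x y} → 0ℚ ≤ y - x → x ≤ y
  sub-≤ {x} {y} h = subst₂ _≤_ (ℚ.+-identityˡ x) (solve 2 (λ x y → (y :- x) :+ x := y) refl x y) (ℚ.+-monoˡ-≤ x h)

  ≤-sub : ∀ {x y} → x ≤ y → 0ℚ ≤ y - x
  ≤-sub {x} {y} h = subst (_≤ y - x) (ℚ.+-inverseʳ x) (ℚ.+-monoˡ-≤ (- x) h)

  <-sub : ∀ {x y} → x < y → 0ℚ < y - x
  <-sub {x} {y} h = subst (_< y - x) (ℚ.+-inverseʳ x) (ℚ.+-monoˡ-< (- x) h)

  sub-< : ∀ {x y} → 0ℚ < y - x → x < y
  sub-< {x} {y} h = subst₂ _<_ (ℚ.+-identityˡ x) (solve 2 (λ x y → (y :- x) :+ x := y) refl x y) (ℚ.+-monoˡ-< x h)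

  0≤1 : 0ℚ ≤ 1ℚ
  0≤1 = ℚ.nonNegative⁻¹ 1ℚ

  0<1 : 0ℚ < 1ℚ
  0<1 = ℚ.positive⁻¹ 1ℚ

  0≤x² : ∀ x → 0ℚ ≤ x * x
  0≤x² x with ℚ.≤-total 0ℚ x
  ... | inj₁ 0≤x = 0≤* 0≤x 0≤x
  ... | inj₂ x≤0 = subst (0ℚ ≤_) (solve 1 (λ x → (:- x) :* (:- x) := x :* x) refl x) (0≤* (ℚ.neg-antimono-≤ x≤0) (ℚ.neg-antimono-≤ x≤0))

  *-mono-≤ : ∀ {a b c d} → 0ℚ ≤ a → 0ℚ ≤ d → a ≤ b → c ≤ d → a * c ≤ b * d
  *-mono-≤ {a} {b} {c} {d} 0≤a 0≤d a≤b c≤d = ℚ.≤-trans (ℚ.*-monoˡ-≤-nonNeg a {{ℚ.nonNegative 0≤a}} c≤d)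
    (ℚ.*-monoʳ-≤-nonNeg d {{ℚ.nonNegative 0≤d}} a≤b)

  ℤ→ℚ-nonneg : ∀ n → 0ℚ ≤ ℤ→ℚ (+ n)
  ℤ→ℚ-nonneg zero    = ℚ.≤-refl
  ℤ→ℚ-nonneg (suc n) = subst (0ℚ ≤_) (sym (ℤ→ℚ-+ (+ 1) (+ n))) (0≤+ 0≤1 (ℤ→ℚ-nonneg n))

  ℤ→ℚ-mono-≤ : ∀ {i j} → i ℤ.≤ j → ℤ→ℚ i ≤ ℤ→ℚ j
  ℤ→ℚ-mono-≤ {i} {j} i≤j = sub-≤ (subst (0ℚ ≤_) (begin
    ℤ→ℚ (+ ℤ.∣ j ℤ.- i ∣)   ≡⟨ cong ℤ→ℚ (ℤ.0≤i⇒+∣i∣≡i (ℤ.i≤j⇒0≤j-i i≤j)) ⟩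
    ℤ→ℚ (j ℤ.- i)           ≡⟨ trans (ℤ→ℚ-+ j (ℤ.- i)) (cong (λ q → ℤ→ℚ j + q) (ℤ→ℚ-neg i)) ⟩
    ℤ→ℚ j - ℤ→ℚ i           ∎) (ℤ→ℚ-nonneg ℤ.∣ j ℤ.- i ∣))
    where open ≡-Reasoning

  ℤ→ℚ-injective : ∀ {i j} → ℤ→ℚ i ≡ ℤ→ℚ j → i ≡ j
  ℤ→ℚ-injective {i} {j} h with ℚᵘ.≃-trans (ℚᵘ.≃-sym (ℚ.toℚᵘ-fromℚᵘ (ℚᵘ.mkℚᵘ i 0)))
                               (ℚᵘ.≃-trans (ℚ.toℚᵘ-cong h) (ℚ.toℚᵘ-fromℚᵘ (ℚᵘ.mkℚᵘ j 0)))
  ... | ℚᵘ.*≡* eq = trans (sym (ℤ.*-identityʳ i)) (trans eq (ℤ.*-identityʳ j))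

  ℤ→ℚ-pos : ∀ n → 0ℚ < ℤ→ℚ (+ suc n)
  ℤ→ℚ-pos n = ℚ.<-≤-trans 0<1 (ℤ→ℚ-mono-≤ {+ 1} {+ suc n} (ℤ.+≤+ (s≤s z≤n)))

  double-≤ : ∀ {x y} → x + x ≤ y + y → x ≤ y
  double-≤ {x} {y} h with x ℚ.≤? y
  ... | yes x≤y = x≤y
  ... | no  x≰y = ⊥-elim (ℚ.<-irrefl refl (ℚ.<-≤-trans (ℚ.+-mono-< (ℚ.≰⇒> x≰y) (ℚ.≰⇒> x≰y)) h))

-- Adjoining a square root of -1 to a commutative ring.

module ComplexNumbers where

  open import Data.Product using (_×_)
  open IntegerCoefficients

  -- Instantiated twice: with rational coefficients for points of the unit circle, and with bounded
  -- sequences for the ring in which the character takes its values.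
  module Complexification (R : CommutativeRing 0ℓ 0ℓ) where

    open CommutativeRing R
    open FromℤRing R using (module Solver)
    open Solver using (solve; con; _:+_; _:*_; :-_; _:-_; _:=_)

    record _≈ᶜ_ (z w : Carrier × Carrier) : Set where
      constructor _,_
      field
        re≈ : proj₁ z ≈ proj₁ w
        im≈ : proj₂ z ≈ proj₂ w
    open _≈ᶜ_ public

    _+ᶜ_ _*ᶜ_ : Carrier × Carrier → Carrier × Carrier → Carrier × Carrier
    (a , b) +ᶜ (c , d) = a + c , b + d
    (a , b) *ᶜ (c , d) = a * c - b * d , a * d + b * c

    -ᶜ_ conj : Carrier × Carrier → Carrier × Carrier
    -ᶜ (a , b) = - a , - b
    conj (a , b) = a , - b

    ℂ : CommutativeRing 0ℓ 0ℓ
    ℂ = record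
      { Carrier = Carrier × Carrier
      ; _≈_ = _≈ᶜ_ ; _+_ = _+ᶜ_ ; _*_ = _*ᶜ_ ; -_ = -ᶜ_ ; 0# = 0# , 0# ; 1# = 1# , 0#
      ; isCommutativeRing = record
        { isRing = record
          { +-isAbelianGroup = record
            { isGroup = record
              { isMonoid = record
                { isSemigroup = record
                  { isMagma = record
                    { isEquivalence = record
                      { refl = refl , refl
                      ; sym = λ (p , q) → sym p , sym q
                      ; trans = λ (p , q) (p′ , q′) → trans p p′ , trans q q′ }
                    ; ∙-cong = λ (p , q) (p′ , q′) → +-cong p p′ , +-cong q q′ }
                  ; assoc = λ (a , b) (c , d) (e , f) → +-assoc a c e , +-assoc b d f }
                ; identity = (λ (a , b) → +-identityˡ a , +-identityˡ b) , (λ (a , b) → +-identityʳ a , +-identityʳ b) }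
              ; inverse = (λ (a , b) → -‿inverseˡ a , -‿inverseˡ b) , (λ (a , b) → -‿inverseʳ a , -‿inverseʳ b)
              ; ⁻¹-cong = λ (p , q) → -‿cong p , -‿cong q }
            ; comm = λ (a , b) (c , d) → +-comm a c , +-comm b d }
          ; *-cong = λ (p , q) (p′ , q′) → +-cong (*-cong p p′) (-‿cong (*-cong q q′)) , +-cong (*-cong p q′) (*-cong q p′)
          ; *-assoc = λ (a , b) (c , d) (e , f) →
              solve 6 (λ a b c d e f → (a :* c :- b :* d) :* e :- (a :* d :+ b :* c) :* f := a :* (c :* e :- d :* f) :- b :* (c :* f :+ d :* e)) refl a b c d e f ,
              solve 6 (λ a b c d e f → (a :* c :- b :* d) :* f :+ (a :* d :+ b :* c) :* e := a :* (c :* f :+ d :* e) :+ b :* (c :* e :- d :* f)) refl a b c d e f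
          ; *-identity =
              (λ (a , b) → solve 2 (λ a b → con (+ 1) :* a :- con (+ 0) :* b := a) refl a b , solve 2 (λ a b → con (+ 1) :* b :+ con (+ 0) :* a := b) refl a b) ,
              (λ (a , b) → solve 2 (λ a b → a :* con (+ 1) :- b :* con (+ 0) := a) refl a b , solve 2 (λ a b → a :* con (+ 0) :+ b :* con (+ 1) := b) refl a b)
          ; distrib =
              (λ (a , b) (c , d) (e , f) →
                solve 6 (λ a b c d e f → a :* (c :+ e) :- b :* (d :+ f) := (a :* c :- b :* d) :+ (a :* e :- b :* f)) refl a b c d e f ,
                solve 6 (λ a b c d e f → a :* (d :+ f) :+ b :* (c :+ e) := (a :* d :+ b :* c) :+ (a :* f :+ b :* e)) refl a b c d e f) ,
              (λ (a , b) (c , d) (e , f) →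
                solve 6 (λ a b c d e f → (c :+ e) :* a :- (d :+ f) :* b := (c :* a :- d :* b) :+ (e :* a :- f :* b)) refl a b c d e f ,
                solve 6 (λ a b c d e f → (c :+ e) :* b :+ (d :+ f) :* a := (c :* b :+ d :* a) :+ (e :* b :+ f :* a)) refl a b c d e f) }
        ; *-comm = λ (a , b) (c , d) →
            solve 4 (λ a b c d → a :* c :- b :* d := c :* a :- d :* b) refl a b c d ,
            solve 4 (λ a b c d → a :* d :+ b :* c := c :* b :+ d :* a) refl a b c d } }

    conj-cong : ∀ {z w} → z ≈ᶜ w → conj z ≈ᶜ conj w
    conj-cong (p , q) = p , -‿cong q

    conj-+ : ∀ z w → conj (z +ᶜ w) ≈ᶜ (conj z +ᶜ conj w)
    conj-+ (a , b) (c , d) = refl , solve 2 (λ b d → :- (b :+ d) := (:- b) :+ (:- d)) refl b d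

    conj-* : ∀ z w → conj (z *ᶜ w) ≈ᶜ (conj z *ᶜ conj w)
    conj-* (a , b) (c , d) = solve 4 (λ a b c d → a :* c :- b :* d := a :* c :- (:- b) :* (:- d)) refl a b c d ,
                             solve 4 (λ a b c d → :- (a :* d :+ b :* c) := a :* (:- d) :+ (:- b) :* c) refl a b c d

    conj-involutive : ∀ z → conj (conj z) ≈ᶜ z
    conj-involutive (a , b) = refl , solve 1 (λ b → :- (:- b) := b) refl b

    embed : Carrier → Carrier × Carrier
    embed a = a , 0#

    embed-+ : ∀ a b → embed (a + b) ≈ᶜ (embed a +ᶜ embed b)
    embed-+ a b = refl , sym (+-identityˡ 0#)

    embed-* : ∀ a b → embed (a * b) ≈ᶜ (embed a *ᶜ embed b)
    embed-* a b = solve 2 (λ a b → a :* b := a :* b :- con (+ 0) :* con (+ 0)) refl a b ,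
                  solve 2 (λ a b → con (+ 0) := a :* con (+ 0) :+ con (+ 0) :* b) refl a b

    embed-scale : ∀ m z → (embed m *ᶜ z) ≈ᶜ (m * proj₁ z , m * proj₂ z)
    embed-scale m (a , b) = solve 3 (λ m a b → m :* a :- con (+ 0) :* b := m :* a) refl m a b ,
                            solve 3 (λ m a b → m :* b :+ con (+ 0) :* a := m :* b) refl m a b

    real⇒embed : ∀ z → proj₂ z ≈ 0# → z ≈ᶜ embed (proj₁ z)
    real⇒embed z h = refl , h

-- The ring of bounded rational sequences modulo null sequences.

module BoundedSequences where

  open import Data.Rational using (_+_; _*_; _-_; -_; _≤_; ∣_∣)
  open import Relation.Binary.PropositionalEquality using (refl; sym; trans; cong; subst; subst₂)
  open IntegerCoefficients
  open import Defs using (ℤ→ℚ)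
  open Rationals

  open ℚι using (module Solver)
  open Solver using (solve; con; _:+_; _:*_; :-_; _:-_; _:=_)

  -- Convergence to zero, tested against 1/m with the denominator cleared. Since bounds are natural
  -- numbers as well, a bounded factor `B` only changes `m` into `B * m`.
  record Null (s : ℕ → ℚ) : Set where
    constructor null
    field
      small : ∀ m → ∃ λ N → ∀ n → N ℕ.≤ n → ∣ s n ∣ * ℤ→ℚ (+ m) ≤ 1ℚ
  open Null public

  Bounded : (ℕ → ℚ) → Set
  Bounded s = ∃ λ B → ∀ n → ∣ s n ∣ ≤ ℤ→ℚ (+ B)

  Null-≗ : ∀ {s t} → (∀ n → s n ≡ t n) → Null s → Null t
  Null-≗ {s} {t} h ns .small m with small ns m
  ... | N , b = N , λ n N≤n → subst (λ q → ∣ q ∣ * ℤ→ℚ (+ m) ≤ 1ℚ) (h n) (b n N≤n)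

  Null-0 : Null (λ _ → 0ℚ)
  Null-0 .small m = 0 , λ n _ → subst (_≤ 1ℚ) (sym (ℚ.*-zeroˡ (ℤ→ℚ (+ m)))) 0≤1

  Null-neg : ∀ {s} → Null s → Null (λ n → - s n)
  Null-neg {s} ns .small m with small ns m
  ... | N , b = N , λ n N≤n → subst (λ q → q * ℤ→ℚ (+ m) ≤ 1ℚ) (sym (ℚ.∣-p∣≡∣p∣ (s n))) (b n N≤n)

  Null-+ : ∀ {s t} → Null s → Null t → Null (λ n → s n + t n)
  Null-+ {s} {t} ns nt .small m with small ns (m ℕ.+ m) | small nt (m ℕ.+ m)
  ... | M , hM | N , hN = M ℕ.⊔ N , λ n le → double-≤ (begin
    ∣ s n + t n ∣ * q + ∣ s n + t n ∣ * q
      ≡⟨ ℚ.*-distribˡ-+ ∣ s n + t n ∣ q q ⟨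
    ∣ s n + t n ∣ * (q + q)
      ≤⟨ ℚ.*-monoʳ-≤-nonNeg (q + q) {{ℚ.nonNegative (0≤+ 0≤q 0≤q)}} (ℚ.∣p+q∣≤∣p∣+∣q∣ (s n) (t n)) ⟩
    (∣ s n ∣ + ∣ t n ∣) * (q + q)
      ≡⟨ cong ((∣ s n ∣ + ∣ t n ∣) *_) (ℤ→ℚ-+ (+ m) (+ m)) ⟨
    (∣ s n ∣ + ∣ t n ∣) * ℤ→ℚ (+ (m ℕ.+ m))
      ≡⟨ ℚ.*-distribʳ-+ (ℤ→ℚ (+ (m ℕ.+ m))) ∣ s n ∣ ∣ t n ∣ ⟩
    ∣ s n ∣ * ℤ→ℚ (+ (m ℕ.+ m)) + ∣ t n ∣ * ℤ→ℚ (+ (m ℕ.+ m))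
      ≤⟨ ℚ.+-mono-≤ (hM n (ℕ.m⊔n≤o⇒m≤o M N le)) (hN n (ℕ.m⊔n≤o⇒n≤o M N le)) ⟩
    1ℚ + 1ℚ ∎)
    where
    open ℚ.≤-Reasoning
    q = ℤ→ℚ (+ m)
    0≤q = ℤ→ℚ-nonneg m

  Null-* : ∀ {s t} → Bounded s → Null t → Null (λ n → s n * t n)
  Null-* {s} {t} (B , hB) nt .small m with small nt (B ℕ.* m)
  ... | N , hN = N , λ n N≤n → begin
    ∣ s n * t n ∣ * q                 ≡⟨ cong (_* q) (ℚ.∣p*q∣≡∣p∣*∣q∣ (s n) (t n)) ⟩
    (∣ s n ∣ * ∣ t n ∣) * q           ≤⟨ ℚ.*-monoʳ-≤-nonNeg q {{ℚ.nonNegative (ℤ→ℚ-nonneg m)}}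
                                         (ℚ.*-monoʳ-≤-nonNeg ∣ t n ∣ {{ℚ.∣-∣-nonNeg (t n)}} (hB n)) ⟩
    (ℤ→ℚ (+ B) * ∣ t n ∣) * q         ≡⟨ solve 3 (λ b t q → (b :* t) :* q := t :* (b :* q)) refl (ℤ→ℚ (+ B)) ∣ t n ∣ q ⟩
    ∣ t n ∣ * (ℤ→ℚ (+ B) * q)         ≡⟨ cong (∣ t n ∣ *_) (trans (cong ℤ→ℚ (ℤ.pos-* B m)) (ℤ→ℚ-* (+ B) (+ m))) ⟨
    ∣ t n ∣ * ℤ→ℚ (+ (B ℕ.* m))       ≤⟨ hN n N≤n ⟩
    1ℚ                                ∎
    where
    open ℚ.≤-Reasoning
    q = ℤ→ℚ (+ m)

  abstract
    Bounded-+ : ∀ {s t} → Bounded s → Bounded t → Bounded (λ n → s n + t n)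
    Bounded-+ {s} {t} (B , hB) (C , hC) = B ℕ.+ C , λ n → ℚ.≤-trans (ℚ.∣p+q∣≤∣p∣+∣q∣ (s n) (t n))
      (subst (∣ s n ∣ + ∣ t n ∣ ≤_) (sym (ℤ→ℚ-+ (+ B) (+ C))) (ℚ.+-mono-≤ (hB n) (hC n)))

    Bounded-neg : ∀ {s} → Bounded s → Bounded (λ n → - s n)
    Bounded-neg {s} (B , hB) = B , λ n → subst (_≤ ℤ→ℚ (+ B)) (sym (ℚ.∣-p∣≡∣p∣ (s n))) (hB n)

    Bounded-* : ∀ {s t} → Bounded s → Bounded t → Bounded (λ n → s n * t n)
    Bounded-* {s} {t} (B , hB) (C , hC) = B ℕ.* C , λ n → subst₂ _≤_ (sym (ℚ.∣p*q∣≡∣p∣*∣q∣ (s n) (t n)))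
      (sym (trans (cong ℤ→ℚ (ℤ.pos-* B C)) (ℤ→ℚ-* (+ B) (+ C))))
      (*-mono-≤ (ℚ.0≤∣p∣ (s n)) (ℤ→ℚ-nonneg C) (hB n) (hC n))

    Bounded-const : ∀ z → Bounded (λ _ → ℤ→ℚ z)
    Bounded-const z = ℤ.∣ z ∣ , λ _ → bound z
      where
      bound : ∀ z → ∣ ℤ→ℚ z ∣ ≤ ℤ→ℚ (+ ℤ.∣ z ∣)
      bound (+ n)    = ℚ.≤-reflexive (ℚ.0≤p⇒∣p∣≡p (ℤ→ℚ-nonneg n))
      bound -[1+ n ] = ℚ.≤-reflexive (trans (cong ∣_∣ (ℤ→ℚ-neg (+ suc n))) (trans (ℚ.∣-p∣≡∣p∣ (ℤ→ℚ (+ suc n))) (ℚ.0≤p⇒∣p∣≡p (ℤ→ℚ-nonneg (suc n)))))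

  record BoundedSequence : Set where
    constructor bseq
    field
      at      : ℕ → ℚ
      bounded : Bounded at
  open BoundedSequence public

  private
    _≈_ : BoundedSequence → BoundedSequence → Set
    x ≈ y = Null (λ n → at x n - at y n)

    ≗⇒≈ : ∀ {s t : ℕ → ℚ} → (∀ n → s n ≡ t n) → Null (λ n → s n - t n)
    ≗⇒≈ {s} {t} h = Null-≗ (λ n → sym (trans (cong (_- t n) (h n)) (ℚ.+-inverseʳ (t n)))) Null-0

  -- Bounded rational sequences modulo null sequences.
  𝔹 : CommutativeRing 0ℓ 0ℓ
  𝔹 = record
    { Carrier = BoundedSequence
    ; _≈_ = _≈_
    ; _+_ = λ x y → bseq (λ n → at x n + at y n) (Bounded-+ {at x} {at y} (bounded x) (bounded y))
    ; _*_ = λ x y → bseq (λ n → at x n * at y n) (Bounded-* {at x} {at y} (bounded x) (bounded y))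
    ; -_  = λ x → bseq (λ n → - at x n) (Bounded-neg {at x} (bounded x))
    ; 0#  = bseq (λ _ → 0ℚ) (Bounded-const (+ 0))
    ; 1#  = bseq (λ _ → 1ℚ) (Bounded-const (+ 1))
    ; isCommutativeRing = record
      { isRing = record
        { +-isAbelianGroup = record
          { isGroup = record
            { isMonoid = record
              { isSemigroup = record
                { isMagma = record
                  { isEquivalence = record
                    { refl  = λ {x} → ≗⇒≈ {at x} (λ _ → refl)
                    ; sym   = λ {x} {y} h → Null-≗ (λ n → solve 2 (λ a b → :- (a :- b) := b :- a) refl (at x n) (at y n)) (Null-neg h)
                    ; trans = λ {x} {y} {z} h h′ → Null-≗ (λ n → solve 3 (λ a b c → (a :- b) :+ (b :- c) := a :- c) refl (at x n) (at y n) (at z n)) (Null-+ h h′) }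
                  ; ∙-cong = λ {x} {y} {u} {v} h h′ → Null-≗ (λ n → solve 4 (λ a b c d → (a :- b) :+ (c :- d) := (a :+ c) :- (b :+ d)) refl (at x n) (at y n) (at u n) (at v n)) (Null-+ h h′) }
                ; assoc = λ x y z → ≗⇒≈ (λ n → ℚ.+-assoc (at x n) (at y n) (at z n)) }
              ; identity = (λ x → ≗⇒≈ (λ n → ℚ.+-identityˡ (at x n))) , (λ x → ≗⇒≈ (λ n → ℚ.+-identityʳ (at x n))) }
            ; inverse = (λ x → ≗⇒≈ (λ n → ℚ.+-inverseˡ (at x n))) , (λ x → ≗⇒≈ (λ n → ℚ.+-inverseʳ (at x n)))
            ; ⁻¹-cong = λ {x} {y} h → Null-≗ (λ n → solve 2 (λ a b → :- (a :- b) := (:- a) :- (:- b)) refl (at x n) (at y n)) (Null-neg h) }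
          ; comm = λ x y → ≗⇒≈ (λ n → ℚ.+-comm (at x n) (at y n)) }
        ; *-cong = λ {x} {y} {u} {v} h h′ → Null-≗ (λ n → solve 4 (λ a b c d → a :* (c :- d) :+ d :* (a :- b) := a :* c :- b :* d) refl (at x n) (at y n) (at u n) (at v n))
            (Null-+ {λ n → at x n * (at u n - at v n)} {λ n → at v n * (at x n - at y n)}
              (Null-* {at x} {λ n → at u n - at v n} (bounded x) h′) (Null-* {at v} {λ n → at x n - at y n} (bounded v) h))
        ; *-assoc = λ x y z → ≗⇒≈ (λ n → ℚ.*-assoc (at x n) (at y n) (at z n))
        ; *-identity = (λ x → ≗⇒≈ (λ n → ℚ.*-identityˡ (at x n))) , (λ x → ≗⇒≈ (λ n → ℚ.*-identityʳ (at x n)))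
        ; distrib = (λ x y z → ≗⇒≈ (λ n → ℚ.*-distribˡ-+ (at x n) (at y n) (at z n))) , (λ x y z → ≗⇒≈ (λ n → ℚ.*-distribʳ-+ (at x n) (at y n) (at z n))) }
      ; *-comm = λ x y → ≗⇒≈ (λ n → ℚ.*-comm (at x n) (at y n)) } }

  const : ℤ → BoundedSequence
  const z = bseq (λ _ → ℤ→ℚ z) (Bounded-const z)

  pointwise : ∀ {x y} → (∀ n → at x n ≡ at y n) → CommutativeRing._≈_ 𝔹 x y
  pointwise {x} {y} = ≗⇒≈ {at x} {at y}

-- Rational points of the unit circle whose p-th powers are close to 1.

module ApproximateRoots where

  open import Data.Rational using (_+_; _*_; _-_; -_; _≤_; _<_; ∣_∣)
  open import Data.Product using (_×_)
  open import Relation.Binary.PropositionalEquality using (refl; sym; trans; cong; cong₂; subst; subst₂)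
  open IntegerCoefficients
  open import Defs using (ℤ→ℚ)
  open Rationals
  open ComplexNumbers

  module OddPower (R : CommutativeRing 0ℓ 0ℓ) where
    open CommutativeRing R hiding (zero) renaming (_*_ to _·_; -_ to neg_; sym to ≈-sym; trans to ≈-trans; refl to ≈-refl)
    open FromℤRing R using (module Solver)
    open Solver using (solve; _:*_; :-_; _:=_)
    open import Algebra.Properties.Semiring.Exp semiring using (_^_)

    neg-even-power : ∀ z q → (neg z) ^ (q ℕ.+ q) ≈ z ^ (q ℕ.+ q)
    neg-even-power z zero    = ≈-refl
    neg-even-power z (suc q) rewrite ℕ.+-suc q q = ≈-trans
      (*-congˡ (*-congˡ (neg-even-power z q)))
      (solve 2 (λ z u → (:- z) :* ((:- z) :* u) := z :* (z :* u)) ≈-refl z (z ^ (q ℕ.+ q)))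

    neg-odd-power : ∀ z q → (neg z) ^ suc (q ℕ.+ q) ≈ neg (z ^ suc (q ℕ.+ q))
    neg-odd-power z q = ≈-trans (*-congˡ (neg-even-power z q))
      (solve 2 (λ z u → (:- z) :* u := :- (z :* u)) ≈-refl z (z ^ (q ℕ.+ q)))

  open ℚι using (module Solver)
  open Solver using (solve; con; _:+_; _:*_; :-_; _:-_; _:=_)
  open Complexification ℚ-ring
  open import Algebra.Properties.Semiring.Exp (CommutativeRing.semiring ℂ) using (_^_; ^-homo-*; ^-assocʳ; ^-congˡ)

  least : ∀ {P : ℕ → Set} → Decidable P → ∀ b →
          (∀ n → n ℕ.< b → ¬ P n) ⊎ (∃ λ n → P n × (∀ m → m ℕ.< n → ¬ P m))
  least P? zero    = inj₁ λ _ ()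
  least P? (suc b) with least P? b
  ... | inj₂ found = inj₂ found
  ... | inj₁ none with P? b
  ...   | yes p = inj₂ (b , p , none)
  ...   | no ¬p = inj₁ λ n n<1+b → below n (ℕ.≤-pred n<1+b)
    where
    below : ∀ n → n ℕ.≤ b → _
    below n n≤b with n ℕ.≟ b
    ... | yes refl = ¬p
    ... | no  n≢b  = none n (ℕ.≤∧≢⇒< n≤b n≢b)

  ∣∣-≤ : ∀ {x b} → x ≤ b → - x ≤ b → ∣ x ∣ ≤ b
  ∣∣-≤ {x} h h′ with ℚ.∣p∣≡p∨∣p∣≡-p x
  ... | inj₁ e = subst (_≤ _) (sym e) h
  ... | inj₂ e = subst (_≤ _) (sym e) h′

  -- The ℓ¹ norm is rational and submultiplicative, so no square roots occur.
  norm : ℚ × ℚ → ℚ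
  norm (a , b) = ∣ a ∣ + ∣ b ∣

  norm-cong : ∀ {z w} → z ≈ᶜ w → norm z ≡ norm w
  norm-cong (p , q) = cong₂ (λ a b → ∣ a ∣ + ∣ b ∣) p q

  norm≥0 : ∀ z → 0ℚ ≤ norm z
  norm≥0 (a , b) = 0≤+ (ℚ.0≤∣p∣ a) (ℚ.0≤∣p∣ b)

  norm-+ : ∀ z w → norm (z +ᶜ w) ≤ norm z + norm w
  norm-+ (a , b) (c , d) = ℚ.≤-trans (ℚ.+-mono-≤ (ℚ.∣p+q∣≤∣p∣+∣q∣ a c) (ℚ.∣p+q∣≤∣p∣+∣q∣ b d))
    (ℚ.≤-reflexive (solve 4 (λ a b c d → (a :+ c) :+ (b :+ d) := (a :+ b) :+ (c :+ d)) refl (∣ a ∣) (∣ b ∣) (∣ c ∣) (∣ d ∣)))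

  norm-neg : ∀ z → norm (-ᶜ z) ≡ norm z
  norm-neg (a , b) = cong₂ _+_ (ℚ.∣-p∣≡∣p∣ a) (ℚ.∣-p∣≡∣p∣ b)

  norm-* : ∀ z w → norm (z *ᶜ w) ≤ norm z * norm w
  norm-* (a , b) (c , d) = begin
    ∣ a * c - b * d ∣ + ∣ a * d + b * c ∣
      ≤⟨ ℚ.+-mono-≤ (ℚ.∣p-q∣≤∣p∣+∣q∣ (a * c) (b * d)) (ℚ.∣p+q∣≤∣p∣+∣q∣ (a * d) (b * c)) ⟩
    (∣ a * c ∣ + ∣ b * d ∣) + (∣ a * d ∣ + ∣ b * c ∣)
      ≡⟨ cong₂ _+_ (cong₂ _+_ (ℚ.∣p*q∣≡∣p∣*∣q∣ a c) (ℚ.∣p*q∣≡∣p∣*∣q∣ b d)) (cong₂ _+_ (ℚ.∣p*q∣≡∣p∣*∣q∣ a d) (ℚ.∣p*q∣≡∣p∣*∣q∣ b c)) ⟩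
    (∣ a ∣ * ∣ c ∣ + ∣ b ∣ * ∣ d ∣) + (∣ a ∣ * ∣ d ∣ + ∣ b ∣ * ∣ c ∣)
      ≡⟨ solve 4 (λ a b c d → (a :* c :+ b :* d) :+ (a :* d :+ b :* c) := (a :+ b) :* (c :+ d)) refl (∣ a ∣) (∣ b ∣) (∣ c ∣) (∣ d ∣) ⟩
    (∣ a ∣ + ∣ b ∣) * (∣ c ∣ + ∣ d ∣) ∎
    where open ℚ.≤-Reasoning

  IsUnit : ℚ × ℚ → Set
  IsUnit (a , b) = a * a + b * b ≡ 1ℚ

  unit-* : ∀ z w → IsUnit z → IsUnit w → IsUnit (z *ᶜ w)
  unit-* (a , b) (c , d) h h′ = trans
    (solve 4 (λ a b c d → (a :* c :- b :* d) :* (a :* c :- b :* d) :+ (a :* d :+ b :* c) :* (a :* d :+ b :* c) :=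
                          (a :* a :+ b :* b) :* (c :* c :+ d :* d)) refl a b c d)
    (trans (cong₂ _*_ h h′) (ℚ.*-identityˡ 1ℚ))

  unit-^ : ∀ z n → IsUnit z → IsUnit (z ^ n)
  unit-^ z zero    h = refl
  unit-^ z (suc n) h = unit-* z (z ^ n) h (unit-^ z n h)

  private
    square≤1 : ∀ {x} → x * x ≤ 1ℚ → x ≤ 1ℚ
    square≤1 {x} h with x ℚ.≤? 1ℚ
    ... | yes x≤1 = x≤1
    ... | no  x≰1 = ⊥-elim (ℚ.<-irrefl refl (ℚ.<-≤-trans (sub-< (subst (0ℚ <_)
          (solve 1 (λ x → (x :- con (+ 1)) :* (x :- con (+ 1)) :+ ((x :- con (+ 1)) :+ (x :- con (+ 1))) := x :* x :- con (+ 1)) refl x)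
          (ℚ.+-mono-≤-< (0≤x² (x - 1ℚ)) (ℚ.+-mono-< 0<x-1 0<x-1)))) h))
      where
      0<x-1 : 0ℚ < x - 1ℚ
      0<x-1 = <-sub (ℚ.≰⇒> x≰1)

  unit-re≤1 : ∀ z → IsUnit z → proj₁ z ≤ 1ℚ
  unit-re≤1 (a , b) h = square≤1 (sub-≤ (subst (0ℚ ≤_) (trans (solve 2 (λ a b → b :* b := (a :* a :+ b :* b) :- a :* a) refl a b) (cong (_- a * a) h)) (0≤x² b)))

  unit-im≤1 : ∀ z → IsUnit z → proj₂ z ≤ 1ℚ
  unit-im≤1 (a , b) h = square≤1 (sub-≤ (subst (0ℚ ≤_) (trans (solve 2 (λ a b → a :* a := (a :* a :+ b :* b) :- b :* b) refl a b) (cong (_- b * b) h)) (0≤x² a)))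

  unit-neg : ∀ z → IsUnit z → IsUnit (-ᶜ z)
  unit-neg (a , b) h = trans (solve 2 (λ a b → (:- a) :* (:- a) :+ (:- b) :* (:- b) := a :* a :+ b :* b) refl a b) h

  unit-∣re∣ : ∀ z → IsUnit z → ∣ proj₁ z ∣ ≤ 1ℚ
  unit-∣re∣ z h = ∣∣-≤ (unit-re≤1 z h) (unit-re≤1 (-ᶜ z) (unit-neg z h))

  unit-∣im∣ : ∀ z → IsUnit z → ∣ proj₂ z ∣ ≤ 1ℚ
  unit-∣im∣ z h = ∣∣-≤ (unit-im≤1 z h) (unit-im≤1 (-ᶜ z) (unit-neg z h))

  unit-norm : ∀ z → IsUnit z → norm z ≤ 1ℚ + 1ℚ
  unit-norm z h = ℚ.+-mono-≤ (unit-∣re∣ z h) (unit-∣im∣ z h)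

  private
    2ℚ : ℚ
    2ℚ = 1ℚ + 1ℚ

  -- Powers of a unit z = (x , y) with small positive y; N is the last index before z ^ n crosses the
  -- negative real axis, and -z ^ (N / p) is an approximate p-th root of unity.
  module Walk (x y : ℚ) (unit : IsUnit (x , y)) (0<y : 0ℚ < y) (½≤x : 1ℚ ≤ x + x)
    (1-x≤y : 1ℚ - x ≤ y) (J : ℕ) (large : 2ℚ < ℤ→ℚ (+ J) * y) where

    private
      z : ℚ × ℚ
      z = x , y

      re im : ℕ → ℚ
      re n = proj₁ (z ^ n)
      im n = proj₂ (z ^ n)

      unit-n : ∀ n → re n * re n + im n * im n ≡ 1ℚ
      unit-n n = unit-^ z n unit

      re-double : ∀ n → re (n ℕ.+ n) ≡ 2ℚ * (re n * re n) - 1ℚ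
      re-double n = trans (re≈ (^-homo-* z n n)) (trans
        (solve 2 (λ a b → a :* a :- b :* b := con (+ 2) :* (a :* a) :- (a :* a :+ b :* b)) refl (re n) (im n))
        (cong (λ v → 2ℚ * (re n * re n) - v) (unit-n n)))

      im-double : ∀ n → im (n ℕ.+ n) ≡ 2ℚ * (re n * im n)
      im-double n = trans (im≈ (^-homo-* z n n))
        (solve 2 (λ a b → a :* b :+ b :* a := con (+ 2) :* (a :* b)) refl (re n) (im n))

      re>0 : ∀ n → 0ℚ < im n → 0ℚ < im (n ℕ.+ n) → 0ℚ < re n
      re>0 n 0<im 0<im₂ = ℚ.≰⇒> λ re≤0 → ℚ.<-irrefl refl (ℚ.<-≤-trans 0<im₂ (sub-≤ (subst (0ℚ ≤_)
        (trans (solve 2 (λ a b → con (+ 2) :* ((:- a) :* b) := con (+ 0) :- con (+ 2) :* (a :* b)) refl (re n) (im n)) (cong (λ v → 0ℚ - v) (sym (im-double n))))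
        (0≤* (0≤+ 0≤1 0≤1) (0≤* (ℚ.neg-antimono-≤ re≤0) (ℚ.<⇒≤ 0<im))))))

      -- Positivity at 4n gives 2 b² > 1 for b = re (2n), hence b ≥ 1/2; then a² ≥ 3/4 for a = re n,
      -- and a ≥ 3/4 as a ≤ 1. So doubling multiplies the imaginary part by 2a ≥ 3/2.
      growth : ∀ n → 0ℚ < im n → 0ℚ < re n → 0ℚ < re (n ℕ.+ n) → 0ℚ < re ((n ℕ.+ n) ℕ.+ (n ℕ.+ n)) →
               im n + 2ℚ * im n ≤ 2ℚ * im (n ℕ.+ n)
      growth n 0<im 0<a 0<b 0<c = subst (λ v → im n + 2ℚ * im n ≤ 2ℚ * v) (sym (im-double n)) (sub-≤ (subst (0ℚ ≤_)
        (solve 2 (λ a i → i :* ((con (+ 2) :* (con (+ 2) :* (a :* a) :- con (+ 1)) :- con (+ 1)) :+ con (+ 4) :* (a :* (con (+ 1) :- a))) :=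
                          con (+ 2) :* (con (+ 2) :* (a :* i)) :- (i :+ con (+ 2) :* i)) refl (re n) (im n))
        (0≤* (ℚ.<⇒≤ 0<im) (0≤+ 0≤2b-1 (0≤* 0≤4 (0≤* (ℚ.<⇒≤ 0<a) (≤-sub (unit-re≤1 (z ^ n) (unit-^ z n unit)))))))))
        where
        b : ℚ
        b = re (n ℕ.+ n)
        0≤4 : 0ℚ ≤ ℚι.ι (+ 4)
        0≤4 = subst (0ℚ ≤_) (ℤ→ℚ≡ι (+ 4)) (ℤ→ℚ-nonneg 4)
        0≤2b-1 : 0ℚ ≤ 2ℚ * (2ℚ * (re n * re n) - 1ℚ) - 1ℚ
        0≤2b-1 = subst (λ v → 0ℚ ≤ 2ℚ * v - 1ℚ) (re-double n) (subst (0ℚ ≤_)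
          (solve 1 (λ b → (con (+ 2) :* (b :* b) :- con (+ 1)) :+ con (+ 2) :* (b :* (con (+ 1) :- b)) := con (+ 2) :* b :- con (+ 1)) refl b)
          (0≤+ (ℚ.<⇒≤ (subst (0ℚ <_) (re-double (n ℕ.+ n)) 0<c))
               (0≤* (0≤+ 0≤1 0≤1) (0≤* (ℚ.<⇒≤ 0<b) (≤-sub (unit-re≤1 (z ^ (n ℕ.+ n)) (unit-^ z (n ℕ.+ n) unit)))))))

      double : ℕ → ℕ
      double zero    = 1
      double (suc j) = double j ℕ.+ double j

      0<double : ∀ j → 0 ℕ.< double j
      0<double zero    = s≤s z≤n
      0<double (suc j) = ℕ.≤-trans (0<double j) (ℕ.m≤m+n (double j) (double j))

      double-mono : ∀ {i j} → i ℕ.≤ j → double i ℕ.≤ double j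
      double-mono {zero}  {j}     _        = 0<double j
      double-mono {suc i} {suc j} (s≤s le) = ℕ.+-mono-≤ (double-mono le) (double-mono le)

      Crossed : ℕ → Set
      Crossed n = im (suc n) ≤ 0ℚ

      module _ (uncrossed : ∀ n → n ℕ.< double (J ℕ.+ 3) → ¬ Crossed n) where

        0<im : ∀ n → 0 ℕ.< n → n ℕ.≤ double (J ℕ.+ 3) → 0ℚ < im n
        0<im (suc n) _ n< = ℚ.≰⇒> (uncrossed n n<)

        0<im-d : ∀ j → j ℕ.≤ J ℕ.+ 3 → 0ℚ < im (double j)
        0<im-d j j≤ = 0<im (double j) (0<double j) (double-mono j≤)

        0<re-d : ∀ j → suc j ℕ.≤ J ℕ.+ 3 → 0ℚ < re (double j)
        0<re-d j j≤ = re>0 (double j) (0<im-d j (ℕ.<⇒≤ j≤)) (0<im-d (suc j) j≤)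

        im-1 : im 1 ≡ y
        im-1 = solve 2 (λ x y → x :* con (+ 0) :+ y :* con (+ 1) := y) refl x y

        -- Each doubling adds at least `im (double j)`, which is at least `y`; this linear growth
        -- already violates the bound 1 for imaginary parts at `J`. The three further doublings in
        -- `J + 3` provide the positivity that `growth` asks for.
        grows : ∀ j → j ℕ.≤ J → (2ℚ + ℤ→ℚ (+ j)) * y ≤ 2ℚ * im (double j)
        grows zero    _   = ℚ.≤-reflexive (trans (cong (_* y) (ℚ.+-identityʳ 2ℚ)) (cong (2ℚ *_) (sym im-1)))
        grows (suc j) j<J = begin
          (2ℚ + ℤ→ℚ (+ suc j)) * y
            ≡⟨ cong (λ v → (2ℚ + v) * y) (ℤ→ℚ-+ (+ 1) (+ j)) ⟩
          (2ℚ + (1ℚ + q)) * y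
            ≡⟨ solve 2 (λ q y → (con (+ 2) :+ (con (+ 1) :+ q)) :* y := y :+ (con (+ 2) :+ q) :* y) refl q y ⟩
          y + (2ℚ + q) * y
            ≤⟨ ℚ.+-mono-≤ y≤ (grows j (ℕ.<⇒≤ j<J)) ⟩
          im (double j) + 2ℚ * im (double j)
            ≤⟨ growth (double j) (0<im-d j j≤₀) (0<re-d j j≤₁) (0<re-d (suc j) j≤₂) (0<re-d (suc (suc j)) j≤₃) ⟩
          2ℚ * im (double (suc j)) ∎
          where
          open ℚ.≤-Reasoning
          q = ℤ→ℚ (+ j)
          j≤₃ : 3 ℕ.+ j ℕ.≤ J ℕ.+ 3
          j≤₃ = ℕ.≤-trans (ℕ.+-monoʳ-≤ 3 (ℕ.<⇒≤ j<J)) (ℕ.≤-reflexive (ℕ.+-comm 3 J))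
          j≤₂ : 2 ℕ.+ j ℕ.≤ J ℕ.+ 3
          j≤₂ = ℕ.<⇒≤ j≤₃
          j≤₁ : 1 ℕ.+ j ℕ.≤ J ℕ.+ 3
          j≤₁ = ℕ.<⇒≤ j≤₂
          j≤₀ : j ℕ.≤ J ℕ.+ 3
          j≤₀ = ℕ.<⇒≤ j≤₁
          y≤ : y ≤ im (double j)
          y≤ = double-≤ (subst₂ _≤_ (solve 1 (λ y → con (+ 2) :* y := y :+ y) refl y) (solve 1 (λ v → con (+ 2) :* v := v :+ v) refl (im (double j)))
            (ℚ.≤-trans (sub-≤ (subst (0ℚ ≤_) (solve 2 (λ q y → q :* y := (con (+ 2) :+ q) :* y :- con (+ 2) :* y) refl q y)
              (0≤* (ℤ→ℚ-nonneg j) (ℚ.<⇒≤ 0<y)))) (grows j (ℕ.<⇒≤ j<J))))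

        absurd : ⊥
        absurd = ℚ.<-irrefl refl (begin-strict
          2ℚ                            <⟨ large ⟩
          ℤ→ℚ (+ J) * y                 ≤⟨ sub-≤ (subst (0ℚ ≤_) (solve 2 (λ q y → con (+ 2) :* y := (con (+ 2) :+ q) :* y :- q :* y) refl (ℤ→ℚ (+ J)) y)
                                             (0≤* (0≤+ 0≤1 0≤1) (ℚ.<⇒≤ 0<y))) ⟩
          (2ℚ + ℤ→ℚ (+ J)) * y          ≤⟨ grows J ℕ.≤-refl ⟩
          2ℚ * im (double J)            ≤⟨ ℚ.*-monoˡ-≤-nonNeg 2ℚ (unit-im≤1 (z ^ double J) (unit-^ z (double J) unit)) ⟩
          2ℚ * 1ℚ                       ≡⟨ ℚ.*-identityʳ 2ℚ ⟩
          2ℚ                            ∎)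
          where open ℚ.≤-Reasoning

      -- A bounded search: `absurd` supplies the explicit bound on the index.
      crossing : ∃ λ N → Crossed N × (∀ m → m ℕ.< N → ¬ Crossed m)
      crossing with least (λ n → im (suc n) ℚ.≤? 0ℚ) (double (J ℕ.+ 3))
      ... | inj₁ none  = ⊥-elim (absurd none)
      ... | inj₂ found = found

      N : ℕ
      N = proj₁ crossing

      0≤y : 0ℚ ≤ y
      0≤y = ℚ.<⇒≤ 0<y

      0≤x : 0ℚ ≤ x
      0≤x = double-≤ (ℚ.≤-trans 0≤1 ½≤x)

      0<im-before : ∀ n → 0 ℕ.< n → n ℕ.≤ N → 0ℚ < im n
      0<im-before (suc n) _ n< = ℚ.≰⇒> (proj₂ (proj₂ crossing) n n<)

      0≤im-N : 0ℚ ≤ im N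
      0≤im-N = go N refl
        where
        go : ∀ n → n ≡ N → 0ℚ ≤ im n
        go zero    _   = ℚ.≤-refl
        go (suc n) n≡N = ℚ.<⇒≤ (0<im-before (suc n) (s≤s z≤n) (ℕ.≤-reflexive n≡N))

      crossed : x * im N + y * re N ≤ 0ℚ
      crossed = proj₁ (proj₂ crossing)

      re-N≤0 : re N ≤ 0ℚ
      re-N≤0 with re N ℚ.≤? 0ℚ
      ... | yes h = h
      ... | no  h = ⊥-elim (ℚ.<-irrefl refl (ℚ.<-≤-trans (ℚ.+-mono-≤-< (0≤* 0≤x 0≤im-N) (0<* 0<y (ℚ.≰⇒> h))) crossed))

      -- The next step crosses the axis, so x b + y a ≤ 0 for z^N = (a , b); with a ≥ -1 and x ≥ 1/2
      -- this gives b ≤ y/x ≤ 2y.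
      im-N≤2y : im N ≤ y + y
      im-N≤2y = sub-≤ (subst (0ℚ ≤_)
        (solve 4 (λ x y a b → b :* ((x :+ x) :- con (+ 1)) :+ (con (+ 2) :* (con (+ 0) :- (x :* b :+ y :* a)) :+ con (+ 2) :* (y :* (a :- (:- con (+ 1))))) := (y :+ y) :- b) refl x y (re N) (im N))
        (0≤+ (0≤* 0≤im-N (≤-sub ½≤x)) (0≤+ (0≤* 0≤2 (≤-sub crossed)) (0≤* 0≤2 (0≤* 0≤y (≤-sub -1≤re))))))
        where
        0≤2 : 0ℚ ≤ 2ℚ
        0≤2 = 0≤+ 0≤1 0≤1
        -1≤re : - 1ℚ ≤ re N
        -1≤re = subst (- 1ℚ ≤_) (solve 1 (λ a → :- (:- a) := a) refl (re N))
          (ℚ.neg-antimono-≤ (unit-re≤1 (-ᶜ (z ^ N)) (unit-neg (z ^ N) (unit-^ z N unit))))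

      -- On the quarter circle a ≤ 0 ≤ b one has |a| + b ≥ 1, that is, 1 + a ≤ b.
      1+re≤2y : 1ℚ + re N ≤ y + y
      1+re≤2y = ℚ.≤-trans (sub-≤ (subst (0ℚ ≤_)
          (trans (solve 2 (λ a b → (:- a) :* (con (+ 1) :+ a) :+ ((b :* (con (+ 1) :- b)) :+ ((a :* a :+ b :* b) :- con (+ 1))) := b :- (con (+ 1) :+ a)) refl (re N) (im N)) refl)
          (0≤+ (0≤* (ℚ.neg-antimono-≤ re-N≤0) 0≤1+re) (0≤+ (0≤* 0≤im-N (≤-sub (unit-im≤1 (z ^ N) (unit-^ z N unit))))
            (ℚ.≤-reflexive (sym (trans (cong (_- 1ℚ) (unit-n N)) (ℚ.+-inverseʳ 1ℚ)))))))) im-N≤2y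
        where
        0≤1+re : 0ℚ ≤ 1ℚ + re N
        0≤1+re = subst (0ℚ ≤_) (solve 1 (λ a → con (+ 1) :- (:- a) := con (+ 1) :+ a) refl (re N))
          (≤-sub (unit-re≤1 (-ᶜ (z ^ N)) (unit-neg (z ^ N) (unit-^ z N unit))))

      1ᶜ : ℚ × ℚ
      1ᶜ = 1ℚ , 0ℚ

      near-N : norm ((z ^ N) +ᶜ 1ᶜ) ≤ 2ℚ * 2ℚ * y
      near-N = ℚ.≤-trans (ℚ.+-mono-≤ (∣∣-≤ (subst (_≤ y + y) (ℚ.+-comm 1ℚ (re N)) 1+re≤2y)
          (ℚ.≤-trans (sub-≤ (subst (0ℚ ≤_) (solve 1 (λ a → con (+ 2) :* (con (+ 1) :- (:- a)) := (a :+ con (+ 1)) :- (:- (a :+ con (+ 1)))) refl (re N))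
            (0≤* (0≤+ 0≤1 0≤1) (≤-sub (unit-re≤1 (-ᶜ (z ^ N)) (unit-neg (z ^ N) (unit-^ z N unit))))))) (subst (_≤ y + y) (ℚ.+-comm 1ℚ (re N)) 1+re≤2y)))
        (∣∣-≤ (subst (_≤ y + y) (sym (ℚ.+-identityʳ (im N))) im-N≤2y)
          (ℚ.≤-trans (subst (λ v → - v ≤ im N) (sym (ℚ.+-identityʳ (im N))) (ℚ.≤-trans (ℚ.neg-antimono-≤ 0≤im-N) 0≤im-N)) im-N≤2y)))
        (ℚ.≤-reflexive (solve 1 (λ y → (y :+ y) :+ (y :+ y) := con (+ 2) :* con (+ 2) :* y) refl y))

      step : norm (z +ᶜ (-ᶜ 1ᶜ)) ≤ 2ℚ * y
      step = ℚ.≤-trans (ℚ.+-mono-≤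
          (∣∣-≤ (ℚ.≤-trans (sub-≤ (subst (0ℚ ≤_) (solve 1 (λ x → con (+ 2) :* (con (+ 1) :- x) := (con (+ 1) :- x) :- (x :- con (+ 1))) refl x)
              (0≤* (0≤+ 0≤1 0≤1) (≤-sub (unit-re≤1 z unit))))) 1-x≤y)
            (subst (_≤ y) (solve 1 (λ x → con (+ 1) :- x := :- (x :- con (+ 1))) refl x) 1-x≤y))
          (∣∣-≤ (ℚ.≤-reflexive (ℚ.+-identityʳ y)) (subst (λ v → - v ≤ y) (sym (ℚ.+-identityʳ y)) (ℚ.≤-trans (ℚ.neg-antimono-≤ 0≤y) 0≤y))))
        (ℚ.≤-reflexive (solve 1 (λ y → y :+ y := con (+ 2) :* y) refl y))

      near-1 : ∀ r → norm ((z ^ r) +ᶜ (-ᶜ 1ᶜ)) ≤ ℤ→ℚ (+ r) * (2ℚ * (2ℚ * y))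
      near-1 zero    = ℚ.≤-reflexive (sym (ℚ.*-zeroˡ (2ℚ * (2ℚ * y))))
      near-1 (suc r) = begin
        norm ((z ^ suc r) +ᶜ (-ᶜ 1ᶜ))
          ≡⟨ norm-cong (solve 4 (λ x y a b → (x :* a :- y :* b) :+ (:- con (+ 1)) := (a :* (x :+ (:- con (+ 1))) :- b :* (y :+ (:- con (+ 0)))) :+ (a :+ (:- con (+ 1)))) refl x y (re r) (im r) ,
                        solve 4 (λ x y a b → (x :* b :+ y :* a) :+ (:- con (+ 0)) := (a :* (y :+ (:- con (+ 0))) :+ b :* (x :+ (:- con (+ 1)))) :+ (b :+ (:- con (+ 0)))) refl x y (re r) (im r)) ⟩
        norm (((z ^ r) *ᶜ (z +ᶜ (-ᶜ 1ᶜ))) +ᶜ ((z ^ r) +ᶜ (-ᶜ 1ᶜ)))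
          ≤⟨ norm-+ ((z ^ r) *ᶜ (z +ᶜ (-ᶜ 1ᶜ))) ((z ^ r) +ᶜ (-ᶜ 1ᶜ)) ⟩
        norm ((z ^ r) *ᶜ (z +ᶜ (-ᶜ 1ᶜ))) + norm ((z ^ r) +ᶜ (-ᶜ 1ᶜ))
          ≤⟨ ℚ.+-mono-≤ (ℚ.≤-trans (norm-* (z ^ r) (z +ᶜ (-ᶜ 1ᶜ))) (*-mono-≤ (norm≥0 (z ^ r)) (0≤* (0≤+ 0≤1 0≤1) 0≤y) (unit-norm (z ^ r) (unit-^ z r unit)) step)) (near-1 r) ⟩
        2ℚ * (2ℚ * y) + ℤ→ℚ (+ r) * (2ℚ * (2ℚ * y))
          ≡⟨ solve 2 (λ r v → v :+ r :* v := (con (+ 1) :+ r) :* v) refl (ℤ→ℚ (+ r)) (2ℚ * (2ℚ * y)) ⟩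
        (1ℚ + ℤ→ℚ (+ r)) * (2ℚ * (2ℚ * y))
          ≡⟨ cong (_* (2ℚ * (2ℚ * y))) (ℤ→ℚ-+ (+ 1) (+ r)) ⟨
        ℤ→ℚ (+ suc r) * (2ℚ * (2ℚ * y)) ∎
        where open ℚ.≤-Reasoning

    module _ (q : ℕ) where
      private
        p m r : ℕ
        p = suc (q ℕ.+ q)
        m = N ℕ./ p
        r = N ℕ.% p

        N≡ : m ℕ.* p ℕ.+ r ≡ N
        N≡ = trans (ℕ.+-comm (m ℕ.* p) r) (sym (ℕ.m≡m%n+[m/n]*n N p))

      -- The exponent p is odd, so w^p = - z^(mp), and mp differs from N by fewer than p steps. The
      -- minus sign also moves the root to the left half plane, away from 1.
      w : ℚ × ℚ
      w = -ᶜ (z ^ m)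

      w-unit : IsUnit w
      w-unit = unit-neg (z ^ m) (unit-^ z m unit)

      -- For m > 0 one has 2m ≤ N since p ≥ 3, so z^m and z^(2m) are both above the real axis, which
      -- puts z^m into the right half plane.
      w-re≤0 : 1 ℕ.≤ q → proj₁ w ≤ 0ℚ
      w-re≤0 1≤q = ℚ.neg-antimono-≤ (go m refl)
        where
        go : ∀ i → i ≡ m → 0ℚ ≤ re i
        go zero    _ = 0≤1
        go (suc i) e = ℚ.<⇒≤ (re>0 (suc i) (0<im-before (suc i) (s≤s z≤n) (ℕ.≤-trans (ℕ.m≤m+n (suc i) (suc i)) twice))
                                           (0<im-before (suc i ℕ.+ suc i) (s≤s z≤n) twice))
          where
          twice : suc i ℕ.+ suc i ℕ.≤ N
          twice = ℕ.≤-trans (ℕ.≤-reflexive (trans (cong (λ j → j ℕ.+ j) e) (trans (cong (m ℕ.+_) (sym (ℕ.+-identityʳ m))) (ℕ.*-comm 2 m))))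
            (ℕ.≤-trans (ℕ.*-monoʳ-≤ m (s≤s (ℕ.≤-trans 1≤q (ℕ.m≤m+n q q)))) (ℕ.≤-trans (ℕ.m≤m+n (m ℕ.* p) r) (ℕ.≤-reflexive N≡)))

      -- The 4 comes from the distance of z^N to -1, at most 4y; the 8p from undoing fewer than p
      -- steps of norm at most 4y each, times the norm of `u`, at most 2.
      w^p-near-1 : norm ((w ^ p) +ᶜ (-ᶜ 1ᶜ)) ≤ ℤ→ℚ (+ (4 ℕ.+ p ℕ.* 8)) * y
      w^p-near-1 = begin
        norm ((w ^ p) +ᶜ (-ᶜ 1ᶜ))
          ≡⟨ norm-cong (C.trans (C.+-congʳ { -ᶜ 1ᶜ } (C.trans (OddPower.neg-odd-power ℂ (z ^ m) q) (C.-‿cong (^-assocʳ z m p))))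
               (solve 1 (λ a → (:- a) :+ (:- con (+ 1)) := :- (a :+ con (+ 1))) refl (re (m ℕ.* p)) ,
                solve 1 (λ a → (:- a) :+ (:- con (+ 0)) := :- (a :+ con (+ 0))) refl (im (m ℕ.* p)))) ⟩
        norm (-ᶜ (u +ᶜ 1ᶜ))
          ≡⟨ norm-neg (u +ᶜ 1ᶜ) ⟩
        norm (u +ᶜ 1ᶜ)
          ≡⟨ norm-cong split ⟩
        norm (((z ^ N) +ᶜ 1ᶜ) +ᶜ (-ᶜ (u *ᶜ ((z ^ r) +ᶜ (-ᶜ 1ᶜ)))))
          ≤⟨ norm-+ ((z ^ N) +ᶜ 1ᶜ) (-ᶜ (u *ᶜ ((z ^ r) +ᶜ (-ᶜ 1ᶜ)))) ⟩
        norm ((z ^ N) +ᶜ 1ᶜ) + norm (-ᶜ (u *ᶜ ((z ^ r) +ᶜ (-ᶜ 1ᶜ))))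
          ≤⟨ ℚ.+-mono-≤ near-N (ℚ.≤-trans (ℚ.≤-reflexive (norm-neg (u *ᶜ ((z ^ r) +ᶜ (-ᶜ 1ᶜ)))))
               (ℚ.≤-trans (norm-* u ((z ^ r) +ᶜ (-ᶜ 1ᶜ))) (*-mono-≤ (norm≥0 u) (0≤* (ℤ→ℚ-nonneg p) (0≤* (0≤+ 0≤1 0≤1) (0≤* (0≤+ 0≤1 0≤1) 0≤y)))
                 (unit-norm u (unit-^ z (m ℕ.* p) unit))
                 (ℚ.≤-trans (near-1 r) (ℚ.*-monoʳ-≤-nonNeg (2ℚ * (2ℚ * y)) {{ℚ.nonNegative (0≤* (0≤+ 0≤1 0≤1) (0≤* (0≤+ 0≤1 0≤1) 0≤y))}}
                   (ℤ→ℚ-mono-≤ {+ r} {+ p} (ℤ.+≤+ (ℕ.<⇒≤ (ℕ.m%n<n N p))))))))) ⟩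
        2ℚ * 2ℚ * y + 2ℚ * (ℤ→ℚ (+ p) * (2ℚ * (2ℚ * y)))
          ≡⟨ solve 2 (λ p y → con (+ 2) :* con (+ 2) :* y :+ con (+ 2) :* (p :* (con (+ 2) :* (con (+ 2) :* y))) := (con (+ 4) :+ p :* con (+ 8)) :* y) refl (ℤ→ℚ (+ p)) y ⟩
        (ℚι.ι (+ 4) + ℤ→ℚ (+ p) * ℚι.ι (+ 8)) * y
          ≡⟨ cong (_* y) (trans (ℤ→ℚ-+ (+ 4) (+ (p ℕ.* 8))) (cong₂ _+_ (ℤ→ℚ≡ι (+ 4)) (trans (cong ℤ→ℚ (ℤ.pos-* p 8)) (trans (ℤ→ℚ-* (+ p) (+ 8)) (cong (ℤ→ℚ (+ p) *_) (ℤ→ℚ≡ι (+ 8))))))) ⟨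
        ℤ→ℚ (+ (4 ℕ.+ p ℕ.* 8)) * y ∎
        where
        open ℚ.≤-Reasoning
        module C = CommutativeRing ℂ
        u : ℚ × ℚ
        u = z ^ (m ℕ.* p)
        zN : (z ^ N) ≈ᶜ (u *ᶜ (z ^ r))
        zN = C.trans (C.reflexive (cong (z ^_) (sym N≡))) (^-homo-* z (m ℕ.* p) r)
        -- Splitting off u (z^r - 1) avoids dividing by z^r.
        split : (u +ᶜ 1ᶜ) ≈ᶜ (((z ^ N) +ᶜ 1ᶜ) +ᶜ (-ᶜ (u *ᶜ ((z ^ r) +ᶜ (-ᶜ 1ᶜ)))))
        split = trans (solve 4 (λ a b c d → a :+ con (+ 1) := ((a :* c :- b :* d) :+ con (+ 1)) :+ (:- (a :* (c :+ (:- con (+ 1))) :- b :* (d :+ (:- con (+ 0)))))) refl (proj₁ u) (proj₂ u) (re r) (im r))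
                  (cong (λ v → (v + 1ℚ) + proj₁ (-ᶜ (u *ᶜ ((z ^ r) +ᶜ (-ᶜ 1ᶜ))))) (sym (re≈ zN))) ,
                trans (solve 4 (λ a b c d → b :+ con (+ 0) := ((a :* d :+ b :* c) :+ con (+ 0)) :+ (:- (a :* (d :+ (:- con (+ 0))) :+ b :* (c :+ (:- con (+ 1)))))) refl (proj₁ u) (proj₂ u) (re r) (im r))
                  (cong (λ v → (v + 0ℚ) + proj₂ (-ᶜ (u *ᶜ ((z ^ r) +ᶜ (-ᶜ 1ᶜ))))) (sym (im≈ zN)))

-- Integers modulo a prime.

module Residues where

  open import Relation.Binary.PropositionalEquality using (refl; sym; trans; cong; cong₂; subst)
  open IntegerCoefficients
  open BinaryForms using (IsDomain)

  ℤ-ring : CommutativeRing 0ℓ 0ℓ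
  ℤ-ring = ℤ.+-*-commutativeRing

  open FromℤRing.Solver ℤ-ring using (solve; con; _:+_; _:*_; :-_; _:-_; _:=_)

  module ModP (p : ℕ) (prime : Prime p) where

    private instance
      p≢0 : NonZero p
      p≢0 = prime⇒nonZero prime

    infix 4 _≋_
    -- The field with p elements is kept as the integers with this congruence, so that reducing the
    -- coefficients of `L` is the identity. The explicit quotient turns congruences into ring
    -- identities.
    record _≋_ (a b : ℤ) : Set where
      constructor congruent
      field
        quotient : ℤ
        equality : a ≡ b ℤ.+ quotient ℤ.* + p

    ∣⇒≋0 : ∀ {a} → + p ℤ.∣ a → a ≋ + 0
    ∣⇒≋0 d with ∣ᵤ⇒∣ d
    ... | divides q eq = congruent q (trans eq (sym (ℤ.+-identityˡ _)))

    ≋0⇒∣ : ∀ {a} → a ≋ + 0 → + p ℤ.∣ a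
    ≋0⇒∣ (congruent q eq) = ∣⇒∣ᵤ (divides q (trans eq (ℤ.+-identityˡ _)))

    private
      ≋-sym : ∀ {a b} → a ≋ b → b ≋ a
      ≋-sym {a} {b} (congruent q eq) = congruent (ℤ.- q)
        (trans (solve 3 (λ b q p → b := (b :+ q :* p) :+ (:- q) :* p) refl b q (+ p)) (cong (ℤ._+ ((ℤ.- q) ℤ.* + p)) (sym eq)))

      ≋-trans : ∀ {a b c} → a ≋ b → b ≋ c → a ≋ c
      ≋-trans {a} {b} {c} (congruent q refl) (congruent r refl) = congruent (r ℤ.+ q)
        (solve 4 (λ c r q p → (c :+ r :* p) :+ q :* p := c :+ (r :+ q) :* p) refl c r q (+ p))

      ≡⇒≋ : ∀ {a b} → a ≡ b → a ≋ b
      ≡⇒≋ {a} refl = congruent (+ 0) (sym (ℤ.+-identityʳ a))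

      +-cong : ∀ {a b c d} → a ≋ b → c ≋ d → a ℤ.+ c ≋ b ℤ.+ d
      +-cong {b = b} {d = d} (congruent q refl) (congruent r refl) = congruent (q ℤ.+ r)
        (solve 5 (λ b d q r p → (b :+ q :* p) :+ (d :+ r :* p) := (b :+ d) :+ (q :+ r) :* p) refl b d q r (+ p))

      *-cong : ∀ {a b c d} → a ≋ b → c ≋ d → a ℤ.* c ≋ b ℤ.* d
      *-cong {b = b} {d = d} (congruent q refl) (congruent r refl) = congruent (b ℤ.* r ℤ.+ q ℤ.* d ℤ.+ q ℤ.* (r ℤ.* + p))
        (solve 5 (λ b d q r p → (b :+ q :* p) :* (d :+ r :* p) := b :* d :+ (b :* r :+ q :* d :+ q :* (r :* p)) :* p) refl b d q r (+ p))

      neg-cong : ∀ {a b} → a ≋ b → ℤ.- a ≋ ℤ.- b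
      neg-cong {b = b} (congruent q refl) = congruent (ℤ.- q)
        (solve 3 (λ b q p → :- (b :+ q :* p) := (:- b) :+ (:- q) :* p) refl b q (+ p))

    ring : CommutativeRing 0ℓ 0ℓ
    ring = record
      { Carrier = ℤ ; _≈_ = _≋_ ; _+_ = ℤ._+_ ; _*_ = ℤ._*_ ; -_ = ℤ.-_ ; 0# = + 0 ; 1# = + 1
      ; isCommutativeRing = record
        { isRing = record
          { +-isAbelianGroup = record
            { isGroup = record
              { isMonoid = record
                { isSemigroup = record
                  { isMagma = record
                    { isEquivalence = record { refl = ≡⇒≋ refl ; sym = ≋-sym ; trans = ≋-trans }
                    ; ∙-cong = +-cong }
                  ; assoc = λ a b c → ≡⇒≋ (ℤ.+-assoc a b c) }
                ; identity = (λ a → ≡⇒≋ (ℤ.+-identityˡ a)) , (λ a → ≡⇒≋ (ℤ.+-identityʳ a)) }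
              ; inverse = (λ a → ≡⇒≋ (ℤ.+-inverseˡ a)) , (λ a → ≡⇒≋ (ℤ.+-inverseʳ a))
              ; ⁻¹-cong = neg-cong }
            ; comm = λ a b → ≡⇒≋ (ℤ.+-comm a b) }
          ; *-cong = *-cong
          ; *-assoc = λ a b c → ≡⇒≋ (ℤ.*-assoc a b c)
          ; *-identity = (λ a → ≡⇒≋ (ℤ.*-identityˡ a)) , (λ a → ≡⇒≋ (ℤ.*-identityʳ a))
          ; distrib = (λ a b c → ≡⇒≋ (ℤ.*-distribˡ-+ a b c)) , (λ a b c → ≡⇒≋ (ℤ.*-distribʳ-+ a b c)) }
        ; *-comm = λ a b → ≡⇒≋ (ℤ.*-comm a b) } }

    ≋0? : ∀ a → Dec (a ≋ + 0)
    ≋0? a = map′ (∣⇒≋0 {a}) ≋0⇒∣ (p ℕ.∣? ℤ.∣ a ∣)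

    zero? : ∀ a → a ≋ + 0 ⊎ ¬ a ≋ + 0
    zero? a with ≋0? a
    ... | yes z = inj₁ z
    ... | no nz = inj₂ nz

    small-nonzero : ∀ n → suc n ℕ.< p → ¬ + suc n ≋ + 0
    small-nonzero n n<p z = ℕ.<⇒≱ n<p (ℕ.∣⇒≤ (≋0⇒∣ z))

    isDomain : IsDomain ring
    isDomain = record
      { noZeroDivisors = λ x y z → Sum.map (∣⇒≋0 {x}) (∣⇒≋0 {y})
          (euclidsLemma ℤ.∣ x ∣ ℤ.∣ y ∣ prime (subst (p ℕ.∣_) (ℤ.abs-* x y) (≋0⇒∣ z)))
      ; 1≉0 = small-nonzero 0 (ℕ.nonTrivial⇒n>1 p {{prime⇒nonTrivial prime}}) }

    module R = CommutativeRing ring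
    open FromℤRing ring using (ι; ι-unique)

    ι≋id : ∀ z → z ≋ ι z
    ι≋id = ι-unique (λ z → z) (λ i j → R.refl) R.refl

    residue : ℤ → Fin p
    residue z = fromℕ< (ℤ.n%d<d z (+ p))

    toℤ : Fin p → ℤ
    toℤ a = + toℕ a

    residue-≋ : ∀ z → toℤ (residue z) ≋ z
    residue-≋ z = ≋-sym (congruent (z ℤ./ + p) (trans (ℤ.a≡a%n+[a/n]*n z (+ p))
      (cong (λ r → + r ℤ.+ (z ℤ./ + p) ℤ.* + p) (sym (Fin.toℕ-fromℕ< (ℤ.n%d<d z (+ p)))))))

    private
      aux : ∀ m n → m ℕ.< p → n ℕ.≤ m → + m ≋ + n → m ≡ n
      aux m n m<p n≤m h with m ℕ.∸ n in eq
      ... | zero  = ℕ.≤-antisym (ℕ.m∸n≡0⇒m≤n eq) n≤m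
      ... | suc d = contradiction (≋-trans (≡⇒≋ (trans (cong +_ (sym eq)) (trans (sym (ℤ.⊖-≥ n≤m)) (sym (ℤ.m-n≡m⊖n m n)))))
                      (≋-trans (+-cong h (≡⇒≋ (refl {x = ℤ.- + n}))) (≡⇒≋ (ℤ.+-inverseʳ (+ n)))))
                    (small-nonzero d (ℕ.≤-<-trans (ℕ.≤-trans (ℕ.≤-reflexive (sym eq)) (ℕ.m∸n≤m m n)) m<p))

    toℤ-injective : ∀ {a b} → toℤ a ≋ toℤ b → a ≡ b
    toℤ-injective {a} {b} a≋b with ℕ.≤-total (toℕ b) (toℕ a)
    ... | inj₁ b≤a = Fin.toℕ-injective (aux (toℕ a) (toℕ b) (Fin.toℕ<n a) b≤a a≋b)
    ... | inj₂ a≤b = Fin.toℕ-injective (sym (aux (toℕ b) (toℕ a) (Fin.toℕ<n b) a≤b (≋-sym a≋b)))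

    inverse : ∀ a → ¬ a ≋ + 0 → ∃ λ b → + b ℤ.* a ≋ + 1
    inverse a a≉0 with residue a in eq
    ... | r with toℕ r in eqr
    ...   | zero  = contradiction (≋-trans (≋-sym (residue-≋ a)) (≡⇒≋ (cong +_ (trans (cong toℕ eq) eqr)))) a≉0
    ...   | suc n = unpack (coprime-Bézout (prime⇒coprime {n = suc n} prime (subst (ℕ._< p) eqr (Fin.toℕ<n r))))
      where
      a≋ : a ≋ + suc n
      a≋ = ≋-trans (≋-sym (residue-≋ a)) (≡⇒≋ (cong +_ (trans (cong toℕ eq) eqr)))
      unpack : Bézout.Identity 1 p (suc n) → ∃ λ b → + b ℤ.* a ≋ + 1
      unpack (Bézout.-+ x y e) = y , ≋-trans (*-cong (≡⇒≋ (refl {x = + y})) a≋) (congruent (+ x)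
        (trans (sym (ℤ.pos-* y (suc n))) (trans (cong +_ (sym e)) (cong (λ v → + 1 ℤ.+ v) (ℤ.pos-* x p)))))
      -- Here 1 + y s = x p with s the residue, so the inverse is -y, represented by the natural
      -- number y (p - 1).
      unpack (Bézout.+- x y e) = y ℕ.* (p ℕ.∸ 1) , ≋-trans (*-cong (≡⇒≋ (refl {x = + (y ℕ.* (p ℕ.∸ 1))})) a≋) (congruent (+ (y ℕ.* suc n) ℤ.- + x)
        (begin
          + (y ℕ.* (p ℕ.∸ 1)) ℤ.* + suc n
            ≡⟨ cong (ℤ._* + suc n) (ℤ.pos-* y (p ℕ.∸ 1)) ⟩
          (+ y ℤ.* + (p ℕ.∸ 1)) ℤ.* + suc n
            ≡⟨ solve 3 (λ y q s → (y :* q) :* s := (y :* s) :* (con (+ 1) :+ q) :- y :* s) refl (+ y) (+ (p ℕ.∸ 1)) (+ suc n) ⟩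
          (+ y ℤ.* + suc n) ℤ.* (+ 1 ℤ.+ + (p ℕ.∸ 1)) ℤ.- + y ℤ.* + suc n
            ≡⟨ cong₂ (λ u v → (+ y ℤ.* + suc n) ℤ.* u ℤ.- v) (cong +_ (ℕ.suc-pred p)) refl ⟩
          (+ y ℤ.* + suc n) ℤ.* + p ℤ.- + y ℤ.* + suc n
            ≡⟨ solve 2 (λ v p → v :* p :- v := con (+ 1) :+ (v :* p :- (con (+ 1) :+ v))) refl (+ y ℤ.* + suc n) (+ p) ⟩
          + 1 ℤ.+ ((+ y ℤ.* + suc n) ℤ.* + p ℤ.- (+ 1 ℤ.+ + y ℤ.* + suc n))
            ≡⟨ cong₂ (λ u v → + 1 ℤ.+ (u ℤ.* + p ℤ.- v)) (sym (ℤ.pos-* y (suc n)))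
                 (trans (cong (λ v → + 1 ℤ.+ v) (sym (ℤ.pos-* y (suc n)))) (trans (cong +_ e) (ℤ.pos-* x p))) ⟩
          + 1 ℤ.+ (+ (y ℕ.* suc n) ℤ.* + p ℤ.- + x ℤ.* + p)
            ≡⟨ solve 3 (λ u x p → con (+ 1) :+ (u :* p :- x :* p) := con (+ 1) :+ (u :- x) :* p) refl (+ (y ℕ.* suc n)) (+ x) (+ p) ⟩
          + 1 ℤ.+ (+ (y ℕ.* suc n) ℤ.- + x) ℤ.* + p ∎))
        where open ≡-Reasoning

-- Additive characters from roots of unity.

module Characters where

  open import Data.Rational using (_≤_; ∣_∣)
  open import Data.List using (tabulate)
  open IntegerCoefficients
  open import Defs using (ℤ→ℚ)
  open FiniteSums
  open Rationals
  open ComplexNumbers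
  open BoundedSequences
  open ApproximateRoots
  open Residues

  -- The value ring built below has zero divisors, so the cancellation of p, which stands in for a
  -- division in the orthogonality argument, is part of the record.
  record AdditiveCharacter (p : ℕ) (prime : Prime p) (C : CommutativeRing 0ℓ 0ℓ) : Set where
    open ModP p prime using (_≋_; toℤ)
    open CommutativeRing C
    open ListSum C using (∑)
    open FromℤRing C using (ι)
    field
      χ        : ℤ → Carrier
      χ-0      : χ (+ 0) ≈ 1#
      χ-+      : ∀ a b → χ (a ℤ.+ b) ≈ χ a * χ b
      χ-cong   : ∀ {a b} → a ≋ b → χ a ≈ χ b
      χ-sum    : ∀ m → ¬ m ≋ + 0 → ∑ (allFin p) (λ a → χ (toℤ a ℤ.* m)) ≈ 0#
      p-cancel : ∀ x → ι (+ p) * x ≈ 0# → x ≈ 0#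

  module PowerCharacter (R : CommutativeRing 0ℓ 0ℓ) where
    open CommutativeRing R hiding (zero)
    open FromℤRing R using (module Solver)
    open Solver using (solve; con; _:+_; _:*_; :-_; _:-_; _:=_)
    open ListSum R
    open import Algebra.Properties.Semiring.Exp semiring using (_^_; ^-homo-*; ^-assocʳ; ^-congˡ; ^-congʳ)
    open import Relation.Binary.Reasoning.Setoid setoid

    1^n≈1 : ∀ n → 1# ^ n ≈ 1#
    1^n≈1 zero    = refl
    1^n≈1 (suc n) = trans (*-identityˡ _) (1^n≈1 n)

    telescope : ∀ n (f : ℕ → Carrier) → ∑ (allFin n) (λ a → f (toℕ a) - f (suc (toℕ a))) ≈ f 0 - f n
    telescope n f = go n id f (λ a → f (toℕ a) - f (suc (toℕ a))) (λ _ → refl)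
      where
      go : ∀ n {A : Set} (h : Fin n → A) (f : ℕ → Carrier) (g : A → Carrier) →
           (∀ i → g (h i) ≈ f (toℕ i) - f (suc (toℕ i))) → ∑ (tabulate h) g ≈ f 0 - f n
      go zero    h f g eq = sym (-‿inverseʳ (f 0))
      go (suc n) h f g eq = trans (+-cong (eq zero) (go n (h ∘ suc) (f ∘ suc) g (eq ∘ suc)))
        (solve 3 (λ a b c → (a :- b) :+ (b :- c) := a :- c) refl (f 0) (f 1) (f (suc n)))

    module _ (ζ ζ⁻¹ : Carrier) (inv : ζ * ζ⁻¹ ≈ 1#) where

      χ : ℤ → Carrier
      χ (+ n)    = ζ ^ n
      χ -[1+ n ] = ζ⁻¹ ^ suc n

      private
        χ-⊖ : ∀ m n → χ (m ℤ.⊖ n) ≈ ζ ^ m * ζ⁻¹ ^ n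
        χ-⊖ m       zero    = sym (*-identityʳ _)
        χ-⊖ zero    (suc n) = sym (*-identityˡ _)
        χ-⊖ (suc m) (suc n) = begin
          χ (suc m ℤ.⊖ suc n)                 ≡⟨ ≡.cong χ (ℤ.[1+m]⊖[1+n]≡m⊖n m n) ⟩
          χ (m ℤ.⊖ n)                         ≈⟨ χ-⊖ m n ⟩
          ζ ^ m * ζ⁻¹ ^ n                     ≈⟨ *-identityˡ _ ⟨
          1# * (ζ ^ m * ζ⁻¹ ^ n)              ≈⟨ *-congʳ inv ⟨
          (ζ * ζ⁻¹) * (ζ ^ m * ζ⁻¹ ^ n)       ≈⟨ solve 4 (λ a b c d → (a :* b) :* (c :* d) := (a :* c) :* (b :* d)) refl ζ ζ⁻¹ (ζ ^ m) (ζ⁻¹ ^ n) ⟩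
          ζ ^ suc m * ζ⁻¹ ^ suc n             ∎

      χ-+ : ∀ a b → χ (a ℤ.+ b) ≈ χ a * χ b
      χ-+ (+ m)    (+ n)    = ^-homo-* ζ m n
      χ-+ (+ m)    -[1+ n ] = χ-⊖ m (suc n)
      χ-+ -[1+ m ] (+ n)    = trans (χ-⊖ n (suc m)) (*-comm _ _)
      χ-+ -[1+ m ] -[1+ n ] = trans (reflexive (≡.cong (λ k → ζ⁻¹ ^ suc k) (≡.sym (ℕ.+-suc m n)))) (^-homo-* ζ⁻¹ (suc m) (suc n))

      module _ (p : ℕ) (prime : Prime p) (root : ζ ^ p ≈ 1#)
               (cancel : ∀ x → (1# - ζ) * x ≈ 0# → x ≈ 0#) where
        open ModP p prime using (_≋_; congruent; toℤ; inverse; ≋0⇒∣; module R)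

        private
          χ-neg : ∀ a → χ (ℤ.- a) * χ a ≈ 1#
          χ-neg a = trans (sym (χ-+ (ℤ.- a) a)) (reflexive (≡.cong χ (ℤ.+-inverseˡ a)))

          χ-multiple : ∀ q → χ (q ℤ.* + p) ≈ 1#
          χ-multiple (+ n) = begin
            χ (+ n ℤ.* + p)   ≡⟨ ≡.cong χ (ℤ.pos-* n p) ⟨
            ζ ^ (n ℕ.* p)     ≡⟨ ≡.cong (ζ ^_) (ℕ.*-comm n p) ⟩
            ζ ^ (p ℕ.* n)     ≈⟨ ^-assocʳ ζ p n ⟨
            (ζ ^ p) ^ n       ≈⟨ ^-congˡ n root ⟩
            1# ^ n            ≈⟨ 1^n≈1 n ⟩
            1#                ∎
          χ-multiple -[1+ n ] = begin
            χ (-[1+ n ] ℤ.* + p)                                ≡⟨ ≡.cong χ (ℤ.neg-distribˡ-* (+ suc n) (+ p)) ⟨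
            χ (ℤ.- (+ suc n ℤ.* + p))                           ≈⟨ *-identityʳ _ ⟨
            χ (ℤ.- (+ suc n ℤ.* + p)) * 1#                      ≈⟨ *-congˡ (χ-multiple (+ suc n)) ⟨
            χ (ℤ.- (+ suc n ℤ.* + p)) * χ (+ suc n ℤ.* + p)     ≈⟨ χ-neg (+ suc n ℤ.* + p) ⟩
            1#                                                  ∎

        χ-cong : ∀ {a b} → a ≋ b → χ a ≈ χ b
        χ-cong {b = b} (congruent q ≡.refl) = trans (χ-+ b (q ℤ.* + p)) (trans (*-congˡ (χ-multiple q)) (*-identityʳ _))

        χ-power : ∀ n m → χ (+ n ℤ.* m) ≈ χ m ^ n
        χ-power zero    m = reflexive (≡.cong χ (ℤ.*-zeroˡ m))
        χ-power (suc n) m = trans (reflexive (≡.cong χ (≡.trans (ℤ.*-distribʳ-+ m (+ 1) (+ n)) (≡.cong (ℤ._+ + n ℤ.* m) (ℤ.*-identityˡ m)))))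
          (trans (χ-+ m (+ n ℤ.* m)) (*-congˡ (χ-power n m)))

        -- If η fixes x, so does η^n; phrased as a fact about annihilators, without division.
        geometric : ∀ η n x → (1# - η) * x ≈ 0# → (1# - η ^ n) * x ≈ 0#
        geometric η zero    x h = trans (*-congʳ (-‿inverseʳ 1#)) (zeroˡ x)
        geometric η (suc n) x h = begin
          (1# - η * η ^ n) * x
            ≈⟨ solve 3 (λ η u x → (con (+ 1) :- η :* u) :* x := (con (+ 1) :- η) :* x :+ η :* ((con (+ 1) :- u) :* x)) refl η (η ^ n) x ⟩
          (1# - η) * x + η * ((1# - η ^ n) * x)
            ≈⟨ +-cong h (*-congˡ (geometric η n x h)) ⟩
          0# + η * 0#
            ≈⟨ trans (+-identityˡ _) (zeroʳ η) ⟩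
          0# ∎

        -- ζ = η ^ n with n inverse to m, so 1 - η divides 1 - ζ.
        χ-sum : ∀ m → ¬ m ≋ + 0 → ∑ (allFin p) (λ a → χ (toℤ a ℤ.* m)) ≈ 0#
        χ-sum m m≉0 with inverse m m≉0
        ... | n , nm≋1 = cancel S (trans (*-congʳ (+-congˡ (-‿cong ζ≈))) (geometric η n S (begin
            (1# - η) * S
              ≈⟨ ∑-*ˡ (allFin p) (1# - η) _ ⟩
            ∑ (allFin p) (λ a → (1# - η) * χ (toℤ a ℤ.* m))
              ≈⟨ ∑-cong (allFin p) (λ a → trans (*-congˡ (χ-power (toℕ a) m))
                   (solve 2 (λ η u → (con (+ 1) :- η) :* u := u :- η :* u) refl η (η ^ toℕ a))) ⟩
            ∑ (allFin p) (λ a → η ^ toℕ a - η ^ suc (toℕ a))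
              ≈⟨ telescope p (η ^_) ⟩
            1# - η ^ p
              ≈⟨ +-congˡ (-‿cong (trans (sym (χ-power p m)) (χ-cong {+ p ℤ.* m} {+ 0} (congruent m (≡.trans (ℤ.*-comm (+ p) m) (≡.sym (ℤ.+-identityˡ _))))))) ⟩
            1# - 1#
              ≈⟨ -‿inverseʳ 1# ⟩
            0# ∎)))
          where
          η S : Carrier
          η = χ m
          S = ∑ (allFin p) (λ a → χ (toℤ a ℤ.* m))
          ζ≈ : ζ ≈ η ^ n
          ζ≈ = trans (sym (*-identityʳ ζ)) (trans (sym (χ-cong {+ n ℤ.* m} {+ 1} nm≋1)) (χ-power n m))

  module ℂ𝔹 = Complexification 𝔹

  ℂ : CommutativeRing 0ℓ 0ℓ
  ℂ = ℂ𝔹.ℂ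

  private
    module B = CommutativeRing 𝔹
    module C = CommutativeRing ℂ
  open FromℤRing ℂ using (ι; ι-unique)

  embed-const : ∀ z → ℂ𝔹.embed (const z) C.≈ ι z
  embed-const = ι-unique (λ z → ℂ𝔹.embed (const z))
    (λ i j → C.trans {i = ℂ𝔹.embed (const (i ℤ.+ j))} (pointwise {const (i ℤ.+ j)} {const i B.+ const j} (λ _ → ℤ→ℚ-+ i j) ℂ𝔹., B.refl {B.0#}) (ℂ𝔹.embed-+ (const i) (const j)))
    (C.refl {C.1#})

  -- In a ring with zero divisors, a factor bounded below by 1 is what can be cancelled.
  Null-cancel : ∀ {c s : ℕ → ℚ} → (∀ n → 1ℚ ≤ c n) → Null (λ n → c n ℚ.* s n) → Null s
  Null-cancel {c} {s} 1≤c h .small m with small h m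
  ... | N , b = N , λ n N≤n → ℚ.≤-trans (ℚ.*-monoʳ-≤-nonNeg (ℤ→ℚ (+ m)) {{ℚ.nonNegative (ℤ→ℚ-nonneg m)}} (begin
      ∣ s n ∣              ≡⟨ ℚ.*-identityˡ ∣ s n ∣ ⟨
      1ℚ ℚ.* ∣ s n ∣       ≤⟨ ℚ.*-monoʳ-≤-nonNeg ∣ s n ∣ {{ℚ.∣-∣-nonNeg (s n)}} (1≤c n) ⟩
      c n ℚ.* ∣ s n ∣      ≡⟨ cong₂ ℚ._*_ (ℚ.0≤p⇒∣p∣≡p (ℚ.≤-trans 0≤1 (1≤c n))) ≡.refl ⟨
      ∣ c n ∣ ℚ.* ∣ s n ∣  ≡⟨ ℚ.∣p*q∣≡∣p∣*∣q∣ (c n) (s n) ⟨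
      ∣ c n ℚ.* s n ∣      ∎)) (b n N≤n)
    where
    open ℚ.≤-Reasoning
    cong₂ = ≡.cong₂

-- A p-th root of unity with bounded sequences as coordinates.

module RootOfUnity where

  open import Data.Rational using (_+_; _*_; _-_; -_; _≤_; _<_; ∣_∣)
  open import Relation.Binary.PropositionalEquality using (refl; cong; sym; trans; subst; subst₂)
  open IntegerCoefficients
  open import Defs using (ℤ→ℚ)
  open Rationals
  open ComplexNumbers
  open BoundedSequences
  open ApproximateRoots
  open Characters

  open ℚι using (module Solver)
  open Solver using (solve; con; _:+_; _:*_; :-_; _:-_; _:=_)

  private
    module ℚ² = Complexification ℚ-ring
    2ℚ : ℚ
    2ℚ = 1ℚ + 1ℚ

  -- The rational point (t² - 1 , 2t) / (t² + 1) of the unit circle.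
  module Point (n : ℕ) where
    -- Starting at 2 gives x ≥ 1/2 and 1 - x ≤ y; as n grows, y ≤ 2/t tends to zero.
    T : ℕ
    T = suc (suc n)

    t d : ℚ
    t = ℤ→ℚ (+ T)
    d = ℤ→ℚ (+ suc (T ℕ.* T))

    private
      instance
        d-pos : ℚ.Positive d
        d-pos = ℚ.positive (ℤ→ℚ-pos (T ℕ.* T))
        d≢0 : ℚ.NonZero d
        d≢0 = ℚ.pos⇒nonZero d

    u x y : ℚ
    u = ℚ.1/ d
    x = 1ℚ - 2ℚ * u
    y = 2ℚ * (t * u)

    private
      ud : u * d ≡ 1ℚ
      ud = ℚ.*-inverseˡ d

      d≡ : d ≡ 1ℚ + t * t
      d≡ = trans (ℤ→ℚ-+ (+ 1) (+ (T ℕ.* T))) (cong (λ v → 1ℚ + v) (trans (cong ℤ→ℚ (ℤ.pos-* T T)) (ℤ→ℚ-* (+ T) (+ T))))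

      utt : u * (1ℚ + t * t) ≡ 1ℚ
      utt = trans (cong (u *_) (sym d≡)) ud

      0<u : 0ℚ < u
      0<u = ℚ.positive⁻¹ u {{ℚ.1/pos⇒pos d}}

      t≡ : t ≡ 2ℚ + ℤ→ℚ (+ n)
      t≡ = ℤ→ℚ-+ (+ 2) (+ n)

      2≤t : 2ℚ ≤ t
      2≤t = subst₂ _≤_ (ℚ.+-identityʳ 2ℚ) (sym t≡) (ℚ.+-monoʳ-≤ 2ℚ (ℤ→ℚ-nonneg n))

      0≤t : 0ℚ ≤ t
      0≤t = ℤ→ℚ-nonneg T

      0<t : 0ℚ < t
      0<t = ℤ→ℚ-pos (suc n)

      0≤2 : 0ℚ ≤ 2ℚ
      0≤2 = 0≤+ 0≤1 0≤1

    unit : IsUnit (x , y)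
    unit = trans (solve 2 (λ u t → (con (+ 1) :- con (+ 2) :* u) :* (con (+ 1) :- con (+ 2) :* u) :+ (con (+ 2) :* (t :* u)) :* (con (+ 2) :* (t :* u)) :=
                            con (+ 1) :+ con (+ 4) :* u :* (u :* (con (+ 1) :+ t :* t) :- con (+ 1))) refl u t)
           (trans (cong (λ v → 1ℚ + ℚι.ι (+ 4) * u * (v - 1ℚ)) utt) (solve 1 (λ u → con (+ 1) :+ con (+ 4) :* u :* (con (+ 1) :- con (+ 1)) := con (+ 1)) refl u))

    0<y : 0ℚ < y
    0<y = 0<* (ℚ.+-mono-< 0<1 0<1) (0<* 0<t 0<u)

    ½≤x : 1ℚ ≤ x + x
    ½≤x = sub-≤ (subst (0ℚ ≤_)
      (trans (cong (_- ℚι.ι (+ 4) * u) utt) (solve 1 (λ u → con (+ 1) :- con (+ 4) :* u := ((con (+ 1) :- con (+ 2) :* u) :+ (con (+ 1) :- con (+ 2) :* u)) :- con (+ 1)) refl u))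
      (subst (0ℚ ≤_) (solve 2 (λ u t → u :* (con (+ 1) :+ ((t :- con (+ 2)) :* t :+ con (+ 2) :* (t :- con (+ 2)))) := u :* (con (+ 1) :+ t :* t) :- con (+ 4) :* u) refl u t)
        (0≤* (ℚ.<⇒≤ 0<u) (0≤+ 0≤1 (0≤+ (0≤* (≤-sub 2≤t) 0≤t) (0≤* 0≤2 (≤-sub 2≤t)))))))

    1-x≤y : 1ℚ - x ≤ y
    1-x≤y = sub-≤ (subst (0ℚ ≤_) (solve 2 (λ u t → con (+ 2) :* (u :* ((t :- con (+ 2)) :+ con (+ 1))) := con (+ 2) :* (t :* u) :- (con (+ 1) :- (con (+ 1) :- con (+ 2) :* u))) refl u t)
      (0≤* 0≤2 (0≤* (ℚ.<⇒≤ 0<u) (0≤+ (≤-sub 2≤t) 0≤1))))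

    large : 2ℚ < d * y
    large = sub-< (subst (0ℚ <_) (trans (solve 1 (λ t → con (+ 2) :* ((t :- con (+ 2)) :+ con (+ 1)) := con (+ 2) :* t :* con (+ 1) :- con (+ 2)) refl t)
        (trans (cong (λ v → 2ℚ * t * v - 2ℚ) (sym ud)) (solve 3 (λ t u d → con (+ 2) :* t :* (u :* d) :- con (+ 2) := d :* (con (+ 2) :* (t :* u)) :- con (+ 2)) refl t u d)))
      (0<* (ℚ.+-mono-< 0<1 0<1) (ℚ.+-mono-≤-< (≤-sub 2≤t) 0<1)))

    yt≤2 : t * y ≤ 2ℚ
    yt≤2 = sub-≤ (subst (0ℚ ≤_) (trans (solve 1 (λ u → con (+ 2) :* u := con (+ 2) :* con (+ 1) :- con (+ 2) :* con (+ 1) :+ con (+ 2) :* u) refl u)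
        (trans (cong (λ v → 2ℚ * 1ℚ - 2ℚ * v + 2ℚ * u) (sym utt)) (solve 2 (λ u t → con (+ 2) :* con (+ 1) :- con (+ 2) :* (u :* (con (+ 1) :+ t :* t)) :+ con (+ 2) :* u := con (+ 2) :- t :* (con (+ 2) :* (t :* u))) refl u t)))
      (0≤* 0≤2 (ℚ.<⇒≤ 0<u)))

    -- The choice J = 1 + T², which is `d`, works because d y = 2t exceeds 2.
    open Walk x y unit 0<y ½≤x 1-x≤y (suc (T ℕ.* T)) large public

  𝔹-cancel : ∀ m x → (∀ n → 1ℚ ≤ at m n) → CommutativeRing._≈_ 𝔹 (CommutativeRing._*_ 𝔹 m x) (CommutativeRing.0# 𝔹) →
             CommutativeRing._≈_ 𝔹 x (CommutativeRing.0# 𝔹)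
  𝔹-cancel m x 1≤m h = Null-cancel 1≤m (Null-≗ (λ n → shift (at m n) (at x n)) h)
    where
    shift : ∀ m x → m * x - 0ℚ ≡ m * (x - 0ℚ)
    shift = solve 2 (λ m x → m :* x :- con (+ 0) := m :* (x :- con (+ 0))) refl

  ℂ-cancel : ∀ m z → (∀ n → 1ℚ ≤ at m n) → CommutativeRing._≈_ ℂ (CommutativeRing._*_ ℂ (ℂ𝔹.embed m) z) (CommutativeRing.0# ℂ) →
             CommutativeRing._≈_ ℂ z (CommutativeRing.0# ℂ)
  ℂ-cancel m z 1≤m h = 𝔹-cancel m (proj₁ z) 1≤m (ℂ𝔹.re≈ scaled) ℂ𝔹., 𝔹-cancel m (proj₂ z) 1≤m (ℂ𝔹.im≈ scaled)
    where
    module C = CommutativeRing ℂ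
    scaled : (CommutativeRing._*_ 𝔹 m (proj₁ z) , CommutativeRing._*_ 𝔹 m (proj₂ z)) C.≈ C.0#
    scaled = C.trans (C.sym (ℂ𝔹.embed-scale m z)) h

  module _ (R : CommutativeRing 0ℓ 0ℓ) where
    private module R = CommutativeRing R
    open FromℤRing R using () renaming (module Solver to RS)

    -- |1 - ζ|² = 2 - 2 Re ζ
    1-ζ-cancel : ∀ {ζ ζ′} → (ζ R.* ζ′) R.≈ R.1# →
      (∀ z → (((R.1# R.+ R.1#) R.- (ζ R.+ ζ′)) R.* z) R.≈ R.0# → z R.≈ R.0#) → ∀ z → ((R.1# R.- ζ) R.* z) R.≈ R.0# → z R.≈ R.0#
    1-ζ-cancel {ζ} {ζ′} inv cancel z h = cancel z (begin
      ((R.1# R.+ R.1#) R.- (ζ R.+ ζ′)) R.* z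
        ≈⟨ R.*-congʳ (R.+-congʳ (R.+-congˡ (R.sym inv))) ⟩
      ((R.1# R.+ ζ R.* ζ′) R.- (ζ R.+ ζ′)) R.* z
        ≈⟨ RS.solve 3 (λ ζ ζ′ z → ((RS.con (+ 1) RS.:+ ζ RS.:* ζ′) RS.:- (ζ RS.:+ ζ′)) RS.:* z RS.:=
                                 (RS.con (+ 1) RS.:- ζ′) RS.:* ((RS.con (+ 1) RS.:- ζ) RS.:* z)) R.refl ζ ζ′ z ⟩
      (R.1# R.- ζ′) R.* ((R.1# R.- ζ) R.* z)
        ≈⟨ R.*-congˡ h ⟩
      (R.1# R.- ζ′) R.* R.0#
        ≈⟨ R.zeroʳ _ ⟩
      R.0# ∎)
      where open import Relation.Binary.Reasoning.Setoid R.setoid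

  module _ (q : ℕ) (1≤q : 1 ℕ.≤ q) where

    private
      p : ℕ
      p = suc (q ℕ.+ q)

      a b : ℕ → ℚ
      a n = proj₁ (Point.w n q)
      b n = proj₂ (Point.w n q)

      bounded-by-1 : ∀ {s : ℕ → ℚ} → (∀ n → ∣ s n ∣ ≤ 1ℚ) → Bounded s
      bounded-by-1 h = 1 , h

      as bs : BoundedSequence
      as = bseq a (bounded-by-1 λ n → unit-∣re∣ (Point.w n q) (Point.w-unit n q))
      bs = bseq b (bounded-by-1 λ n → unit-∣im∣ (Point.w n q) (Point.w-unit n q))

      module C = CommutativeRing ℂ
      open ℂ𝔹 using (conj; _,_)
      open import Algebra.Properties.Semiring.Exp C.semiring using (_^_)
      open import Algebra.Properties.Semiring.Exp (CommutativeRing.semiring ℚ².ℂ) using () renaming (_^_ to _^ℚ_)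

    ζ : C.Carrier
    ζ = as , bs

    private
      ζζ̄≈1 : (ζ C.* conj ζ) C.≈ C.1#
      ζζ̄≈1 = pointwise {proj₁ (ζ C.* conj ζ)} {proj₁ C.1#}
               (λ n → trans (solve 2 (λ a b → a :* a :- b :* (:- b) := a :* a :+ b :* b) refl (a n) (b n)) (Point.w-unit n q)) ,
             pointwise {proj₂ (ζ C.* conj ζ)} {proj₂ C.1#}
               (λ n → solve 2 (λ a b → a :* (:- b) :+ b :* a := con (+ 0)) refl (a n) (b n))

      at-power : ∀ k n → (at (proj₁ (ζ ^ k)) n , at (proj₂ (ζ ^ k)) n) ≡ (Point.w n q ^ℚ k)
      at-power zero    n = refl
      at-power (suc k) n = cong (Point.w n q ℚ².*ᶜ_) (at-power k n)

      -- The error is at most c y with c = 4 + 8p, and y ≤ 2/t with t > n. Once n ≥ 2cm this bounds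
      -- 2m |s n| by 2.
      near⇒null : (s : ℕ → ℚ) → (∀ n → ∣ s n ∣ ≤ norm ((Point.w n q ^ℚ p) ℚ².+ᶜ (ℚ².-ᶜ (1ℚ , 0ℚ)))) → Null s
      near⇒null s h .small m = m ℕ.* (c ℕ.+ c) , λ n N≤n → double-≤ (begin
        ∣ s n ∣ * M + ∣ s n ∣ * M
          ≤⟨ ℚ.+-mono-≤ (bound n) (bound n) ⟩
        (c′ * Point.y n) * M + (c′ * Point.y n) * M
          ≡⟨ solve 3 (λ c y M → (c :* y) :* M :+ (c :* y) :* M := (M :* (c :+ c)) :* y) refl c′ (Point.y n) M ⟩
        (M * (c′ + c′)) * Point.y n
          ≡⟨ cong (_* Point.y n) (trans (cong ℤ→ℚ (ℤ.pos-* m (c ℕ.+ c))) (trans (ℤ→ℚ-* (+ m) (+ (c ℕ.+ c))) (cong (M *_) (ℤ→ℚ-+ (+ c) (+ c))))) ⟨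
        ℤ→ℚ (+ (m ℕ.* (c ℕ.+ c))) * Point.y n
          ≤⟨ ℚ.*-monoʳ-≤-nonNeg (Point.y n) {{ℚ.nonNegative (ℚ.<⇒≤ (Point.0<y n))}}
               (ℤ→ℚ-mono-≤ {+ (m ℕ.* (c ℕ.+ c))} {+ Point.T n} (ℤ.+≤+ (ℕ.m≤n⇒m≤1+n (ℕ.m≤n⇒m≤1+n N≤n)))) ⟩
        Point.t n * Point.y n
          ≤⟨ Point.yt≤2 n ⟩
        1ℚ + 1ℚ ∎)
        where
        open ℚ.≤-Reasoning
        c : ℕ
        c = 4 ℕ.+ p ℕ.* 8
        c′ M : ℚ
        c′ = ℤ→ℚ (+ c)
        M = ℤ→ℚ (+ m)
        bound : ∀ n → ∣ s n ∣ * M ≤ (c′ * Point.y n) * M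
        bound n = ℚ.*-monoʳ-≤-nonNeg M {{ℚ.nonNegative (ℤ→ℚ-nonneg m)}} (ℚ.≤-trans (h n) (Point.w^p-near-1 n q))

      ζ^p≈1 : (ζ ^ p) C.≈ C.1#
      ζ^p≈1 = near⇒null (λ n → at (proj₁ (ζ ^ p)) n - 1ℚ) (λ n → subst (λ z → ∣ proj₁ z - 1ℚ ∣ ≤ N n) (sym (at-power p n)) (re≤ n)) ,
              near⇒null (λ n → at (proj₂ (ζ ^ p)) n - 0ℚ) (λ n → subst (λ z → ∣ proj₂ z - 0ℚ ∣ ≤ N n) (sym (at-power p n)) (im≤ n))
        where
        N : ℕ → ℚ
        N n = norm ((Point.w n q ^ℚ p) ℚ².+ᶜ (ℚ².-ᶜ (1ℚ , 0ℚ)))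
        re≤ : ∀ n → ∣ proj₁ (Point.w n q ^ℚ p) - 1ℚ ∣ ≤ N n
        re≤ n = subst (_≤ N n) (ℚ.+-identityʳ _) (ℚ.+-monoʳ-≤ ∣ proj₁ (Point.w n q ^ℚ p) - 1ℚ ∣ (ℚ.0≤∣p∣ (proj₂ (Point.w n q ^ℚ p) - 0ℚ)))
        im≤ : ∀ n → ∣ proj₂ (Point.w n q ^ℚ p) - 0ℚ ∣ ≤ N n
        im≤ n = subst (_≤ N n) (ℚ.+-identityˡ _) (ℚ.+-monoˡ-≤ ∣ proj₂ (Point.w n q ^ℚ p) - 0ℚ ∣ (ℚ.0≤∣p∣ (proj₁ (Point.w n q ^ℚ p) - 1ℚ)))

      modulus : C.Carrier
      modulus = (C.1# C.+ C.1#) C.- (ζ C.+ conj ζ)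

      modulus-real : modulus C.≈ ℂ𝔹.embed (proj₁ modulus)
      modulus-real = ℂ𝔹.real⇒embed modulus (pointwise {proj₂ modulus} {CommutativeRing.0# 𝔹}
        (λ n → solve 1 (λ b → (con (+ 0) :+ con (+ 0)) :- (b :+ (:- b)) := con (+ 0)) refl (b n)))

      -- The real part of ζ is nonpositive, so |1 - ζ|² = 2 - 2 Re ζ stays away from zero and can be
      -- cancelled in the ring of sequences.
      1≤modulus : ∀ n → 1ℚ ≤ at (proj₁ modulus) n
      1≤modulus n = bound (a n) (Point.w-re≤0 n q 1≤q)
        where
        bound : ∀ a → a ≤ 0ℚ → 1ℚ ≤ (1ℚ + 1ℚ) - (a + a)
        bound a a≤0 = sub-≤ (subst (0ℚ ≤_) (solve 1 (λ a → (con (+ 1) :+ (con (+ 0) :- a)) :+ (con (+ 0) :- a) := ((con (+ 1) :+ con (+ 1)) :- (a :+ a)) :- con (+ 1)) refl a)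
          (0≤+ (0≤+ 0≤1 (≤-sub a≤0)) (≤-sub a≤0)))

      modulus-cancel : ∀ z → (modulus C.* z) C.≈ C.0# → z C.≈ C.0#
      modulus-cancel z h = ℂ-cancel (proj₁ modulus) z 1≤modulus (C.trans (C.*-congʳ {z} (C.sym modulus-real)) h)

      p-cancel : ∀ z → (FromℤRing.ι ℂ (+ p) C.* z) C.≈ C.0# → z C.≈ C.0#
      p-cancel z h = ℂ-cancel (const (+ p)) z (λ _ → ℤ→ℚ-mono-≤ {+ 1} {+ p} (ℤ.+≤+ (s≤s z≤n)))
        (C.trans (C.*-congʳ {z} (embed-const (+ p))) h)

    module _ (prime : Prime p) where
      open PowerCharacter ℂ

      character : AdditiveCharacter p prime ℂ
      character = record
        { χ        = χ ζ (conj ζ) ζζ̄≈1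
        ; χ-0      = C.refl {C.1#}
        ; χ-+      = χ-+ ζ (conj ζ) ζζ̄≈1
        ; χ-cong   = χ-cong ζ (conj ζ) ζζ̄≈1 p prime ζ^p≈1 (1-ζ-cancel ℂ ζζ̄≈1 modulus-cancel)
        ; χ-sum    = χ-sum ζ (conj ζ) ζζ̄≈1 p prime ζ^p≈1 (1-ζ-cancel ℂ ζζ̄≈1 modulus-cancel)
        ; p-cancel = p-cancel }

      open AdditiveCharacter character using () renaming (χ to χ′)

      private
        conj-1 : conj C.1# C.≈ C.1#
        conj-1 = CommutativeRing.refl 𝔹 {CommutativeRing.1# 𝔹} , pointwise {CommutativeRing.-_ 𝔹 (CommutativeRing.0# 𝔹)} {CommutativeRing.0# 𝔹} (λ _ → refl)

        conj-power : ∀ k → conj (ζ ^ k) C.≈ (conj ζ ^ k)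
        conj-power zero    = conj-1
        conj-power (suc k) = C.trans (ℂ𝔹.conj-* ζ (ζ ^ k)) (C.*-congˡ {conj ζ} (conj-power k))

      conj-χ : ∀ a → conj (χ′ a) C.≈ χ′ (ℤ.- a)
      conj-χ (+ zero)  = conj-1
      conj-χ (+ suc n) = conj-power (suc n)
      conj-χ -[1+ n ]  = C.trans (ℂ𝔹.conj-cong (C.sym (conj-power (suc n)))) (ℂ𝔹.conj-involutive (ζ ^ suc n))

-- Fourier transforms of multilinear phases and their sums over solutions.

module FourierExpansion where

  open import Data.List.Relation.Unary.Unique.Propositional using (Unique)
  open import Data.Product using (_×_)
  open IntegerCoefficients
  open import Defs using (vectors)
  open FiniteSums
  open Residues
  open Characters

  lookup-injective : ∀ {A : Set} {n} {u v : Vec A n} → (∀ i → lookup u i ≡ lookup v i) → u ≡ v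
  lookup-injective {u = []}    {[]}    h = ≡.refl
  lookup-injective {u = x ∷ u} {y ∷ v} h = ≡.cong₂ _∷_ (h zero) (lookup-injective (h ∘ suc))

  column : ∀ {A : Set} {K D} → Fin K → Vec (Vec A K) D → Vec A D
  column i = Vec.map (λ y → lookup y i)

  prodList-unique : ∀ {A : Set} {K} {l : Fin K → List A} → (∀ i → Unique (l i)) → Unique (prodList l)
  prodList-unique {K = zero}  u = [] ∷ []
  prodList-unique {K = suc K} u = Unique.cartesianProductWith⁺ _∷_ Vec.∷-injective (u zero) (prodList-unique (u ∘ suc))

  ∈-prodList⁺ : ∀ {A : Set} {K} {l : Fin K → List A} {v} → (∀ i → lookup v i ∈ l i) → v ∈ prodList l
  ∈-prodList⁺ {K = zero}  {v = []}    h = here ≡.refl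
  ∈-prodList⁺ {K = suc K} {v = x ∷ v} h = ∈-cartesianProductWith⁺ _∷_ (h zero) (∈-prodList⁺ (h ∘ suc))

  ∈-prodList⁻ : ∀ {A : Set} {K} {l : Fin K → List A} {v} → v ∈ prodList l → ∀ i → lookup v i ∈ l i
  ∈-prodList⁻ {K = suc K} {l} v∈ i with ∈-cartesianProductWith⁻ _∷_ (l zero) (prodList (l ∘ suc)) v∈
  ∈-prodList⁻ {K = suc K} {l} v∈ zero    | a , b , a∈ , b∈ , ≡.refl = a∈
  ∈-prodList⁻ {K = suc K} {l} v∈ (suc i) | a , b , a∈ , b∈ , ≡.refl = ∈-prodList⁻ b∈ i

  module Vectors (p : ℕ) (prime : Prime p) where
    open ModP p prime public
    open import Algebra.Properties.Semiring.Sum (CommutativeRing.semiring ℤ-ring) using () renaming (sum to sumℤ) public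
    open import Algebra.Properties.Semiring.Sum R.semiring using (sum-cong-≋; ∑-distrib-+; *-distribˡ-sum)

    F : Set
    F = Fin p

    0F : F
    0F = residue (+ 0)

    dot : ∀ {K} → (Fin K → ℤ) → Vec F K → ℤ
    dot c y = sumℤ λ i → c i ℤ.* toℤ (lookup y i)

    _⊕_ _⊖_ : ∀ {K} → Vec F K → Vec F K → Vec F K
    _⊕_ = zipWith (λ a b → residue (toℤ a ℤ.+ toℤ b))
    _⊖_ = zipWith (λ a b → residue (toℤ a ℤ.- toℤ b))

    lookup-⊕ : ∀ {K} (u v : Vec F K) i → toℤ (lookup (u ⊕ v) i) ≋ toℤ (lookup u i) ℤ.+ toℤ (lookup v i)
    lookup-⊕ u v i = R.trans (R.reflexive (≡.cong toℤ (Vec.lookup-zipWith _ i u v))) (residue-≋ (toℤ (lookup u i) ℤ.+ toℤ (lookup v i)))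

    lookup-⊖ : ∀ {K} (u v : Vec F K) i → toℤ (lookup (u ⊖ v) i) ≋ toℤ (lookup u i) ℤ.- toℤ (lookup v i)
    lookup-⊖ u v i = R.trans (R.reflexive (≡.cong toℤ (Vec.lookup-zipWith _ i u v))) (residue-≋ (toℤ (lookup u i) ℤ.- toℤ (lookup v i)))

    open FromℤRing.Solver ring using (solve; con; _:+_; _:*_; :-_; _:-_; _:=_)

    vec-≋ : ∀ {K} {u v : Vec F K} → (∀ i → toℤ (lookup u i) ≋ toℤ (lookup v i)) → u ≡ v
    vec-≋ h = lookup-injective (λ i → toℤ-injective (h i))

    private
      +--cancel : ∀ a b → (a ℤ.+ b) ℤ.- b ≋ a
      +--cancel = solve 2 (λ a b → (a :+ b) :- b := a) R.refl

      -+-cancel : ∀ a b → (a ℤ.- b) ℤ.+ b ≋ a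
      -+-cancel = solve 2 (λ a b → (a :- b) :+ b := a) R.refl

    ⊕⊖ : ∀ {K} (v u : Vec F K) → (u ⊕ v) ⊖ v ≡ u
    ⊕⊖ v u = vec-≋ λ i → R.trans (lookup-⊖ (u ⊕ v) v i) (R.trans (R.+-congʳ {ℤ.- toℤ (lookup v i)} (lookup-⊕ u v i))
      (+--cancel (toℤ (lookup u i)) (toℤ (lookup v i))))

    ⊖⊕ : ∀ {K} (v u : Vec F K) → (u ⊖ v) ⊕ v ≡ u
    ⊖⊕ v u = vec-≋ λ i → R.trans (lookup-⊕ (u ⊖ v) v i) (R.trans (R.+-congʳ {toℤ (lookup v i)} (lookup-⊖ u v i))
      (-+-cancel (toℤ (lookup u i)) (toℤ (lookup v i))))

    dot-⊕ : ∀ {K} c (u v : Vec F K) → dot c (u ⊕ v) ≋ dot c u ℤ.+ dot c v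
    dot-⊕ {K} c u v = R.trans (sum-cong-≋ {K} (λ i → R.trans (R.*-congˡ {c i} (lookup-⊕ u v i)) (R.distribˡ (c i) (toℤ (lookup u i)) (toℤ (lookup v i)))))
      (∑-distrib-+ (λ i → c i ℤ.* toℤ (lookup u i)) (λ i → c i ℤ.* toℤ (lookup v i)))

    dot-⊖ : ∀ {K} c (u v : Vec F K) → dot c (u ⊖ v) ≋ dot c u ℤ.- dot c v
    dot-⊖ c u v = R.trans (solve 2 (λ a b → a := (a :+ b) :- b) R.refl (dot c (u ⊖ v)) (dot c v))
      (R.+-congʳ (R.trans (R.sym (dot-⊕ c (u ⊖ v) v)) (R.reflexive (≡.cong (dot c) (⊖⊕ v u)))))

    -- Closure under both operations makes translation by a member a permutation of the list, which
    -- is what orthogonality uses. The same record serves for the solutions modulo p and for their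
    -- dual frequency vectors.
    record Subgroup (K : ℕ) : Set where
      field
        list   : List (Vec F K)
        unique : Unique list
        closed-⊕ : ∀ {u v} → u ∈ list → v ∈ list → u ⊕ v ∈ list
        closed-⊖ : ∀ {u v} → u ∈ list → v ∈ list → u ⊖ v ∈ list

    coords : ∀ {K} → Vec F K → Fin K → ℤ
    coords ρ i = toℤ (lookup ρ i)

    Perpendicular : ∀ {K} → (Fin K → ℤ) → List (Vec F K) → Set
    Perpendicular c G = All (λ y → dot c y ≋ + 0) G

    perpendicular? : ∀ {K} (c : Fin K → ℤ) G → Dec (Perpendicular c G)
    perpendicular? c G = All.all? (λ y → ≋0? (dot c y)) G

    -- A variable that carries a kernel has all residues as frequencies; one that carries the
    -- constant term has only the frequency zero.
    frequencies : Bool → List F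
    frequencies true  = allFin p
    frequencies false = 0F ∷ []

    frequencies-unique : ∀ b → Unique (frequencies b)
    frequencies-unique true  = Unique.allFin⁺ p
    frequencies-unique false = [] ∷ []

    frequencies-closed : ∀ b {r s} t → r ∈ frequencies b → s ∈ frequencies b → (r ≡ 0F → s ≡ 0F → t ≡ 0F) → t ∈ frequencies b
    frequencies-closed true  t _ _ _ = ∈-allFin t
    frequencies-closed false t (here r≡) (here s≡) h = here (h r≡ s≡)

    -- The annihilator of `G` among the vectors supported on the mask. For the solutions of `L` this
    -- is the part of the row span modulo p with that support.
    dual-list : ∀ {K} → Subgroup K → (Fin K → Bool) → List (Vec F K)
    dual-list G mask = filter (λ ρ → perpendicular? (coords ρ) (Subgroup.list G)) (prodList (frequencies ∘ mask))

    module _ {K} (G : Subgroup K) (mask : Fin K → Bool) where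
      open Subgroup G using () renaming (list to g)

      private
        P? : Decidable (λ ρ → Perpendicular (coords ρ) g)
        P? ρ = perpendicular? (coords ρ) g

      ∈-dual⁻ : ∀ {ρ} → ρ ∈ dual-list G mask → Perpendicular (coords ρ) g × (∀ i → lookup ρ i ∈ frequencies (mask i))
      ∈-dual⁻ ρ∈ with ∈-filter⁻ P? {xs = prodList (frequencies ∘ mask)} ρ∈
      ... | ρ∈l , perp = perp , ∈-prodList⁻ ρ∈l

      ∈-dual⁺ : ∀ {ρ} → Perpendicular (coords ρ) g → (∀ i → lookup ρ i ∈ frequencies (mask i)) → ρ ∈ dual-list G mask
      ∈-dual⁺ perp h = ∈-filter⁺ P? (∈-prodList⁺ h) perp

      private
        dot-comm : ∀ (ρ y : Vec F K) → dot (coords ρ) y ≋ dot (coords y) ρ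
        dot-comm ρ y = sum-cong-≋ {K} (λ i → R.*-comm (toℤ (lookup ρ i)) (toℤ (lookup y i)))

        combine : ∀ {u v w} → (∀ y → dot (coords y) u ≋ + 0 → dot (coords y) v ≋ + 0 → dot (coords y) w ≋ + 0) →
                  (∀ i → lookup u i ≡ 0F → lookup v i ≡ 0F → lookup w i ≡ 0F) →
                  u ∈ dual-list G mask → v ∈ dual-list G mask → w ∈ dual-list G mask
        combine {u} {v} {w} h h′ u∈ v∈ with ∈-dual⁻ u∈ | ∈-dual⁻ v∈
        ... | up , ul | vp , vl = ∈-dual⁺
          (All.map (λ {y} (a , b) → R.trans (dot-comm w y) (h y (R.trans (R.sym (dot-comm u y)) a) (R.trans (R.sym (dot-comm v y)) b))) (All.zip (up , vp)))
          (λ i → frequencies-closed (mask i) (lookup w i) (ul i) (vl i) (h′ i))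

        zero-sum : ∀ {u v} → u ≡ 0F → v ≡ 0F → residue (toℤ u ℤ.+ toℤ v) ≡ 0F
        zero-sum ≡.refl ≡.refl = toℤ-injective (R.trans (residue-≋ (toℤ 0F ℤ.+ toℤ 0F)) (R.trans (R.+-cong {toℤ 0F} {+ 0} {toℤ 0F} {+ 0} (residue-≋ (+ 0)) (residue-≋ (+ 0))) (R.sym (residue-≋ (+ 0)))))

        zero-diff : ∀ {u v} → u ≡ 0F → v ≡ 0F → residue (toℤ u ℤ.- toℤ v) ≡ 0F
        zero-diff ≡.refl ≡.refl = toℤ-injective (R.trans (residue-≋ (toℤ 0F ℤ.- toℤ 0F)) (R.trans (R.-‿inverseʳ (toℤ 0F)) (R.sym (residue-≋ (+ 0)))))

      dual : Subgroup K
      dual = record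
        { list = dual-list G mask
        ; unique = Unique.filter⁺ P? (prodList-unique (λ i → frequencies-unique (mask i)))
        ; closed-⊕ = λ {u} {v} → combine {u} {v} {u ⊕ v}
            (λ y a b → R.trans (dot-⊕ (coords y) u v) (R.trans (R.+-cong a b) (R.+-identityʳ (+ 0))))
            (λ i a b → ≡.trans (Vec.lookup-zipWith _ i u v) (zero-sum a b))
        ; closed-⊖ = λ {u} {v} → combine {u} {v} {u ⊖ v}
            (λ y a b → R.trans (dot-⊖ (coords y) u v) (R.trans (R.+-cong a (R.-‿cong b)) (R.-‿inverseʳ (+ 0))))
            (λ i a b → ≡.trans (Vec.lookup-zipWith _ i u v) (zero-diff a b)) }

    -- The number N with Σ_{ρ₀,…,ρ_d ∈ W} χ(Σ_i c_i ρ₀ᵢ ⋯ ρ_dᵢ) = N.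
    multilinear-count : ∀ {K} → List (Vec F K) → ℕ → (Fin K → ℤ) → ℕ
    multilinear-count W zero    c = if does (perpendicular? c W) then length W else 0
    multilinear-count W (suc d) c = ListAction.sum (List.map (λ ρ → multilinear-count W d (λ i → c i ℤ.* coords ρ i)) W)

    -- A block of degree d contributes phases c(τ) r₀ ⋯ r_d in d + 1 coordinates.
    Blocks : Set → Set
    Blocks T = List (ℕ × (T → ℤ))

    dimension : ∀ {T} → Blocks T → ℕ
    dimension []             = 0
    dimension ((d , _) ∷ bs) = suc d ℕ.+ dimension bs

    block-count : ∀ {T K} → List (Vec F K) → (Fin K → T) → Blocks T → ℕ
    block-count W τ []             = 1
    block-count W τ ((d , f) ∷ bs) = multilinear-count W d (f ∘ τ) ℕ.* block-count W τ bs

  module Transform (p : ℕ) (prime : Prime p) (C : CommutativeRing 0ℓ 0ℓ) (ψ : AdditiveCharacter p prime C) where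
    open Vectors p prime
    open AdditiveCharacter ψ
    open CommutativeRing C hiding (zero; ring)
    open FromℤRing C
    open Solver using (solve; con; _:+_; _:*_; :-_; _:-_; _:=_)
    open ListSum C hiding (sum)
    open import Algebra.Properties.Semiring.Exp semiring using (_^_)
    open import Relation.Binary.Reasoning.Setoid setoid

    ∑-const : ∀ {A : Set} (xs : List A) x → ∑ xs (λ _ → x) ≈ ι (+ length xs) * x
    ∑-const []       x = sym (zeroˡ x)
    ∑-const (_ ∷ xs) x = trans (+-congˡ (∑-const xs x)) (trans
      (solve 2 (λ x n → x :+ n :* x := (con (+ 1) :+ n) :* x) refl x (ι (+ length xs))) (*-congʳ (sym (ι-+ (+ 1) (+ length xs)))))

    ι-sum : ∀ {A : Set} (xs : List A) (f : A → ℕ) → ∑ xs (λ x → ι (+ f x)) ≈ ι (+ ListAction.sum (List.map f xs))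
    ι-sum []       f = refl
    ι-sum (x ∷ xs) f = trans (+-congˡ (ι-sum xs f)) (sym (ι-+ (+ f x) (+ ListAction.sum (List.map f xs))))

    χ-∏ : ∀ {K} (c : Fin K → ℤ) → χ (sumℤ c) ≈ ∏ (λ i → χ (c i))
    χ-∏ {zero}  c = χ-0
    χ-∏ {suc K} c = trans (χ-+ (c zero) _) (*-congˡ (χ-∏ (c ∘ suc)))

    module _ {K} (G : Subgroup K) (c : Fin K → ℤ) where
      open Subgroup G

      private
        S : Carrier
        S = ∑ list (λ y → χ (dot c y))

        shift : ∀ {y₀} → y₀ ∈ list → χ (dot c y₀) * S ≈ S
        shift {y₀} y₀∈ = begin
          χ (dot c y₀) * S
            ≈⟨ ∑-*ˡ list (χ (dot c y₀)) _ ⟩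
          ∑ list (λ y → χ (dot c y₀) * χ (dot c y))
            ≈⟨ ∑-cong list (λ y → trans (*-comm _ _) (trans (sym (χ-+ (dot c y) (dot c y₀))) (sym (χ-cong (dot-⊕ c y y₀))))) ⟩
          ∑ list (λ y → χ (dot c (y ⊕ y₀)))
            ≈⟨ ∑-reindex (Vec.≡-dec Fin._≟_) (_⊕ y₀) (_⊖ y₀) unique (λ y∈ → closed-⊕ y∈ y₀∈) (λ y∈ → closed-⊖ y∈ y₀∈) (⊕⊖ y₀) (⊖⊕ y₀) (λ y → χ (dot c y)) ⟨
          S ∎

        shift-multiple : ∀ {y₀} → y₀ ∈ list → ∀ n → χ (+ n ℤ.* dot c y₀) * S ≈ S
        shift-multiple {y₀} y₀∈ zero    = trans (*-congʳ (trans (reflexive (≡.cong χ (ℤ.*-zeroˡ (dot c y₀)))) χ-0)) (*-identityˡ S)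
        shift-multiple {y₀} y₀∈ (suc n) = begin
          χ (+ suc n ℤ.* m) * S
            ≡⟨ ≡.cong (λ z → χ z * S) (≡.trans (ℤ.*-distribʳ-+ m (+ 1) (+ n)) (≡.cong (ℤ._+ + n ℤ.* m) (ℤ.*-identityˡ m))) ⟩
          χ (m ℤ.+ + n ℤ.* m) * S
            ≈⟨ *-congʳ (χ-+ m (+ n ℤ.* m)) ⟩
          (χ m * χ (+ n ℤ.* m)) * S
            ≈⟨ trans (*-assoc _ _ _) (*-congˡ (shift-multiple y₀∈ n)) ⟩
          χ m * S
            ≈⟨ shift y₀∈ ⟩
          S ∎
          where m = dot c y₀

      -- If the phase is nontrivial at some y₀ in the list, invariance under translation by all
      -- multiples of y₀ gives p S = S · Σ_a χ(a m) with m = dot c y₀ nonzero modulo p, and that sum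
      -- vanishes.
      subgroup-sum : ∑ list (λ y → χ (dot c y)) ≈ ⟦ does (perpendicular? c list) ⟧ * ι (+ length list)
      subgroup-sum with perpendicular? c list
      ... | yes perp = begin
        S                          ≈⟨ ∑-cong-∈ list (λ y y∈ → trans (χ-cong (All.lookup perp y∈)) χ-0) ⟩
        ∑ list (λ _ → 1#)          ≈⟨ ∑-const list 1# ⟩
        ι (+ length list) * 1#     ≈⟨ *-comm _ _ ⟩
        1# * ι (+ length list)     ∎
      ... | no ¬perp with Membership.find (¬All⇒Any¬ (λ y → ≋0? (dot c y)) list ¬perp)
      ...   | y₀ , y₀∈ , m≉0 = trans (p-cancel S (begin
        ι (+ p) * S
          ≡⟨ ≡.cong (λ n → ι (+ n) * S) (List-length p) ⟨
        ι (+ length (allFin p)) * S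
          ≈⟨ ∑-const (allFin p) S ⟨
        ∑ (allFin p) (λ _ → S)
          ≈⟨ ∑-cong (allFin p) (λ a → shift-multiple y₀∈ (toℕ a)) ⟨
        ∑ (allFin p) (λ a → χ (toℤ a ℤ.* dot c y₀) * S)
          ≈⟨ ∑-*ʳ (allFin p) S _ ⟨
        ∑ (allFin p) (λ a → χ (toℤ a ℤ.* dot c y₀)) * S
          ≈⟨ *-congʳ (χ-sum (dot c y₀) m≉0) ⟩
        0# * S
          ≈⟨ zeroˡ S ⟩
        0# ∎)) (sym (zeroˡ _))
        where
        open import Data.List.Properties using (length-tabulate)
        List-length : ∀ n → length (allFin n) ≡ n
        List-length n = length-tabulate (λ i → i)

    module _ {T : Set} (active : T → Bool) where

      -- `d` is the number of coordinates left in the current block and `c` its coefficient times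
      -- the frequencies already chosen; at zero the phase χ(c) is released and the next block
      -- starts. Expanded, a block of an active label is the Fourier transform of (r₀ , ... , r_d) ↦
      -- χ(f(t) r₀ ⋯ r_d).
      kernel : (t : T) (d : ℕ) → ℤ → (bs : Blocks T) → Vec F (d ℕ.+ dimension bs) → Carrier
      kernel t zero    c []             x        = χ c
      kernel t zero    c ((d , f) ∷ bs) x        = χ c * kernel t (suc d) (f t) bs x
      kernel t (suc d) c bs             (x ∷ xs) =
        ∑ (frequencies (active t)) (λ r → χ (toℤ x ℤ.* toℤ r) * kernel t d (c ℤ.* toℤ r) bs xs)

      module _ {K} (G : Subgroup K) (τ : Fin K → T) where
        open Subgroup G

        private
          W : List (Vec F K)
          W = dual-list G (active ∘ τ)

          s : Carrier
          s = ι (+ length list)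

          -- What is left of the kernels after summation over the solutions: the recursion of
          -- `kernel` with a vector of `W` in place of each scalar frequency.
          E : (d : ℕ) → (Fin K → ℤ) → Blocks T → Carrier
          E zero    c []             = χ (sumℤ c)
          E zero    c ((d , f) ∷ bs) = χ (sumℤ c) * E (suc d) (f ∘ τ) bs
          E (suc d) c bs             = ∑ W (λ ρ → E d (λ i → c i ℤ.* coords ρ i) bs)

          indicator : ∀ ρ → ∑ list (λ y → ∏ (λ i → χ (coords y i ℤ.* coords ρ i))) ≈ ⟦ does (perpendicular? (coords ρ) list) ⟧ * s
          indicator ρ = trans (∑-cong list (λ y → trans (∏-cong (λ i → reflexive (≡.cong χ (ℤ.*-comm (coords y i) (coords ρ i)))))
            (sym (χ-∏ (λ i → coords ρ i ℤ.* coords y i))))) (subgroup-sum G (coords ρ))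

          -- For every coordinate the product over the variables is multiplied out into a sum over
          -- frequency vectors ρ. Summing over the solutions first leaves `s` times the indicator
          -- that ρ annihilates them, so only the vectors of `W` remain.
          block-sum : ∀ d c bs → ∑ (vectors list (d ℕ.+ dimension bs)) (λ X → ∏ (λ i → kernel (τ i) d (c i) bs (column i X))) ≈
                                 s ^ (d ℕ.+ dimension bs) * E d c bs
          block-sum zero c [] = trans (+-identityʳ _) (trans (sym (χ-∏ c)) (sym (*-identityˡ _)))
          block-sum zero c ((d , f) ∷ bs) = begin
            ∑ Xs (λ X → ∏ (λ i → χ (c i) * k X i))
              ≈⟨ ∑-cong Xs (λ X → trans (∏-* (λ i → χ (c i)) (k X)) (*-congʳ (sym (χ-∏ c)))) ⟩
            ∑ Xs (λ X → χ (sumℤ c) * ∏ (k X))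
              ≈⟨ ∑-*ˡ Xs (χ (sumℤ c)) (λ X → ∏ (k X)) ⟨
            χ (sumℤ c) * ∑ Xs (λ X → ∏ (k X))
              ≈⟨ *-congˡ (block-sum (suc d) (f ∘ τ) bs) ⟩
            χ (sumℤ c) * (s ^ suc (d ℕ.+ dimension bs) * E (suc d) (f ∘ τ) bs)
              ≈⟨ solve 3 (λ a b c → a :* (b :* c) := b :* (a :* c)) refl _ _ _ ⟩
            s ^ suc (d ℕ.+ dimension bs) * (χ (sumℤ c) * E (suc d) (f ∘ τ) bs) ∎
            where
            Xs = vectors list (suc d ℕ.+ dimension bs)
            k : Vec (Vec F K) (suc d ℕ.+ dimension bs) → Fin K → Carrier
            k X i = kernel (τ i) (suc d) (f (τ i)) bs (column i X)
          block-sum (suc d) c bs = begin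
            ∑ (vectors list (suc n)) (λ X → ∏ (λ i → kernel (τ i) (suc d) (c i) bs (column i X)))
              ≈⟨ ∑-vectors-suc list n _ ⟩
            ∑ list (λ y → ∑ Xs (λ X → ∏ (λ i → ∑ (frequencies (active (τ i))) (λ r → χ (coords y i ℤ.* toℤ r) * k X i r))))
              ≈⟨ ∑-cong list (λ y → ∑-cong Xs (λ X → trans (∏-∑ (λ i → frequencies (active (τ i))) (λ i r → χ (coords y i ℤ.* toℤ r) * k X i r))
                   (∑-cong ρs (λ ρ → ∏-* (λ i → χ (coords y i ℤ.* coords ρ i)) (λ i → k X i (lookup ρ i)))))) ⟩
            ∑ list (λ y → ∑ Xs (λ X → ∑ ρs (λ ρ → a y ρ * b X ρ)))
              ≈⟨ ∑-cong list (λ y → ∑-swap Xs ρs (λ X ρ → a y ρ * b X ρ)) ⟩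
            ∑ list (λ y → ∑ ρs (λ ρ → ∑ Xs (λ X → a y ρ * b X ρ)))
              ≈⟨ ∑-swap list ρs (λ y ρ → ∑ Xs (λ X → a y ρ * b X ρ)) ⟩
            ∑ ρs (λ ρ → ∑ list (λ y → ∑ Xs (λ X → a y ρ * b X ρ)))
              ≈⟨ ∑-cong ρs (λ ρ → trans (∑-cong list (λ y → sym (∑-*ˡ Xs (a y ρ) (λ X → b X ρ)))) (sym (∑-*ʳ list (∑ Xs (λ X → b X ρ)) (λ y → a y ρ)))) ⟩
            ∑ ρs (λ ρ → ∑ list (λ y → a y ρ) * ∑ Xs (λ X → b X ρ))
              ≈⟨ ∑-cong ρs (λ ρ → *-cong (indicator ρ) (block-sum d (λ i → c i ℤ.* coords ρ i) bs)) ⟩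
            ∑ ρs (λ ρ → (⟦ does (perpendicular? (coords ρ) list) ⟧ * s) * (s ^ n * e ρ))
              ≈⟨ ∑-cong ρs (λ ρ → solve 4 (λ b s t e → (b :* s) :* (t :* e) := (s :* t) :* (b :* e)) refl _ s (s ^ n) (e ρ)) ⟩
            ∑ ρs (λ ρ → s ^ suc n * (⟦ does (perpendicular? (coords ρ) list) ⟧ * e ρ))
              ≈⟨ ∑-*ˡ ρs (s ^ suc n) _ ⟨
            s ^ suc n * ∑ ρs (λ ρ → ⟦ does (perpendicular? (coords ρ) list) ⟧ * e ρ)
              ≈⟨ *-congˡ (∑-filter (λ ρ → perpendicular? (coords ρ) list) ρs e) ⟨
            s ^ suc n * ∑ W e ∎
            where
            n = d ℕ.+ dimension bs
            Xs = vectors list n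
            ρs = prodList (λ i → frequencies (active (τ i)))
            k : Vec (Vec F K) n → Fin K → F → Carrier
            k X i r = kernel (τ i) d (c i ℤ.* toℤ r) bs (column i X)
            a : Vec F K → Vec F K → Carrier
            a y ρ = ∏ (λ i → χ (coords y i ℤ.* coords ρ i))
            b : Vec (Vec F K) n → Vec F K → Carrier
            b X ρ = ∏ (λ i → k X i (lookup ρ i))
            e : Vec F K → Carrier
            e ρ = E d (λ i → c i ℤ.* coords ρ i) bs

          E₀ : Blocks T → Carrier
          E₀ []             = 1#
          E₀ ((d , f) ∷ bs) = E (suc d) (f ∘ τ) bs

          E-zero : ∀ c bs → E zero c bs ≈ χ (sumℤ c) * E₀ bs
          E-zero c []       = sym (*-identityʳ _)
          E-zero c (b ∷ bs) = refl

          -- The innermost of the d + 1 sums is a character sum over the subgroup `W`, so it is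
          -- `length W` or zero. For this reason the complex value is a natural number.
          E-suc : ∀ d c bs → E (suc d) c bs ≈ ι (+ multilinear-count W d c) * E₀ bs
          E-suc zero c bs = begin
            ∑ W (λ ρ → E zero (λ i → c i ℤ.* coords ρ i) bs)
              ≈⟨ ∑-cong W (λ ρ → E-zero (λ i → c i ℤ.* coords ρ i) bs) ⟩
            ∑ W (λ ρ → χ (dot c ρ) * E₀ bs)
              ≈⟨ ∑-*ʳ W (E₀ bs) _ ⟨
            ∑ W (λ ρ → χ (dot c ρ)) * E₀ bs
              ≈⟨ *-congʳ (trans (subgroup-sum (dual G (active ∘ τ)) c) (choose (does (perpendicular? c W)))) ⟩
            ι (+ multilinear-count W 0 c) * E₀ bs ∎
            where
            choose : ∀ b → ⟦ b ⟧ * ι (+ length W) ≈ ι (+ (if b then length W else 0))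
            choose true  = *-identityˡ _
            choose false = zeroˡ _
          E-suc (suc d) c bs = begin
            ∑ W (λ ρ → E (suc d) (λ i → c i ℤ.* coords ρ i) bs)
              ≈⟨ ∑-cong W (λ ρ → E-suc d (λ i → c i ℤ.* coords ρ i) bs) ⟩
            ∑ W (λ ρ → ι (+ multilinear-count W d (λ i → c i ℤ.* coords ρ i)) * E₀ bs)
              ≈⟨ ∑-*ʳ W (E₀ bs) _ ⟨
            ∑ W (λ ρ → ι (+ multilinear-count W d (λ i → c i ℤ.* coords ρ i))) * E₀ bs
              ≈⟨ *-congʳ (ι-sum W (λ ρ → multilinear-count W d (λ i → c i ℤ.* coords ρ i))) ⟩
            ι (+ multilinear-count W (suc d) c) * E₀ bs ∎

          E₀-count : ∀ bs → E₀ bs ≈ ι (+ block-count W τ bs)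
          E₀-count []             = refl
          E₀-count ((d , f) ∷ bs) = begin
            E (suc d) (f ∘ τ) bs
              ≈⟨ E-suc d (f ∘ τ) bs ⟩
            ι (+ multilinear-count W d (f ∘ τ)) * E₀ bs
              ≈⟨ *-congˡ (E₀-count bs) ⟩
            ι (+ multilinear-count W d (f ∘ τ)) * ι (+ block-count W τ bs)
              ≈⟨ ι-* (+ multilinear-count W d (f ∘ τ)) (+ block-count W τ bs) ⟨
            ι (+ multilinear-count W d (f ∘ τ) ℤ.* + block-count W τ bs)
              ≡⟨ ≡.cong ι (ℤ.pos-* (multilinear-count W d (f ∘ τ)) (block-count W τ bs)) ⟨
            ι (+ block-count W τ ((d , f) ∷ bs)) ∎

        kernel-sum : ∀ bs → ∑ (vectors list (dimension bs)) (λ X → ∏ (λ i → kernel (τ i) 0 (+ 0) bs (column i X))) ≈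
                            s ^ dimension bs * ι (+ block-count W τ bs)
        -- The recursion starts with no coordinates left and coefficient 0, so the first phase
        -- released is χ(0) = 1.
        kernel-sum bs = trans (block-sum 0 (λ _ → + 0) bs) (*-congˡ (trans (E-zero (λ _ → + 0) bs)
          (trans (*-congʳ (trans (χ-cong zeros) χ-0)) (trans (*-identityˡ _) (E₀-count bs)))))
          where
          open import Algebra.Properties.Semiring.Sum R.semiring using () renaming (sum-replicate-zero to sumℤ-zero)
          zeros : sumℤ {K} (λ _ → + 0) ≋ + 0
          zeros = sumℤ-zero K

-- Sets of variables and their enumeration.

module Masks where

  open import Data.List using (tabulate)
  open import Relation.Nullary.Decidable using (dec-true)
  open FiniteSums

  private
    variable
      K : ℕ

  count : (Fin K → Bool) → ℕ
  count {zero}  m = 0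
  count {suc K} m = if m zero then suc (count (m ∘ suc)) else count (m ∘ suc)

  enum : (m : Fin K → Bool) → Fin (count m) → Fin K
  enum {suc K} m i with m zero
  enum {suc K} m zero    | true  = zero
  enum {suc K} m (suc i) | true  = suc (enum (m ∘ suc) i)
  enum {suc K} m i       | false = suc (enum (m ∘ suc) i)

  enum-injective : (m : Fin K → Bool) → ∀ {i j} → enum m i ≡ enum m j → i ≡ j
  enum-injective {suc K} m {i}     {j}     h with m zero
  enum-injective {suc K} m {zero}  {zero}  h | true  = ≡.refl
  enum-injective {suc K} m {suc i} {suc j} h | true  = ≡.cong suc (enum-injective (m ∘ suc) (Fin.suc-injective h))
  enum-injective {suc K} m {i}     {j}     h | false = enum-injective (m ∘ suc) (Fin.suc-injective h)

  enum-true : (m : Fin K → Bool) → ∀ i → m (enum m i) ≡ true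
  enum-true {suc K} m i with m zero in eq
  enum-true {suc K} m zero    | true  = eq
  enum-true {suc K} m (suc i) | true  = enum-true (m ∘ suc) i
  enum-true {suc K} m i       | false = enum-true (m ∘ suc) i

  enum-surjective : (m : Fin K → Bool) → ∀ j → m j ≡ true → ∃ λ i → enum m i ≡ j
  enum-surjective {suc K} m j       h with m zero in eq
  enum-surjective {suc K} m zero    h | true  = zero , ≡.refl
  enum-surjective {suc K} m (suc j) h | true  with enum-surjective (m ∘ suc) j h
  ... | i , e = suc i , ≡.cong suc e
  enum-surjective {suc K} m zero    h | false = contradiction (≡.trans (≡.sym eq) h) λ ()
  enum-surjective {suc K} m (suc j) h | false with enum-surjective (m ∘ suc) j h
  ... | i , e = i , ≡.cong suc e

  module _ (R : CommutativeRing 0ℓ 0ℓ) where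
    open CommutativeRing R hiding (zero)
    open ListSum R

    sum-enum : (m : Fin K → Bool) (f : Fin K → Carrier) → (∀ i → m i ≡ false → f i ≈ 0#) → sum f ≈ sum (f ∘ enum m)
    sum-enum {zero}  m f h = refl
    sum-enum {suc K} m f h with m zero in eq
    ... | true  = +-congˡ (sum-enum (m ∘ suc) (f ∘ suc) (λ i → h (suc i)))
    ... | false = trans (+-cong (h zero eq) (sum-enum (m ∘ suc) (f ∘ suc) (λ i → h (suc i)))) (+-identityˡ _)

    ∏-enum : (m : Fin K → Bool) (f : Fin K → Carrier) → (∀ i → m i ≡ false → f i ≈ 1#) → ∏ f ≈ ∏ (f ∘ enum m)
    ∏-enum {zero}  m f h = refl
    ∏-enum {suc K} m f h with m zero in eq
    ... | true  = *-congˡ (∏-enum (m ∘ suc) (f ∘ suc) (λ i → h (suc i)))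
    ... | false = trans (*-cong (h zero eq) (∏-enum (m ∘ suc) (f ∘ suc) (λ i → h (suc i)))) (*-identityˡ _)

  without : Fin K → (Fin K → Bool) → Fin K → Bool
  without i m j with j Fin.≟ i
  ... | yes _ = false
  ... | no  _ = m j

  without-≢ : ∀ {i j} (m : Fin K → Bool) → j ≢ i → without i m j ≡ m j
  without-≢ {i = i} {j} m j≢i with j Fin.≟ i
  ... | yes j≡i = contradiction j≡i j≢i
  ... | no  _   = ≡.refl

  without-≡ : ∀ i (m : Fin K → Bool) → without i m i ≡ false
  without-≡ i m with i Fin.≟ i
  ... | yes _   = ≡.refl
  ... | no  i≢i = contradiction ≡.refl i≢i

  count-cong : {m m′ : Fin K → Bool} → (∀ i → m i ≡ m′ i) → count m ≡ count m′
  count-cong {zero}  h = ≡.refl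
  count-cong {suc K} {m} {m′} h rewrite h zero = ≡.cong (λ c → if m′ zero then suc c else c) (count-cong (h ∘ suc))

  without-suc : ∀ i (m : Fin (suc K) → Bool) j → without (suc i) m (suc j) ≡ without i (m ∘ suc) j
  without-suc i m j with j Fin.≟ i
  ... | yes _ = ≡.refl
  ... | no  _ = ≡.refl

  count-without : ∀ i (m : Fin K → Bool) → m i ≡ true → suc (count (without i m)) ≡ count m
  count-without {suc K} zero m h rewrite h = ≡.cong suc (count-cong {m = without zero m ∘ suc} {m′ = m ∘ suc} (λ j → without-≢ {i = zero} {j = suc j} m λ ()))
  count-without {suc K} (suc i) m h with m zero
  ... | true  = ≡.cong suc (≡.trans (≡.cong suc (count-cong (without-suc i m))) (count-without i (m ∘ suc) h))
  ... | false = ≡.trans (≡.cong suc (count-cong (without-suc i m))) (count-without i (m ∘ suc) h)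

  without-false : ∀ i (m : Fin K → Bool) j → without i m j ≡ false → j ≢ i → m j ≡ false
  without-false i m j h j≢i = ≡.trans (≡.sym (without-≢ m j≢i)) h

  image : ∀ {k} → (Fin k → Fin K) → Fin K → Bool
  image ι j = does (Fin.any? (λ a → ι a Fin.≟ j))

  image-true : ∀ {k} (ι : Fin k → Fin K) a → image ι (ι a) ≡ true
  image-true ι a = dec-true (Fin.any? (λ b → ι b Fin.≟ ι a)) (a , ≡.refl)

  image⁻ : ∀ {k} (ι : Fin k → Fin K) j → image ι j ≡ true → ∃ λ a → ι a ≡ j
  image⁻ ι j h with Fin.any? (λ a → ι a Fin.≟ j)
  ... | yes w = w

  count-image : ∀ {k} (ι : Fin k → Fin K) → (∀ {a b} → ι a ≡ ι b → a ≡ b) → count (image ι) ≡ k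
  count-image {k = k} ι inj = ℕ.≤-antisym (Fin.injective⇒≤ {f = to} to-inj) (Fin.injective⇒≤ {f = from} from-inj)
    where
    to : Fin (count (image ι)) → Fin k
    to i = proj₁ (image⁻ ι (enum (image ι) i) (enum-true (image ι) i))
    to-inj : ∀ {i j} → to i ≡ to j → i ≡ j
    to-inj {i} {j} h = enum-injective (image ι) (≡.trans (≡.sym (proj₂ (image⁻ ι _ (enum-true (image ι) i))))
      (≡.trans (≡.cong ι h) (proj₂ (image⁻ ι _ (enum-true (image ι) j)))))
    from : Fin k → Fin (count (image ι))
    from a = proj₁ (enum-surjective (image ι) (ι a) (image-true ι a))
    from-inj : ∀ {a b} → from a ≡ from b → a ≡ b
    from-inj {a} {b} h = inj (≡.trans (≡.sym (proj₂ (enum-surjective (image ι) (ι a) (image-true ι a))))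
      (≡.trans (≡.cong (enum (image ι)) h) (proj₂ (enum-surjective (image ι) (ι b) (image-true ι b)))))

  -- Compares `supportSize`, a filtered length, with the size of a mask.
  filter-≤-count : ∀ {P : Fin K → Set} (P? : Decidable P) (m : Fin K → Bool) → (∀ i → P i → m i ≡ true) →
                   length (filter P? (allFin K)) ℕ.≤ count m
  filter-≤-count {K} {P} P? m h = go K (λ i → i) m h
    where
    go : ∀ n (f : Fin n → Fin K) (m : Fin n → Bool) → (∀ i → P (f i) → m i ≡ true) → length (filter P? (tabulate f)) ℕ.≤ count m
    go zero    f m h = z≤n
    go (suc n) f m h with P? (f zero) | m zero in eq
    ... | yes p | true  = s≤s (go n (f ∘ suc) (m ∘ suc) (λ i → h (suc i)))
    ... | yes p | false = contradiction (≡.trans (≡.sym eq) (h zero p)) λ ()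
    ... | no  _ | true  = ℕ.m≤n⇒m≤1+n (go n (f ∘ suc) (m ∘ suc) (λ i → h (suc i)))
    ... | no  _ | false = go n (f ∘ suc) (m ∘ suc) (λ i → h (suc i))

-- Rational row spans with integer data.

module RationalSpans where

  open import Data.Integer using (_+_; _*_; -_; _-_)
  open import Data.Product using (_×_)
  open import Relation.Binary.PropositionalEquality using (refl; sym; trans; cong; cong₂)
  open IntegerCoefficients
  open Rationals
  open Residues using (ℤ-ring)
  open Masks
  open import Defs
  open import Algebra.Properties.Semiring.Sum (CommutativeRing.semiring ℤ-ring) using (sum; sum-cong-≋; ∑-distrib-+; *-distribˡ-sum; *-distribʳ-sum; ∑-comm; sum-replicate-zero)

  open FromℤRing.Solver ℤ-ring using (solve; con; _:+_; _:*_; :-_; _:-_; _:=_)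

  _∙_ : ∀ {n} → (Fin n → ℤ) → (Fin n → ℤ) → ℤ
  v ∙ x = sum λ j → v j * x j

  nonzero-* : ∀ {a b} → a ≢ 0ℤ → b ≢ 0ℤ → a * b ≢ 0ℤ
  nonzero-* {a} a≢0 b≢0 h with ℤ.i*j≡0⇒i≡0∨j≡0 a h
  ... | inj₁ e = a≢0 e
  ... | inj₂ e = b≢0 e

  private
    cancel : ∀ {a b} → a ≢ 0ℤ → a * b ≡ 0ℤ → b ≡ 0ℤ
    cancel {a} a≢0 h with ℤ.i*j≡0⇒i≡0∨j≡0 a h
    ... | inj₁ e = contradiction e a≢0
    ... | inj₂ e = e

  ∙-linearˡ : ∀ {n} a b (u v x : Fin n → ℤ) → (λ j → a * u j + b * v j) ∙ x ≡ a * (u ∙ x) + b * (v ∙ x)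
  ∙-linearˡ {n} a b u v x = trans (sum-cong-≋ {n} (λ j → solve 5 (λ a b u v x → (a :* u :+ b :* v) :* x := a :* (u :* x) :+ b :* (v :* x)) refl a b (u j) (v j) (x j)))
    (trans (∑-distrib-+ (λ j → a * (u j * x j)) (λ j → b * (v j * x j))) (sym (cong₂ _+_ (*-distribˡ-sum a (λ j → u j * x j)) (*-distribˡ-sum b (λ j → v j * x j)))))

  ∙-comm : ∀ {n} (u x : Fin n → ℤ) → u ∙ x ≡ x ∙ u
  ∙-comm {n} u x = sum-cong-≋ {n} (λ j → ℤ.*-comm (u j) (x j))

  ∙-linearʳ : ∀ {n} a b (v x y : Fin n → ℤ) → v ∙ (λ j → a * x j + b * y j) ≡ a * (v ∙ x) + b * (v ∙ y)
  ∙-linearʳ a b v x y = trans (∙-comm v _) (trans (∙-linearˡ a b x y v) (cong₂ (λ s t → a * s + b * t) (∙-comm x v) (∙-comm y v)))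

  unit-vector : ∀ {n} → Fin n → Fin n → ℤ
  unit-vector i j = if does (j Fin.≟ i) then + 1 else + 0

  ∙-unit : ∀ {n} (v : Fin n → ℤ) i → v ∙ unit-vector i ≡ v i
  ∙-unit {suc n} v zero    = trans (cong₂ _+_ (ℤ.*-identityʳ (v zero)) (trans (sum-cong-≋ {n} (λ j → ℤ.*-zeroʳ (v (suc j)))) (sum-replicate-zero n))) (ℤ.+-identityʳ (v zero))
  ∙-unit {suc n} v (suc i) = trans (cong₂ _+_ (ℤ.*-zeroʳ (v zero)) (∙-unit (v ∘ suc) i)) (ℤ.+-identityˡ (v (suc i)))

  combination : ∀ {m n} → (Fin m → Fin n → ℤ) → (Fin m → ℤ) → Fin n → ℤ
  combination A c j = sum λ i → c i * A i j

  combination-∙ : ∀ {m n} (A : Fin m → Fin n → ℤ) c x → combination A c ∙ x ≡ sum (λ i → c i * (A i ∙ x))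
  combination-∙ {m} {n} A c x = trans (sum-cong-≋ {n} (λ j → *-distribʳ-sum (x j) (λ i → c i * A i j)))
    (trans (∑-comm (λ j i → c i * A i j * x j)) (sum-cong-≋ {m} (λ i → trans (sum-cong-≋ {n} (λ j → ℤ.*-assoc (c i) (A i j) (x j)))
      (sym (*-distribˡ-sum (c i) (λ j → A i j * x j))))))

  -- Membership in the rational row span with denominators cleared; the explicit `D` matters later,
  -- since the prime has to exceed its absolute value.
  InSpan : ∀ {m n} → (Fin m → Fin n → ℤ) → (Fin n → ℤ) → Set
  InSpan A v = ∃ λ D → D ≢ 0ℤ × ∃ λ c → ∀ j → D * v j ≡ combination A c j

  Separated : ∀ {m n} → (Fin m → Fin n → ℤ) → (Fin n → ℤ) → Set
  Separated A v = ∃ λ x → (∀ i → A i ∙ x ≡ 0ℤ) × v ∙ x ≢ 0ℤ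

  -- Fredholm alternative over ℚ, with denominators cleared.
  span-or-separated : ∀ {m n} (A : Fin m → Fin n → ℤ) v → InSpan A v ⊎ Separated A v
  span-or-separated {zero} A v with Fin.any? (λ j → ¬? (v j ℤ.≟ 0ℤ))
  ... | yes (j , vj≢0) = inj₂ (unit-vector j , (λ ()) , λ h → vj≢0 (trans (sym (∙-unit v j)) h))
  ... | no  all0 = inj₁ (+ 1 , (λ ()) , (λ ()) , λ j → trans (ℤ.*-identityˡ (v j)) (vanish j))
    where
    vanish : ∀ j → v j ≡ 0ℤ
    vanish j with v j ℤ.≟ 0ℤ
    ... | yes z = z
    ... | no nz = contradiction (j , nz) all0
  span-or-separated {suc m} A v with span-or-separated (A ∘ suc) v
  ... | inj₁ (D , D≢0 , c , h) = inj₁ (D , D≢0 , (λ { zero → 0ℤ ; (suc i) → c i }) , λ j → trans (h j) (sym (trans (cong (_+ combination (A ∘ suc) c j) (ℤ.*-zeroˡ (A zero j))) (ℤ.+-identityˡ (combination (A ∘ suc) c j)))))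
  ... | inj₂ (x , Ax , vx) with span-or-separated (A ∘ suc) (A zero)
  ...   | inj₁ (D , D≢0 , c , h) = inj₂ (x , (λ { zero → cancel D≢0 (begin
            D * (A zero ∙ x)                              ≡⟨ solve 1 (λ u → u := u :+ con (+ 0)) refl (D * (A zero ∙ x)) ⟩
            D * (A zero ∙ x) + 0ℤ * (A zero ∙ x)          ≡⟨ ∙-linearˡ D 0ℤ (A zero) (A zero) x ⟨
            (λ j → D * A zero j + 0ℤ * A zero j) ∙ x      ≡⟨ sum-cong-≋ (λ j → cong (_* x j) (trans (ℤ.+-identityʳ (D * A zero j)) (h j))) ⟩
            combination (A ∘ suc) c ∙ x                   ≡⟨ combination-∙ (A ∘ suc) c x ⟩
            sum (λ i → c i * (A (suc i) ∙ x))             ≡⟨ sum-cong-≋ {m} (λ i → trans (cong (c i *_) (Ax i)) (ℤ.*-zeroʳ (c i))) ⟩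
            sum {m} (λ _ → 0ℤ)                            ≡⟨ sum-replicate-zero m ⟩
            0ℤ                                            ∎) ; (suc i) → Ax i }) , vx)
    where open ≡-Reasoning
  -- `x′` detects row zero alone, so the combination of `v` and row zero that is orthogonal to `x′`
  -- is tested against the remaining rows.
  ...   | inj₂ (x′ , Ax′ , αx′) with span-or-separated (A ∘ suc) (λ j → (A zero ∙ x′) * v j + (- (v ∙ x′)) * A zero j)
  ...     | inj₁ (D , D≢0 , c , h) = inj₁ (D * α , nonzero-* D≢0 αx′ , (λ { zero → D * (v ∙ x′) ; (suc i) → c i }) , λ j → begin
              D * α * v j
                ≡⟨ solve 5 (λ D α v w a → D :* α :* v := D :* w :* a :+ D :* (α :* v :+ (:- w) :* a)) refl D α (v j) (v ∙ x′) (A zero j) ⟩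
              D * (v ∙ x′) * A zero j + D * (α * v j + (- (v ∙ x′)) * A zero j)
                ≡⟨ cong (λ s → D * (v ∙ x′) * A zero j + s) (h j) ⟩
              D * (v ∙ x′) * A zero j + combination (A ∘ suc) c j ∎)
    where
    open ≡-Reasoning
    α : ℤ
    α = A zero ∙ x′
  ...     | inj₂ (y , Ay , uy) = inj₂ (z , (λ { zero → orth₀ ; (suc i) → orth i }) , λ h → uy (trans (trans (∙-linearˡ α (- w) v (A zero) y)
              (trans (solve 4 (λ α w s t → α :* s :+ (:- w) :* t := α :* s :+ (:- t) :* w) refl α w (v ∙ y) β) (sym (∙-linearʳ α (- β) v y x′)))) h))
    where
    α β w : ℤ
    α = A zero ∙ x′
    β = A zero ∙ y
    w = v ∙ x′
    z : Fin _ → ℤ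
    z j = α * y j + (- β) * x′ j
    orth₀ : A zero ∙ z ≡ 0ℤ
    orth₀ = trans (∙-linearʳ α (- β) (A zero) y x′) (solve 2 (λ α β → α :* β :+ (:- β) :* α := con (+ 0)) refl α β)
    orth : ∀ i → A (suc i) ∙ z ≡ 0ℤ
    orth i = trans (∙-linearʳ α (- β) (A (suc i)) y x′) (trans (cong₂ (λ s t → α * s + (- β) * t) (Ay i) (Ax′ i))
      (solve 2 (λ α β → α :* con (+ 0) :+ (:- β) :* con (+ 0) := con (+ 0)) refl α β))

  private
    module ℚS = CommutativeRing ℚ-ring
  open import Algebra.Properties.Semiring.Sum ℚS.semiring using () renaming (sum to sum-ℚ; sum-cong-≋ to sum-ℚ-cong)

  ℤ→ℚ-sum : ∀ {n} (f : Fin n → ℤ) → ℤ→ℚ (sum f) ≡ sum-ℚ (λ i → ℤ→ℚ (f i))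
  ℤ→ℚ-sum {zero}  f = refl
  ℤ→ℚ-sum {suc n} f = trans (ℤ→ℚ-+ (f zero) (sum (f ∘ suc))) (cong (λ s → ℤ→ℚ (f zero) ℚ.+ s) (ℤ→ℚ-sum (f ∘ suc)))

  combination-InRowSpan : ∀ {m K} (L : LinearSystem m K) c → InRowSpan L (λ j → ℤ→ℚ (combination L c j))
  combination-InRowSpan {m} L c = (λ i → ℤ→ℚ (c i)) , λ j → trans (ℤ→ℚ-sum (λ i → c i * L i j)) (sum-ℚ-cong {m} (λ i → ℤ→ℚ-* (c i) (L i j)))

  module _ {m K} (L : LinearSystem m K) {s : ℕ} (girth : HasGirth L s) where

    -- A set of fewer than s variables is unconstrained by L.
    free-variable : ∀ (S : Fin K → Bool) i → S i ≡ true → count S ℕ.< s →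
      ∃ λ x → (∀ r → L r ∙ x ≡ 0ℤ) × (∀ j → S j ≡ true → j ≢ i → x j ≡ 0ℤ) × x i ≢ 0ℤ
    -- The columns of `S` other than `i` are erased. If a multiple of the unit vector at `i` were a
    -- combination of the erased rows, the same combination of rows of `L` would be supported on
    -- `S`, against the girth; a separating vector, with zeros put in the erased columns, is the
    -- solution sought.
    free-variable S i Si small with span-or-separated (λ r j → if without i S j then 0ℤ else L r j) (unit-vector i)
    ... | inj₂ (x , Lx , xi) = x′ , Lx′ , x′-zero , x′i
      where
      x′ : Fin K → ℤ
      x′ j = if without i S j then 0ℤ else x j
      move : ∀ b l x → (if b then 0ℤ else l) * x ≡ l * (if b then 0ℤ else x)
      move true  l x = sym (ℤ.*-zeroʳ l)
      move false l x = refl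
      Lx′ : ∀ r → L r ∙ x′ ≡ 0ℤ
      Lx′ r = trans (sum-cong-≋ {K} (λ j → sym (move (without i S j) (L r j) (x j)))) (Lx r)
      x′-zero : ∀ j → S j ≡ true → j ≢ i → x′ j ≡ 0ℤ
      x′-zero j Sj j≢i rewrite without-≢ {i = i} {j} S j≢i | Sj = refl
      x′i : x′ i ≢ 0ℤ
      x′i rewrite without-≡ i S = λ h → xi (trans (∙-comm (unit-vector i) x) (trans (∙-unit x i) h))
    ... | inj₁ (D , D≢0 , c , h) = contradiction small (ℕ.≤⇒≯ (ℕ.≤-trans
        (HasGirth.minimal girth v (combination-InRowSpan L c) (i , λ e → D≢0 (trans (sym wi) (ℤ→ℚ-injective {w i} {0ℤ} e))))
        (filter-≤-count (λ j → ¬? (v j ℚ.≟ 0ℚ)) S supported)))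
      where
      w : Fin K → ℤ
      w = combination L c
      v : Fin K → ℚ
      v j = ℤ→ℚ (w j)
      w-off : ∀ j → without i S j ≡ false → w j ≡ D * unit-vector i j
      w-off j off = trans (sum-cong-≋ {m} (λ r → cong (λ b → c r * (if b then 0ℤ else L r j)) (sym off))) (sym (h j))
      wi : w i ≡ D
      wi = trans (w-off i (without-≡ i S)) (trans (cong (λ b → D * (if b then + 1 else + 0)) (dec-true (i Fin.≟ i) refl)) (ℤ.*-identityʳ D))
        where open import Relation.Nullary.Decidable using (dec-true)
      supported : ∀ j → v j ≢ 0ℚ → S j ≡ true
      supported j vj≢0 with S j in eq
      ... | true  = refl
      ... | false = contradiction (cong ℤ→ℚ (trans (w-off j (trans (without-≢ {i = i} {j} S j≢i) eq))
          (trans (cong (λ b → D * (if b then + 1 else + 0)) (dec-false (j Fin.≟ i) j≢i)) (ℤ.*-zeroʳ D)))) vj≢0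
        where
        open import Relation.Nullary.Decidable using (dec-false)
        j≢i : j ≢ i
        j≢i refl = contradiction (trans (sym Si) eq) λ ()

  module _ {m K m′ k} (L : LinearSystem m K) (L′ : LinearSystem m′ k) (ι : Fin k → Fin K) (sub : IsSubsystem L′ ι L) where

    extend : Fin m′ → Fin K → ℤ
    extend r = combination (λ a → unit-vector (ι a)) (L′ r)

    extend-∙ : ∀ r x → extend r ∙ x ≡ sum (λ a → L′ r a * x (ι a))
    extend-∙ r x = trans (combination-∙ (λ a → unit-vector (ι a)) (L′ r) x)
      (sum-cong-≋ {k} (λ a → cong (L′ r a *_) (trans (∙-comm (unit-vector (ι a)) x) (∙-unit x (ι a)))))

    extend-ι : ∀ r b → extend r (ι b) ≡ L′ r b
    extend-ι r b = trans (sym (∙-unit (extend r) (ι b))) (trans (extend-∙ r (unit-vector (ι b)))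
      (trans (sum-cong-≋ {k} (λ a → cong (L′ r a *_) (same a))) (∙-unit (L′ r) b)))
      where
      same : ∀ a → unit-vector (ι b) (ι a) ≡ unit-vector b a
      same a with ι a Fin.≟ ι b | a Fin.≟ b
      ... | yes _  | yes _  = refl
      ... | yes e  | no a≢b = contradiction (IsSubsystem.distinct sub e) a≢b
      ... | no ≢   | yes e  = contradiction (cong ι e) ≢
      ... | no _   | no _   = refl

    extend-off : ∀ r j → image ι j ≡ false → extend r j ≡ 0ℤ
    extend-off r j off = trans (sum-cong-≋ {k} (λ a → trans (cong (L′ r a *_) (zero-at a)) (ℤ.*-zeroʳ (L′ r a)))) (sum-replicate-zero k)
      where
      zero-at : ∀ a → unit-vector (ι a) j ≡ 0ℤ
      zero-at a with j Fin.≟ ι a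
      ... | no _     = refl
      ... | yes refl = contradiction (trans (sym (image-true ι a)) off) λ ()

    -- `IsSubsystem` speaks of solutions. A vector separating the extended row from the rows of `L`
    -- would solve `L` but violate `L′`, so the row lies in the span.
    extend-InSpan : ∀ r → InSpan L (extend r)
    extend-InSpan r with span-or-separated L (extend r)
    ... | inj₁ span = span
    ... | inj₂ (x , Lx , vx) = contradiction (trans (extend-∙ r x) (ℤ→ℚ-injective {sum (λ a → L′ r a * x (ι a))} {0ℤ} (trans (ℤ→ℚ-sum (λ a → L′ r a * x (ι a)))
        (trans (sum-ℚ-cong {k} (λ a → ℤ→ℚ-* (L′ r a) (x (ι a))))
          (IsSubsystem.implied sub (λ j → ℤ→ℚ (x j)) (λ i → trans (sum-ℚ-cong {K} (λ j → sym (ℤ→ℚ-* (L i j) (x j))))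
            (trans (sym (ℤ→ℚ-sum (λ j → L i j * x j))) (cong ℤ→ℚ (Lx i)))) r))))) vx

  -- Found by search, because its absolute value enters the bound on p. If all minors vanish, either
  -- the first row is zero or a nonzero entry of it yields a dependency of the two rows.
  nonzero-minor : ∀ {k} (L : LinearSystem 2 k) → RowsIndependent L → ∃ λ s → ∃ λ t → L zero s * L (suc zero) t - L zero t * L (suc zero) s ≢ 0ℤ
  nonzero-minor {k} L indep with Fin.any? (λ s → Fin.any? (λ t → ¬? (L zero s * L (suc zero) t - L zero t * L (suc zero) s ℤ.≟ 0ℤ)))
  ... | yes (s , t , nz) = s , t , nz
  ... | no  none with Fin.any? (λ s → ¬? (L zero s ℤ.≟ 0ℤ))
  ...   | no zero-row = contradiction (indep c dependent zero) λ ()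
    where
    c : Fin 2 → ℚ
    c zero    = 1ℚ
    c (suc _) = 0ℚ
    zero-entry : ∀ j → L zero j ≡ 0ℤ
    zero-entry j with L zero j ℤ.≟ 0ℤ
    ... | yes z = z
    ... | no nz = contradiction (j , nz) zero-row
    dependent : ∀ j → rowCombination L c j ≡ 0ℚ
    dependent j = trans (cong (λ z → 1ℚ ℚ.* ℤ→ℚ z ℚ.+ (0ℚ ℚ.* ℤ→ℚ (L (suc zero) j) ℚ.+ 0ℚ)) (zero-entry j))
      (trans (cong (λ q → 1ℚ ℚ.* 0ℚ ℚ.+ (q ℚ.+ 0ℚ)) (ℚ.*-zeroˡ (ℤ→ℚ (L (suc zero) j)))) refl)
  ...   | yes (s , nz) = contradiction (ℤ→ℚ-injective {L zero s} {0ℤ} (indep c dependent (suc zero))) nz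
    where
    c : Fin 2 → ℚ
    c zero    = ℤ→ℚ (- L (suc zero) s)
    c (suc _) = ℤ→ℚ (L zero s)
    minor : ∀ t → L zero s * L (suc zero) t - L zero t * L (suc zero) s ≡ 0ℤ
    minor t with L zero s * L (suc zero) t - L zero t * L (suc zero) s ℤ.≟ 0ℤ
    ... | yes z = z
    ... | no nz = contradiction (s , t , nz) none
    dependent : ∀ j → rowCombination L c j ≡ 0ℚ
    dependent j = trans (cong₂ (λ u v → u ℚ.+ (v ℚ.+ 0ℚ)) (sym (ℤ→ℚ-* (- L (suc zero) s) (L zero j))) (sym (ℤ→ℚ-* (L zero s) (L (suc zero) j))))
      (trans (cong (λ v → ℤ→ℚ (- L (suc zero) s * L zero j) ℚ.+ v) (ℚ.+-identityʳ _))
        (trans (sym (ℤ→ℚ-+ (- L (suc zero) s * L zero j) (L zero s * L (suc zero) j)))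
          (cong ℤ→ℚ (trans (solve 4 (λ a b c d → (:- a) :* b :+ c :* d := c :* d :- b :* a) refl (L (suc zero) s) (L zero j) (L zero s) (L (suc zero) j)) (minor j)))))

-- Dual frequency vectors, maximal counts and tensor relations.

module FrequencyCounts where

  open import Data.List.Properties using (length-tabulate)
  open import Data.List.Relation.Unary.Unique.Propositional using (Unique)
  open import Data.Vec using (tabulate)
  open import Data.Product using (_×_)
  open import Relation.Nullary.Decidable using (dec-true; dec-false)
  open IntegerCoefficients
  open FiniteSums using (length-cartesianProductWith)
  open Residues
  open BinaryForms
  open Masks
  open FourierExpansion

  module Pigeonhole {A : Set} (_≟_ : DecidableEquality A) where
    open Removal _≟_

    unique-⊆-length : ∀ {xs ys : List A} → Unique xs → Unique ys → (∀ {x} → x ∈ xs → x ∈ ys) → length xs ℕ.≤ length ys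
    unique-⊆-length {[]}     _        _  _  = z≤n
    unique-⊆-length {x ∷ xs} {ys} (x∉ ∷ u) uy ⊆ = ℕ.≤-trans
      (s≤s (unique-⊆-length u (remove-unique {x} uy) (λ {z} z∈ → remove-∈ (⊆ (there z∈)) (λ z≡x → All.lookup x∉ z∈ (≡.sym z≡x)))))
      (ℕ.≤-reflexive (length-remove {x} {ys} uy (⊆ (here ≡.refl))))

    unique-⊂-length : ∀ {xs ys : List A} {z} → Unique xs → Unique ys → (∀ {x} → x ∈ xs → x ∈ ys) → z ∈ ys → z ∉ xs → length xs ℕ.< length ys
    unique-⊂-length {xs} {ys} {z} u uy ⊆ z∈ z∉ = ℕ.≤-trans
      (s≤s (unique-⊆-length u (remove-unique {z} uy) (λ x∈ → remove-∈ (⊆ x∈) (λ { ≡.refl → z∉ x∈ }))))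
      (ℕ.≤-reflexive (length-remove {z} {ys} uy z∈))

  unique-map : ∀ {A B : Set} {f : A → B} {xs} → (∀ {x y} → x ∈ xs → y ∈ xs → f x ≡ f y → x ≡ y) → Unique xs → Unique (map f xs)
  unique-map {xs = []}     inj _        = []
  unique-map {f = f} {x ∷ xs} inj (x∉ ∷ u) = All.tabulate fresh ∷ unique-map (λ a b → inj (there a) (there b)) u
    where
    fresh : ∀ {y} → y ∈ map f xs → f x ≢ y
    fresh y∈ fx≡y with ∈-map⁻ f y∈
    ... | z , z∈ , y≡fz = All.lookup x∉ z∈ (inj (here ≡.refl) (there z∈) (≡.trans fx≡y y≡fz))

  sum-≤ : ∀ {A : Set} (xs : List A) (f : A → ℕ) b → (∀ x → f x ℕ.≤ b) → ListAction.sum (map f xs) ℕ.≤ length xs ℕ.* b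
  sum-≤ []       f b h = z≤n
  sum-≤ (x ∷ xs) f b h = ℕ.+-mono-≤ (h x) (sum-≤ xs f b h)

  sum-≡ : ∀ {A : Set} (xs : List A) (f : A → ℕ) b → All (λ x → f x ≡ b) xs → ListAction.sum (map f xs) ≡ length xs ℕ.* b
  sum-≡ []       f b []       = ≡.refl
  sum-≡ (x ∷ xs) f b (e ∷ es) = ≡.cong₂ ℕ._+_ e (sum-≡ xs f b es)

  sum-< : ∀ {A : Set} (xs : List A) (f : A → ℕ) b → (∀ x → f x ℕ.≤ b) → ∀ {x} → x ∈ xs → f x ℕ.< b → ListAction.sum (map f xs) ℕ.< length xs ℕ.* b
  sum-< (x ∷ xs) f b h (here ≡.refl) lt = ℕ.+-mono-<-≤ lt (sum-≤ xs f b h)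
  sum-< (x ∷ xs) f b h (there x∈)    lt = ℕ.+-mono-≤-< (h x) (sum-< xs f b h x∈ lt)

  module Counts (p : ℕ) (prime : Prime p) where
    open Vectors p prime
    open Forms ring isDomain
    open FromℤRing.Solver ring using (solve; con; _:+_; _:*_; :-_; _:-_; _:=_)
    open import Algebra.Properties.Semiring.Sum R.semiring using (sum-cong-≋; *-distribˡ-sum; ∑-distrib-+)

    Vanishes : ∀ {K} → List (Vec F K) → ℕ → (Fin K → ℤ) → Set
    Vanishes W zero    c = Perpendicular c W
    Vanishes W (suc d) c = All (λ ρ → Vanishes W d (λ i → c i ℤ.* coords ρ i)) W

    vanishes? : ∀ {K} (W : List (Vec F K)) d c → Dec (Vanishes W d c)
    vanishes? W zero    c = perpendicular? c W
    vanishes? W (suc d) c = All.all? (λ ρ → vanishes? W d (λ i → c i ℤ.* coords ρ i)) W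

    multilinear-count-≤ : ∀ {K} (W : List (Vec F K)) d c → multilinear-count W d c ℕ.≤ length W ℕ.^ suc d
    multilinear-count-≤ W zero    c with does (perpendicular? c W)
    ... | true  = ℕ.≤-reflexive (≡.sym (ℕ.*-identityʳ _))
    ... | false = z≤n
    multilinear-count-≤ W (suc d) c = sum-≤ W _ _ (λ ρ → multilinear-count-≤ W d (λ i → c i ℤ.* coords ρ i))

    multilinear-count-≡ : ∀ {K} (W : List (Vec F K)) d c → Vanishes W d c → multilinear-count W d c ≡ length W ℕ.^ suc d
    multilinear-count-≡ W zero    c h rewrite dec-true (perpendicular? c W) h = ≡.sym (ℕ.*-identityʳ _)
    multilinear-count-≡ W (suc d) c h = sum-≡ W _ _ (All.map (multilinear-count-≡ W d _) h)

    -- Together with the upper bound: the count is maximal only if the form vanishes identically.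
    -- One slice that falls short is enough, and at the bottom a nontrivial phase sums to zero, less
    -- than the positive length.
    multilinear-count-< : ∀ {K} (W : List (Vec F K)) d c → 1 ℕ.≤ length W → ¬ Vanishes W d c → multilinear-count W d c ℕ.< length W ℕ.^ suc d
    multilinear-count-< W zero    c 1≤ h rewrite dec-false (perpendicular? c W) h = ℕ.≤-trans 1≤ (ℕ.≤-reflexive (≡.sym (ℕ.*-identityʳ _)))
    multilinear-count-< W (suc d) c 1≤ h with find (¬All⇒Any¬ (λ ρ → vanishes? W d (λ i → c i ℤ.* coords ρ i)) W h)
    ... | ρ , ρ∈ , ¬v = sum-< W _ _ (λ ρ → multilinear-count-≤ W d (λ i → c i ℤ.* coords ρ i)) ρ∈ (multilinear-count-< W d _ 1≤ ¬v)

    module _ {T : Set} {K : ℕ} (W : List (Vec F K)) (τ : Fin K → T) where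

      AllVanish : Blocks T → Set
      AllVanish bs = All (λ b → Vanishes W (proj₁ b) (proj₂ b ∘ τ)) bs

      allVanish? : ∀ bs → Dec (AllVanish bs)
      allVanish? bs = All.all? (λ b → vanishes? W (proj₁ b) (proj₂ b ∘ τ)) bs

      block-count-≤ : ∀ bs → block-count W τ bs ℕ.≤ length W ℕ.^ dimension bs
      block-count-≤ []             = ℕ.≤-refl
      block-count-≤ ((d , f) ∷ bs) = ℕ.≤-trans (ℕ.*-mono-≤ (multilinear-count-≤ W d (f ∘ τ)) (block-count-≤ bs))
        (ℕ.≤-reflexive (≡.sym (ℕ.^-distribˡ-+-* (length W) (suc d) (dimension bs))))

      block-count-≡ : ∀ bs → AllVanish bs → block-count W τ bs ≡ length W ℕ.^ dimension bs
      block-count-≡ []             []       = ≡.refl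
      block-count-≡ ((d , f) ∷ bs) (v ∷ vs) = ≡.trans (≡.cong₂ ℕ._*_ (multilinear-count-≡ W d (f ∘ τ) v) (block-count-≡ bs vs))
        (≡.sym (ℕ.^-distribˡ-+-* (length W) (suc d) (dimension bs)))

      block-count-< : ∀ bs → 1 ℕ.≤ length W → ¬ AllVanish bs → block-count W τ bs ℕ.< length W ℕ.^ dimension bs
      block-count-< []             1≤ h = contradiction [] h
      block-count-< ((d , f) ∷ bs) 1≤ h with vanishes? W d (f ∘ τ)
      ... | yes v = ℕ.≤-trans (product-<ʳ (≡.subst (1 ℕ.≤_) (≡.sym eq) (pos (suc d))) (ℕ.≤-reflexive eq) (block-count-< bs 1≤ (λ vs → h (v ∷ vs))))
          (ℕ.≤-reflexive (≡.sym (ℕ.^-distribˡ-+-* (length W) (suc d) (dimension bs))))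
        where
        eq = multilinear-count-≡ W d (f ∘ τ) v
        pos : ∀ n → 1 ℕ.≤ length W ℕ.^ n
        pos n = ℕ.m^n>0 (length W) {{ℕ.>-nonZero 1≤}} n
        product-<ʳ : ∀ {a A b B} → 1 ℕ.≤ a → a ℕ.≤ A → b ℕ.< B → a ℕ.* b ℕ.< A ℕ.* B
        product-<ʳ {a} {A} {b} {B} 1≤a a≤A b<B = ℕ.<-≤-trans (ℕ.*-monoʳ-< a {{ℕ.>-nonZero 1≤a}} b<B) (ℕ.*-monoˡ-≤ B a≤A)
      ... | no ¬v = ℕ.≤-trans (product-<ˡ (multilinear-count-< W d (f ∘ τ) 1≤ ¬v) (block-count-≤ bs) (ℕ.m^n>0 (length W) {{ℕ.>-nonZero 1≤}} (dimension bs)))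
          (ℕ.≤-reflexive (≡.sym (ℕ.^-distribˡ-+-* (length W) (suc d) (dimension bs))))
        where
        product-<ˡ : ∀ {a A b B} → a ℕ.< A → b ℕ.≤ B → 1 ℕ.≤ B → a ℕ.* b ℕ.< A ℕ.* B
        product-<ˡ {a} {A} {b} {B} a<A b≤B 1≤B = ℕ.≤-<-trans (ℕ.*-monoʳ-≤ a b≤B) (ℕ.*-monoˡ-< B {{ℕ.>-nonZero 1≤B}} a<A)

      block-count-++ : ∀ bs bs′ → block-count W τ (bs List.++ bs′) ≡ block-count W τ bs ℕ.* block-count W τ bs′
      block-count-++ []             bs′ = ≡.sym (ℕ.+-identityʳ _)
      block-count-++ ((d , f) ∷ bs) bs′ = ≡.trans (≡.cong (multilinear-count W d (f ∘ τ) ℕ.*_) (block-count-++ bs bs′)) (≡.sym (ℕ.*-assoc (multilinear-count W d (f ∘ τ)) _ _))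

    repeat : ∀ {T} → ℕ → Blocks T → Blocks T
    repeat zero    bs = []
    repeat (suc n) bs = bs List.++ repeat n bs

    block-count-repeat : ∀ {T K} (W : List (Vec F K)) (τ : Fin K → T) n bs → block-count W τ (repeat n bs) ≡ block-count W τ bs ℕ.^ n
    block-count-repeat W τ zero    bs = ≡.refl
    block-count-repeat W τ (suc n) bs = ≡.trans (block-count-++ W τ bs (repeat n bs)) (≡.cong (block-count W τ bs ℕ.*_) (block-count-repeat W τ n bs))

    -- Together they say that `W` is the image of the plane under z ↦ (⟨ℓ_i , z⟩)_i, up to
    -- congruence.
    Contains Spanned : ∀ {K} → List (Vec F K) → (Fin K → Point) → Set
    Contains W ℓ = ∀ z → ∃ λ ρ → ρ ∈ W × (∀ i → coords ρ i ≋ pair (ℓ i) z)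
    Spanned  W ℓ = ∀ {ρ} → ρ ∈ W → ∃ λ z → ∀ i → coords ρ i ≋ pair (ℓ i) z

    form-∷ : ∀ {K} (c : Fin K → ℤ) ℓ z zs (ρ : Vec F K) → (∀ i → coords ρ i ≋ pair (ℓ i) z) →
             form c ℓ (z ∷ zs) ≋ form (λ i → c i ℤ.* coords ρ i) ℓ zs
    form-∷ {K} c ℓ z zs ρ h = sum-cong-≋ {K} λ i → R.trans (R.*-congˡ {c i} (R.*-congʳ {pairs (ℓ i) zs} (R.sym (h i))))
      (R.sym (R.*-assoc (c i) (coords ρ i) (pairs (ℓ i) zs)))

    form-[] : ∀ {K} (c : Fin K → ℤ) ℓ → form c ℓ [] ≋ sumℤ c
    form-[] {K} c ℓ = sum-cong-≋ {K} λ i → R.*-identityʳ (c i)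

    -- Substituting ρ_i = ⟨ℓ_i , z⟩ in one argument after the other turns the multilinear form with
    -- d + 1 arguments into the tensor relation of that degree.
    vanishes⇒relation : ∀ {K} (W : List (Vec F K)) ℓ → Contains W ℓ → ∀ d c → Vanishes W d c → Relation (suc d) c ℓ
    vanishes⇒relation W ℓ contains d c v (z ∷ zs) len with contains z
    vanishes⇒relation W ℓ contains zero    c v (z ∷ []) len | ρ , ρ∈ , h =
      R.trans (form-∷ c ℓ z [] ρ h) (R.trans (form-[] (λ i → c i ℤ.* coords ρ i) ℓ) (All.lookup v ρ∈))
    vanishes⇒relation W ℓ contains (suc d) c v (z ∷ zs) len | ρ , ρ∈ , h =
      R.trans (form-∷ c ℓ z zs ρ h) (vanishes⇒relation W ℓ contains d _ (All.lookup v ρ∈) zs (ℕ.suc-injective len))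

    relation⇒vanishes : ∀ {K} (W : List (Vec F K)) ℓ → Spanned W ℓ → ∀ d c → Relation (suc d) c ℓ → Vanishes W d c
    relation⇒vanishes W ℓ span zero    c rel = All.tabulate λ {ρ} ρ∈ → let z , h = span ρ∈ in
      R.trans (R.sym (form-[] (λ i → c i ℤ.* coords ρ i) ℓ)) (R.trans (R.sym (form-∷ c ℓ z [] ρ h)) (rel (z ∷ []) ≡.refl))
    relation⇒vanishes W ℓ span (suc d) c rel = All.tabulate λ {ρ} ρ∈ → let z , h = span ρ∈ in
      relation⇒vanishes W ℓ span d _ (λ zs len → R.trans (R.sym (form-∷ c ℓ z zs ρ h)) (rel (z ∷ zs) (≡.cong suc len)))

    Girth : ∀ {K} → List (Vec F K) → ℕ → Set
    Girth {K} Sol s = ∀ (m : Fin K → Bool) → count m ℕ.≤ s → ∀ (r : Fin K → ℤ) →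
      Perpendicular r Sol → (∀ j → m j ≡ false → r j ≋ + 0) → ∀ j → r j ≋ + 0

    -- Two annihilating vectors supported on the mask, their entries at `j` packed into the point
    -- ℓ_j; the nonzero minor at `s`, `t` records their independence.
    record Basis {K} (Sol : List (Vec F K)) (m : Fin K → Bool) (ℓ : Fin K → Point) : Set where
      field
        perp₁ : Perpendicular (proj₁ ∘ ℓ) Sol
        perp₂ : Perpendicular (proj₂ ∘ ℓ) Sol
        off   : ∀ j → m j ≡ false → proj₁ (ℓ j) ≋ + 0 × proj₂ (ℓ j) ≋ + 0
        s t   : Fin K
        det≉0 : ¬ det (ℓ s) (ℓ t) ≋ + 0

    perpendicular-combination : ∀ {K} {Sol : List (Vec F K)} (x y : ℤ) {u v : Fin K → ℤ} →
      Perpendicular u Sol → Perpendicular v Sol → Perpendicular (λ i → u i ℤ.* x ℤ.+ v i ℤ.* y) Sol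
    perpendicular-combination {K} x y {u} {v} pu pv = All.map (λ {w} (a , b) → begin
      sumℤ (λ i → (u i ℤ.* x ℤ.+ v i ℤ.* y) ℤ.* coords w i)
        ≈⟨ sum-cong-≋ {K} (λ i → solve 5 (λ u v x y c → (u :* x :+ v :* y) :* c := x :* (u :* c) :+ y :* (v :* c)) R.refl (u i) (v i) x y (coords w i)) ⟩
      sumℤ (λ i → x ℤ.* (u i ℤ.* coords w i) ℤ.+ y ℤ.* (v i ℤ.* coords w i))
        ≈⟨ ∑-distrib-+ (λ i → x ℤ.* (u i ℤ.* coords w i)) (λ i → y ℤ.* (v i ℤ.* coords w i)) ⟩
      sumℤ (λ i → x ℤ.* (u i ℤ.* coords w i)) ℤ.+ sumℤ (λ i → y ℤ.* (v i ℤ.* coords w i))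
        ≈⟨ R.+-cong (*-distribˡ-sum x (λ i → u i ℤ.* coords w i)) (*-distribˡ-sum y (λ i → v i ℤ.* coords w i)) ⟨
      x ℤ.* dot u w ℤ.+ y ℤ.* dot v w
        ≈⟨ R.+-cong (R.*-congˡ {x} a) (R.*-congˡ {y} b) ⟩
      x ℤ.* + 0 ℤ.+ y ℤ.* + 0
        ≈⟨ solve 2 (λ x y → x :* con (+ 0) :+ y :* con (+ 0) := con (+ 0)) R.refl x y ⟩
      + 0 ∎) (All.zip (pu , pv))
      where open import Relation.Binary.Reasoning.Setoid R.setoid

    pair-zero : ∀ {ℓ} z → proj₁ ℓ ≋ + 0 × proj₂ ℓ ≋ + 0 → pair ℓ z ≋ + 0
    pair-zero (x , y) (a , b) = R.trans (R.+-cong (R.*-congʳ {x} a) (R.*-congʳ {y} b))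
      (solve 2 (λ x y → con (+ 0) :* x :+ con (+ 0) :* y := con (+ 0)) R.refl x y)

    module _ {K : ℕ} (G : Subgroup K) (k : ℕ) (girth : Girth (Subgroup.list G) k) where
      open Subgroup G using () renaming (list to Sol)

      module _ (m : Fin K → Bool) (size : count m ≡ suc (suc k)) where

        -- In this module the mask has two elements more than `k`. Two further zeros leave a support
        -- of size `k`, on which the girth admits only zero; so annihilating vectors are determined
        -- by any two coordinates in the mask.
        two-zeros : ∀ (r : Fin K → ℤ) → Perpendicular r Sol → (∀ j → m j ≡ false → r j ≋ + 0) →
                    ∀ {s t} → s ≢ t → m s ≡ true → m t ≡ true → r s ≋ + 0 → r t ≋ + 0 → ∀ j → r j ≋ + 0
        two-zeros r perp off {s} {t} s≢t ms mt rs rt = girth m′ (ℕ.≤-reflexive (ℕ.suc-injective (ℕ.suc-injective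
            (≡.trans (≡.cong suc (count-without t (without s m) (≡.trans (without-≢ {i = s} {j = t} m (s≢t ∘ ≡.sym)) mt))) (≡.trans (count-without s m ms) size))))) r perp off′
          where
          m′ : Fin K → Bool
          m′ = without t (without s m)
          off′ : ∀ j → m′ j ≡ false → r j ≋ + 0
          off′ j h with j Fin.≟ t | j Fin.≟ s
          ... | yes ≡.refl | _ = rt
          ... | _ | yes ≡.refl = rs
          ... | no j≢t | no j≢s = off j (without-false s m j h j≢s)

        module _ (ℓ : Fin K → Point) (basis : Basis Sol m ℓ) where
          open Basis basis

          private
            comb : ℤ × ℤ → Fin K → ℤ
            comb z i = pair (ℓ i) z

            comb-perp : ∀ z → Perpendicular (comb z) Sol
            comb-perp (x , y) = perpendicular-combination x y {proj₁ ∘ ℓ} {proj₂ ∘ ℓ} perp₁ perp₂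

            comb-off : ∀ z j → m j ≡ false → comb z j ≋ + 0
            comb-off z j mj = pair-zero z (off j mj)

            in-mask : ∀ j → ¬ (proj₁ (ℓ j) ≋ + 0 × proj₂ (ℓ j) ≋ + 0) → m j ≡ true
            in-mask j h with m j in eq
            ... | true  = ≡.refl
            ... | false = contradiction (off j eq) h

            det-zeroˡ : ∀ a b → proj₁ a ≋ + 0 × proj₂ a ≋ + 0 → det a b ≋ + 0
            det-zeroˡ (a , b) (c , d) (x , y) = R.trans (R.+-cong (R.*-congʳ {d} x) (R.-‿cong (R.*-congʳ {c} y)))
              (solve 2 (λ c d → con (+ 0) :* d :- con (+ 0) :* c := con (+ 0)) R.refl c d)

            det-zeroʳ : ∀ a b → proj₁ b ≋ + 0 × proj₂ b ≋ + 0 → det a b ≋ + 0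
            det-zeroʳ a b h = R.trans (det-swap a b) (R.trans (R.-‿cong (det-zeroˡ b a h)) (solve 0 (:- con (+ 0) := con (+ 0)) R.refl))

          private
            s∈ : m s ≡ true
            s∈ = in-mask s (λ h → det≉0 (det-zeroˡ (ℓ s) (ℓ t) h))

            t∈ : m t ≡ true
            t∈ = in-mask t (λ h → det≉0 (det-zeroʳ (ℓ s) (ℓ t) h))

            s≢t : s ≢ t
            s≢t s≡t = det≉0 (≡.subst (λ j → det (ℓ s) (ℓ j) ≋ + 0) s≡t (det-self (ℓ s)))

          private
            -- If det (ℓ i) (ℓ j) = 0 then det (ℓ i) is identically zero, hence so is ℓ i.
            det-row : ∀ {i j} → i ≢ j → m i ≡ true → m j ≡ true → det (ℓ i) (ℓ j) ≋ + 0 → ∀ l → det (ℓ i) (ℓ l) ≋ + 0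
            det-row {i} {j} i≢j mi mj h l = R.trans (R.sym (turn l)) (two-zeros (comb w) (comb-perp w) (comb-off w) i≢j mi mj
                (R.trans (turn i) (det-self (ℓ i))) (R.trans (turn j) h) l)
              where
              w : ℤ × ℤ
              w = perp (ℓ i)
              turn : ∀ l → comb w l ≋ det (ℓ i) (ℓ l)
              turn l = pair-perp (ℓ l) (ℓ i)

          -- A vanishing determinant gives a combination of the two basis vectors with zeros at `i`
          -- and `j`, hence zero everywhere. Then ℓ_i is parallel to both ℓ_s and ℓ_t, so it is
          -- zero, and the same argument for the pair `s`, `i` makes ℓ_s parallel to ℓ_t.
          generic : ∀ {i j} → m i ≡ true → m j ≡ true → i ≢ j → ¬ det (ℓ i) (ℓ j) ≋ + 0
          generic {i} {j} mi mj i≢j h = det≉0 (det-row s≢i s∈ mi (det-zeroʳ (ℓ s) (ℓ i) ℓi) t)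
            where
            row : ∀ l → det (ℓ i) (ℓ l) ≋ + 0
            row = det-row i≢j mi mj h
            ℓi : proj₁ (ℓ i) ≋ + 0 × proj₂ (ℓ i) ≋ + 0
            ℓi = cancel det≉0 (R.trans (solve 6 (λ a b a₁ b₁ a₂ b₂ → (a₁ :* b₂ :- b₁ :* a₂) :* a := a₁ :* (a :* b₂ :- b :* a₂) :- a₂ :* (a :* b₁ :- b :* a₁)) R.refl
                    (proj₁ (ℓ i)) (proj₂ (ℓ i)) (proj₁ (ℓ s)) (proj₂ (ℓ s)) (proj₁ (ℓ t)) (proj₂ (ℓ t))) (zero-combination (proj₁ (ℓ s)) (proj₁ (ℓ t)))) ,
                 cancel det≉0 (R.trans (solve 6 (λ a b a₁ b₁ a₂ b₂ → (a₁ :* b₂ :- b₁ :* a₂) :* b := b₁ :* (a :* b₂ :- b :* a₂) :- b₂ :* (a :* b₁ :- b :* a₁)) R.refl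
                    (proj₁ (ℓ i)) (proj₂ (ℓ i)) (proj₁ (ℓ s)) (proj₂ (ℓ s)) (proj₁ (ℓ t)) (proj₂ (ℓ t))) (zero-combination (proj₂ (ℓ s)) (proj₂ (ℓ t))))
              where
              zero-combination : ∀ x y → x ℤ.* det (ℓ i) (ℓ t) ℤ.- y ℤ.* det (ℓ i) (ℓ s) ≋ + 0
              zero-combination x y = R.trans (R.+-cong (R.*-congˡ {x} (row t)) (R.-‿cong (R.*-congˡ {y} (row s))))
                (solve 2 (λ x y → x :* con (+ 0) :- y :* con (+ 0) := con (+ 0)) R.refl x y)
            s≢i : s ≢ i
            s≢i ≡.refl = det≉0 (det-zeroˡ (ℓ s) (ℓ t) ℓi)

          private
            W : List (Vec F K)
            W = dual-list G m

            vector : ℤ × ℤ → Vec F K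
            vector z = tabulate (λ i → residue (comb z i))

            vector-coords : ∀ z i → coords (vector z) i ≋ comb z i
            vector-coords z i = R.trans (R.reflexive (≡.cong toℤ (Vec.lookup∘tabulate (λ i → residue (comb z i)) i))) (residue-≋ (comb z i))

            residue-0 : ∀ {x} → x ≋ + 0 → residue x ≡ 0F
            residue-0 h = toℤ-injective (R.trans (residue-≋ _) (R.trans h (R.sym (residue-≋ (+ 0)))))

            vector-∈ : ∀ z → vector z ∈ W
            vector-∈ z = ∈-dual⁺ G m (All.map (λ {y} h → R.trans (sum-cong-≋ {K} (λ i → R.*-congʳ {coords y i} (vector-coords z i))) h) (comb-perp z)) allowed
              where
              allowed : ∀ i → lookup (vector z) i ∈ frequencies (m i)
              allowed i with m i in eq
              ... | true  = ∈-allFin _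
              ... | false = here (≡.trans (Vec.lookup∘tabulate (λ i → residue (comb z i)) i) (residue-0 (comb-off z i eq)))

          contains : Contains W ℓ
          contains z = vector z , vector-∈ z , vector-coords z

          spanned : Spanned W ℓ
          spanned {ρ} ρ∈ = z , λ i → R.trans (solve 2 (λ a b → a := (a :- b) :+ b) R.refl (coords ρ i) (comb z i))
              (R.trans (R.+-congʳ {comb z i} (two-zeros r r-perp r-off s≢t s∈ t∈ r-s r-t i)) (R.+-identityˡ (comb z i)))
            where
            δ = proj₁ (inverse (det (ℓ s) (ℓ t)) det≉0)
            δ-inv = proj₂ (inverse (det (ℓ s) (ℓ t)) det≉0)
            a₁ = proj₁ (ℓ s)
            b₁ = proj₂ (ℓ s)
            a₂ = proj₁ (ℓ t)
            b₂ = proj₂ (ℓ t)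
            z : ℤ × ℤ
            -- Cramer's rule for the two equations at `s` and `t`; the remainder `r` then vanishes
            -- at both and so everywhere.
            z = + δ ℤ.* (coords ρ s ℤ.* b₂ ℤ.- coords ρ t ℤ.* b₁) , + δ ℤ.* (a₁ ℤ.* coords ρ t ℤ.- a₂ ℤ.* coords ρ s)
            r : Fin K → ℤ
            r i = coords ρ i ℤ.- comb z i
            r-perp : Perpendicular r Sol
            r-perp = All.map (λ {y} h → R.trans (sum-cong-≋ {K} (λ i → R.*-congʳ {coords y i}
                (solve 2 (λ a b → a :- b := a :* con (+ 1) :+ b :* (:- con (+ 1))) R.refl (coords ρ i) (comb z i)))) h)
              (perpendicular-combination (+ 1) (ℤ.- + 1) {coords ρ} {comb z} (proj₁ (∈-dual⁻ G m ρ∈)) (comb-perp z))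
            ρ-off : ∀ j → m j ≡ false → coords ρ j ≋ + 0
            ρ-off j mj with ≡.subst (λ b → lookup ρ j ∈ frequencies b) mj (proj₂ (∈-dual⁻ G m ρ∈) j)
            ... | here e = R.trans (R.reflexive (≡.cong toℤ e)) (residue-≋ (+ 0))
            r-off : ∀ j → m j ≡ false → r j ≋ + 0
            r-off j mj = R.trans (R.+-cong (ρ-off j mj) (R.-‿cong (comb-off z j mj))) (R.-‿inverseʳ (+ 0))
            r-s : r s ≋ + 0
            r-s = R.trans (solve 7 (λ δ a₁ b₁ a₂ b₂ x y → x :- (a₁ :* (δ :* (x :* b₂ :- y :* b₁)) :+ b₁ :* (δ :* (a₁ :* y :- a₂ :* x))) := x :* (con (+ 1) :- δ :* (a₁ :* b₂ :- b₁ :* a₂))) R.refl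
                (+ δ) a₁ b₁ a₂ b₂ (coords ρ s) (coords ρ t))
              (R.trans (R.*-congˡ {coords ρ s} (R.trans (R.+-congˡ {+ 1} (R.-‿cong δ-inv)) (R.-‿inverseʳ (+ 1)))) (R.zeroʳ (coords ρ s)))
            r-t : r t ≋ + 0
            r-t = R.trans (solve 7 (λ δ a₁ b₁ a₂ b₂ x y → y :- (a₂ :* (δ :* (x :* b₂ :- y :* b₁)) :+ b₂ :* (δ :* (a₁ :* y :- a₂ :* x))) := y :* (con (+ 1) :- δ :* (a₁ :* b₂ :- b₁ :* a₂))) R.refl
                (+ δ) a₁ b₁ a₂ b₂ (coords ρ s) (coords ρ t))
              (R.trans (R.*-congˡ {coords ρ t} (R.trans (R.+-congˡ {+ 1} (R.-‿cong δ-inv)) (R.-‿inverseʳ (+ 1)))) (R.zeroʳ (coords ρ t)))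

          p²≤dual : p ℕ.* p ℕ.≤ length W
          p²≤dual = ℕ.≤-trans (ℕ.≤-reflexive (≡.sym (≡.trans (length-map f pairs²) pairs²-length)))
              (Pigeonhole.unique-⊆-length (Vec.≡-dec Fin._≟_) (unique-map (λ _ _ → f-injective) (Unique.cartesianProduct⁺ (Unique.allFin⁺ p) (Unique.allFin⁺ p)))
                (Subgroup.unique (dual G m)) f-∈)
            where
            pairs² : List (F × F)
            pairs² = cartesianProduct (allFin p) (allFin p)
            pairs²-length : length pairs² ≡ p ℕ.* p
            pairs²-length = ≡.trans (length-cartesianProductWith _,_ (allFin p) (allFin p)) (≡.cong₂ ℕ._*_ (length-tabulate {n = p} (λ i → i)) (length-tabulate {n = p} (λ i → i)))
            f : F × F → Vec F K
            f (x , y) = vector (toℤ x , toℤ y)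
            f-∈ : ∀ {v} → v ∈ map f pairs² → v ∈ W
            f-∈ v∈ with ∈-map⁻ f v∈
            ... | (x , y) , _ , ≡.refl = vector-∈ (toℤ x , toℤ y)
            f-injective : ∀ {z z′} → f z ≡ f z′ → z ≡ z′
            f-injective {x , y} {x′ , y′} h = ≡.cong₂ _,_ (toℤ-injective (equal x≋)) (toℤ-injective (equal y≋))
              where
              same : ∀ i → comb (toℤ x , toℤ y) i ℤ.- comb (toℤ x′ , toℤ y′) i ≋ + 0
              same i = R.trans (R.+-congʳ {ℤ.- comb (toℤ x′ , toℤ y′) i} (R.trans (R.sym (vector-coords (toℤ x , toℤ y) i)) (R.trans (R.reflexive (≡.cong (λ v → coords v i) h)) (vector-coords (toℤ x′ , toℤ y′) i))))
                (R.-‿inverseʳ (comb (toℤ x′ , toℤ y′) i))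
              equal : ∀ {a b} → a ℤ.- b ≋ + 0 → a ≋ b
              equal {a} {b} h = R.trans (solve 2 (λ a b → a := (a :- b) :+ b) R.refl a b) (R.trans (R.+-congʳ {b} h) (R.+-identityˡ b))
              zero-combination : ∀ c d → c ℤ.* (comb (toℤ x , toℤ y) s ℤ.- comb (toℤ x′ , toℤ y′) s) ℤ.- d ℤ.* (comb (toℤ x , toℤ y) t ℤ.- comb (toℤ x′ , toℤ y′) t) ≋ + 0
              zero-combination c d = R.trans (R.+-cong (R.*-congˡ {c} (same s)) (R.-‿cong (R.*-congˡ {d} (same t))))
                (solve 2 (λ x y → x :* con (+ 0) :- y :* con (+ 0) := con (+ 0)) R.refl c d)
              x≋ : toℤ x ℤ.- toℤ x′ ≋ + 0
              x≋ = cancel det≉0 (R.trans (solve 8 (λ a₁ b₁ a₂ b₂ x y x′ y′ → (a₁ :* b₂ :- b₁ :* a₂) :* (x :- x′) :=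
                     b₂ :* ((a₁ :* x :+ b₁ :* y) :- (a₁ :* x′ :+ b₁ :* y′)) :- b₁ :* ((a₂ :* x :+ b₂ :* y) :- (a₂ :* x′ :+ b₂ :* y′))) R.refl
                     (proj₁ (ℓ s)) (proj₂ (ℓ s)) (proj₁ (ℓ t)) (proj₂ (ℓ t)) (toℤ x) (toℤ y) (toℤ x′) (toℤ y′)) (zero-combination (proj₂ (ℓ t)) (proj₂ (ℓ s))))
              y≋ : toℤ y ℤ.- toℤ y′ ≋ + 0
              y≋ = cancel det≉0 (R.trans (solve 8 (λ a₁ b₁ a₂ b₂ x y x′ y′ → (a₁ :* b₂ :- b₁ :* a₂) :* (y :- y′) :=
                     (:- a₂) :* ((a₁ :* x :+ b₁ :* y) :- (a₁ :* x′ :+ b₁ :* y′)) :- (:- a₁) :* ((a₂ :* x :+ b₂ :* y) :- (a₂ :* x′ :+ b₂ :* y′))) R.refl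
                     (proj₁ (ℓ s)) (proj₂ (ℓ s)) (proj₁ (ℓ t)) (proj₂ (ℓ t)) (toℤ x) (toℤ y) (toℤ x′) (toℤ y′)) (zero-combination (ℤ.- proj₁ (ℓ t)) (ℤ.- proj₁ (ℓ s))))

-- Labellings of maximal count and the sign of their weight.

module FullLabellings where

  open import Data.List.Properties using (length-tabulate)
  open import Data.List.Relation.Unary.Unique.Propositional using (Unique)
  open import Data.Vec using (tabulate)
  open import Data.Product using (_×_)
  open IntegerCoefficients
  open FiniteSums
  open Residues
  open BinaryForms
  open SignedRelations
  open Masks
  open FourierExpansion
  open FrequencyCounts

  at : ∀ {K k} (m : Fin K → Bool) → count m ≡ k → Fin k → Fin K
  at m ≡.refl = enum m

  at-injective : ∀ {K k} (m : Fin K → Bool) (size : count m ≡ k) {i j} → at m size i ≡ at m size j → i ≡ j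
  at-injective m ≡.refl = enum-injective m

  at-true : ∀ {K k} (m : Fin K → Bool) (size : count m ≡ k) i → m (at m size i) ≡ true
  at-true m ≡.refl = enum-true m

  at-surjective : ∀ {K k} (m : Fin K → Bool) (size : count m ≡ k) j → m j ≡ true → ∃ λ i → at m size i ≡ j
  at-surjective m ≡.refl = enum-surjective m

  module _ (R : CommutativeRing 0ℓ 0ℓ) where
    open CommutativeRing R hiding (zero)
    open ListSum R

    sum-at : ∀ {K k} (m : Fin K → Bool) (size : count m ≡ k) (f : Fin K → Carrier) → (∀ i → m i ≡ false → f i ≈ 0#) → sum f ≈ sum (λ i → f (at m size i))
    sum-at m ≡.refl = sum-enum R m

    ∏-at : ∀ {K k} (m : Fin K → Bool) (size : count m ≡ k) (f : Fin K → Carrier) → (∀ i → m i ≡ false → f i ≈ 1#) → ∏ f ≈ ∏ (λ i → f (at m size i))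
    ∏-at m ≡.refl = ∏-enum R m

    ∏-one : ∀ {K} (f : Fin K → Carrier) → (∀ i → f i ≈ 1#) → ∏ f ≈ 1#
    ∏-one {zero}  f h = refl
    ∏-one {suc K} f h = trans (*-cong (h zero) (∏-one (f ∘ suc) (h ∘ suc))) (*-identityˡ 1#)

    ∏-single : ∀ {K} (f : Fin K → Carrier) i → (∀ j → j ≢ i → f j ≈ 1#) → ∏ f ≈ f i
    ∏-single f zero    h = trans (*-congˡ (∏-one (f ∘ suc) (λ j → h (suc j) λ ()))) (*-identityʳ _)
    ∏-single f (suc i) h = trans (*-cong (h zero λ ()) (∏-single (f ∘ suc) i (λ j j≢i → h (suc j) (j≢i ∘ Fin.suc-injective)))) (*-identityˡ _)

  -- Serves to show that pairwise distinct labels include the one with negative weight.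
  injective⇒hits-zero : ∀ {n} (f : Fin (suc n) → Fin (suc n)) → (∀ {i j} → f i ≡ f j → i ≡ j) → ∃ λ i → f i ≡ zero
  injective⇒hits-zero {n} f inj with Fin.any? (λ i → f i Fin.≟ zero)
  ... | yes hit = hit
  ... | no  none = contradiction (Fin.injective⇒≤ {f = g} g-injective) ℕ.1+n≰n
    where
    avoid : ∀ i → zero ≢ f i
    avoid i e = none (i , ≡.sym e)
    g : Fin (suc n) → Fin n
    g i = Fin.punchOut (avoid i)
    g-injective : ∀ {i j} → g i ≡ g j → i ≡ j
    g-injective {i} {j} e = inj (Fin.punchOut-injective (avoid i) (avoid j) e)

  module Sizes (p : ℕ) (prime : Prime p) {K : ℕ} where
    open Vectors p prime
    open Forms ring isDomain
    open Counts p prime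
    open FromℤRing.Solver ring using (solve; con; _:+_; _:*_; :-_; _:-_; _:=_)
    open import Algebra.Properties.Semiring.Sum R.semiring using (sum-cong-≋; sum-replicate-zero)

    module _ (G : Subgroup K) (k : ℕ) (girth : Girth (Subgroup.list G) k) where
      open Subgroup G using () renaming (list to Sol)

      private
        0̂ : Vec F K
        0̂ = tabulate (λ _ → 0F)

        0̂-coords : ∀ i → coords 0̂ i ≋ + 0
        0̂-coords i = R.trans (R.reflexive (≡.cong toℤ (Vec.lookup∘tabulate (λ _ → 0F) i))) (residue-≋ (+ 0))

        0F-∈ : ∀ b → 0F ∈ frequencies b
        0F-∈ true  = ∈-allFin 0F
        0F-∈ false = here ≡.refl

        off-zero : ∀ {m ρ} → ρ ∈ dual-list G m → ∀ j → m j ≡ false → coords ρ j ≋ + 0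
        off-zero {m} {ρ} ρ∈ j mj with ≡.subst (λ b → lookup ρ j ∈ frequencies b) mj (proj₂ (∈-dual⁻ G m ρ∈) j)
        ... | here e = R.trans (R.reflexive (≡.cong toℤ e)) (residue-≋ (+ 0))

      1≤dual : ∀ m → 1 ℕ.≤ length (dual-list G m)
      1≤dual m = nonempty (∈-dual⁺ G m {0̂} (All.tabulate λ {y} _ → R.trans (sum-cong-≋ {K} (λ i → R.trans (R.*-congʳ {coords y i} (0̂-coords i)) (R.zeroˡ (coords y i)))) (sum-replicate-zero K))
          (λ i → ≡.subst (_∈ frequencies (m i)) (≡.sym (Vec.lookup∘tabulate (λ _ → 0F) i)) (0F-∈ (m i))))
        where
        nonempty : ∀ {A : Set} {x : A} {xs} → x ∈ xs → 1 ℕ.≤ length xs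
        nonempty (here _)  = s≤s z≤n
        nonempty (there _) = s≤s z≤n

      small-dual : ∀ m → count m ℕ.≤ k → length (dual-list G m) ≡ 1
      small-dual m small = ℕ.≤-antisym (Pigeonhole.unique-⊆-length (Vec.≡-dec Fin._≟_) (Subgroup.unique (dual G m)) ([] ∷ []) (λ ρ∈ → here (all-zero ρ∈))) (1≤dual m)
        where
        all-zero : ∀ {ρ} → ρ ∈ dual-list G m → ρ ≡ 0̂
        all-zero {ρ} ρ∈ = vec-≋ (λ i → R.trans (girth m small (coords ρ) (proj₁ (∈-dual⁻ G m ρ∈)) (off-zero {m} ρ∈) i) (R.sym (0̂-coords i)))

      -- On few variables the zero vector is the only frequency; every form vanishes there, and the
      -- count is a power of 1.
      small-count : ∀ {T : Set} (τ : Fin K → T) m → count m ℕ.≤ k → ∀ bs → block-count (dual-list G m) τ bs ≡ 1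
      small-count τ m small bs = ≡.trans (block-count-≡ W τ bs (All.universal (λ b → vanish (proj₁ b) (proj₂ b ∘ τ)) bs))
          (≡.trans (≡.cong (ℕ._^ dimension bs) (small-dual m small)) (ℕ.^-zeroˡ (dimension bs)))
        where
        W : List (Vec F K)
        W = dual-list G m
        vanish : ∀ d c → Vanishes W d c
        vanish zero    c = All.tabulate λ {ρ} ρ∈ → R.trans (sum-cong-≋ {K} (λ i → R.trans (R.*-congˡ {c i}
          (girth m small (coords ρ) (proj₁ (∈-dual⁻ G m ρ∈)) (off-zero {m} ρ∈) i)) (R.zeroʳ (c i)))) (sum-replicate-zero K)
        vanish (suc d) c = All.universal (λ ρ → vanish d (λ i → c i ℤ.* coords ρ i)) W

      module _ (m : Fin K → Bool) (size : count m ≡ suc (suc k)) where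
        private
          s t : Fin K
          s = at m size zero
          t = at m size (suc zero)

          s≢t : s ≢ t
          s≢t e = contradiction (at-injective m size e) λ ()

          1F : F
          1F = residue (+ 1)

          f : Vec F K → F × F
          f ρ = lookup ρ s , lookup ρ t

          W : List (Vec F K)
          W = dual-list G m

          f-injective : ∀ {ρ ρ′} → ρ ∈ W → ρ′ ∈ W → f ρ ≡ f ρ′ → ρ ≡ ρ′
          f-injective {ρ} {ρ′} ρ∈ ρ′∈ h = ≡.trans (≡.sym (⊖⊕ ρ′ ρ)) (≡.trans (≡.cong (_⊕ ρ′) zero-diff) (0̂⊕ ρ′))
            where
            d∈ : (ρ ⊖ ρ′) ∈ W
            d∈ = Subgroup.closed-⊖ (dual G m) ρ∈ ρ′∈
            same : ∀ i → lookup ρ i ≡ lookup ρ′ i → coords (ρ ⊖ ρ′) i ≋ + 0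
            same i e = R.trans (lookup-⊖ ρ ρ′ i) (R.trans (R.reflexive (≡.cong (λ r → toℤ r ℤ.- toℤ (lookup ρ′ i)) e)) (R.-‿inverseʳ (toℤ (lookup ρ′ i))))
            zero-diff : ρ ⊖ ρ′ ≡ 0̂
            zero-diff = vec-≋ (λ i → R.trans (two-zeros G k girth m size (coords (ρ ⊖ ρ′)) (proj₁ (∈-dual⁻ G m d∈)) (off-zero {m} d∈) s≢t (at-true m size zero) (at-true m size (suc zero))
              (same s (≡.cong proj₁ h)) (same t (≡.cong proj₂ h)) i) (R.sym (0̂-coords i)))
            0̂⊕ : ∀ v → 0̂ ⊕ v ≡ v
            0̂⊕ v = vec-≋ (λ i → R.trans (lookup-⊕ 0̂ v i) (R.trans (R.+-congʳ {coords v i} (0̂-coords i)) (R.+-identityˡ (coords v i))))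

          pairs² : List (F × F)
          pairs² = cartesianProduct (allFin p) (allFin p)

          pairs²-length : length pairs² ≡ p ℕ.* p
          pairs²-length = ≡.trans (length-cartesianProductWith _,_ (allFin p) (allFin p)) (≡.cong₂ ℕ._*_ (length-tabulate {n = p} (λ i → i)) (length-tabulate {n = p} (λ i → i)))

          pairs²-unique : Unique pairs²
          pairs²-unique = Unique.cartesianProduct⁺ (Unique.allFin⁺ p) (Unique.allFin⁺ p)

          ∈-pairs² : ∀ z → z ∈ pairs²
          ∈-pairs² (x , y) = ∈-cartesianProduct⁺ (∈-allFin x) (∈-allFin y)

          _≟²_ : (z z′ : F × F) → Dec (z ≡ z′)
          _≟²_ = Product.≡-dec Fin._≟_ Fin._≟_

          image-unique : Unique (map f W)
          image-unique = unique-map f-injective (Subgroup.unique (dual G m))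

          missing⇒< : ∀ z → (∀ {ρ} → ρ ∈ W → f ρ ≢ z) → length W ℕ.< p ℕ.* p
          missing⇒< z missing = ℕ.≤-trans (ℕ.≤-reflexive (≡.cong suc (≡.sym (length-map f W))))
            (ℕ.≤-trans (Pigeonhole.unique-⊂-length _≟²_ image-unique pairs²-unique (λ _ → ∈-pairs² _) (∈-pairs² z) (λ z∈ → let ρ , ρ∈ , e = ∈-map⁻ f z∈ in missing ρ∈ (≡.sym e)))
              (ℕ.≤-reflexive pairs²-length))

        dual≤p² : length (dual-list G m) ℕ.≤ p ℕ.* p
        dual≤p² = ℕ.≤-trans (ℕ.≤-reflexive (≡.sym (length-map f W)))
          (ℕ.≤-trans (Pigeonhole.unique-⊆-length _≟²_ image-unique pairs²-unique (λ _ → ∈-pairs² _)) (ℕ.≤-reflexive pairs²-length))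

        -- Two coordinates determine a dual vector, so they embed the dual into pairs of residues.
        -- If (1 , 0) and (0 , 1) are both attained, their preimages are a basis; otherwise the
        -- image misses a pair.
        dual<p²-or-basis : length (dual-list G m) ℕ.< p ℕ.* p ⊎ ∃ (Basis Sol m)
        dual<p²-or-basis with any? (λ ρ → f ρ ≟² (1F , 0F)) W | any? (λ ρ → f ρ ≟² (0F , 1F)) W
        ... | no none | _ = inj₁ (missing⇒< (1F , 0F) (λ ρ∈ e → none (Any-intro ρ∈ e)))
          where
          Any-intro : ∀ {ρ xs} → ρ ∈ xs → f ρ ≡ (1F , 0F) → Any (λ ρ → f ρ ≡ (1F , 0F)) xs
          Any-intro (here ≡.refl) e = here e
          Any-intro (there ρ∈)    e = there (Any-intro ρ∈ e)
        ... | yes _ | no none = inj₁ (missing⇒< (0F , 1F) (λ ρ∈ e → none (Any-intro ρ∈ e)))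
          where
          Any-intro : ∀ {ρ xs} → ρ ∈ xs → f ρ ≡ (0F , 1F) → Any (λ ρ → f ρ ≡ (0F , 1F)) xs
          Any-intro (here ≡.refl) e = here e
          Any-intro (there ρ∈)    e = there (Any-intro ρ∈ e)
        ... | yes u∃ | yes v∃ with find u∃ | find v∃
        ...   | u , u∈ , fu | v , v∈ , fv = inj₂ ((λ i → coords u i , coords v i) , record
          { perp₁ = proj₁ (∈-dual⁻ G m u∈) ; perp₂ = proj₁ (∈-dual⁻ G m v∈)
          ; off = λ j mj → off-zero {m} u∈ j mj , off-zero {m} v∈ j mj
          ; s = s ; t = t
          ; det≉0 = λ h → IsDomain.1≉0 isDomain (R.trans (R.sym (R.trans
              (R.+-cong (R.*-cong {coords u s} {+ 1} {coords v t} {+ 1} (value (≡.cong proj₁ fu)) (value (≡.cong proj₂ fv)))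
                (R.-‿cong (R.*-cong {coords v s} {+ 0} {coords u t} {+ 0} (value (≡.cong proj₁ fv)) (value (≡.cong proj₂ fu)))))
              (solve 0 (con (+ 1) :* con (+ 1) :- con (+ 0) :* con (+ 0) := con (+ 1)) R.refl))) h) })
          where
          value : ∀ {a z} → a ≡ residue z → toℤ a ≋ z
          value {z = z} ≡.refl = residue-≋ z

    -- Degree d gives d + 1 moment conditions, one fewer than the number of points.
    relation-exists : ∀ d (ℓ : Fin (2 ℕ.+ d) → Point) → ∃ λ (γ : Fin (2 ℕ.+ d) → ℤ) → (∃ λ i → ¬ γ i ≋ + 0) × Relation d γ ℓ
    relation-exists d ℓ with underdetermined zero? (suc d) (λ x i → proj₁ (ℓ i) ^ toℕ x ℤ.* proj₂ (ℓ i) ^ (d ℕ.∸ toℕ x))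
      where open NewtonIdentities.Newton ring using (_^_)
    ... | γ , nz , rows = γ , nz , moments⇒Relation d γ ℓ (λ x y x+y≡d → begin
        sumℤ (λ i → γ i ℤ.* (proj₁ (ℓ i) ^ x ℤ.* proj₂ (ℓ i) ^ y))
          ≈⟨ sum-cong-≋ {2 ℕ.+ d} (λ i → R.trans (R.*-comm (γ i) (proj₁ (ℓ i) ^ x ℤ.* proj₂ (ℓ i) ^ y)) (R.reflexive (≡.cong₂ (λ x y → proj₁ (ℓ i) ^ x ℤ.* proj₂ (ℓ i) ^ y ℤ.* γ i)
               (≡.sym (Fin.toℕ-fromℕ< (x< x y x+y≡d))) (y≡ x y x+y≡d)))) ⟩
        sumℤ (λ i → (proj₁ (ℓ i) ^ toℕ (fromℕ< (x< x y x+y≡d)) ℤ.* proj₂ (ℓ i) ^ (d ℕ.∸ toℕ (fromℕ< (x< x y x+y≡d)))) ℤ.* γ i)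
          ≈⟨ rows (fromℕ< (x< x y x+y≡d)) ⟩
        + 0 ∎)
      where
      open NewtonIdentities.Newton ring using (_^_)
      open import Relation.Binary.Reasoning.Setoid R.setoid
      x< : ∀ x y → x ℕ.+ y ≡ d → x ℕ.< suc d
      x< x y e = s≤s (ℕ.≤-trans (ℕ.m≤m+n x y) (ℕ.≤-reflexive e))
      y≡ : ∀ x y (e : x ℕ.+ y ≡ d) → y ≡ d ℕ.∸ toℕ (fromℕ< (x< x y e))
      y≡ x y e = ≡.sym (≡.trans (≡.cong (d ℕ.∸_) (Fin.toℕ-fromℕ< (x< x y e))) (≡.trans (≡.cong (ℕ._∸ x) (≡.sym e)) (ℕ.m+n∸m≡n x y)))

    module Witness (h : ℕ) (char : ∀ n → suc n ℕ.≤ 4 ℕ.+ (h ℕ.+ h) → ¬ NewtonIdentities.Newton._·_ ring (suc n) (+ 1) ≋ + 0)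
      (G : Subgroup K) (girth : Girth (Subgroup.list G) (2 ℕ.+ (h ℕ.+ h)))
      (m₀ : Fin K → Bool) (size₀ : count m₀ ≡ 4 ℕ.+ (h ℕ.+ h)) (ℓK : Fin K → Point) (basis₀ : Basis (Subgroup.list G) m₀ ℓK) where

      open SignRelation ring isDomain using (sign; relations⇒injective)
      open import Relation.Binary.Reasoning.Setoid R.setoid
      module ΣZ = ListSum ℤ-ring

      k : ℕ
      k = 4 ℕ.+ (h ℕ.+ h)

      -- `nothing` stands for picking the constant E in a factor E + g; the variables with a `just`
      -- label form the support.
      Label : Set
      Label = Maybe (Fin k × Bool)

      private
        e₀ : Fin k → Fin K
        e₀ = at m₀ size₀

        ℓ₀ : Fin k → Point
        ℓ₀ j = ℓK (e₀ j)

        generic₀ : Generic ℓ₀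
        generic₀ i≢j = generic G _ girth m₀ size₀ ℓK basis₀ (at-true m₀ size₀ _) (at-true m₀ size₀ _) (i≢j ∘ at-injective m₀ size₀)

        abstract
          γ-exists : ∃ λ (γ : Fin k → ℤ) → (∃ λ i → ¬ γ i ≋ + 0) × Relation (2 ℕ.+ (h ℕ.+ h)) γ ℓ₀
          γ-exists = relation-exists (2 ℕ.+ (h ℕ.+ h)) ℓ₀

      γ : Fin k → ℤ
      γ = proj₁ γ-exists

      private
        γ-relation : Relation (2 ℕ.+ (h ℕ.+ h)) γ ℓ₀
        γ-relation = proj₂ (proj₂ γ-exists)

        γ≉0 : ∀ i → ¬ γ i ≋ + 0
        γ≉0 = relation-nonzero zero? {c = γ} {ℓ = ℓ₀} generic₀ γ-relation (proj₁ (proj₂ γ-exists))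

        γ-relation-at : ∀ z → Relation (1 ℕ.+ (h ℕ.+ h)) (λ i → γ i ℤ.* pair (ℓ₀ i) z) ℓ₀
        γ-relation-at z zs len = R.trans (sum-cong-≋ {k} (λ i → R.*-assoc (γ i) (pair (ℓ₀ i) z) (pairs (ℓ₀ i) zs))) (γ-relation (z ∷ zs) (≡.cong suc len))

      cP cA cB : Label → ℤ
      cP nothing        = + 0
      cP (just (j , ε)) = sign ε ℤ.* γ j
      cA nothing        = + 0
      cA (just (j , _)) = γ j ℤ.* proj₁ (ℓ₀ j)
      cB nothing        = + 0
      cB (just (j , _)) = γ j ℤ.* proj₂ (ℓ₀ j)

      -- An entry d of a block stands for d + 1 factors, so the degrees are k - 2, k - 3, k - 3. The
      -- first block carries the sign of the label; the other two carry the two coordinates of its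
      -- point.
      triple : Blocks Label
      triple = (1 ℕ.+ (h ℕ.+ h) , cP) ∷ (h ℕ.+ h , cA) ∷ (h ℕ.+ h , cB) ∷ []

      Λ : ℕ
      Λ = (p ℕ.* p) ℕ.^ dimension triple

      -- The negative value is -(k - 1). The two labels of index zero thus balance the 2 (k - 1)
      -- labels of weight 1, and k labels with distinct indices contain exactly one of index zero.
      weight : Label → ℤ
      weight nothing            = + 1
      weight (just (zero , _))  = -[1+ (2 ℕ.+ (h ℕ.+ h)) ]
      weight (just (suc _ , _)) = + 1

      support : (Fin K → Label) → Fin K → Bool
      support τ = is-just ∘ τ

      private
        off-nothing : ∀ (x : Label) → is-just x ≡ false → x ≡ nothing
        off-nothing nothing _ = ≡.refl

        the : ∀ (x : Label) → is-just x ≡ true → Fin k × Bool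
        the (just y) _ = y

        the-≡ : ∀ (x : Label) (e : is-just x ≡ true) → x ≡ just (the x e)
        the-≡ (just y) _ = ≡.refl

      module _ (τ : Fin K → Label) (size : count (support τ) ≡ k) where
        private
          W : List (Vec F K)
          W = dual-list G (support τ)

          e : Fin k → Fin K
          e = at (support τ) size

          label : Fin k → Fin k × Bool
          label i = the (τ (e i)) (at-true (support τ) size i)

          τ-e : ∀ i → τ (e i) ≡ just (label i)
          τ-e i = the-≡ (τ (e i)) (at-true (support τ) size i)

          restrict : ∀ (c : Label → ℤ) → c nothing ≡ + 0 → ∀ d ℓ → Relation d (c ∘ τ) ℓ → Relation d (λ i → c (just (label i))) (ℓ ∘ e)
          restrict c c0 d ℓ rel zs len = R.trans (sum-cong-≋ {k} (λ i → R.reflexive (≡.cong (λ x → c x ℤ.* pairs (ℓ (e i)) zs) (≡.sym (τ-e i)))))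
            (R.trans (R.sym (sum-at ring (support τ) size (λ i → c (τ i) ℤ.* pairs (ℓ i) zs)
              (λ i off → R.trans (R.reflexive (≡.cong (λ x → x ℤ.* pairs (ℓ i) zs) (≡.trans (≡.cong c (off-nothing (τ i) off)) c0))) (R.zeroˡ (pairs (ℓ i) zs))))) (rel zs len))

        count-≤ : block-count W τ triple ℕ.≤ Λ
        count-≤ = ℕ.≤-trans (block-count-≤ W τ triple) (ℕ.^-monoˡ-≤ (dimension triple) (dual≤p² G _ girth (support τ) size))

        -- The maximum needs p² dual vectors and the vanishing of all three forms. A dual of size p²
        -- has a basis, the forms become relations at its points, and these make the indices of the
        -- labels pairwise distinct; the weight of index zero then occurs once and all others are 1.
        full⇒negative : block-count W τ triple ≡ Λ → ΣZ.∏ (weight ∘ τ) ≡ -[1+ (2 ℕ.+ (h ℕ.+ h)) ]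
        full⇒negative full with dual<p²-or-basis G _ girth (support τ) size
        ... | inj₁ W<p² = contradiction (ℕ.≤-<-trans (block-count-≤ W τ triple) (ℕ.^-monoˡ-< (dimension triple) W<p²)) (ℕ.<-irrefl full)
        ... | inj₂ (ℓ , basis) with allVanish? W τ triple
        ...   | no ¬v = contradiction (ℕ.<-≤-trans (block-count-< W τ triple (1≤dual G _ girth (support τ)) ¬v)
                  (ℕ.^-monoˡ-≤ (dimension triple) (dual≤p² G _ girth (support τ) size))) (ℕ.<-irrefl full)
        ...   | yes (vP ∷ vA ∷ vB ∷ []) = ≡.trans (∏-at ℤ-ring (support τ) size (weight ∘ τ) (λ i off → ≡.cong weight (off-nothing (τ i) off)))
                  (≡.trans (ΣZ.∏-cong {k} (λ i → ≡.cong weight (τ-e i)))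
                  (≡.trans (∏-single ℤ-ring (λ i → weight (just (label i))) i₀ others) at-zero))
          where
          contains′ : Contains W ℓ
          contains′ = contains G _ girth (support τ) size ℓ basis
          j-injective : ∀ {i l} → proj₁ (label i) ≡ proj₁ (label l) → i ≡ l
          j-injective = relations⇒injective {h} char {γ} {ℓ₀} {ℓ ∘ e} γ≉0 generic₀
            (λ i≢l → generic G _ girth (support τ) size ℓ basis (at-true (support τ) size _) (at-true (support τ) size _) (i≢l ∘ at-injective (support τ) size))
            (proj₁ ∘ label) (proj₂ ∘ label)
            (restrict cP ≡.refl _ ℓ (vanishes⇒relation W ℓ contains′ (1 ℕ.+ (h ℕ.+ h)) (cP ∘ τ) vP))
            (restrict cA ≡.refl _ ℓ (vanishes⇒relation W ℓ contains′ (h ℕ.+ h) (cA ∘ τ) vA))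
            (restrict cB ≡.refl _ ℓ (vanishes⇒relation W ℓ contains′ (h ℕ.+ h) (cB ∘ τ) vB))
          hit : ∃ λ i → proj₁ (label i) ≡ zero
          hit = injective⇒hits-zero (proj₁ ∘ label) j-injective
          i₀ : Fin k
          i₀ = proj₁ hit
          weight-zero : ∀ (y : Fin k × Bool) → proj₁ y ≡ zero → weight (just y) ≡ -[1+ (2 ℕ.+ (h ℕ.+ h)) ]
          weight-zero (zero , _) _ = ≡.refl
          weight-suc : ∀ (y : Fin k × Bool) → proj₁ y ≢ zero → weight (just y) ≡ + 1
          weight-suc (zero , _)  h = contradiction ≡.refl h
          weight-suc (suc _ , _) h = ≡.refl
          at-zero : weight (just (label i₀)) ≡ -[1+ (2 ℕ.+ (h ℕ.+ h)) ]
          at-zero = weight-zero (label i₀) (proj₂ hit)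
          others : ∀ i → i ≢ i₀ → weight (just (label i)) ≡ + 1
          others i i≢i₀ = weight-suc (label i) (λ z → i≢i₀ (j-injective (≡.trans z (≡.sym (proj₂ hit)))))

      private
        choose : ∀ b j → m₀ j ≡ b → Label
        choose true  j eq = just (proj₁ (at-surjective m₀ size₀ j eq) , true)
        choose false j eq = nothing

      -- Gives the i-th variable of the subsystem its own label (i , +), so that at least one
      -- labelling attains the maximum.
      τ₀-vec : Vec Label K
      τ₀-vec = tabulate (λ j → choose (m₀ j) j ≡.refl)

      τ₀ : Fin K → Label
      τ₀ = lookup τ₀-vec

      private
        choose-true : ∀ b j (eq : m₀ j ≡ b) → b ≡ true → ∀ i → e₀ i ≡ j → choose b j eq ≡ just (i , true)
        choose-true true j eq _ i e = ≡.cong (λ i → just (i , true)) (at-injective m₀ size₀ (≡.trans (proj₂ (at-surjective m₀ size₀ j eq)) (≡.sym e)))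

        τ₀-e : ∀ i → τ₀ (e₀ i) ≡ just (i , true)
        τ₀-e i = ≡.trans (Vec.lookup∘tabulate (λ j → choose (m₀ j) j ≡.refl) (e₀ i)) (choose-true (m₀ (e₀ i)) (e₀ i) ≡.refl (at-true m₀ size₀ i) i ≡.refl)

        choose-support : ∀ b j (eq : m₀ j ≡ b) → is-just (choose b j eq) ≡ b
        choose-support true  j eq = ≡.refl
        choose-support false j eq = ≡.refl

      support-τ₀ : ∀ j → support τ₀ j ≡ m₀ j
      support-τ₀ j = ≡.trans (≡.cong is-just (Vec.lookup∘tabulate (λ j → choose (m₀ j) j ≡.refl) j)) (choose-support (m₀ j) j ≡.refl)

      private
        W₀ : List (Vec F K)
        W₀ = dual-list G (support τ₀)

        size′ : count (support τ₀) ≡ k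
        size′ = ≡.trans (count-cong support-τ₀) size₀

        basis′ : Basis (Subgroup.list G) (support τ₀) ℓK
        basis′ = record { perp₁ = Basis.perp₁ basis₀ ; perp₂ = Basis.perp₂ basis₀ ; off = λ j sj → Basis.off basis₀ j (≡.trans (≡.sym (support-τ₀ j)) sj)
                        ; s = Basis.s basis₀ ; t = Basis.t basis₀ ; det≉0 = Basis.det≉0 basis₀ }

        lift : ∀ (c : Label → ℤ) → c nothing ≡ + 0 → ∀ d (c₀ : Fin k → ℤ) → (∀ i → c (just (i , true)) ≋ c₀ i) → Relation d c₀ ℓ₀ → Relation d (c ∘ τ₀) ℓK
        lift c c0 d c₀ same rel zs len = R.trans (sum-at ring m₀ size₀ (λ i → c (τ₀ i) ℤ.* pairs (ℓK i) zs)
            (λ i off → R.trans (R.reflexive (≡.cong (λ x → x ℤ.* pairs (ℓK i) zs) (≡.trans (≡.cong c (off-nothing (τ₀ i) (≡.trans (support-τ₀ i) off))) c0))) (R.zeroˡ (pairs (ℓK i) zs))))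
          (R.trans (sum-cong-≋ {k} (λ i → R.*-congʳ {pairs (ℓ₀ i) zs} (R.trans (R.reflexive (≡.cong c (τ₀-e i))) (same i)))) (rel zs len))

        spanned₀ : Spanned W₀ ℓK
        spanned₀ = spanned G _ girth (support τ₀) size′ ℓK basis′

      τ₀-size : count (support τ₀) ≡ k
      τ₀-size = size′

      -- The relation for γ makes the first form vanish and, with one argument fixed to (1 , 0) or
      -- (0 , 1), the other two; the subsystem provides the p² dual vectors.
      τ₀-full : block-count W₀ τ₀ triple ≡ Λ
      τ₀-full = ≡.trans (block-count-≡ W₀ τ₀ triple
          (relation⇒vanishes W₀ ℓK spanned₀ (1 ℕ.+ (h ℕ.+ h)) (cP ∘ τ₀) (lift cP ≡.refl _ γ (λ i → R.*-identityˡ (γ i)) γ-relation) ∷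
           relation⇒vanishes W₀ ℓK spanned₀ (h ℕ.+ h) (cA ∘ τ₀) (lift cA ≡.refl _ (λ i → γ i ℤ.* pair (ℓ₀ i) (+ 1 , + 0))
             (λ i → solve 3 (λ g a b → g :* a := g :* (a :* con (+ 1) :+ b :* con (+ 0))) R.refl (γ i) (proj₁ (ℓ₀ i)) (proj₂ (ℓ₀ i))) (γ-relation-at (+ 1 , + 0))) ∷
           relation⇒vanishes W₀ ℓK spanned₀ (h ℕ.+ h) (cB ∘ τ₀) (lift cB ≡.refl _ (λ i → γ i ℤ.* pair (ℓ₀ i) (+ 0 , + 1))
             (λ i → solve 3 (λ g a b → g :* b := g :* (a :* con (+ 0) :+ b :* con (+ 1))) R.refl (γ i) (proj₁ (ℓ₀ i)) (proj₂ (ℓ₀ i))) (γ-relation-at (+ 0 , + 1))) ∷ []))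
        (≡.cong (ℕ._^ dimension triple) (ℕ.≤-antisym (dual≤p² G _ girth (support τ₀) size′) (p²≤dual G _ girth (support τ₀) size′ ℓK basis′)))

-- Girth and subsystem modulo a large prime.

module LargePrimes where

  open import Data.List.Relation.Unary.Unique.Propositional using (Unique)
  open import Data.Vec using (tabulate)
  open import Defs using (LinearSystem; HasGirth; IsSubsystem; RowsIndependent; vectors)
  open IntegerCoefficients
  open FiniteSums
  open Residues
  open BinaryForms
  open Masks
  open RationalSpans
  open FourierExpansion
  open FrequencyCounts

  vectors≡prodList : ∀ {A : Set} (xs : List A) n → vectors xs n ≡ prodList {K = n} (λ _ → xs)
  vectors≡prodList xs zero    = ≡.refl
  vectors≡prodList xs (suc n) = ≡.cong (List.cartesianProductWith _∷_ xs) (vectors≡prodList xs n)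

  ∈-vectors : ∀ {A : Set} (xs : List A) {n} → (∀ x → x ∈ xs) → ∀ (v : Vec A n) → v ∈ vectors xs n
  ∈-vectors xs {n} all v = ≡.subst (v ∈_) (≡.sym (vectors≡prodList xs n)) (∈-prodList⁺ (λ i → all (lookup v i)))

  vectors-unique : ∀ {A : Set} {xs : List A} n → Unique xs → Unique (vectors xs n)
  vectors-unique {xs = xs} n u = ≡.subst Unique (≡.sym (vectors≡prodList xs n)) (prodList-unique {K = n} (λ _ → u))

  ∈-≤-sum : ∀ {A : Set} {xs : List A} (f : A → ℕ) {x} → x ∈ xs → f x ℕ.≤ ListAction.sum (map f xs)
  ∈-≤-sum f (here ≡.refl)          = ℕ.m≤m+n _ _
  ∈-≤-sum {xs = y ∷ _} f (there x∈) = ℕ.≤-trans (∈-≤-sum f x∈) (ℕ.m≤n+m _ (f y))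

  module Solutions {m K : ℕ} (L : LinearSystem m K) (p : ℕ) (prime : Prime p) where
    open Vectors p prime
    open Forms ring isDomain
    open Counts p prime
    open FromℤRing.Solver ring using (solve; con; _:+_; _:*_; :-_; _:-_; _:=_)
    open import Algebra.Properties.Semiring.Sum R.semiring using (sum-cong-≋; sum-replicate-zero; *-distribˡ-sum)

    IsZero : Vec F K → Set
    IsZero y = ∀ i → dot (L i) y ≋ + 0

    isZero? : Decidable IsZero
    isZero? y = Fin.all? (λ i → ≋0? (dot (L i) y))

    solution-group : Subgroup K
    solution-group = record
      { list = filter isZero? (vectors (allFin p) K)
      ; unique = Unique.filter⁺ isZero? (vectors-unique K (Unique.allFin⁺ p))
      ; closed-⊕ = λ {u} {v} u∈ v∈ → member (λ i → R.trans (dot-⊕ (L i) u v) (R.trans (R.+-cong (zero-of u∈ i) (zero-of v∈ i)) (R.+-identityʳ (+ 0))))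
      ; closed-⊖ = λ {u} {v} u∈ v∈ → member (λ i → R.trans (dot-⊖ (L i) u v) (R.trans (R.+-cong (zero-of u∈ i) (R.-‿cong (zero-of v∈ i))) (R.-‿inverseʳ (+ 0)))) }
      where
      member : ∀ {y} → IsZero y → y ∈ filter isZero? (vectors (allFin p) K)
      member {y} h = ∈-filter⁺ isZero? (∈-vectors (allFin p) ∈-allFin y) h
      zero-of : ∀ {y} → y ∈ filter isZero? (vectors (allFin p) K) → IsZero y
      zero-of y∈ = proj₂ (∈-filter⁻ isZero? {xs = vectors (allFin p) K} y∈)

    private
      Sol : List (Vec F K)
      Sol = Subgroup.list solution-group

      nonzero-mod-p : ∀ {x} → x ≢ 0ℤ → ℤ.∣ x ∣ ℕ.< p → ¬ x ≋ + 0
      nonzero-mod-p {x} x≢0 small h = ℕ.<⇒≱ small (ℕ.∣⇒≤ {{ℕ.≢-nonZero (x≢0 ∘ ℤ.∣i∣≡0⇒i≡0)}} (≋0⇒∣ h))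

      reduce : (Fin K → ℤ) → Vec F K
      reduce x = tabulate (λ j → residue (x j))

      dot-reduce : ∀ c x → dot c (reduce x) ≋ c ∙ x
      dot-reduce c x = sum-cong-≋ {K} (λ j → R.*-congˡ {c j} (R.trans (R.reflexive (≡.cong toℤ (Vec.lookup∘tabulate (λ j → residue (x j)) j))) (residue-≋ (x j))))

    module _ {s : ℕ} (girth : HasGirth L s) (s′ : ℕ) (s′<s : s′ ℕ.< s)
             (bound : ∀ S i (Si : lookup S i ≡ true) (small : count (lookup S) ℕ.< s) →
               ℤ.∣ proj₁ (free-variable L girth (lookup S) i Si small) i ∣ ℕ.< p) where

      -- For each position `i` of a small support there is an integer solution of `L` that is zero
      -- at the other positions and nonzero at `i`. Its entry there is below p, so it survives
      -- reduction, and perpendicularity to it leaves only the term at `i`.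
      girth-mod-p : Girth Sol s′
      girth-mod-p m′ small r perp off i with m′ i in eq
      ... | false = off i eq
      ... | true  = cancel (nonzero-mod-p xi≢0 (bound S i Si small′)) (R.trans (R.*-comm (x i) (r i)) (R.trans (R.sym (sum-single (λ j → r j ℤ.* x j) i others))
          (R.trans (R.sym (dot-reduce r x)) (All.lookup perp x∈))))
        where
        -- The mask as a vector: the bound on p ranges over the finite list of such vectors.
        S : Vec Bool K
        S = tabulate m′
        S≡ : ∀ j → lookup S j ≡ m′ j
        S≡ j = Vec.lookup∘tabulate m′ j
        Si : lookup S i ≡ true
        Si = ≡.trans (S≡ i) eq
        small′ : count (lookup S) ℕ.< s
        small′ = ℕ.≤-<-trans (ℕ.≤-trans (ℕ.≤-reflexive (count-cong S≡)) small) s′<s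
        found = free-variable L girth (lookup S) i Si small′
        x : Fin K → ℤ
        x = proj₁ found
        xi≢0 : x i ≢ 0ℤ
        xi≢0 = proj₂ (proj₂ (proj₂ found))
        x∈ : reduce x ∈ Sol
        x∈ = ∈-filter⁺ isZero? (∈-vectors (allFin p) ∈-allFin (reduce x)) (λ l → R.trans (dot-reduce (L l) x) (R.reflexive (proj₁ (proj₂ found) l)))
        others : ∀ j → j ≢ i → r j ℤ.* x j ≋ + 0
        others j j≢i with m′ j in eqj
        ... | false = R.trans (R.*-congʳ {x j} (off j eqj)) (R.zeroˡ (x j))
        ... | true  = R.trans (R.*-congˡ {r j} (R.reflexive (proj₁ (proj₂ (proj₂ found)) j (≡.trans (S≡ j) eqj) j≢i))) (R.zeroʳ (r j))

    module _ {k : ℕ} (L′ : LinearSystem 2 k) (ι : Fin k → Fin K) (sub : IsSubsystem L′ ι L) (independent : RowsIndependent L′)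
             (minor-bound : ℤ.∣ L′ zero (proj₁ (nonzero-minor L′ independent)) ℤ.* L′ (suc zero) (proj₁ (proj₂ (nonzero-minor L′ independent))) ℤ.-
                               L′ zero (proj₁ (proj₂ (nonzero-minor L′ independent))) ℤ.* L′ (suc zero) (proj₁ (nonzero-minor L′ independent)) ∣ ℕ.< p)
             (span-bound : ∀ r → ℤ.∣ proj₁ (extend-InSpan L L′ ι sub r) ∣ ℕ.< p) where

      private
        s t : Fin k
        s = proj₁ (nonzero-minor L′ independent)
        t = proj₁ (proj₂ (nonzero-minor L′ independent))

        v : Fin 2 → Fin K → ℤ
        v = extend L L′ ι sub

        -- `D` times the extended row is an integer combination of rows of `L`, and `D` is nonzero
        -- modulo p.
        v-perp : ∀ r → Perpendicular (v r) Sol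
        v-perp r = All.tabulate λ {y} y∈ → cancel (nonzero-mod-p D≢0 (span-bound r)) (begin
            D ℤ.* dot (v r) y
              ≈⟨ *-distribˡ-sum D (λ j → v r j ℤ.* coords y j) ⟩
            sumℤ (λ j → D ℤ.* (v r j ℤ.* coords y j))
              ≈⟨ sum-cong-≋ {K} (λ j → R.reflexive (≡.trans (≡.sym (ℤ.*-assoc D (v r j) (coords y j))) (≡.cong (ℤ._* coords y j) (h j)))) ⟩
            combination L c ∙ coords y
              ≡⟨ combination-∙ L c (coords y) ⟩
            sumℤ (λ i → c i ℤ.* (L i ∙ coords y))
              ≈⟨ sum-cong-≋ {m} (λ i → R.trans (R.*-congˡ {c i} (proj₂ (∈-filter⁻ isZero? {xs = vectors (allFin p) K} y∈) i)) (R.zeroʳ (c i))) ⟩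
            sumℤ {m} (λ _ → + 0)
              ≈⟨ sum-replicate-zero m ⟩
            + 0 ∎)
          where
          open import Relation.Binary.Reasoning.Setoid R.setoid
          span = extend-InSpan L L′ ι sub r
          D = proj₁ span
          D≢0 = proj₁ (proj₂ span)
          c = proj₁ (proj₂ (proj₂ span))
          h = proj₂ (proj₂ (proj₂ span))

      subsystem-basis : Basis Sol (image ι) (λ j → v zero j , v (suc zero) j)
      subsystem-basis = record
        { perp₁ = v-perp zero ; perp₂ = v-perp (suc zero)
        ; off = λ j off → R.reflexive (extend-off L L′ ι sub zero j off) , R.reflexive (extend-off L L′ ι sub (suc zero) j off)
        ; s = ι s ; t = ι t
        ; det≉0 = λ h → nonzero-mod-p (proj₂ (proj₂ (nonzero-minor L′ independent))) minor-bound
            (R.trans (R.reflexive (≡.trans (≡.cong (λ z → L′ zero s ℤ.* L′ (suc zero) t ℤ.- z) (ℤ.*-comm (L′ zero t) (L′ (suc zero) s)))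
              (≡.sym (≡.cong₂ ℤ._-_ (≡.cong₂ ℤ._*_ (extend-ι L L′ ι sub zero s) (extend-ι L L′ ι sub (suc zero) t))
                                    (≡.cong₂ ℤ._*_ (extend-ι L L′ ι sub (suc zero) s) (extend-ι L L′ ι sub zero t)))))) h) }

  module _ {m K : ℕ} (L : LinearSystem m K) {s : ℕ} (girth : HasGirth L s) where

    private
      entry : (S : Vec Bool K) (i : Fin K) → ℕ
      entry S i with lookup S i Bool.≟ true | count (lookup S) ℕ.<? s
      ... | yes Si | yes small = ℤ.∣ proj₁ (free-variable L girth (lookup S) i Si small) i ∣
      ... | _      | _         = 0

    -- Sums the sizes of the entries provided by `free-variable` over all masks and positions, which
    -- gives an explicit bound above which the girth survives reduction.
    girth-bound : ℕ
    girth-bound = ListAction.sum (map (λ S → ListAction.sum (map (entry S) (allFin K))) (vectors (true ∷ false ∷ []) K))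

    girth-bound-≤ : ∀ S i (Si : lookup S i ≡ true) (small : count (lookup S) ℕ.< s) →
                    ℤ.∣ proj₁ (free-variable L girth (lookup S) i Si small) i ∣ ℕ.≤ girth-bound
    girth-bound-≤ S i Si small = ℕ.≤-trans (≡.subst (ℕ._≤ ListAction.sum (map (entry S) (allFin K))) (entry-≡ Si small) (∈-≤-sum (entry S) (∈-allFin i)))
        (∈-≤-sum (λ S → ListAction.sum (map (entry S) (allFin K))) (∈-vectors (true ∷ false ∷ []) (λ { true → here ≡.refl ; false → there (here ≡.refl) }) S))
      where
      entry-≡ : ∀ Si small → entry S i ≡ ℤ.∣ proj₁ (free-variable L girth (lookup S) i Si small) i ∣
      entry-≡ Si small with lookup S i Bool.≟ true | count (lookup S) ℕ.<? s
      -- The solution depends on the proofs it is given, so those found by the two decisions have to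
      -- be identified with the given ones.
      ... | yes Si′ | yes small′ = ≡.cong₂ (λ a b → ℤ.∣ proj₁ (free-variable L girth (lookup S) i a b) i ∣) (Decidable⇒UIP.≡-irrelevant Bool._≟_ Si′ Si) (ℕ.<-irrelevant small′ small)
      ... | yes _   | no ¬small  = contradiction small ¬small
      ... | no ¬Si  | _          = contradiction Si ¬Si

-- The inequality for many copies of the blocks and a large constant.

module TensorPower where

  open import Data.Integer using (_+_; _*_; -_; _-_; _≤_; _<_; ∣_∣)
  open import Data.Product using (_×_)
  open import Relation.Binary.PropositionalEquality using (refl; sym; trans; cong; cong₂; subst; subst₂)
  open IntegerCoefficients
  open FiniteSums
  open Residues using (ℤ-ring)
  open Masks
  open FourierExpansion using (∈-prodList⁺; ∈-prodList⁻)

  open FromℤRing.Solver ℤ-ring using (solve; con; _:+_; _:*_; :-_; _:-_; _:=_)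
  open ListSum ℤ-ring

  -- (1 + 1/l)^n ≥ 1 + n/l with denominators cleared.
  bernoulli : ∀ l n → (l ℕ.+ n) ℕ.* l ℕ.^ n ℕ.≤ l ℕ.* suc l ℕ.^ n
  bernoulli l zero    = ℕ.≤-reflexive (cong (ℕ._* 1) (ℕ.+-identityʳ l))
  bernoulli l (suc n) = begin
    (l ℕ.+ suc n) ℕ.* (l ℕ.* l ℕ.^ n)
      ≡⟨ ℕ.*-assoc (l ℕ.+ suc n) l (l ℕ.^ n) ⟨
    (l ℕ.+ suc n) ℕ.* l ℕ.* l ℕ.^ n
      ≤⟨ ℕ.*-monoˡ-≤ (l ℕ.^ n) step ⟩
    suc l ℕ.* (l ℕ.+ n) ℕ.* l ℕ.^ n
      ≡⟨ ℕ.*-assoc (suc l) (l ℕ.+ n) (l ℕ.^ n) ⟩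
    suc l ℕ.* ((l ℕ.+ n) ℕ.* l ℕ.^ n)
      ≤⟨ ℕ.*-monoʳ-≤ (suc l) (bernoulli l n) ⟩
    suc l ℕ.* (l ℕ.* suc l ℕ.^ n)
      ≡⟨ trans (sym (ℕ.*-assoc (suc l) l _)) (trans (cong (ℕ._* suc l ℕ.^ n) (ℕ.*-comm (suc l) l)) (ℕ.*-assoc l (suc l) _)) ⟩
    l ℕ.* (suc l ℕ.* suc l ℕ.^ n) ∎
    where
    open ℕ.≤-Reasoning
    step : (l ℕ.+ suc n) ℕ.* l ℕ.≤ suc l ℕ.* (l ℕ.+ n)
    step = begin
      (l ℕ.+ suc n) ℕ.* l        ≡⟨ cong (ℕ._* l) (ℕ.+-suc l n) ⟩
      l ℕ.+ (l ℕ.+ n) ℕ.* l      ≤⟨ ℕ.+-mono-≤ (ℕ.m≤m+n l n) (ℕ.≤-reflexive (ℕ.*-comm (l ℕ.+ n) l)) ⟩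
      (l ℕ.+ n) ℕ.+ l ℕ.* (l ℕ.+ n) ∎

  -- With n = C l + 1 the factor l + n in Bernoulli's inequality exceeds C l; for base zero n = 1
  -- will do.
  exponential-gap : ∀ C l → ∃ λ n → C ℕ.* l ℕ.^ n ℕ.< suc l ℕ.^ n
  exponential-gap C zero    = 1 , ℕ.≤-trans (s≤s (ℕ.≤-reflexive (ℕ.*-zeroʳ C))) (s≤s z≤n)
  exponential-gap C (suc l) = n , ℕ.*-cancelˡ-< (suc l) _ _ (begin-strict
    suc l ℕ.* (C ℕ.* suc l ℕ.^ n)
      ≡⟨ ℕ.*-assoc (suc l) C _ ⟨
    suc l ℕ.* C ℕ.* suc l ℕ.^ n
      <⟨ ℕ.*-monoˡ-< (suc l ℕ.^ n) {{ℕ.>-nonZero (ℕ.m^n>0 (suc l) n)}} (ℕ.≤-trans (ℕ.≤-reflexive (cong suc (ℕ.*-comm (suc l) C))) (ℕ.m≤n+m n (suc l))) ⟩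
    (suc l ℕ.+ n) ℕ.* suc l ℕ.^ n
      ≤⟨ bernoulli (suc l) n ⟩
    suc l ℕ.* suc (suc l) ℕ.^ n ∎)
    where
    open ℕ.≤-Reasoning
    n : ℕ
    n = suc (C ℕ.* suc l)

  private
    variable
      A : Set

  ∑-mono : ∀ (xs : List A) {f g : A → ℤ} → (∀ x → x ∈ xs → f x ≤ g x) → ∑ xs f ≤ ∑ xs g
  ∑-mono []       h = ℤ.≤-refl
  ∑-mono (x ∷ xs) h = ℤ.+-mono-≤ (h x (here refl)) (∑-mono xs (λ y y∈ → h y (there y∈)))

  ∑-gap : ∀ {xs : List A} {f g : A → ℤ} {x δ} → (∀ y → y ∈ xs → f y ≤ g y) → x ∈ xs → f x + δ ≤ g x → ∑ xs f + δ ≤ ∑ xs g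
  ∑-gap {xs = x ∷ xs} {f} {g} {δ = δ} h (here refl) gap = subst (_≤ ∑ (x ∷ xs) g)
    (solve 3 (λ a b d → (a :+ d) :+ b := (a :+ b) :+ d) refl (f x) (∑ xs f) δ) (ℤ.+-mono-≤ gap (∑-mono xs (λ y y∈ → h y (there y∈))))
  ∑-gap {xs = y ∷ xs} {f} {g} {δ = δ} h (there x∈) gap = subst (_≤ ∑ (y ∷ xs) g) (sym (ℤ.+-assoc (f y) (∑ xs f) δ))
    (ℤ.+-mono-≤ (h y (here refl)) (∑-gap (λ z z∈ → h z (there z∈)) x∈ gap))

  ∑-nonneg : ∀ (xs : List A) {f : A → ℤ} → (∀ x → 0ℤ ≤ f x) → 0ℤ ≤ ∑ xs f
  ∑-nonneg []       h = ℤ.≤-refl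
  ∑-nonneg (x ∷ xs) h = ℤ.+-mono-≤ (h x) (∑-nonneg xs h)

  0≤* : ∀ {a b} → 0ℤ ≤ a → 0ℤ ≤ b → 0ℤ ≤ a * b
  0≤* {a} {b} 0≤a 0≤b = subst (_≤ a * b) (ℤ.*-zeroʳ a) (ℤ.*-monoˡ-≤-nonNeg a {{ℤ.nonNegative 0≤a}} 0≤b)

  0≤+ : ∀ n → 0ℤ ≤ + n
  0≤+ n = ℤ.+≤+ z≤n

  i≤∣i∣ : ∀ i → i ≤ + ∣ i ∣
  i≤∣i∣ (+ n)    = ℤ.≤-refl
  i≤∣i∣ -[1+ n ] = ℤ.-≤+

  *-bound : ∀ w {a b} → a ℕ.≤ b → w * + a ≤ + ∣ w ∣ * + b
  *-bound w {a} {b} a≤b = ℤ.≤-trans (ℤ.*-monoʳ-≤-nonNeg (+ a) (i≤∣i∣ w)) (ℤ.*-monoˡ-≤-nonNeg (+ ∣ w ∣) (ℤ.+≤+ a≤b))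

  sgn : ℕ → ℤ
  sgn zero    = + 1
  sgn (suc n) = - sgn n

  sgn-even : ∀ h → sgn (h ℕ.+ h) ≡ + 1
  sgn-even zero    = refl
  sgn-even (suc h) rewrite ℕ.+-suc h h = trans (ℤ.neg-involutive (sgn (h ℕ.+ h))) (sgn-even h)

  sgn-value : ∀ n → sgn n ≡ + 1 ⊎ sgn n ≡ -[1+ 0 ]
  sgn-value zero    = inj₁ refl
  sgn-value (suc n) with sgn-value n
  ... | inj₁ e rewrite e = inj₂ refl
  ... | inj₂ e rewrite e = inj₁ refl

  1+sgn≤2 : ∀ n → 0ℤ ≤ + 1 + sgn n × + 1 + sgn n ≤ + 2
  1+sgn≤2 n with sgn-value n
  ... | inj₁ e rewrite e = ℤ.+≤+ z≤n , ℤ.≤-refl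
  ... | inj₂ e rewrite e = ℤ.≤-refl , ℤ.+≤+ z≤n

  -- E to the number of variables outside the support, the contribution of the constant terms;
  -- `κ-count` states this without subtraction.
  κ : ∀ {K} → ℕ → Vec Bool K → ℕ
  κ E []          = 1
  κ E (true ∷ S)  = κ E S
  κ E (false ∷ S) = E ℕ.* κ E S

  κ-∏⁺ : ∀ {K} E (S : Vec Bool K) → ∏ (λ i → if lookup S i then + 1 else + E) ≡ + κ E S
  κ-∏⁺ E []          = refl
  κ-∏⁺ E (true ∷ S)  = trans (ℤ.*-identityˡ _) (κ-∏⁺ E S)
  κ-∏⁺ E (false ∷ S) = trans (cong (+ E *_) (κ-∏⁺ E S)) (sym (ℤ.pos-* E (κ E S)))

  κ-∏⁻ : ∀ {K} E (S : Vec Bool K) → ∏ (λ i → if lookup S i then -[1+ 0 ] else + E) ≡ sgn (count (lookup S)) * + κ E S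
  κ-∏⁻ E []          = refl
  κ-∏⁻ E (true ∷ S)  = trans (cong (-[1+ 0 ] *_) (κ-∏⁻ E S)) (solve 2 (λ s k → (:- con (+ 1)) :* (s :* k) := (:- s) :* k) refl (sgn (count (lookup S))) (+ κ E S))
  κ-∏⁻ E (false ∷ S) = trans (cong (+ E *_) (κ-∏⁻ E S)) (trans (solve 3 (λ e s k → e :* (s :* k) := s :* (e :* k)) refl (+ E) (sgn (count (lookup S))) (+ κ E S))
    (cong (sgn (count (lookup S)) *_) (sym (ℤ.pos-* E (κ E S)))))

  κ-count : ∀ {K} E (S : Vec Bool K) → κ E S ℕ.* E ℕ.^ count (lookup S) ≡ E ℕ.^ K
  κ-count E []          = refl
  κ-count E (true ∷ S)  = trans (trans (sym (ℕ.*-assoc (κ E S) E _)) (trans (cong (ℕ._* E ℕ.^ count (lookup S)) (ℕ.*-comm (κ E S) E)) (ℕ.*-assoc E (κ E S) _))) (cong (E ℕ.*_) (κ-count E S))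
  κ-count E (false ∷ S) = trans (ℕ.*-assoc E (κ E S) _) (cong (E ℕ.*_) (κ-count E S))

  count-≤ : ∀ {K} (m : Fin K → Bool) → count m ℕ.≤ K
  count-≤ {zero}  m = z≤n
  count-≤ {suc K} m with m zero
  ... | true  = s≤s (count-≤ (m ∘ suc))
  ... | false = ℕ.m≤n⇒m≤1+n (count-≤ (m ∘ suc))

  bools : List Bool
  bools = false ∷ true ∷ []

  isZero : ℕ → ℤ
  isZero zero    = + 1
  isZero (suc _) = + 0

  masks : ∀ K → List (Vec Bool K)
  masks K = prodList {K = K} (λ _ → bools)

  ∑-isZero : ∀ K → ∑ (masks K) (λ S → isZero (count (lookup S))) ≡ + 1
  ∑-isZero zero    = refl
  ∑-isZero (suc K) = trans (∑-cartesian _∷_ bools (masks K) (λ S → isZero (count (lookup S))))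
    (trans (cong₂ (λ a b → a + (b + 0ℤ)) (∑-isZero K) (∑-0 (masks K))) refl)

  module _ {T : Set} (Ts : List T) where

    labels : List (Maybe T)
    labels = nothing ∷ map just Ts

    options : Bool → List (Maybe T)
    options true  = map just Ts
    options false = nothing ∷ []

    ∑-by-support : ∀ K (f : Vec (Maybe T) K → ℤ) → ∑ (prodList {K = K} (λ _ → labels)) f ≡ ∑ (masks K) (λ S → ∑ (prodList (λ i → options (lookup S i))) f)
    ∑-by-support zero    f = sym (ℤ.+-identityʳ _)
    ∑-by-support (suc K) f = begin
      ∑ (prodList {K = suc K} (λ _ → labels)) f
        ≡⟨ ∑-cartesian _∷_ labels vs f ⟩
      ∑ vs (λ v → f (nothing ∷ v)) + ∑ (map just Ts) (λ a → ∑ vs (λ v → f (a ∷ v)))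
        ≡⟨ cong₂ _+_ (by nothing) (∑-cong (map just Ts) by) ⟩
      ∑ (masks K) (λ S → ∑ (ws S) (λ v → f (nothing ∷ v))) + ∑ (map just Ts) (λ a → ∑ (masks K) (λ S → ∑ (ws S) (λ v → f (a ∷ v))))
        ≡⟨ cong (λ z → ∑ (masks K) (λ S → ∑ (ws S) (λ v → f (nothing ∷ v))) + z) (∑-swap (map just Ts) (masks K) (λ a S → ∑ (ws S) (λ v → f (a ∷ v)))) ⟩
      ∑ (masks K) (λ S → ∑ (ws S) (λ v → f (nothing ∷ v))) + ∑ (masks K) (λ S → ∑ (map just Ts) (λ a → ∑ (ws S) (λ v → f (a ∷ v))))
        ≡⟨ cong₂ _+_ (∑-cong (masks K) (λ S → trans (sym (ℤ.+-identityʳ _)) (sym (∑-cartesian _∷_ (options false) (ws S) f))))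
                     (trans (∑-cong (masks K) (λ S → sym (∑-cartesian _∷_ (options true) (ws S) f))) (sym (ℤ.+-identityʳ _))) ⟩
      ∑ (masks K) (λ S → g (false ∷ S)) + (∑ (masks K) (λ S → g (true ∷ S)) + 0ℤ)
        ≡⟨ ∑-cartesian _∷_ bools (masks K) g ⟨
      ∑ (masks (suc K)) g ∎
      where
      open ≡-Reasoning
      vs : List (Vec (Maybe T) K)
      vs = prodList {K = K} (λ _ → labels)
      ws : Vec Bool K → List (Vec (Maybe T) K)
      ws S = prodList (λ i → options (lookup S i))
      g : Vec Bool (suc K) → ℤ
      g S = ∑ (prodList (λ i → options (lookup S i))) f
      by : ∀ a → ∑ vs (λ v → f (a ∷ v)) ≡ ∑ (masks K) (λ S → ∑ (ws S) (λ v → f (a ∷ v)))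
      by a = ∑-by-support K (λ v → f (a ∷ v))

    options-is-just : ∀ b {a} → a ∈ options b → is-just a ≡ b
    options-is-just true {a} a∈ with ∈-map⁻ just a∈
    ... | _ , _ , refl = refl
    options-is-just false (here refl) = refl

  -- The coefficients of E + g and E - g on the kernels.
  signed⁺ signed⁻ : ∀ {T : Set} → (Maybe T → ℤ) → ℕ → Maybe T → ℤ
  signed⁺ weight E a = (if is-just a then + 1 else + E) * weight a
  signed⁻ weight E a = (if is-just a then -[1+ 0 ] else + E) * weight a

  module Inequality (K h : ℕ) {T : Set} (Ts : List T) (complete : ∀ t → t ∈ Ts) (weight : Maybe T → ℤ) (weight-nothing : weight nothing ≡ + 1)
    (balanced : ∑ Ts (weight ∘ just) ≡ 0ℤ) (A : Vec (Maybe T) K → ℕ) (l : ℕ)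
    (A-small : ∀ v → count (is-just ∘ lookup v) ℕ.≤ 2 ℕ.+ (h ℕ.+ h) → A v ≡ 1)
    (A-≤ : ∀ v → count (is-just ∘ lookup v) ≡ 4 ℕ.+ (h ℕ.+ h) → A v ℕ.≤ suc l)
    (A-full : ∀ v → count (is-just ∘ lookup v) ≡ 4 ℕ.+ (h ℕ.+ h) → A v ≡ suc l → ∏ (weight ∘ lookup v) ≡ -[1+ (2 ℕ.+ (h ℕ.+ h)) ])
    (v₀ : Vec (Maybe T) K) (v₀-size : count (is-just ∘ lookup v₀) ≡ 4 ℕ.+ (h ℕ.+ h)) (v₀-full : A v₀ ≡ suc l) where

    private
      plus minus : ℕ → Maybe T → ℤ
      plus  = signed⁺ weight
      minus = signed⁻ weight

    -- For exact kernels, t_L(f) + t_L(1 - f) is this number divided by (2E)^K, so it has to be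
    -- compared with 2 E^K. `A v` is the count of one copy of the blocks, `n` the number of copies.
    total : ℕ → ℕ → ℤ
    total n E = ∑ (prodList {K = K} (λ _ → labels Ts)) (λ v → (∏ (plus E ∘ lookup v) + ∏ (minus E ∘ lookup v)) * + (A v ℕ.^ n))

    private
      k : ℕ
      k = 4 ℕ.+ (h ℕ.+ h)

      wt : Vec (Maybe T) K → ℤ
      wt v = ∏ (weight ∘ lookup v)

      vectors-of : Vec Bool K → List (Vec (Maybe T) K)
      vectors-of S = prodList (λ i → options Ts (lookup S i))

      #_ : Vec Bool K → ℕ
      # S = count (lookup S)

      support-≡ : ∀ S {v} → v ∈ vectors-of S → ∀ i → is-just (lookup v i) ≡ lookup S i
      support-≡ S v∈ i = options-is-just Ts (lookup S i) (∈-prodList⁻ v∈ i)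

      support-count : ∀ S {v} → v ∈ vectors-of S → count (is-just ∘ lookup v) ≡ # S
      support-count S v∈ = count-cong (support-≡ S v∈)

      c₁ : Vec Bool K → ℤ
      c₁ S = ∑ (vectors-of S) (λ v → + ∣ wt v ∣)

      C : ℕ
      C = ∣ ∑ (masks K) c₁ ∣

      C≡ : + C ≡ ∑ (masks K) c₁
      C≡ = ℤ.0≤i⇒+∣i∣≡i (∑-nonneg (masks K) (λ S → ∑-nonneg (vectors-of S) (λ v → 0≤+ ∣ wt v ∣)))

      -- Chosen so that all labellings on k variables that are not full, together of size at most C
      -- lⁿ, are outweighed by a single full one of size (l + 1)ⁿ.
      n : ℕ
      n = proj₁ (exponential-gap C l)

      gap : C ℕ.* l ℕ.^ n ℕ.< suc l ℕ.^ n
      gap = proj₂ (exponential-gap C l)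

      Lⁿ : ℤ
      Lⁿ = + (l ℕ.^ n)

      Λⁿ : ℤ
      Λⁿ = + (suc l ℕ.^ n)

      t : Vec Bool K → ℤ
      t S = ∑ (vectors-of S) (λ v → wt v * + (A v ℕ.^ n))

      y₁ : Vec Bool K → ℤ
      y₁ S = ∑ (vectors-of S) (λ v → + ∣ wt v ∣ * + (A v ℕ.^ n))

      y₁≥0 : ∀ S → 0ℤ ≤ y₁ S
      y₁≥0 S = ∑-nonneg (vectors-of S) (λ v → 0≤* (0≤+ ∣ wt v ∣) (0≤+ (A v ℕ.^ n)))

      c₁≥0 : ∀ S → 0ℤ ≤ c₁ S
      c₁≥0 S = ∑-nonneg (vectors-of S) (λ v → 0≤+ ∣ wt v ∣)

      -- Absolute size of the whole sum once n is fixed; E is chosen after n in order to exceed it.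
      Y : ℕ
      Y = ∣ ∑ (masks K) y₁ ∣

      Y≡ : + Y ≡ ∑ (masks K) y₁
      Y≡ = ℤ.0≤i⇒+∣i∣≡i (∑-nonneg (masks K) y₁≥0)

      t≤y₁ : ∀ S → t S ≤ y₁ S
      t≤y₁ S = ∑-mono (vectors-of S) (λ v _ → *-bound (wt v) ℕ.≤-refl)

      -- Labellings that are not full have count at most l. Full ones have negative weight, so their
      -- term is below any nonnegative bound.
      t-term : ∀ v → count (is-just ∘ lookup v) ≡ k → wt v * + (A v ℕ.^ n) ≤ + ∣ wt v ∣ * Lⁿ
      t-term v size with A v ℕ.≟ suc l
      ... | no  A≢ = *-bound (wt v) (ℕ.^-monoˡ-≤ n (ℕ.≤-pred (ℕ.≤∧≢⇒< (A-≤ v size) A≢)))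
      ... | yes A≡ = ℤ.≤-trans (ℤ.≤-trans (ℤ.≤-reflexive (cong (_* + (A v ℕ.^ n)) (A-full v size A≡)))
          (ℤ.*-monoʳ-≤-nonNeg (+ (A v ℕ.^ n)) { -[1+ (2 ℕ.+ (h ℕ.+ h)) ]} {0ℤ} ℤ.-≤+)) (0≤* (0≤+ ∣ wt v ∣) (0≤+ (l ℕ.^ n)))

      t≤ : ∀ S → # S ≡ k → t S ≤ c₁ S * Lⁿ
      t≤ S size = ℤ.≤-trans (∑-mono (vectors-of S) (λ v v∈ → t-term v (trans (support-count S v∈) size)))
        (ℤ.≤-reflexive (sym (∑-*ʳ (vectors-of S) Lⁿ _)))

      S₀ : Vec Bool K
      S₀ = Vec.map is-just v₀

      S₀-size : # S₀ ≡ k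
      S₀-size = trans (count-cong (λ i → Vec.lookup-map i is-just v₀)) v₀-size

      v₀∈ : v₀ ∈ vectors-of S₀
      v₀∈ = ∈-prodList⁺ (λ i → subst (λ b → lookup v₀ i ∈ options Ts b) (sym (Vec.lookup-map i is-just v₀)) (own (lookup v₀ i)))
        where
        own : ∀ a → a ∈ options Ts (is-just a)
        own (just x) = ∈-map⁺ just (complete x)
        own nothing  = here refl

      -- The full labelling `v₀` has weight at most -1, which leaves room for an additional Λⁿ.
      t₀≤ : t S₀ + Λⁿ ≤ c₁ S₀ * Lⁿ
      t₀≤ = ℤ.≤-trans (∑-gap {xs = vectors-of S₀} {g = λ v → + ∣ wt v ∣ * Lⁿ} {x = v₀} (λ v v∈ → t-term v (trans (support-count S₀ v∈) S₀-size)) v₀∈ gap₀)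
        (ℤ.≤-reflexive (sym (∑-*ʳ (vectors-of S₀) Lⁿ _)))
        where
        gap₀ : wt v₀ * + (A v₀ ℕ.^ n) + Λⁿ ≤ + ∣ wt v₀ ∣ * Lⁿ
        gap₀ = ℤ.≤-trans (ℤ.≤-reflexive (trans (cong₂ (λ w a → w * + (a ℕ.^ n) + Λⁿ) (A-full v₀ v₀-size v₀-full) v₀-full)
            (solve 2 (λ w x → (:- (con (+ 1) :+ w)) :* x :+ x := (:- w) :* x) refl (+ (2 ℕ.+ (h ℕ.+ h))) Λⁿ)))
          (ℤ.≤-trans (ℤ.*-monoʳ-≤-nonNeg Λⁿ { - + (2 ℕ.+ (h ℕ.+ h))} {0ℤ} ℤ.-≤+) (0≤* (0≤+ ∣ wt v₀ ∣) (0≤+ (l ℕ.^ n))))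

      t-empty : ∀ S → # S ≡ 0 → t S ≡ + 1
      t-empty S empty = trans (∑-cong-∈ (vectors-of S) (λ v v∈ → trans (cong (λ a → wt v * + (a ℕ.^ n)) (A-small v (ℕ.≤-trans (ℕ.≤-reflexive (trans (support-count S v∈) empty)) z≤n)))
          (trans (cong (λ a → wt v * + a) (ℕ.^-zeroˡ n)) (ℤ.*-identityʳ (wt v)))))
        (trans (sym (∏-∑ (λ i → options Ts (lookup S i)) (λ _ → weight))) (ones S empty))
        where
        ones : ∀ {K} (S : Vec Bool K) → count (lookup S) ≡ 0 → ∏ (λ i → ∑ (options Ts (lookup S i)) weight) ≡ + 1
        ones []          _ = refl
        ones (false ∷ S) e = trans (cong₂ _*_ (trans (ℤ.+-identityʳ (weight nothing)) weight-nothing) (ones S e)) refl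

      -- The count is 1 here, so the sum over labellings factors over the variables, and each
      -- variable in the support contributes the total weight of the labels, which is zero.
      t-small : ∀ S → 1 ℕ.≤ # S → # S ℕ.≤ 2 ℕ.+ (h ℕ.+ h) → t S ≡ 0ℤ
      t-small S nonempty small = trans (∑-cong-∈ (vectors-of S) (λ v v∈ → trans (cong (λ a → wt v * + (a ℕ.^ n)) (A-small v (ℕ.≤-trans (ℕ.≤-reflexive (support-count S v∈)) small)))
          (trans (cong (λ a → wt v * + a) (ℕ.^-zeroˡ n)) (ℤ.*-identityʳ (wt v)))))
        (trans (sym (∏-∑ (λ i → options Ts (lookup S i)) (λ _ → weight))) (cancels S nonempty))
        where
        cancels : ∀ {K} (S : Vec Bool K) → 1 ℕ.≤ count (lookup S) → ∏ (λ i → ∑ (options Ts (lookup S i)) weight) ≡ 0ℤ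
        cancels (true ∷ S)  _ = trans (cong (_* rest) (trans (∑-map just Ts weight) balanced)) (ℤ.*-zeroˡ rest)
          where rest = ∏ (λ i → ∑ (options Ts (lookup S i)) weight)
        cancels (false ∷ S) e = trans (cong ((weight nothing + 0ℤ) *_) (cancels S e)) (ℤ.*-zeroʳ (weight nothing + 0ℤ))

    module _ (E : ℕ) (Y<E : Y ℕ.< E) where
      private
        1≤E : 1 ℕ.≤ E
        1≤E = ℕ.≤-trans (s≤s z≤n) Y<E

        k≤K : k ℕ.≤ K
        k≤K = subst (ℕ._≤ K) v₀-size (count-≤ (is-just ∘ lookup v₀))

        P : ℕ
        P = E ℕ.^ (K ℕ.∸ k)

        P-eq : P ℕ.* E ℕ.^ k ≡ E ℕ.^ K
        P-eq = trans (sym (ℕ.^-distribˡ-+-* E (K ℕ.∸ k) k)) (cong (E ℕ.^_) (ℕ.m∸n+n≡m k≤K))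

        pos : ∀ j → 1 ℕ.≤ E ℕ.^ j
        pos j = ℕ.m^n>0 E {{ℕ.>-nonZero 1≤E}} j

        κ-k : ∀ S → # S ≡ k → κ E S ≡ P
        κ-k S size = ℕ.*-cancelʳ-≡ (κ E S) P (E ℕ.^ k) {{ℕ.>-nonZero (pos k)}} (trans (cong (λ c → κ E S ℕ.* E ℕ.^ c) (sym size)) (trans (κ-count E S) (sym P-eq)))

        κ-large : ∀ S → k ℕ.< # S → E ℕ.* κ E S ℕ.≤ P
        κ-large S large = ℕ.*-cancelʳ-≤ (E ℕ.* κ E S) P (E ℕ.^ k) {{ℕ.>-nonZero (pos k)}} (begin
          E ℕ.* κ E S ℕ.* E ℕ.^ k     ≡⟨ trans (cong (ℕ._* E ℕ.^ k) (ℕ.*-comm E (κ E S))) (ℕ.*-assoc (κ E S) E _) ⟩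
          κ E S ℕ.* E ℕ.^ suc k       ≤⟨ ℕ.*-monoʳ-≤ (κ E S) (ℕ.^-monoʳ-≤ E {{ℕ.>-nonZero 1≤E}} large) ⟩
          κ E S ℕ.* E ℕ.^ (# S)       ≡⟨ trans (κ-count E S) (sym P-eq) ⟩
          P ℕ.* E ℕ.^ k               ∎)
          where open ℕ.≤-Reasoning

        κ-0 : ∀ S → # S ≡ 0 → κ E S ≡ E ℕ.^ K
        κ-0 S empty = trans (sym (ℕ.*-identityʳ (κ E S))) (trans (cong (λ c → κ E S ℕ.* E ℕ.^ c) (sym empty)) (κ-count E S))

        -- Up to κ this is 1 + (-1)^|S|, from E + g and E - g: zero on odd supports and 2 on even
        -- ones.
        coefficient : Vec Bool K → ℤ
        coefficient S = (+ 1 + sgn (# S)) * + κ E S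

        grouped : total n E ≡ ∑ (masks K) (λ S → coefficient S * t S)
        grouped = trans (∑-by-support Ts K _) (∑-cong (masks K) (λ S → trans (∑-cong-∈ (vectors-of S) (term S)) (sym (∑-*ˡ (vectors-of S) (coefficient S) _))))
          where
          term : ∀ S v → v ∈ vectors-of S → (∏ (plus E ∘ lookup v) + ∏ (minus E ∘ lookup v)) * + (A v ℕ.^ n) ≡ coefficient S * (wt v * + (A v ℕ.^ n))
          term S v v∈ = trans (cong₂ (λ a b → (a + b) * + (A v ℕ.^ n))
              (trans (∏-* (λ i → if is-just (lookup v i) then + 1 else + E) (weight ∘ lookup v))
                (cong (_* wt v) (trans (∏-cong (λ i → cong (λ b → if b then + 1 else + E) (support-≡ S v∈ i))) (κ-∏⁺ E S))))
              (trans (∏-* (λ i → if is-just (lookup v i) then -[1+ 0 ] else + E) (weight ∘ lookup v))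
                (cong (_* wt v) (trans (∏-cong (λ i → cong (λ b → if b then -[1+ 0 ] else + E) (support-≡ S v∈ i))) (κ-∏⁻ E S)))))
            (solve 4 (λ k s w a → (k :* w :+ s :* k :* w) :* a := (con (+ 1) :+ s) :* k :* (w :* a)) refl (+ κ E S) (sgn (# S)) (wt v) (+ (A v ℕ.^ n)))

        2E 2P : ℤ
        2E = + 2 * + E
        2P = + 2 * + P

        0≤2P : 0ℤ ≤ 2P
        0≤2P = 0≤* (0≤+ 2) (0≤+ P)

        X₀ : ℤ
        X₀ = 2E * + (E ℕ.^ K)

        bound : Vec Bool K → ℤ
        bound S = isZero (# S) * X₀ + (+ E * 2P * (c₁ S * Lⁿ) + 2P * y₁ S)

        rest≥0₁ : ∀ S → 0ℤ ≤ + E * 2P * (c₁ S * Lⁿ)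
        rest≥0₁ S = 0≤* (0≤* (0≤+ E) 0≤2P) (0≤* (c₁≥0 S) (0≤+ (l ℕ.^ n)))

        rest≥0₂ : ∀ S → 0ℤ ≤ 2P * y₁ S
        rest≥0₂ S = 0≤* 0≤2P (y₁≥0 S)

        X₀≥0 : 0ℤ ≤ X₀
        X₀≥0 = 0≤* (0≤* (0≤+ 2) (0≤+ E)) (0≤+ (E ℕ.^ K))

        isZero≥0 : ∀ j → 0ℤ ≤ isZero j
        isZero≥0 zero    = 0≤+ 1
        isZero≥0 (suc _) = ℤ.≤-refl

        coefficient-k : ∀ S → # S ≡ k → coefficient S ≡ 2P
        coefficient-k S size = cong₂ (λ s x → (+ 1 + s) * + x)
          (trans (cong sgn size) (trans (solve 1 (λ s → :- (:- (:- (:- s))) := s) refl (sgn (h ℕ.+ h))) (sgn-even h))) (κ-k S size)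

        ≤-sum₁ : ∀ {x a b c} → 0ℤ ≤ b → 0ℤ ≤ c → x ≤ a → x ≤ a + (b + c)
        ≤-sum₁ {x} {a} 0≤b 0≤c x≤a = ℤ.≤-trans (ℤ.≤-reflexive (sym (ℤ.+-identityʳ x))) (ℤ.+-mono-≤ x≤a (ℤ.+-mono-≤ 0≤b 0≤c))

        ≤-sum₂ : ∀ {x a b c} → 0ℤ ≤ a → 0ℤ ≤ c → x ≤ b → x ≤ a + (b + c)
        ≤-sum₂ {x} 0≤a 0≤c x≤b = ℤ.≤-trans (ℤ.≤-reflexive (solve 1 (λ x → x := con (+ 0) :+ (x :+ con (+ 0))) refl x)) (ℤ.+-mono-≤ 0≤a (ℤ.+-mono-≤ x≤b 0≤c))

        ≤-sum₃ : ∀ {x a b c} → 0ℤ ≤ a → 0ℤ ≤ b → x ≤ c → x ≤ a + (b + c)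
        ≤-sum₃ {x} 0≤a 0≤b x≤c = ℤ.≤-trans (ℤ.≤-reflexive (solve 1 (λ x → x := con (+ 0) :+ (con (+ 0) :+ x)) refl x)) (ℤ.+-mono-≤ 0≤a (ℤ.+-mono-≤ 0≤b x≤c))

        isZero-term≥0 : ∀ S → 0ℤ ≤ isZero (# S) * X₀
        isZero-term≥0 S = 0≤* (isZero≥0 (# S)) X₀≥0

        ≤-bound-zero : ∀ S {x} → x ≡ 0ℤ → x ≤ bound S
        ≤-bound-zero S refl = ≤-sum₁ {a = isZero (# S) * X₀} (rest≥0₁ S) (rest≥0₂ S) (isZero-term≥0 S)

        -- Everything is multiplied by E because a support larger than k loses at least one factor E
        -- against P = E^(K - k). The three parts of `bound` take the empty support, the supports of
        -- size k and the larger ones; the sizes 1 to k - 1 contribute zero.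
        term≤bound : ∀ S → + E * (coefficient S * t S) ≤ bound S
        term≤bound S with # S ℕ.≟ 0
        ... | yes empty = ≤-sum₁ {a = isZero (# S) * X₀} (rest≥0₁ S) (rest≥0₂ S) (ℤ.≤-reflexive (begin
            + E * ((+ 1 + sgn (# S)) * + κ E S * t S)
              ≡⟨ cong (λ a → + E * (a * t S)) (cong₂ (λ s x → (+ 1 + sgn s) * + x) empty (κ-0 S empty)) ⟩
            + E * ((+ 1 + + 1) * + (E ℕ.^ K) * t S)
              ≡⟨ cong (λ b → + E * ((+ 1 + + 1) * + (E ℕ.^ K) * b)) (t-empty S empty) ⟩
            + E * ((+ 1 + + 1) * + (E ℕ.^ K) * + 1)
              ≡⟨ solve 2 (λ e x → e :* ((con (+ 1) :+ con (+ 1)) :* x :* con (+ 1)) := con (+ 1) :* (con (+ 2) :* e :* x)) refl (+ E) (+ (E ℕ.^ K)) ⟩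
            + 1 * X₀
              ≡⟨ cong (λ c → isZero c * X₀) empty ⟨
            isZero (# S) * X₀ ∎))
          where open ≡-Reasoning
        ... | no nonempty with # S ℕ.≤? 2 ℕ.+ (h ℕ.+ h)
        ...   | yes small = ≤-bound-zero S (trans (cong (λ b → + E * (coefficient S * b)) (t-small S (ℕ.n≢0⇒n>0 nonempty) small))
                  (solve 2 (λ e c → e :* (c :* con (+ 0)) := con (+ 0)) refl (+ E) (coefficient S)))
        ...   | no large with # S ℕ.≟ 3 ℕ.+ (h ℕ.+ h) | # S ℕ.≟ k
        ...     | yes odd | _ = ≤-bound-zero S (trans (cong (λ s → + E * ((+ 1 + s) * + κ E S * t S)) (trans (cong sgn odd) (cong (λ s → - (- (- s))) (sgn-even h))))
                  (solve 3 (λ e k t → e :* ((con (+ 1) :- con (+ 1)) :* k :* t) := con (+ 0)) refl (+ E) (+ κ E S) (t S)))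
        ...     | no _ | yes size = ≤-sum₂ {a = isZero (# S) * X₀} {b = + E * 2P * (c₁ S * Lⁿ)} (isZero-term≥0 S) (rest≥0₂ S)
                  (ℤ.≤-trans (ℤ.≤-reflexive (trans (cong (λ c → + E * (c * t S)) (coefficient-k S size)) (sym (ℤ.*-assoc (+ E) 2P (t S)))))
                    (ℤ.*-monoˡ-≤-nonNeg (+ E * 2P) {{ℤ.nonNegative (0≤* (0≤+ E) 0≤2P)}} (t≤ S size)))
        ...     | no c≢ | no c≢k = ≤-sum₃ {a = isZero (# S) * X₀} {b = + E * 2P * (c₁ S * Lⁿ)} {c = 2P * y₁ S} (isZero-term≥0 S) (rest≥0₁ S) (begin
            + E * ((+ 1 + sgn (# S)) * + κ E S * t S)
              ≡⟨ solve 4 (λ e s k t → e :* (s :* k :* t) := s :* (e :* k) :* t) refl (+ E) (+ 1 + sgn (# S)) (+ κ E S) (t S) ⟩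
            (+ 1 + sgn (# S)) * (+ E * + κ E S) * t S
              ≡⟨ cong (λ x → (+ 1 + sgn (# S)) * x * t S) (ℤ.pos-* E (κ E S)) ⟨
            (+ 1 + sgn (# S)) * + (E ℕ.* κ E S) * t S
              ≤⟨ ℤ.*-monoˡ-≤-nonNeg ((+ 1 + sgn (# S)) * + (E ℕ.* κ E S)) {{ℤ.nonNegative (0≤* (proj₁ (1+sgn≤2 (# S))) (0≤+ (E ℕ.* κ E S)))}} (t≤y₁ S) ⟩
            (+ 1 + sgn (# S)) * + (E ℕ.* κ E S) * y₁ S
              ≤⟨ ℤ.*-monoʳ-≤-nonNeg (y₁ S) {{ℤ.nonNegative (y₁≥0 S)}} (ℤ.≤-trans
                   (ℤ.*-monoʳ-≤-nonNeg (+ (E ℕ.* κ E S)) (proj₂ (1+sgn≤2 (# S)))) (ℤ.*-monoˡ-≤-nonNeg (+ 2) (ℤ.+≤+ (κ-large S k<)))) ⟩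
            2P * y₁ S ∎)
          where
          open ℤ.≤-Reasoning
          k< : k ℕ.< # S
          k< = ℕ.≤∧≢⇒< (ℕ.≤∧≢⇒< (ℕ.≰⇒> large) (c≢ ∘ sym)) (c≢k ∘ sym)

        term₀ : + E * (coefficient S₀ * t S₀) + + E * 2P * Λⁿ ≤ bound S₀
        term₀ = ≤-sum₂ {a = isZero (# S₀) * X₀} {b = + E * 2P * (c₁ S₀ * Lⁿ)} (isZero-term≥0 S₀) (rest≥0₂ S₀)
          (ℤ.≤-trans (ℤ.≤-reflexive (trans (cong (λ c → + E * (c * t S₀) + + E * 2P * Λⁿ) (coefficient-k S₀ S₀-size))
              (solve 4 (λ e p t x → e :* (p :* t) :+ e :* p :* x := e :* p :* (t :+ x)) refl (+ E) 2P (t S₀) Λⁿ)))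
            (ℤ.*-monoˡ-≤-nonNeg (+ E * 2P) {{ℤ.nonNegative (0≤* (0≤+ E) 0≤2P)}} t₀≤))

        bool-∈ : ∀ b → b ∈ bools
        bool-∈ false = here refl
        bool-∈ true  = there (here refl)

        ∑-bound : ∑ (masks K) bound ≡ X₀ + (+ E * 2P * (+ C * Lⁿ) + 2P * + Y)
        ∑-bound = trans (∑-+ (masks K) (λ S → isZero (# S) * X₀) (λ S → + E * 2P * (c₁ S * Lⁿ) + 2P * y₁ S)) (cong₂ _+_
          (trans (sym (∑-*ʳ (masks K) X₀ _)) (trans (cong (_* X₀) (∑-isZero K)) (ℤ.*-identityˡ X₀)))
          (trans (∑-+ (masks K) (λ S → + E * 2P * (c₁ S * Lⁿ)) (λ S → 2P * y₁ S)) (cong₂ _+_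
            (trans (sym (∑-*ˡ (masks K) (+ E * 2P) _)) (cong (+ E * 2P *_) (trans (sym (∑-*ʳ (masks K) Lⁿ _)) (cong (_* Lⁿ) (sym C≡)))))
            (trans (sym (∑-*ˡ (masks K) 2P _)) (cong (2P *_) (sym Y≡))))))

      -- E times the total is at most 2E · E^K + 2P (E (C lⁿ - Λⁿ) + Y), where the inner difference
      -- is at most -1 by the choice of n, and Y < E.
      total< : total n E < + 2 * + (E ℕ.^ K)
      total< = ℤ.*-cancelˡ-<-nonNeg (+ E) (ℤ.≤-<-trans main (ℤ.<-≤-trans (ℤ.+-monoʳ-< X₀ shrink) (ℤ.≤-reflexive
          (solve 2 (λ e x → con (+ 2) :* e :* x :+ con (+ 0) := e :* (con (+ 2) :* x)) refl (+ E) (+ (E ℕ.^ K))))))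
        where
        G : ℤ
        G = + E * 2P * (+ C * Lⁿ) + 2P * + Y - + E * 2P * Λⁿ
        main : + E * total n E ≤ X₀ + G
        main = subst₂ _≤_ (trans (solve 2 (λ x d → (x :+ d) :- d := x) refl (∑ (masks K) (λ S → + E * (coefficient S * t S))) (+ E * 2P * Λⁿ))
                 (trans (sym (∑-*ˡ (masks K) (+ E) _)) (cong (+ E *_) (sym grouped))))
               (solve 4 (λ x a b d → (x :+ (a :+ b)) :- d := x :+ (a :+ b :- d)) refl X₀ (+ E * 2P * (+ C * Lⁿ)) (2P * + Y) (+ E * 2P * Λⁿ))
               (ℤ.+-monoˡ-≤ (- (+ E * 2P * Λⁿ)) (ℤ.≤-trans (∑-gap {xs = masks K} {g = bound} {x = S₀} (λ S _ → term≤bound S) (∈-prodList⁺ {l = λ _ → bools} (λ i → bool-∈ (lookup S₀ i))) term₀) (ℤ.≤-reflexive ∑-bound)))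
        2P>0 : 0ℤ < 2P
        2P>0 = subst (0ℤ <_) (ℤ.pos-* 2 P) (ℤ.+<+ (ℕ.≤-trans (pos (K ℕ.∸ k)) (ℕ.m≤m+n P (P ℕ.+ 0))))
        gap′ : + C * Lⁿ - Λⁿ ≤ -[1+ 0 ]
        gap′ = subst₂ _≤_ {x = + (C ℕ.* l ℕ.^ n) - Λⁿ} {u = + (C ℕ.* l ℕ.^ n) - (+ 1 + + (C ℕ.* l ℕ.^ n))} (cong (_- Λⁿ) (ℤ.pos-* C (l ℕ.^ n)))
            (solve 1 (λ x → x :- (con (+ 1) :+ x) := :- con (+ 1)) refl (+ (C ℕ.* l ℕ.^ n)))
          (ℤ.+-monoʳ-≤ (+ (C ℕ.* l ℕ.^ n)) (ℤ.neg-mono-≤ (ℤ.+≤+ gap)))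
        shrink : G < 0ℤ
        shrink = ℤ.≤-<-trans (ℤ.≤-trans (ℤ.≤-reflexive (solve 5 (λ e p a y x → e :* p :* a :+ p :* y :- e :* p :* x := p :* (e :* (a :- x) :+ y)) refl (+ E) 2P (+ C * Lⁿ) (+ Y) Λⁿ))
            (ℤ.*-monoˡ-≤-nonNeg 2P {{ℤ.nonNegative 0≤2P}} (ℤ.+-monoˡ-≤ (+ Y) (ℤ.*-monoˡ-≤-nonNeg (+ E) gap′))))
          (ℤ.<-≤-trans (ℤ.*-monoˡ-<-pos 2P {{ℤ.positive 2P>0}} negative) (ℤ.≤-reflexive (ℤ.*-zeroʳ 2P)))
          where
          negative : + E * -[1+ 0 ] + + Y < 0ℤ
          negative = subst₂ _<_ (solve 2 (λ e y → y :- e := e :* (:- con (+ 1)) :+ y) refl (+ E) (+ Y)) (ℤ.+-inverseʳ (+ E))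
            (ℤ.+-monoˡ-< (- + E) (ℤ.+<+ Y<E))

    abstract
      eventually-smaller : ∃ λ n → ∃ λ threshold → ∀ E → threshold ℕ.< E → total n E < + 2 * + (E ℕ.^ K)
      eventually-smaller = n , Y , total<

-- Solutions over a vector space as tuples of scalar solutions.

module Transposition where

  open import Data.Vec using (tabulate)
  open import Data.Vec.Relation.Unary.All as VAll using ([]; _∷_) renaming (All to VAll)
  open import Defs using (LinearSystem; vectors; IsSolution𝔽; isSolution𝔽?; solutions)
  open FiniteSums
  open Residues
  open FourierExpansion
  open LargePrimes

  transpose : ∀ {A : Set} {K D} → Vec (Vec A K) D → Vec (Vec A D) K
  transpose X = tabulate (λ i → column i X)

  module _ (R : CommutativeRing 0ℓ 0ℓ) where
    open CommutativeRing R hiding (zero)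
    open ListSum R
    open import Relation.Binary.Reasoning.Setoid setoid

    -- Choosing K vectors of length n + 1 is choosing K first entries and K tails; iterated, this
    -- exchanges rows and columns.
    ∑-peel : ∀ {A : Set} (xs : List A) n K (f : Vec (Vec A (suc n)) K → Carrier) → ∑ (vectors (vectors xs (suc n)) K) f ≈
             ∑ (vectors xs K) (λ y → ∑ (vectors (vectors xs n) K) (λ v → f (zipWith _∷_ y v)))
    ∑-peel xs n zero    f = sym (+-identityʳ _)
    ∑-peel xs n (suc K) f = begin
      ∑ (vectors (vectors xs (suc n)) (suc K)) f
        ≈⟨ ∑-vectors-suc (vectors xs (suc n)) K f ⟩
      ∑ (vectors xs (suc n)) (λ u → ∑ (vectors (vectors xs (suc n)) K) (λ v → f (u ∷ v)))
        ≈⟨ ∑-vectors-suc xs n _ ⟩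
      ∑ xs (λ a → ∑ (vectors xs n) (λ u → ∑ (vectors (vectors xs (suc n)) K) (λ v → f ((a ∷ u) ∷ v))))
        ≈⟨ ∑-cong xs (λ a → ∑-cong (vectors xs n) (λ u → ∑-peel xs n K (λ v → f ((a ∷ u) ∷ v)))) ⟩
      ∑ xs (λ a → ∑ (vectors xs n) (λ u → ∑ (vectors xs K) (λ y → ∑ vs (λ v → f ((a ∷ u) ∷ zipWith _∷_ y v)))))
        ≈⟨ ∑-cong xs (λ a → ∑-swap (vectors xs n) (vectors xs K) _) ⟩
      ∑ xs (λ a → ∑ (vectors xs K) (λ y → ∑ (vectors xs n) (λ u → ∑ vs (λ v → f ((a ∷ u) ∷ zipWith _∷_ y v)))))
        ≈⟨ ∑-cong xs (λ a → ∑-cong (vectors xs K) (λ y → ∑-vectors-suc (vectors xs n) K (λ v → f (zipWith _∷_ (a ∷ y) v)))) ⟨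
      ∑ xs (λ a → ∑ (vectors xs K) (λ y → ∑ (vectors (vectors xs n) (suc K)) (λ v → f (zipWith _∷_ (a ∷ y) v))))
        ≈⟨ ∑-vectors-suc xs K _ ⟨
      ∑ (vectors xs (suc K)) (λ y → ∑ (vectors (vectors xs n) (suc K)) (λ v → f (zipWith _∷_ y v))) ∎
      where vs = vectors (vectors xs n) K

    ∑-transpose : ∀ {A : Set} (xs : List A) D K (f : Vec (Vec A D) K → Carrier) →
                  ∑ (vectors (vectors xs D) K) f ≈ ∑ (vectors (vectors xs K) D) (λ X → f (transpose X))
    ∑-transpose xs zero    K f = trans (only-[] K f) (sym (+-identityʳ _))
      where
      only-[] : ∀ K f → ∑ (vectors ([] ∷ []) K) f ≈ f (tabulate (λ _ → []))
      only-[] zero    f = +-identityʳ _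
      only-[] (suc K) f = trans (∑-vectors-suc ([] ∷ []) K f) (trans (+-identityʳ _) (only-[] K (λ v → f ([] ∷ v))))
    ∑-transpose xs (suc D) K f = begin
      ∑ (vectors (vectors xs (suc D)) K) f
        ≈⟨ ∑-peel xs D K f ⟩
      ∑ (vectors xs K) (λ y → ∑ (vectors (vectors xs D) K) (λ v → f (zipWith _∷_ y v)))
        ≈⟨ ∑-cong (vectors xs K) (λ y → ∑-transpose xs D K (λ v → f (zipWith _∷_ y v))) ⟩
      ∑ (vectors xs K) (λ y → ∑ (vectors (vectors xs K) D) (λ X → f (zipWith _∷_ y (transpose X))))
        ≈⟨ ∑-cong (vectors xs K) (λ y → ∑-cong (vectors (vectors xs K) D) (λ X → reflexive (≡.cong f (zip-transpose y (λ i → column i X))))) ⟩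
      ∑ (vectors xs K) (λ y → ∑ (vectors (vectors xs K) D) (λ X → f (transpose (y ∷ X))))
        ≈⟨ ∑-vectors-suc (vectors xs K) D _ ⟨
      ∑ (vectors (vectors xs K) (suc D)) (λ X → f (transpose X)) ∎
      where
      zip-transpose : ∀ {A : Set} {K D} (y : Vec A K) (c : Fin K → Vec A D) → zipWith Vec._∷_ y (tabulate c) ≡ tabulate (λ i → lookup y i Vec.∷ c i)
      zip-transpose []      c = ≡.refl
      zip-transpose (a ∷ y) c = ≡.cong ((a ∷ c zero) ∷_) (zip-transpose y (c ∘ suc))

    ∧-⟦⟧ : ∀ a b → ⟦ a ∧ b ⟧ ≈ ⟦ a ⟧ * ⟦ b ⟧
    ∧-⟦⟧ true  b = sym (*-identityˡ _)
    ∧-⟦⟧ false b = sym (zeroˡ _)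

    ∑-vectors-filter : ∀ {A : Set} {Q : A → Set} (Q? : Decidable Q) xs n f →
      ∑ (vectors (filter Q? xs) n) f ≈ ∑ (vectors xs n) (λ v → ⟦ does (VAll.all? Q? v) ⟧ * f v)
    ∑-vectors-filter Q? xs zero    f = +-congʳ (sym (*-identityˡ _))
    ∑-vectors-filter Q? xs (suc n) f = begin
      ∑ (vectors (filter Q? xs) (suc n)) f
        ≈⟨ ∑-vectors-suc (filter Q? xs) n f ⟩
      ∑ (filter Q? xs) (λ x → ∑ (vectors (filter Q? xs) n) (λ v → f (x ∷ v)))
        ≈⟨ ∑-filter Q? xs _ ⟩
      ∑ xs (λ x → ⟦ does (Q? x) ⟧ * ∑ (vectors (filter Q? xs) n) (λ v → f (x ∷ v)))
        ≈⟨ ∑-cong xs (λ x → trans (*-congˡ (∑-vectors-filter Q? xs n (λ v → f (x ∷ v)))) (trans (∑-*ˡ (vectors xs n) _ _)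
             (∑-cong (vectors xs n) (λ v → trans (sym (*-assoc _ _ _)) (*-congʳ (sym (∧-⟦⟧ (does (Q? x)) (does (VAll.all? Q? v))))))))) ⟩
      ∑ xs (λ x → ∑ (vectors xs n) (λ v → ⟦ does (VAll.all? Q? (x ∷ v)) ⟧ * f (x ∷ v)))
        ≈⟨ ∑-vectors-suc xs n _ ⟨
      ∑ (vectors xs (suc n)) (λ v → ⟦ does (VAll.all? Q? v) ⟧ * f v) ∎

    module _ {m K : ℕ} (L : LinearSystem m K) (p : ℕ) (prime : Prime p) (D : ℕ) where
      open Solutions L p prime
      open Vectors p prime using (F; dot; ∣⇒≋0; ≋0⇒∣; sumℤ; toℤ; module Subgroup)

      private
        entry : ∀ (X : Vec (Vec F K) D) j a → lookup (lookup (transpose X) j) a ≡ lookup (lookup X a) j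
        entry X j a = ≡.trans (≡.cong (λ v → lookup v a) (Vec.lookup∘tabulate (λ i → column i X) j)) (Vec.lookup-map a (λ y → lookup y j) X)

        sum-cong-≡ : ∀ {n} {f g : Fin n → ℤ} → (∀ i → f i ≡ g i) → sumℤ f ≡ sumℤ g
        sum-cong-≡ {zero}  h = ≡.refl
        sum-cong-≡ {suc n} h = ≡.cong₂ ℤ._+_ (h zero) (sum-cong-≡ (h ∘ suc))

        row : ∀ (X : Vec (Vec F K) D) i a → sumℤ (λ j → L i j ℤ.* + toℕ (lookup (lookup (transpose X) j) a)) ≡ dot (L i) (lookup X a)
        row X i a = sum-cong-≡ (λ j → ≡.cong (λ r → L i j ℤ.* + toℕ r) (entry X j a))

      -- The equations over 𝔽_p^D hold coordinate by coordinate, so a solution is the transpose of a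
      -- D-tuple of scalar solutions; this is the shape in which `kernel-sum` sums.
      ∑-solutions : ∀ f → ∑ (solutions L p D) f ≈ ∑ (vectors (Subgroup.list solution-group) D) (λ X → f (transpose X))
      ∑-solutions f = begin
        ∑ (solutions L p D) f
          ≈⟨ ∑-filter (isSolution𝔽? L p D) (vectors (vectors (allFin p) D) K) f ⟩
        ∑ (vectors (vectors (allFin p) D) K) (λ x → ⟦ does (isSolution𝔽? L p D x) ⟧ * f x)
          ≈⟨ ∑-transpose (allFin p) D K _ ⟩
        ∑ (vectors (vectors (allFin p) K) D) (λ X → ⟦ does (isSolution𝔽? L p D (transpose X)) ⟧ * f (transpose X))
          ≈⟨ ∑-cong (vectors (vectors (allFin p) K) D) (λ X → *-congʳ (does-⇔ (isSolution𝔽? L p D (transpose X)) (VAll.all? isZero? X) (to X) (from X))) ⟩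
        ∑ (vectors (vectors (allFin p) K) D) (λ X → ⟦ does (VAll.all? isZero? X) ⟧ * f (transpose X))
          ≈⟨ ∑-vectors-filter isZero? (vectors (allFin p) K) D _ ⟨
        ∑ (vectors (Subgroup.list solution-group) D) (λ X → f (transpose X)) ∎
        where
        to : ∀ X → IsSolution𝔽 L p D (transpose X) → VAll IsZero X
        to X h = VAll.lookup⁻ (λ a i → ∣⇒≋0 (≡.subst (λ z → + p ℤ.∣ z) (row X i a) (h i a)))
          where import Data.Integer.Divisibility as ℤ
        from : ∀ X → VAll IsZero X → IsSolution𝔽 L p D (transpose X)
        from X h i a = ≡.subst (λ z → + p ℤ.∣ z) (≡.sym (row X i a)) (≋0⇒∣ (VAll.lookup⁺ h a i))
          where import Data.Integer.Divisibility as ℤ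

-- Expansion of the products of E + g and E - g over labellings.

module KernelExpansion where

  open IntegerCoefficients
  open import Defs using (vectors)
  open FiniteSums
  open Residues
  open Characters
  open FourierExpansion
  open TensorPower using (labels; signed⁺; signed⁻)

  module ιSums (C : CommutativeRing 0ℓ 0ℓ) where
    open CommutativeRing C hiding (zero)
    open FromℤRing C
    open ListSum C
    private module Z = ListSum ℤ-ring

    ι-∑ : ∀ {A : Set} (xs : List A) (f : A → ℤ) → ∑ xs (λ x → ι (f x)) ≈ ι (Z.∑ xs f)
    ι-∑ []       f = refl
    ι-∑ (x ∷ xs) f = trans (+-congˡ (ι-∑ xs f)) (sym (ι-+ (f x) (Z.∑ xs f)))

    ι-∏ : ∀ {K} (f : Fin K → ℤ) → ∏ (λ i → ι (f i)) ≈ ι (Z.∏ f)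
    ι-∏ {zero}  f = refl
    ι-∏ {suc K} f = trans (*-congˡ (ι-∏ (f ∘ suc))) (sym (ι-* (f zero) (Z.∏ (f ∘ suc))))

  module Expansion (p : ℕ) (prime : Prime p) (C : CommutativeRing 0ℓ 0ℓ) (ψ : AdditiveCharacter p prime C)
    {T : Set} (Ts : List T) (weight : Maybe T → ℤ) (weight-nothing : weight nothing ≡ + 1)
    (bs : Vectors.Blocks p prime (Maybe T)) (silent : All (λ b → proj₂ b nothing ≡ + 0) bs) where

    open Vectors p prime
    open Transform p prime C ψ
    open AdditiveCharacter ψ
    open CommutativeRing C hiding (zero; ring)
    open FromℤRing C
    open Solver using (solve; con; _:+_; _:*_; :-_; _:-_; _:=_)
    open ListSum C
    open ιSums C
    open import Algebra.Properties.Semiring.Exp semiring using (_^_; ^-congˡ)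
    open import Relation.Binary.Reasoning.Setoid setoid
    private module Z = ListSum ℤ-ring

    κ : Maybe T → Vec F (dimension bs) → Carrier
    κ a = kernel {T = Maybe T} is-just a 0 (+ 0) bs

    g : Vec F (dimension bs) → Carrier
    g x = ∑ Ts (λ t → ι (weight (just t)) * κ (just t) x)

    private
      -- All coefficients of `nothing` are zero and its only frequency is zero, so its kernel is the
      -- constant 1; this makes E + g a single sum over labels.
      kernel-nothing : ∀ d c (bs : Blocks (Maybe T)) → All (λ b → proj₂ b nothing ≡ + 0) bs → c ≋ + 0 → ∀ x → kernel {T = Maybe T} is-just nothing d c bs x ≈ 1#
      kernel-nothing zero    c []             []       h x = trans (χ-cong h) χ-0
      kernel-nothing zero    c ((d , f) ∷ bs) (e ∷ es) h x = trans (*-cong (trans (χ-cong h) χ-0)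
        (kernel-nothing (suc d) (f nothing) bs es (R.reflexive e) x)) (*-identityˡ 1#)
      kernel-nothing (suc d) c bs es h (x ∷ xs) = trans (+-identityʳ _) (trans (*-cong
        (trans (χ-cong (R.trans (R.*-congˡ {toℤ x} (residue-≋ (+ 0))) (R.zeroʳ (toℤ x)))) χ-0)
        (kernel-nothing d (c ℤ.* toℤ 0F) bs es (R.trans (R.*-congʳ {toℤ 0F} h) (R.zeroˡ (toℤ 0F))) xs)) (*-identityˡ 1#))

      κ-nothing : ∀ x → κ nothing x ≈ 1#
      κ-nothing = kernel-nothing 0 (+ 0) bs silent R.refl

    expand⁺ : ∀ E x → ι (+ E) + g x ≈ ∑ (labels Ts) (λ a → ι (signed⁺ weight E a) * κ a x)
    expand⁺ E x = +-cong (sym (trans (*-cong (reflexive (≡.cong ι (≡.trans (≡.cong (+ E ℤ.*_) weight-nothing) (ℤ.*-identityʳ (+ E))))) (κ-nothing x)) (*-identityʳ _)))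
      (sym (trans (∑-map just Ts _) (∑-cong Ts (λ t → *-congʳ (reflexive (≡.cong ι (ℤ.*-identityˡ (weight (just t)))))))))

    expand⁻ : ∀ E x → ι (+ E) - g x ≈ ∑ (labels Ts) (λ a → ι (signed⁻ weight E a) * κ a x)
    expand⁻ E x = +-cong (sym (trans (*-cong (reflexive (≡.cong ι (≡.trans (≡.cong (+ E ℤ.*_) weight-nothing) (ℤ.*-identityʳ (+ E))))) (κ-nothing x)) (*-identityʳ _)))
      (trans (∑-neg Ts _) (sym (trans (∑-map just Ts _) (∑-cong Ts (λ t → trans (*-congʳ (ι-* -[1+ 0 ] (weight (just t))))
        (solve 2 (λ w k → (:- con (+ 1)) :* w :* k := :- (w :* k)) refl (ι (weight (just t))) (κ (just t) x)))))))

    module _ {K : ℕ} (G : Subgroup K) where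
      open Subgroup G

      private
        D : ℕ
        D = dimension bs

        s : Carrier
        s = ι (+ length list)

        B : Vec (Maybe T) K → ℤ
        B v = + block-count (dual-list G (is-just ∘ lookup v)) (lookup v) bs

        vs : List (Vec (Maybe T) K)
        vs = prodList {K = K} (λ _ → labels Ts)

        Xs : List (Vec (Vec F K) D)
        Xs = vectors list D

      -- The product over the variables becomes a sum over labellings, and `kernel-sum` evaluates
      -- each of them.
      product-sum : ∀ (f : Vec F D → Carrier) (ω : Maybe T → ℤ) → (∀ x → f x ≈ ∑ (labels Ts) (λ a → ι (ω a) * κ a x)) →
        ∑ Xs (λ X → ∏ (λ i → f (column i X))) ≈ s ^ D * ι (Z.∑ vs (λ v → Z.∏ (ω ∘ lookup v) ℤ.* B v))
      product-sum f ω h = begin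
        ∑ Xs (λ X → ∏ (λ i → f (column i X)))
          ≈⟨ ∑-cong Xs (λ X → trans (∏-cong (λ i → h (column i X))) (trans (∏-∑ (λ _ → labels Ts) (λ i a → ι (ω a) * κ a (column i X)))
               (∑-cong vs (λ v → trans (∏-* (λ i → ι (ω (lookup v i))) (λ i → κ (lookup v i) (column i X))) (*-congʳ (ι-∏ (ω ∘ lookup v))))))) ⟩
        ∑ Xs (λ X → ∑ vs (λ v → ι (Z.∏ (ω ∘ lookup v)) * ∏ (λ i → κ (lookup v i) (column i X))))
          ≈⟨ ∑-swap Xs vs _ ⟩
        ∑ vs (λ v → ∑ Xs (λ X → ι (Z.∏ (ω ∘ lookup v)) * ∏ (λ i → κ (lookup v i) (column i X))))
          ≈⟨ ∑-cong vs (λ v → trans (sym (∑-*ˡ Xs (ι (Z.∏ (ω ∘ lookup v))) _)) (*-congˡ (kernel-sum is-just G (lookup v) bs))) ⟩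
        ∑ vs (λ v → ι (Z.∏ (ω ∘ lookup v)) * (s ^ D * ι (B v)))
          ≈⟨ ∑-cong vs (λ v → trans (solve 3 (λ a b c → a :* (b :* c) := b :* (a :* c)) refl (ι (Z.∏ (ω ∘ lookup v))) (s ^ D) (ι (B v)))
               (*-congˡ (sym (ι-* (Z.∏ (ω ∘ lookup v)) (B v))))) ⟩
        ∑ vs (λ v → s ^ D * ι (Z.∏ (ω ∘ lookup v) ℤ.* B v))
          ≈⟨ ∑-*ˡ vs (s ^ D) _ ⟨
        s ^ D * ∑ vs (λ v → ι (Z.∏ (ω ∘ lookup v) ℤ.* B v))
          ≈⟨ *-congˡ (ι-∑ vs _) ⟩
        s ^ D * ι (Z.∑ vs (λ v → Z.∏ (ω ∘ lookup v) ℤ.* B v)) ∎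

      s^D : s ^ D ≈ ι (+ (length list ℕ.^ D))
      s^D = go D
        where
        go : ∀ n → s ^ n ≈ ι (+ (length list ℕ.^ n))
        go zero    = refl
        go (suc n) = trans (*-congˡ (go n)) (trans (sym (ι-* (+ length list) (+ (length list ℕ.^ n)))) (reflexive (≡.cong ι (≡.sym (ℤ.pos-* (length list) (length list ℕ.^ n))))))

      expansion : ∀ E → ∑ Xs (λ X → ∏ (λ i → ι (+ E) + g (column i X)) + ∏ (λ i → ι (+ E) - g (column i X))) ≈
        ι (+ (length list ℕ.^ D) ℤ.* Z.∑ vs (λ v → (Z.∏ (signed⁺ weight E ∘ lookup v) ℤ.+ Z.∏ (signed⁻ weight E ∘ lookup v)) ℤ.* B v))
      expansion E = begin
        ∑ Xs (λ X → ∏ (λ i → ι (+ E) + g (column i X)) + ∏ (λ i → ι (+ E) - g (column i X)))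
          ≈⟨ ∑-+ Xs _ _ ⟩
        ∑ Xs (λ X → ∏ (λ i → ι (+ E) + g (column i X))) + ∑ Xs (λ X → ∏ (λ i → ι (+ E) - g (column i X)))
          ≈⟨ +-cong (product-sum (λ x → ι (+ E) + g x) (signed⁺ weight E) (expand⁺ E)) (product-sum (λ x → ι (+ E) - g x) (signed⁻ weight E) (expand⁻ E)) ⟩
        s ^ D * ι (Z.∑ vs P⁺) + s ^ D * ι (Z.∑ vs P⁻)
          ≈⟨ trans (sym (distribˡ _ _ _)) (*-cong s^D (sym (ι-+ (Z.∑ vs P⁺) (Z.∑ vs P⁻)))) ⟩
        ι (+ (length list ℕ.^ D)) * ι (Z.∑ vs P⁺ ℤ.+ Z.∑ vs P⁻)
          ≈⟨ ι-* (+ (length list ℕ.^ D)) (Z.∑ vs P⁺ ℤ.+ Z.∑ vs P⁻) ⟨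
        ι (+ (length list ℕ.^ D) ℤ.* (Z.∑ vs P⁺ ℤ.+ Z.∑ vs P⁻))
          ≡⟨ ≡.cong (λ z → ι (+ (length list ℕ.^ D) ℤ.* z)) (≡.trans (≡.sym (Z.∑-+ vs P⁺ P⁻)) (Z.∑-cong vs (λ v → ≡.sym (ℤ.*-distribʳ-+ (B v) (Z.∏ (signed⁺ weight E ∘ lookup v)) (Z.∏ (signed⁻ weight E ∘ lookup v)))))) ⟩
        ι (+ (length list ℕ.^ D) ℤ.* Z.∑ vs (λ v → (Z.∏ (signed⁺ weight E ∘ lookup v) ℤ.+ Z.∏ (signed⁻ weight E ∘ lookup v)) ℤ.* B v)) ∎
        where
        P⁺ P⁻ : Vec (Maybe T) K → ℤ
        P⁺ v = Z.∏ (signed⁺ weight E ∘ lookup v) ℤ.* B v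
        P⁻ v = Z.∏ (signed⁻ weight E ∘ lookup v) ℤ.* B v

-- Conjugation of kernels and reality of g.

module RealKernels where

  open import Data.Product using (_×_)
  open IntegerCoefficients
  open import Defs using (vectors)
  open FiniteSums
  open ComplexNumbers
  open BoundedSequences
  open Residues
  open Characters
  open RootOfUnity
  open FourierExpansion
  open KernelExpansion
  open TensorPower using (labels; signed⁺; signed⁻)

  private
    module Z = ListSum ℤ-ring

  -- Keeps of the kernel construction only a function and the integers that its product sums
  -- evaluate to.
  record ProductExpansion {p K D : ℕ} (list : List (Vec (Fin p) K)) (g : Vec (Fin p) D → CommutativeRing.Carrier ℂ) (total : ℕ → ℤ) : Set where
    open CommutativeRing ℂ using (_≈_; _+_; _-_)
    open FromℤRing ℂ using (ι)
    open ListSum ℂ using (∑; ∏)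
    field
      expand : ∀ E → ∑ (vectors list D) (λ X → ∏ (λ i → ι (+ E) + g (column i X)) + ∏ (λ i → ι (+ E) - g (column i X))) ≈
                     ι (+ (length list ℕ.^ D) ℤ.* total E)

  signs : List Bool
  signs = true ∷ false ∷ []

  -- After r ↦ - r in n frequencies, conjugation multiplies a phase by parity n = (-1) ^ (n + 1).
  parity : ℕ → ℤ
  parity zero    = -[1+ 0 ]
  parity (suc d) = ℤ.- parity d

  module Reality (q : ℕ) (1≤q : 1 ℕ.≤ q) (prime : Prime (suc (q ℕ.+ q))) {J : Set} where

    p : ℕ
    p = suc (q ℕ.+ q)

    ψ : AdditiveCharacter p prime ℂ
    ψ = character q 1≤q prime

    open Vectors p prime
    open AdditiveCharacter ψ
    open Transform p prime ℂ ψ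
    open CommutativeRing ℂ hiding (zero; ring)
    open FromℤRing ℂ
    open ListSum ℂ
    open ℂ𝔹 using (conj; conj-cong; conj-+; conj-*; embed; re≈; im≈)

    conj-ι : ∀ z → conj (ι z) ≈ ι z
    conj-ι z = trans {conj (ι z)} (conj-cong (sym (embed-const z))) (trans {conj (embed (const z))} {embed (const z)}
      (B.refl {const z} ℂ𝔹., pointwise {B.- B.0#} {B.0#} (λ _ → ≡.refl)) (embed-const z))
      where module B = CommutativeRing 𝔹

    conj-∑ : ∀ {A : Set} (xs : List A) (f : A → Carrier) → conj (∑ xs f) ≈ ∑ xs (λ x → conj (f x))
    conj-∑ []       f = conj-ι (+ 0)
    conj-∑ (x ∷ xs) f = trans {conj (f x + ∑ xs f)} (conj-+ (f x) (∑ xs f)) (+-congˡ {conj (f x)} (conj-∑ xs f))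

    flip : Maybe (J × Bool) → Maybe (J × Bool)
    flip nothing        = nothing
    flip (just (j , ε)) = just (j , not ε)

    kernelᴶ : (t : Maybe (J × Bool)) (d : ℕ) → ℤ → (bs : Blocks (Maybe (J × Bool))) → Vec F (d ℕ.+ dimension bs) → Carrier
    kernelᴶ = kernel is-just

    kernel-cong : ∀ t d {c c′} bs → c ≋ c′ → ∀ x → kernelᴶ t d c bs x ≈ kernelᴶ t d c′ bs x
    kernel-cong t zero    []             h x        = χ-cong h
    kernel-cong t zero    ((d , f) ∷ bs) h x        = *-congʳ {kernelᴶ t (suc d) (f t) bs x} (χ-cong h)
    kernel-cong t (suc d) {c} {c′} bs    h (x ∷ xs) = ∑-cong (frequencies (is-just t)) (λ r → *-congˡ {χ (toℤ x ℤ.* toℤ r)}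
      (kernel-cong t d bs (R.*-congʳ {toℤ r} h) xs))

    private
      neg : F → F
      neg r = residue (ℤ.- toℤ r)

      neg-≋ : ∀ r → toℤ (neg r) ≋ ℤ.- toℤ r
      neg-≋ r = residue-≋ (ℤ.- toℤ r)

      neg-neg : ∀ r → neg (neg r) ≡ r
      neg-neg r = toℤ-injective (R.trans (neg-≋ (neg r)) (R.trans (R.-‿cong (neg-≋ r)) (R.reflexive (ℤ.neg-involutive (toℤ r)))))

      ∑-neg-frequency : ∀ f → ∑ (allFin p) f ≈ ∑ (allFin p) (λ r → f (neg r))
      ∑-neg-frequency = ∑-reindex Fin._≟_ neg neg (Unique.allFin⁺ p) (λ _ → ∈-allFin _) (λ _ → ∈-allFin _) neg-neg neg-neg

    module _ (y : J × Bool) where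
      private
        a a′ : Maybe (J × Bool)
        a  = just y
        a′ = flip a

      -- Conjugation negates every phase. Substituting -r for each frequency restores the linear
      -- phases x r and changes the sign of the coefficient once per frequency; by hypothesis the
      -- flipped label has just these coefficients.
      conj-kernel : ∀ d c (bs : Blocks (Maybe (J × Bool))) → All (λ b → proj₂ b a′ ≋ parity (suc (proj₁ b)) ℤ.* proj₂ b a) bs → ∀ x →
                    conj (kernelᴶ a d c bs x) ≈ kernelᴶ a′ d (parity d ℤ.* c) bs x
      conj-kernel zero c []             []       x = trans {conj (χ c)} (conj-χ q 1≤q prime c) (χ-cong (R.reflexive (≡.sym (ℤ.-1*i≡-i c))))
      conj-kernel zero c ((d , f) ∷ bs) (h ∷ hs) x = trans {conj (χ c * kernelᴶ a (suc d) (f a) bs x)} (conj-* (χ c) (kernelᴶ a (suc d) (f a) bs x))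
        (*-cong {conj (χ c)} (trans {conj (χ c)} (conj-χ q 1≤q prime c) (χ-cong (R.reflexive (≡.sym (ℤ.-1*i≡-i c)))))
          (trans {conj (kernelᴶ a (suc d) (f a) bs x)} (conj-kernel (suc d) (f a) bs hs x) (kernel-cong a′ (suc d) bs (R.sym h) x)))
      conj-kernel (suc d) c bs hs (x ∷ xs) = trans {conj (∑ (allFin p) (λ r → χ (toℤ x ℤ.* toℤ r) * kernelᴶ a d (c ℤ.* toℤ r) bs xs))}
        (conj-∑ (allFin p) _) (trans {∑ (allFin p) _} (∑-cong (allFin p) (λ r →
          trans {conj (χ (toℤ x ℤ.* toℤ r) * kernelᴶ a d (c ℤ.* toℤ r) bs xs)} (conj-* (χ (toℤ x ℤ.* toℤ r)) (kernelᴶ a d (c ℤ.* toℤ r) bs xs))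
            (*-cong {conj (χ (toℤ x ℤ.* toℤ r))} (trans {conj (χ (toℤ x ℤ.* toℤ r))} (conj-χ q 1≤q prime (toℤ x ℤ.* toℤ r)) (χ-cong (phase r)))
              (trans {conj (kernelᴶ a d (c ℤ.* toℤ r) bs xs)} (conj-kernel d (c ℤ.* toℤ r) bs hs xs) (kernel-cong a′ d bs (coefficient r) xs)))))
          (sym (∑-neg-frequency (λ r → χ (toℤ x ℤ.* toℤ r) * kernelᴶ a′ d (parity (suc d) ℤ.* c ℤ.* toℤ r) bs xs))))
        where
        open FromℤRing.Solver ring using (solve; _:*_; :-_; _:=_)
        phase : ∀ r → ℤ.- (toℤ x ℤ.* toℤ r) ≋ toℤ x ℤ.* toℤ (neg r)
        phase r = R.trans (solve 2 (λ x r → :- (x :* r) := x :* (:- r)) R.refl (toℤ x) (toℤ r)) (R.*-congˡ {toℤ x} (R.sym (neg-≋ r)))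
        coefficient : ∀ r → parity d ℤ.* (c ℤ.* toℤ r) ≋ parity (suc d) ℤ.* c ℤ.* toℤ (neg r)
        coefficient r = R.trans (solve 3 (λ s c r → s :* (c :* r) := (:- s) :* c :* (:- r)) R.refl (parity d) c (toℤ r))
          (R.*-congˡ {parity (suc d) ℤ.* c} (R.sym (neg-≋ r)))

    module _ (js : List J) (weight : Maybe (J × Bool) → ℤ) (weight-nothing : weight nothing ≡ + 1)
      (weight-flip : ∀ j → weight (just (j , true)) ≡ weight (just (j , false)))
      (bs : Blocks (Maybe (J × Bool))) (silent : All (λ b → proj₂ b nothing ≡ + 0) bs)
      (odd : ∀ y → All (λ b → proj₂ b (flip (just y)) ≋ parity (suc (proj₁ b)) ℤ.* proj₂ b (just y)) bs) where

      open Expansion p prime ℂ ψ (cartesianProduct js signs) weight weight-nothing bs silent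

      private
        conj-κ : ∀ y x → conj (κ (just y) x) ≈ κ (flip (just y)) x
        conj-κ y x = trans {conj (κ (just y) x)} (conj-kernel y 0 (+ 0) bs (odd y) x)
          (kernel-cong (flip (just y)) 0 bs (R.reflexive (ℤ.*-zeroʳ (parity 0))) x)

        term : Vec F (dimension bs) → J × Bool → Carrier
        term x y = ι (weight (just y)) * κ (just y) x

        conj-term : ∀ x y → weight (just y) ≡ weight (flip (just y)) → conj (term x y) ≈ ι (weight (flip (just y))) * κ (flip (just y)) x
        conj-term x y e = trans {conj (term x y)} (conj-* (ι (weight (just y))) (κ (just y) x))
          (*-cong {conj (ι (weight (just y)))} (trans {conj (ι (weight (just y)))} (conj-ι (weight (just y))) (reflexive (≡.cong ι e))) (conj-κ y x))

      -- Conjugation exchanges the kernels of (j , +) and (j , -), which have the same weight.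
      g-self-conjugate : ∀ x → conj (g x) ≈ g x
      g-self-conjugate x = trans {conj (g x)} (conj-cong (pairs-form)) (trans {conj (∑ js pair-sum)} (conj-∑ js pair-sum)
          (trans {∑ js (λ j → conj (pair-sum j))} (∑-cong js swap) (sym pairs-form)))
        where
        pair-sum : J → Carrier
        pair-sum j = term x (j , true) + (term x (j , false) + 0#)
        pairs-form : g x ≈ ∑ js pair-sum
        pairs-form = ∑-cartesian _,_ js signs (term x)
        swap : ∀ j → conj (pair-sum j) ≈ pair-sum j
        swap j = trans {conj (pair-sum j)} (conj-∑ signs (λ ε → term x (j , ε)))
          (trans {conj (term x (j , true)) + (conj (term x (j , false)) + 0#)}
            (+-cong {conj (term x (j , true))} (conj-term x (j , true) (weight-flip j)) (+-congʳ {0#} (conj-term x (j , false) (≡.sym (weight-flip j)))))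
            (trans {u + (v + 0#)} (sym (+-assoc u v 0#)) (trans {(u + v) + 0#} (+-congʳ {0#} (+-comm u v)) (+-assoc v u 0#))))
          where
          u v : Carrier
          u = term x (j , false)
          v = term x (j , true)

      abstract
        real-expansion : ∃ λ (g : Vec F (dimension bs) → Carrier) → (∀ x → conj (g x) ≈ g x) × (∀ {K} (G : Subgroup K) (total : ℕ → ℤ) →
          (∀ E → Z.∑ (prodList {K = K} (λ _ → labels (cartesianProduct js signs))) (λ v →
            (Z.∏ (signed⁺ weight E ∘ lookup v) ℤ.+ Z.∏ (signed⁻ weight E ∘ lookup v)) ℤ.* + block-count (dual-list G (is-just ∘ lookup v)) (lookup v) bs) ≡ total E) →
          ProductExpansion (Subgroup.list G) g total)
        real-expansion = g , g-self-conjugate , λ G total h → record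
          { expand = λ E → trans {∑ (vectors (Subgroup.list G) (dimension bs)) (λ X → ∏ (λ i → ι (+ E) + g (column i X)) + ∏ (λ i → ι (+ E) - g (column i X)))}
              (expansion G E) (reflexive (≡.cong (λ z → ι (+ (length (Subgroup.list G) ℕ.^ dimension bs) ℤ.* z)) (h E))) }

-- Commonness tested on rational-valued functions.

module RationalFunctions where

  open import Data.Rational using (_+_; _*_; _-_; -_; _≤_; _<_)
  open import Data.Product using (_×_)
  open import Relation.Binary.PropositionalEquality using (refl; sym; trans; cong; cong₂; subst; subst₂)
  open import Defs
  open FiniteSums
  open Rationals

  open ℚι.Solver using (solve; con; _:+_; _:*_; :-_; _:-_; _:=_)
  open ListSum ℚ-ring

  fraction-* : ∀ i n .{{_ : ℕ.NonZero n}} → (i ℚ./ n) * ℤ→ℚ (+ n) ≡ ℤ→ℚ i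
  fraction-* i (suc n) = ℚ.toℚᵘ-injective (begin
    ℚ.toℚᵘ ((i ℚ./ suc n) * ℤ→ℚ (+ suc n))             ≈⟨ ℚ.toℚᵘ-homo-* (i ℚ./ suc n) (ℤ→ℚ (+ suc n)) ⟩
    ℚ.toℚᵘ (i ℚ./ suc n) ℚᵘ.* ℚ.toℚᵘ (ℤ→ℚ (+ suc n))   ≈⟨ ℚᵘ.*-cong (ℚ.toℚᵘ-fromℚᵘ (ℚᵘ.mkℚᵘ i n)) (ℚ.toℚᵘ-fromℚᵘ (ℚᵘ.mkℚᵘ (+ suc n) 0)) ⟩
    ℚᵘ.mkℚᵘ i n ℚᵘ.* ℚᵘ.mkℚᵘ (+ suc n) 0               ≈⟨ ℚᵘ.*≡* (trans (ℤ.*-identityʳ _) (cong (λ d → i ℤ.* + d) (sym (ℕ.*-identityʳ (suc n))))) ⟩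
    ℚᵘ.mkℚᵘ i 0                                        ≈⟨ ℚ.toℚᵘ-fromℚᵘ (ℚᵘ.mkℚᵘ i 0) ⟨
    ℚ.toℚᵘ (ℤ→ℚ i)                                     ∎)
    where open ℚᵘ.≃-Reasoning

  ≤-by-ε : ∀ {x y} → (∀ ε → 0ℚ < ε → x ≤ y + ε) → x ≤ y
  ≤-by-ε {x} {y} h = ℚ.≮⇒≥ λ y<x → ℚ.<-irrefl refl (ℚ.<-≤-trans (below y<x) (h (½ * (x - y)) (0<* (ℚ.positive⁻¹ ½) (<-sub y<x))))
    where
    open ℚ.≤-Reasoning
    half : ∀ y d → y + ½ * d + ½ * d ≡ y + d
    half y d = trans (ℚ.+-assoc y (½ * d) (½ * d)) (cong (λ z → y + z) (trans (sym (ℚ.*-distribʳ-+ d ½ ½)) (ℚ.*-identityˡ d)))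
    below : y < x → y + ½ * (x - y) < x
    below y<x = begin-strict
      y + ½ * (x - y)                      ≡⟨ ℚ.+-identityʳ _ ⟨
      y + ½ * (x - y) + 0ℚ                 <⟨ ℚ.+-monoʳ-< (y + ½ * (x - y)) (0<* (ℚ.positive⁻¹ ½) (<-sub y<x)) ⟩
      y + ½ * (x - y) + ½ * (x - y)        ≡⟨ half y (x - y) ⟩
      y + (x - y)                          ≡⟨ solve 2 (λ x y → y :+ (x :- y) := x) refl x y ⟩
      x                                    ∎

  seq-sum : ∀ {A : Set} (h : A → ℝ) xs a → seq (sumℝ (List.map h xs)) a ≡ ∑ xs (λ x → seq (h x) a)
  seq-sum h []       a = refl
  seq-sum h (x ∷ xs) a = cong (λ z → seq (h x) a + z) (seq-sum h xs a)

  seq-product : ∀ {A : Set} {K} (f : A → ℝ) (x : Vec A K) a → seq (productℝ (Vec.map f x)) a ≡ ∏ (λ i → seq (f (lookup x i)) a)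
  seq-product f []      a = refl
  seq-product f (y ∷ x) a = cong (seq (f y) a *_) (seq-product f x a)

  seq-average : ∀ l a → seq (averageℝ l) a * ℤ→ℚ (+ length l) ≡ seq (sumℝ l) a
  seq-average []         a = ℚ.*-zeroˡ (ℤ→ℚ (+ 0))
  seq-average l@(x ∷ xs) a = trans (swap (+ 1 ℚ./ suc (length xs)) (seq (sumℝ l) a) (ℤ→ℚ (+ suc (length xs))))
      (trans (cong (_* seq (sumℝ l) a) (fraction-* (+ 1) (suc (length xs)))) (ℚ.*-identityˡ _))
    where
    swap : ∀ u s n → (u * s) * n ≡ (u * n) * s
    swap = solve 3 (λ u s n → (u :* s) :* n := (u :* n) :* s) refl

  average-constant : ∀ l {a b} → seq (sumℝ l) a ≡ seq (sumℝ l) b → seq (averageℝ l) a ≡ seq (averageℝ l) b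
  average-constant []       h = refl
  average-constant (x ∷ xs) h = cong ((+ 1 ℚ./ suc (length xs)) *_) h

  ∏-constant : ∀ K n → ∏ {K} (λ _ → ℤ→ℚ (+ n)) ≡ ℤ→ℚ (+ (n ℕ.^ K))
  ∏-constant zero    n = refl
  ∏-constant (suc K) n = trans (cong (ℤ→ℚ (+ n) *_) (∏-constant K n)) (sym (trans (cong ℤ→ℚ (ℤ.pos-* n (n ℕ.^ K))) (ℤ→ℚ-* (+ n) (+ (n ℕ.^ K)))))

  module _ {m K : ℕ} (L : LinearSystem m K) (p D e : ℕ) where

    private
      E : ℕ
      E = suc e

      Ê : ℚ
      Ê = ℤ→ℚ (+ E)

      xs : List (Vec (𝔽^ p D) K)
      xs = solutions L p D

      c : ℚ
      c = + 1 ℚ./ (E ℕ.+ E)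

      c-inverse : c * (Ê + Ê) ≡ 1ℚ
      c-inverse = trans (cong (c *_) (sym (ℤ→ℚ-+ (+ E) (+ E)))) (fraction-* (+ 1) (E ℕ.+ E))

      0≤c : 0ℚ ≤ c
      0≤c = ℚ.nonNegative⁻¹ c {{ℚ.normalize-nonNeg 1 (E ℕ.+ E)}}

    module _ (g : 𝔽^ p D → ℚ) (lower : ∀ x → 0ℚ ≤ Ê + g x) (upper : ∀ x → 0ℚ ≤ Ê - g x) where

      private
        f : 𝔽^ p D → ℝ
        f x = fromℚ ((Ê + g x) * c)

        complement : ∀ e g c → c * (e + e) ≡ 1ℚ → 1ℚ - (e + g) * c ≡ (e - g) * c
        complement e g c h = trans (cong (λ u → u - (e + g) * c) (sym h))
          (solve 3 (λ e g c → c :* (e :+ e) :- (e :+ g) :* c := (e :- g) :* c) refl e g c)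

        f-range : ∀ x → 0ℝ ≤ℝ f x × f x ≤ℝ 1ℝ
        f-range x = (λ ε 0<ε → 0 , λ _ _ → 0≤+ (0≤* (lower x) 0≤c) (ℚ.<⇒≤ 0<ε)) ,
                    (λ ε 0<ε → 0 , λ _ _ → ℚ.≤-trans (sub-≤ (subst (0ℚ ≤_) (sym (complement Ê (g x) c c-inverse)) (0≤* (upper x) 0≤c)))
                      (subst (_≤ 1ℚ + ε) (ℚ.+-identityʳ 1ℚ) (ℚ.+-monoʳ-≤ 1ℚ (ℚ.<⇒≤ 0<ε))))

        scaled : (𝔽^ p D → ℚ) → ℚ
        scaled u = ∑ xs (λ x → ∏ (λ i → u (lookup x i)))

        2Ê^K : ℚ
        2Ê^K = ∏ {K} (λ _ → Ê + Ê)

        -- Multiplying by the number of solutions and by (2E)^K clears all denominators, so that the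
        -- averages become plain sums of products.
        average : ∀ (h : 𝔽^ p D → ℝ) u a → (∀ x → seq (h x) a ≡ u x * c) → seq (t L p D h) a * ℤ→ℚ (+ length xs) * 2Ê^K ≡ scaled u
        average h u a e = begin
          seq (t L p D h) a * ℤ→ℚ (+ length xs) * 2Ê^K
            ≡⟨ cong (λ n → seq (t L p D h) a * ℤ→ℚ (+ n) * 2Ê^K) (length-map (λ x → productℝ (Vec.map h x)) xs) ⟨
          seq (t L p D h) a * ℤ→ℚ (+ length l) * 2Ê^K
            ≡⟨ cong (_* 2Ê^K) (trans (seq-average l a) (seq-sum (λ x → productℝ (Vec.map h x)) xs a)) ⟩
          ∑ xs (λ x → seq (productℝ (Vec.map h x)) a) * 2Ê^K
            ≡⟨ ∑-*ʳ xs 2Ê^K _ ⟩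
          ∑ xs (λ x → seq (productℝ (Vec.map h x)) a * 2Ê^K)
            ≡⟨ ∑-cong xs (λ x → trans (cong (_* 2Ê^K) (trans (seq-product h x a) (∏-cong (λ i → e (lookup x i)))))
                 (trans (sym (∏-* (λ i → u (lookup x i) * c) (λ _ → Ê + Ê))) (∏-cong (λ i → cancel-c (u (lookup x i)))))) ⟩
          scaled u ∎
          where
          open ≡-Reasoning
          l : List ℝ
          l = List.map (λ x → productℝ (Vec.map h x)) xs
          cancel-c : ∀ v → v * c * (Ê + Ê) ≡ v
          cancel-c v = trans (ℚ.*-assoc v c (Ê + Ê)) (trans (cong (v *_) c-inverse) (ℚ.*-identityʳ v))

        target : (2/2^K : ℚ) → 2/2^K * ℤ→ℚ (+ (2 ℕ.^ K)) ≡ ℤ→ℚ (+ 2) → 2/2^K * ℤ→ℚ (+ length xs) * 2Ê^K ≡ ℤ→ℚ (+ 2) * ℤ→ℚ (+ (E ℕ.^ K)) * ℤ→ℚ (+ length xs)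
        target u h = begin
          u * ℤ→ℚ (+ length xs) * 2Ê^K
            ≡⟨ cong (λ z → u * ℤ→ℚ (+ length xs) * z) (trans (∏-cong {K} (λ _ → double)) (trans (∏-* {K} (λ _ → ℤ→ℚ (+ 2)) (λ _ → Ê)) (cong₂ _*_ (∏-constant K 2) (∏-constant K E)))) ⟩
          u * ℤ→ℚ (+ length xs) * (ℤ→ℚ (+ (2 ℕ.^ K)) * ℤ→ℚ (+ (E ℕ.^ K)))
            ≡⟨ rearrange u (ℤ→ℚ (+ length xs)) (ℤ→ℚ (+ (2 ℕ.^ K))) (ℤ→ℚ (+ (E ℕ.^ K))) ⟩
          u * ℤ→ℚ (+ (2 ℕ.^ K)) * ℤ→ℚ (+ (E ℕ.^ K)) * ℤ→ℚ (+ length xs)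
            ≡⟨ cong (λ z → z * ℤ→ℚ (+ (E ℕ.^ K)) * ℤ→ℚ (+ length xs)) h ⟩
          ℤ→ℚ (+ 2) * ℤ→ℚ (+ (E ℕ.^ K)) * ℤ→ℚ (+ length xs) ∎
          where
          open ≡-Reasoning
          double : Ê + Ê ≡ ℤ→ℚ (+ 2) * Ê
          double = solve 1 (λ e → e :+ e := (con (+ 1) :+ con (+ 1)) :* e) refl Ê
          rearrange : ∀ u n t e → u * n * (t * e) ≡ u * t * e * n
          rearrange = solve 4 (λ u n t e → u :* n :* (t :* e) := u :* t :* e :* n) refl

        0≤2Ê^K : 0ℚ ≤ 2Ê^K
        0≤2Ê^K = subst (0ℚ ≤_) (sym (trans (∏-cong {K} (λ _ → sym (ℤ→ℚ-+ (+ E) (+ E)))) (∏-constant K (E ℕ.+ E)))) (ℤ→ℚ-nonneg ((E ℕ.+ E) ℕ.^ K))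

      uncommon : ∑ xs (λ x → ∏ (λ i → Ê + g (lookup x i)) + ∏ (λ i → Ê - g (lookup x i))) < ℤ→ℚ (+ 2) * ℤ→ℚ (+ (E ℕ.^ K)) * ℤ→ℚ (+ length xs) → Uncommon L p
      uncommon small common = ℚ.<-irrefl refl (ℚ.<-≤-trans small (subst₂ _≤_ (target q (fraction-* (+ 2) (2 ℕ.^ K) {{ℕ.m^n≢0 2 K}})) both
          (ℚ.*-monoʳ-≤-nonNeg 2Ê^K {{ℚ.nonNegative 0≤2Ê^K}} (ℚ.*-monoʳ-≤-nonNeg (ℤ→ℚ (+ length xs)) {{ℚ.nonNegative (ℤ→ℚ-nonneg (length xs))}} q≤))))
        where
        q : ℚ
        q = ℚ._/_ (+ 2) (2 ℕ.^ K) {{ℕ.m^n≢0 2 K}}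
        t₁ t₂ : ℕ → ℚ
        t₁ = seq (t L p D f)
        t₂ = seq (t L p D (λ x → 1ℝ -ℝ f x))
        constant : ∀ (h : 𝔽^ p D → ℝ) → (∀ y a → seq (h y) a ≡ seq (h y) 0) → ∀ a → seq (t L p D h) a ≡ seq (t L p D h) 0
        constant h e a = average-constant (List.map (λ x → productℝ (Vec.map h x)) xs) (trans (seq-sum product xs a) (trans (∑-cong xs (λ x →
            trans (seq-product h x a) (trans (∏-cong (λ i → e (lookup x i) a)) (sym (seq-product h x 0))))) (sym (seq-sum product xs 0))))
          where
          product : Vec (𝔽^ p D) K → ℝ
          product x = productℝ (Vec.map h x)
        q≤ : q ≤ t₁ 0 + t₂ 0
        -- All sequences involved are constant, so the index N that commonness yields may be
        -- replaced by 0.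
        q≤ = ≤-by-ε λ ε 0<ε → let N , h = common D f f-range ε 0<ε in subst (λ v → q ≤ v + ε) (cong₂ _+_ (constant f (λ _ _ → refl) N) (constant (λ x → 1ℝ -ℝ f x) (λ _ _ → refl) N)) (h N ℕ.≤-refl)
        distribute : ∀ a b n e → (a + b) * n * e ≡ a * n * e + b * n * e
        distribute = solve 4 (λ a b n e → (a :+ b) :* n :* e := a :* n :* e :+ b :* n :* e) refl
        both : (t₁ 0 + t₂ 0) * ℤ→ℚ (+ length xs) * 2Ê^K ≡ ∑ xs (λ x → ∏ (λ i → Ê + g (lookup x i)) + ∏ (λ i → Ê - g (lookup x i)))
        both = trans (distribute (t₁ 0) (t₂ 0) (ℤ→ℚ (+ length xs)) 2Ê^K) (trans (cong₂ _+_ (average f (λ x → Ê + g x) 0 (λ _ → refl))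
          (average (λ x → 1ℝ -ℝ f x) (λ x → Ê - g x) 0 (λ x → complement Ê (g x) c c-inverse))) (sym (∑-+ xs _ _)))

-- From the ring of sequences to a rational function.

module Approximation where

  open import Data.Rational using (∣_∣)
  open import Relation.Binary.PropositionalEquality using (refl)
  open import Defs using (LinearSystem; vectors; solutions; Uncommon; ℤ→ℚ)
  open IntegerCoefficients
  open FiniteSums
  open Rationals
  open BoundedSequences
  open Characters
  open FourierExpansion
  open LargePrimes
  open Transposition
  open RationalFunctions
  open RealKernels

  private
    module B = CommutativeRing 𝔹
    module C = CommutativeRing ℂ
    module Bs = ListSum 𝔹
    module Cs = ListSum ℂ
    module Q = ListSum ℚ-ring
    module Cι = FromℤRing ℂ

  open ℚι.Solver using (solve; con; _:+_; _:*_; :-_; _:-_; _:=_)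
  open ℂ𝔹 using (conj; embed; embed-+; embed-*; re≈; im≈)

  length-vectors : ∀ {A : Set} (xs : List A) n → length (vectors xs n) ≡ length xs ℕ.^ n
  length-vectors xs zero    = refl
  length-vectors xs (suc n) = ≡.trans (length-cartesianProductWith _∷_ xs (vectors xs n)) (≡.cong (length xs ℕ.*_) (length-vectors xs n))

  ∑-ones : ∀ {A : Set} (xs : List A) → Q.∑ xs (λ _ → 1ℚ) ≡ ℤ→ℚ (+ length xs)
  ∑-ones []       = refl
  ∑-ones (x ∷ xs) = ≡.trans (≡.cong (1ℚ ℚ.+_) (∑-ones xs)) (≡.sym (ℤ→ℚ-+ (+ 1) (+ length xs)))

  embed-∑ : ∀ {A : Set} (xs : List A) (f : A → BoundedSequence) → embed (Bs.∑ xs f) C.≈ Cs.∑ xs (λ x → embed (f x))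
  embed-∑ []       f = C.refl {embed B.0#}
  embed-∑ (x ∷ xs) f = C.trans {embed (f x B.+ Bs.∑ xs f)} (embed-+ (f x) (Bs.∑ xs f)) (C.+-congˡ {embed (f x)} (embed-∑ xs f))

  embed-∏ : ∀ {K} (f : Fin K → BoundedSequence) → embed (Bs.∏ f) C.≈ Cs.∏ (λ i → embed (f i))
  embed-∏ {zero}  f = C.refl {C.1#}
  embed-∏ {suc K} f = C.trans {embed (f zero B.* Bs.∏ (f ∘ suc))} (embed-* (f zero) (Bs.∏ (f ∘ suc))) (C.*-congˡ {embed (f zero)} (embed-∏ (f ∘ suc)))

  at-∑ : ∀ {A : Set} (xs : List A) (f : A → BoundedSequence) n → at (Bs.∑ xs f) n ≡ Q.∑ xs (λ x → at (f x) n)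
  at-∑ []       f n = refl
  at-∑ (x ∷ xs) f n = ≡.cong (λ z → at (f x) n ℚ.+ z) (at-∑ xs f n)

  at-∏ : ∀ {K} (f : Fin K → BoundedSequence) n → at (Bs.∏ f) n ≡ Q.∏ (λ i → at (f i) n)
  at-∏ {zero}  f n = refl
  at-∏ {suc K} f n = ≡.cong (λ z → at (f zero) n ℚ.* z) (at-∏ (f ∘ suc) n)

  -- Twice the imaginary part is null, and the factor 2 cancels by `Null-cancel`.
  self-conjugate⇒real : ∀ z → conj z C.≈ z → z C.≈ embed (proj₁ z)
  self-conjugate⇒real (x , y) h = B.refl {x} ℂ𝔹., Null-≗ (λ n → solve 1 (λ a → a := a :- con (+ 0)) refl (at y n))
    (Null-cancel {λ _ → 1ℚ ℚ.+ 1ℚ} {at y} (λ _ → ≡.subst (ℚ._≤ 1ℚ ℚ.+ 1ℚ) (ℚ.+-identityʳ 1ℚ) (ℚ.+-monoʳ-≤ 1ℚ 0≤1))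
      (Null-≗ (λ n → solve 1 (λ a → :- ((:- a) :- a) := (con (+ 1) :+ con (+ 1)) :* a) refl (at y n)) (Null-neg (im≈ h))))

  x≤∣x∣ : ∀ x → x ℚ.≤ ∣ x ∣
  x≤∣x∣ x with ℚ.≤-total 0ℚ x
  ... | inj₁ 0≤x = ℚ.≤-reflexive (≡.sym (ℚ.0≤p⇒∣p∣≡p 0≤x))
  ... | inj₂ x≤0 = ℚ.≤-trans x≤0 (ℚ.0≤∣p∣ x)

  within-one : ∀ {x m} → ∣ x ℚ.- m ∣ ℚ.* ℤ→ℚ (+ 2) ℚ.≤ 1ℚ → x ℚ.< m ℚ.+ 1ℚ
  within-one {x} {m} h = ℚ.≰⇒> λ m+1≤x → ℚ.<-irrefl refl (ℚ.<-≤-trans (≡.subst (ℚ._< 1ℚ ℚ.+ 1ℚ) (ℚ.+-identityʳ 1ℚ) (ℚ.+-monoʳ-< 1ℚ 0<1))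
      (ℚ.≤-trans (ℚ.+-mono-≤ (1≤ m+1≤x) (1≤ m+1≤x)) (≡.subst (ℚ._≤ 1ℚ) (solve 1 (λ a → a :* (con (+ 1) :+ con (+ 1)) := a :+ a) refl ∣ x ℚ.- m ∣) h)))
    where
    1≤ : m ℚ.+ 1ℚ ℚ.≤ x → 1ℚ ℚ.≤ ∣ x ℚ.- m ∣
    1≤ le = ℚ.≤-trans (sub-≤ (≡.subst (0ℚ ℚ.≤_) (solve 2 (λ x m → x :- (m :+ con (+ 1)) := (x :- m) :- con (+ 1)) refl x m) (≤-sub le))) (x≤∣x∣ (x ℚ.- m))

  ∣v∣≤e⇒0≤e+v : ∀ {e v} → ∣ v ∣ ℚ.≤ e → 0ℚ ℚ.≤ e ℚ.+ v
  ∣v∣≤e⇒0≤e+v {e} {v} h = ≡.subst (0ℚ ℚ.≤_) (solve 2 (λ e v → e :- (:- v) := e :+ v) refl e v)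
    (≤-sub (ℚ.≤-trans (ℚ.≤-trans (x≤∣x∣ (ℚ.- v)) (ℚ.≤-reflexive (ℚ.∣-p∣≡∣p∣ v))) h))

  ∣v∣≤e⇒0≤e-v : ∀ {e v} → ∣ v ∣ ℚ.≤ e → 0ℚ ℚ.≤ e ℚ.- v
  ∣v∣≤e⇒0≤e-v {e} {v} h = ≤-sub (ℚ.≤-trans (x≤∣x∣ v) h)

  module _ {m K : ℕ} (L : LinearSystem m K) (p : ℕ) (prime : Prime p) (D : ℕ) where
    open Vectors p prime using (F; module Subgroup)
    open Solutions L p prime using (solution-group)

    private
      s : ℕ
      s = length (Subgroup.list solution-group)

      Xs : List (Vec (Vec F K) D)
      Xs = vectors (Subgroup.list solution-group) D

      length-solutions : length (solutions L p D) ≡ s ℕ.^ D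
      length-solutions = ℤ.+-injective (ℤ→ℚ-injective {+ length (solutions L p D)} {+ (s ℕ.^ D)} (≡.trans (≡.sym (∑-ones (solutions L p D)))
        (≡.trans (∑-solutions ℚ-ring L p prime D (λ _ → 1ℚ)) (≡.trans (∑-ones Xs) (≡.cong (λ n → ℤ→ℚ (+ n)) (length-vectors (Subgroup.list solution-group) D))))))

    module _ (0<s : 0 ℕ.< s) (g : Vec F D → C.Carrier) (real : ∀ x → conj (g x) C.≈ g x) (total : ℕ → ℤ)
      (expansion : ProductExpansion (Subgroup.list solution-group) g total)
      (threshold : ℕ) (total< : ∀ E → threshold ℕ.< E → total E ℤ.< + 2 ℤ.* + (E ℕ.^ K)) where

      private
        G : Vec F D → BoundedSequence
        G x = proj₁ (g x)

        e E : ℕ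
        -- Adding up the bounds of all values of g makes E at least |g| at every index of the
        -- sequences, so f stays in [0,1] at whichever index is chosen.
        e = threshold ℕ.+ ListAction.sum (List.map (λ x → proj₁ (bounded (G x))) (vectors (allFin p) D))
        E = suc e

        Ê : ℚ
        Ê = ℤ→ℚ (+ E)

        M : ℤ
        M = + (s ℕ.^ D) ℤ.* total E

        T : BoundedSequence
        T = Bs.∑ Xs (λ X → Bs.∏ (λ i → const (+ E) B.+ G (column i X)) B.+ Bs.∏ (λ i → const (+ E) B.- G (column i X)))

        embed-plus : ∀ x → embed (const (+ E) B.+ G x) C.≈ (Cι.ι (+ E) C.+ g x)
        embed-plus x = C.trans {embed (const (+ E) B.+ G x)} (embed-+ (const (+ E)) (G x))
          (C.+-cong {embed (const (+ E))} {Cι.ι (+ E)} {embed (G x)} {g x} (embed-const (+ E)) (C.sym {g x} (self-conjugate⇒real (g x) (real x))))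

        embed-neg : ∀ x → embed (B.- G x) C.≈ (C.- g x)
        embed-neg x = C.trans {embed (B.- G x)} {C.- embed (G x)} (B.refl {B.- G x} ℂ𝔹., pointwise {B.0#} {B.- B.0#} (λ _ → refl))
          (C.-‿cong {embed (G x)} {g x} (C.sym {g x} (self-conjugate⇒real (g x) (real x))))

        embed-minus : ∀ x → embed (const (+ E) B.- G x) C.≈ (Cι.ι (+ E) C.- g x)
        embed-minus x = C.trans {embed (const (+ E) B.- G x)} (embed-+ (const (+ E)) (B.- G x))
          (C.+-cong {embed (const (+ E))} {Cι.ι (+ E)} {embed (B.- G x)} {C.- g x} (embed-const (+ E)) (embed-neg x))

        -- The product sums evaluate to an integer in the ring of sequences; hence the rational
        -- numbers computed along the sequence tend to this integer.
        T≈M : T B.≈ const M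
        T≈M = re≈ {embed T} {embed (const M)} (C.trans {embed T} (embed-∑ Xs _) (C.trans {Cs.∑ Xs _} (Cs.∑-cong Xs summand)
            (C.trans {Cs.∑ Xs _} {Cι.ι M} (ProductExpansion.expand expansion E) (C.sym {embed (const M)} (embed-const M)))))
          where
          P⁺ P⁻ : Vec (Vec F K) D → BoundedSequence
          P⁺ X = Bs.∏ (λ i → const (+ E) B.+ G (column i X))
          P⁻ X = Bs.∏ (λ i → const (+ E) B.- G (column i X))
          summand : ∀ X → embed (P⁺ X B.+ P⁻ X) C.≈ (Cs.∏ (λ i → Cι.ι (+ E) C.+ g (column i X)) C.+ Cs.∏ (λ i → Cι.ι (+ E) C.- g (column i X)))
          summand X = C.trans {embed (P⁺ X B.+ P⁻ X)} (embed-+ (P⁺ X) (P⁻ X)) (C.+-cong {embed (P⁺ X)}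
            (C.trans {embed (P⁺ X)} (embed-∏ (λ i → const (+ E) B.+ G (column i X))) (Cs.∏-cong (λ i → embed-plus (column i X))))
            (C.trans {embed (P⁻ X)} (embed-∏ (λ i → const (+ E) B.- G (column i X))) (Cs.∏-cong (λ i → embed-minus (column i X)))))

        N : ℕ
        -- The tolerance 1/2 is enough, because the target exceeds M by at least 1.
        N = proj₁ (small T≈M 2)

        ĝ : Vec F D → ℚ
        ĝ x = at (G x) N

        T<M+1 : at T N ℚ.< ℤ→ℚ M ℚ.+ 1ℚ
        T<M+1 = within-one {at T N} {ℤ→ℚ M} (proj₂ (small T≈M 2) N ℕ.≤-refl)

        -- The total is an integer strictly below 2 E^K, so after multiplication the difference is
        -- at least s^D, which is at least 1.
        M+1≤ : M ℤ.+ + 1 ℤ.≤ + 2 ℤ.* + (E ℕ.^ K) ℤ.* + length (solutions L p D)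
        M+1≤ = begin
          + n ℤ.* total E ℤ.+ + 1
            ≤⟨ ℤ.+-monoʳ-≤ (+ n ℤ.* total E) (ℤ.+≤+ (ℕ.m^n>0 s {{ℕ.>-nonZero 0<s}} D)) ⟩
          + n ℤ.* total E ℤ.+ + n
            ≡⟨ ≡.trans (≡.cong (λ z → + n ℤ.* total E ℤ.+ z) (≡.sym (ℤ.*-identityʳ (+ n)))) (≡.sym (ℤ.*-distribˡ-+ (+ n) (total E) (+ 1))) ⟩
          + n ℤ.* (total E ℤ.+ + 1)
            ≤⟨ ℤ.*-monoˡ-≤-nonNeg (+ n) (≡.subst (ℤ._≤ X) (ℤ.+-comm (+ 1) (total E)) (ℤ.i<j⇒suc[i]≤j (total< E (s≤s (ℕ.m≤m+n threshold _))))) ⟩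
          + n ℤ.* X
            ≡⟨ ≡.trans (ℤ.*-comm (+ n) X) (≡.cong (λ l → X ℤ.* + l) (≡.sym length-solutions)) ⟩
          X ℤ.* + length (solutions L p D) ∎
          where
          open ℤ.≤-Reasoning
          n : ℕ
          n = s ℕ.^ D
          X : ℤ
          X = + 2 ℤ.* + (E ℕ.^ K)

        bound : ∀ x → ∣ ĝ x ∣ ℚ.≤ Ê
        bound x = ℚ.≤-trans (proj₂ (bounded (G x)) N) (ℤ→ℚ-mono-≤ {+ proj₁ (bounded (G x))} {+ E} (ℤ.+≤+ (ℕ.≤-trans
          (∈-≤-sum (λ x → proj₁ (bounded (G x))) (∈-vectors (allFin p) ∈-allFin x)) (ℕ.≤-trans (ℕ.m≤n+m _ threshold) (ℕ.n≤1+n e)))))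

        product-sum : Vec (Vec F D) K → ℚ
        product-sum x = Q.∏ (λ i → Ê ℚ.+ ĝ (lookup x i)) ℚ.+ Q.∏ (λ i → Ê ℚ.- ĝ (lookup x i))

        at-T : at T N ≡ Q.∑ (solutions L p D) product-sum
        at-T = ≡.trans (at-∑ Xs _ N) (≡.trans (Q.∑-cong Xs (λ X → ≡.cong₂ ℚ._+_
            (≡.trans (at-∏ (λ i → const (+ E) B.+ G (column i X)) N) (Q.∏-cong (λ i → ≡.cong (λ x → Ê ℚ.+ ĝ x) (≡.sym (Vec.lookup∘tabulate (λ i → column i X) i)))))
            (≡.trans (at-∏ (λ i → const (+ E) B.- G (column i X)) N) (Q.∏-cong (λ i → ≡.cong (λ x → Ê ℚ.- ĝ x) (≡.sym (Vec.lookup∘tabulate (λ i → column i X) i)))))))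
          (≡.sym (∑-solutions ℚ-ring L p prime D product-sum)))

        ℤ→ℚ-** : ∀ a b c → ℤ→ℚ (a ℤ.* b ℤ.* c) ≡ ℤ→ℚ a ℚ.* ℤ→ℚ b ℚ.* ℤ→ℚ c
        ℤ→ℚ-** a b c = ≡.trans (ℤ→ℚ-* (a ℤ.* b) c) (≡.cong (ℚ._* ℤ→ℚ c) (ℤ→ℚ-* a b))

      uncommon-from-expansion : Uncommon L p
      uncommon-from-expansion = uncommon L p D e ĝ (λ x → ∣v∣≤e⇒0≤e+v {Ê} {ĝ x} (bound x)) (λ x → ∣v∣≤e⇒0≤e-v {Ê} {ĝ x} (bound x))
        (≡.subst₂ ℚ._<_ at-T (ℤ→ℚ-** (+ 2) (+ (E ℕ.^ K)) (+ length (solutions L p D)))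
          (ℚ.<-≤-trans T<M+1 (≡.subst (ℚ._≤ ℤ→ℚ (+ 2 ℤ.* + (E ℕ.^ K) ℤ.* + length (solutions L p D))) (ℤ→ℚ-+ M (+ 1)) (ℤ→ℚ-mono-≤ {M ℤ.+ + 1} M+1≤))))

-- The construction for one large prime, and the explicit bound.

module Assembly where

  open import Data.List using (tabulate)
  open import Data.Product using (_×_)
  open import Relation.Binary.PropositionalEquality using (refl)
  open import Defs
  open IntegerCoefficients
  open FiniteSums
  open Residues
  open BinaryForms
  open Masks
  open RationalSpans
  open FourierExpansion
  open FrequencyCounts
  open FullLabellings
  open LargePrimes
  open Characters
  open TensorPower using (labels; signed⁺; signed⁻; module Inequality)
  open KernelExpansion
  open RealKernels
  open Approximation

  private
    module Z = ListSum ℤ-ring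

  All-repeat : ∀ {p prime} {T : Set} {P : ℕ × (T → ℤ) → Set} n {bs : Vectors.Blocks p prime T} → All P bs → All P (Counts.repeat p prime n bs)
  All-repeat zero    h = []
  All-repeat {p} {pr} (suc n) h = All.++⁺ h (All-repeat {p} {pr} n h)

  ∑-tabulate-constant : ∀ {A : Set} n (f : Fin n → A) (w : A → ℤ) c → (∀ i → w (f i) ≡ c) → Z.∑ (tabulate f) w ≡ + n ℤ.* c
  ∑-tabulate-constant zero    f w c h = ≡.sym (ℤ.*-zeroˡ c)
  ∑-tabulate-constant (suc n) f w c h = ≡.trans (≡.cong₂ ℤ._+_ (h zero) (∑-tabulate-constant n (f ∘ suc) w c (h ∘ suc)))
    (solve 2 (λ c n → c :+ n :* c := (con (+ 1) :+ n) :* c) refl c (+ n))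
    where open FromℤRing.Solver ℤ-ring using (solve; con; _:+_; _:*_; _:=_)

  parity-double : ∀ h → parity (h ℕ.+ h) ≡ -[1+ 0 ]
  parity-double zero    = refl
  parity-double (suc h) rewrite ℕ.+-suc h h = ≡.trans (ℤ.neg-involutive (parity (h ℕ.+ h))) (parity-double h)

  module _ {m K h : ℕ} (L : LinearSystem m K) (girth : HasGirth L (3 ℕ.+ (h ℕ.+ h))) (L′ : LinearSystem 2 (4 ℕ.+ (h ℕ.+ h)))
    (ι : Fin (4 ℕ.+ (h ℕ.+ h)) → Fin K) (sub : IsSubsystem L′ ι L) (independent : RowsIndependent L′) where

    private
      minor : ℕ
      minor = ℤ.∣ L′ zero (proj₁ (nonzero-minor L′ independent)) ℤ.* L′ (suc zero) (proj₁ (proj₂ (nonzero-minor L′ independent))) ℤ.-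
                  L′ zero (proj₁ (proj₂ (nonzero-minor L′ independent))) ℤ.* L′ (suc zero) (proj₁ (nonzero-minor L′ independent)) ∣

      scale : Fin 2 → ℕ
      scale r = ℤ.∣ proj₁ (extend-InSpan L L′ ι sub r) ∣

      k : ℕ
      k = 4 ℕ.+ (h ℕ.+ h)

    -- p has to exceed k for Newton's identities, the entries of the free solutions for the girth,
    -- and the minor and the denominators of the subsystem for its two rows to stay independent and
    -- in the span.
    prime-bound : ℕ
    prime-bound = suc (k ℕ.+ (girth-bound L girth ℕ.+ (minor ℕ.+ (scale zero ℕ.+ scale (suc zero)))))

    module _ (q : ℕ) (1≤q : 1 ℕ.≤ q) (prime : Prime (suc (q ℕ.+ q))) (large : prime-bound ℕ.≤ suc (q ℕ.+ q)) where

      private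
        p : ℕ
        p = suc (q ℕ.+ q)

      open Vectors p prime hiding (sumℤ)
      open Counts p prime
      open Solutions L p prime
      open Sizes p prime {K}

      private
        k<p : k ℕ.< p
        k<p = ℕ.≤-trans (s≤s (ℕ.m≤m+n k _)) large

        tail< : girth-bound L girth ℕ.+ (minor ℕ.+ (scale zero ℕ.+ scale (suc zero))) ℕ.< p
        tail< = ℕ.≤-trans (s≤s (ℕ.m≤n+m _ k)) large

        girth-bound< : girth-bound L girth ℕ.< p
        girth-bound< = ℕ.≤-<-trans (ℕ.m≤m+n _ _) tail<

        minor< : minor ℕ.< p
        minor< = ℕ.≤-<-trans (ℕ.≤-trans (ℕ.m≤m+n minor _) (ℕ.m≤n+m _ (girth-bound L girth))) tail<

        scale-≤ : ∀ r → scale r ℕ.≤ scale zero ℕ.+ scale (suc zero)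
        scale-≤ zero       = ℕ.m≤m+n _ _
        scale-≤ (suc zero) = ℕ.m≤n+m _ (scale zero)

        scale< : ∀ r → scale r ℕ.< p
        scale< r = ℕ.≤-<-trans (ℕ.≤-trans (scale-≤ r) (ℕ.≤-trans (ℕ.m≤n+m _ minor) (ℕ.m≤n+m _ (girth-bound L girth)))) tail<

        char : ∀ n → suc n ℕ.≤ k → ¬ FromℤRing.ι ring (+ suc n) ≋ + 0
        char n n<k z = small-nonzero n (ℕ.≤-<-trans n<k k<p) (R.trans (ι≋id (+ suc n)) z)

        girth-p : Girth (Subgroup.list solution-group) (2 ℕ.+ (h ℕ.+ h))
        girth-p = girth-mod-p girth (2 ℕ.+ (h ℕ.+ h)) ℕ.≤-refl (λ S i Si small → ℕ.≤-<-trans (girth-bound-≤ L girth S i Si small) girth-bound<)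

        size : count (image ι) ≡ k
        size = count-image ι (IsSubsystem.distinct sub)

      open Witness h char solution-group girth-p (image ι) size _ (subsystem-basis L′ ι sub independent minor< scale<) hiding (k)

      private
        Ts : List (Fin k × Bool)
        Ts = cartesianProduct (allFin k) signs

        complete : ∀ t → t ∈ Ts
        complete (j , ε) = ∈-cartesianProduct⁺ (∈-allFin j) (bool ε)
          where
          bool : ∀ b → b ∈ signs
          bool true  = here refl
          bool false = there (here refl)

        balanced : Z.∑ Ts (weight ∘ just) ≡ + 0
        balanced = ≡.trans (Z.∑-cartesian _,_ (allFin k) signs (weight ∘ just)) (≡.trans
            (≡.cong (λ z → w₀ ℤ.+ (w₀ ℤ.+ + 0) ℤ.+ z) (∑-tabulate-constant (3 ℕ.+ (h ℕ.+ h)) Fin.suc (λ j → weight (just (j , true)) ℤ.+ (weight (just (j , false)) ℤ.+ + 0)) (+ 2) (λ _ → refl)))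
            (solve 1 (λ x → (:- x) :+ ((:- x) :+ con (+ 0)) :+ x :* con (+ 2) := con (+ 0)) refl (+ (3 ℕ.+ (h ℕ.+ h)))))
          where
          open FromℤRing.Solver ℤ-ring using (solve; con; _:+_; _:*_; :-_; _:=_)
          w₀ : ℤ
          w₀ = -[1+ (2 ℕ.+ (h ℕ.+ h)) ]

        weight-flip : ∀ j → weight (just (j , true)) ≡ weight (just (j , false))
        weight-flip zero    = refl
        weight-flip (suc _) = refl

        l : ℕ
        -- Λ is positive; its predecessor bounds the count of every labelling of k variables that is
        -- not full.
        l = ℕ.pred Λ

        Λ≡ : Λ ≡ suc l
        Λ≡ = ≡.sym (ℕ.suc-pred Λ {{ℕ.m^n≢0 (p ℕ.* p) (dimension triple)}})

        A : Vec Label K → ℕ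
        A v = block-count (dual-list solution-group (is-just ∘ lookup v)) (lookup v) triple

      open Inequality K h Ts complete weight refl balanced A l
        (λ v small → small-count solution-group _ girth-p (lookup v) (is-just ∘ lookup v) small triple)
        (λ v full → ≡.subst (A v ℕ.≤_) Λ≡ (count-≤ (lookup v) full))
        (λ v full e → full⇒negative (lookup v) full (≡.trans e (≡.sym Λ≡)))
        τ₀-vec τ₀-size (≡.trans τ₀-full Λ≡)

      private
        copies : ℕ
        copies = proj₁ eventually-smaller

        bs : Blocks Label
        bs = repeat copies triple

        silent : All (λ (b : ℕ × (Label → ℤ)) → proj₂ b nothing ≡ + 0) bs
        silent = All-repeat {p} {prime} copies (refl ∷ refl ∷ refl ∷ [])

        -- Here the parity of k enters: a block of even degree k - 2 changes sign under conjugation,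
        -- as `cP` does under a flip, while one of odd degree k - 3 does not, and `cA`, `cB` ignore
        -- the sign.
        odd : ∀ y → All (λ (b : ℕ × (Label → ℤ)) → proj₂ b (Reality.flip q 1≤q prime (just y)) ≋ parity (suc (proj₁ b)) ℤ.* proj₂ b (just y)) bs
        odd (j , ε) = All-repeat {p} {prime} copies (R.reflexive (≡.trans (negate ε) (≡.cong (λ s → ℤ.- (ℤ.- s) ℤ.* cP (just (j , ε))) (≡.sym (parity-double h)))) ∷
            R.reflexive (keep (cA (just (j , ε)))) ∷ R.reflexive (keep (cB (just (j , ε)))) ∷ [])
          where
          open FromℤRing.Solver ℤ-ring using (solve; con; _:+_; _:*_; :-_; _:=_)
          keep : ∀ x → x ≡ ℤ.- parity (h ℕ.+ h) ℤ.* x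
          keep x = ≡.sym (≡.trans (≡.cong (λ s → ℤ.- s ℤ.* x) (parity-double h)) (ℤ.*-identityˡ x))
          negate⁺ : ∀ g → -[1+ 0 ] ℤ.* g ≡ -[1+ 0 ] ℤ.* (+ 1 ℤ.* g)
          negate⁺ = solve 1 (λ g → (:- con (+ 1)) :* g := (:- con (+ 1)) :* (con (+ 1) :* g)) refl
          negate⁻ : ∀ g → + 1 ℤ.* g ≡ -[1+ 0 ] ℤ.* (-[1+ 0 ] ℤ.* g)
          negate⁻ = solve 1 (λ g → con (+ 1) :* g := (:- con (+ 1)) :* ((:- con (+ 1)) :* g)) refl
          negate : ∀ ε → cP (just (j , Data.Bool.not ε)) ≡ -[1+ 0 ] ℤ.* cP (just (j , ε))
          negate true  = negate⁺ (γ j)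
          negate false = negate⁻ (γ j)

        expansion = Reality.real-expansion q 1≤q prime (allFin k) weight refl weight-flip bs silent odd

        0∈ : Vec.tabulate (λ _ → residue (+ 0)) ∈ Subgroup.list solution-group
        0∈ = ∈-filter⁺ isZero? (∈-vectors (allFin p) ∈-allFin _) (λ i → R.trans (sum-cong-≋ {K} (λ j → R.trans (R.*-congˡ {L i j}
            (R.trans (R.reflexive (≡.cong toℤ (Vec.lookup∘tabulate (λ _ → residue (+ 0)) j))) (residue-≋ (+ 0)))) (R.zeroʳ (L i j)))) (sum-replicate-zero K))
          where open import Algebra.Properties.Semiring.Sum R.semiring using (sum-cong-≋; sum-replicate-zero)

        nonempty : ∀ {A : Set} {x : A} {xs} → x ∈ xs → 0 ℕ.< length xs
        nonempty (here _)  = s≤s z≤n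
        nonempty (there _) = s≤s z≤n

        total≡ : ∀ E → Z.∑ (prodList {K = K} (λ _ → labels Ts)) (λ v → (Z.∏ (signed⁺ weight E ∘ lookup v) ℤ.+ Z.∏ (signed⁻ weight E ∘ lookup v)) ℤ.*
                   + block-count (dual-list solution-group (is-just ∘ lookup v)) (lookup v) bs) ≡ total copies E
        total≡ E = Z.∑-cong (prodList {K = K} (λ _ → labels Ts)) (λ v → ≡.cong (λ n → (Z.∏ (signed⁺ weight E ∘ lookup v) ℤ.+ Z.∏ (signed⁻ weight E ∘ lookup v)) ℤ.* + n)
          (block-count-repeat (dual-list solution-group (is-just ∘ lookup v)) (lookup v) copies triple))

      uncommon-at-large-prime : Uncommon L p
      uncommon-at-large-prime = uncommon-from-expansion L p prime (dimension bs) (nonempty 0∈) (proj₁ expansion) (proj₁ (proj₂ expansion)) (total copies)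
        (proj₂ (proj₂ expansion) solution-group (total copies) total≡)
        (proj₁ (proj₂ eventually-smaller)) (proj₂ (proj₂ eventually-smaller))

  even-form : ∀ k → 4 ℕ.≤ k → 2 ℕ.∣ k → ∃ λ h → k ≡ 4 ℕ.+ (h ℕ.+ h)
  even-form k 4≤k (ℕ.divides zero          refl) = contradiction 4≤k λ ()
  even-form k 4≤k (ℕ.divides (suc zero)    refl) = contradiction 4≤k λ { (s≤s (s≤s ())) }
  even-form k 4≤k (ℕ.divides (suc (suc h)) refl) = h , ≡.cong (4 ℕ.+_) (≡.trans (ℕ.*-comm h 2) (≡.cong (h ℕ.+_) (ℕ.+-identityʳ h)))

  half : ∀ n → ∃ λ q → n ≡ q ℕ.+ q ⊎ n ≡ suc (q ℕ.+ q)
  half zero    = 0 , inj₁ refl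
  half (suc n) with half n
  ... | q , inj₁ refl = q , inj₂ refl
  ... | q , inj₂ refl = suc q , inj₁ (≡.cong suc (≡.sym (ℕ.+-suc q q)))

  odd-prime : ∀ p → Prime p → 2 ℕ.< p → ∃ λ q → 1 ℕ.≤ q × p ≡ suc (q ℕ.+ q)
  odd-prime p isPrime 2<p with half p
  ... | zero  , inj₂ refl = contradiction 2<p λ { (s≤s ()) }
  ... | suc q , inj₂ e    = suc q , s≤s z≤n , e
  ... | q     , inj₁ e with prime⇒irreducible isPrime (ℕ.divides q (≡.trans e (≡.trans (≡.cong (q ℕ.+_) (≡.sym (ℕ.+-identityʳ q))) (ℕ.*-comm 2 q))))
  ...   | inj₁ ()
  ...   | inj₂ refl = contradiction 2<p (ℕ.<-irrefl refl)

open import Defs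
open import Data.Nat using (ℕ; _≤_; _∸_)
open import Data.Nat.Divisibility using (_∣_)
open import Data.Nat.Primality using (Prime)
open import Data.Product using (∃-syntax; _×_)
open Assembly

theorem1p9 : ∀ (k : ℕ) → 4 ≤ k → 2 ∣ k →
    ∀ (m K : ℕ) (L : LinearSystem m K) → Irredundant L → HasGirth L (k ∸ 1) →
    (∃[ L′ ] ∃[ ι ] Irredundant {2} {k} L′ × IsSubsystem L′ ι L) →
    ∃[ pL ] (∀ (p : ℕ) → Prime p → pL ≤ p → Uncommon L p)
theorem1p9 k 4≤k 2∣k m K L irredundant girth (L′ , ι , irredundant′ , sub) = for-form (even-form k 4≤k 2∣k) L girth L′ ι (Irredundant.independent irredundant′) sub
  where
  for-form : ∀ {k} → ∃ (λ h → k ≡ 4 ℕ.+ (h ℕ.+ h)) → ∀ {m K} (L : LinearSystem m K) → HasGirth L (k ℕ.∸ 1) → ∀ (L′ : LinearSystem 2 k) (ι : Fin k → Fin K) →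
             RowsIndependent L′ → IsSubsystem L′ ι L → ∃[ pL ] (∀ (p : ℕ) → Prime p → pL ℕ.≤ p → Uncommon L p)
  -- The bound is at least 5, so p is an odd prime, as the construction of the root of unity
  -- requires.
  for-form (h , ≡.refl) L girth L′ ι independent sub = bound , λ p isPrime bound≤p → at-prime (odd-prime p isPrime (ℕ.≤-trans (s≤s (s≤s (s≤s z≤n))) bound≤p)) isPrime bound≤p
    where
    bound : ℕ
    bound = prime-bound {h = h} L girth L′ ι sub independent
    at-prime : ∀ {p} → (∃ λ q → 1 ℕ.≤ q × p ≡ suc (q ℕ.+ q)) → Prime p → bound ℕ.≤ p → Uncommon L p
    at-prime (q , 1≤q , ≡.refl) isPrime bound≤p = uncommon-at-large-prime {h = h} L girth L′ ι sub independent q 1≤q isPrime bound≤p
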